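{- Let $0<\alpha<1$. Among all $k$-uniform hypertrees with $m$ hyperedges, $S_m^{(k)}$ (resp. $S^{(k)}_{1,2,1,\ldots,1}$) has the largest (resp. the second largest) $2$-nd order $\mathcal{A}_\alpha$-spectral moment for $k\ge2$, and $P_m^{(k)}$ (resp. $F_{m,k}$) has the smallest (resp. the second smallest) $(k+2)$-nd order $\mathcal{A}_\alpha$-spectral moment for $k\ge3$.
   Context: Hypergraphs are finite; $k$-uniform means every hyperedge has exactly $k$ vertices; a hypertree is a connected hypergraph without cycles; a cored vertex is a vertex of degree one. The hyperpath $P_r^{(k)}$ of length $r$ is obtained from the path graph with consecutive edges $e_1,\dots,e_r$ by inserting $k-2$ new (cored) vertices into each edge, giving consecutive hyperedges $e_1^{(k)},\dots,e_r^{(k)}$. The starlike hypertree $S^{(k)}_{n_1,\dots,n_p}$ ($p\ge1$, $n_i\ge1$) is obtained from $p$ hyperpaths of lengths $n_1,\dots,n_p$ by sharing a common (end) vertex; the hyperstar $S_m^{(k)}$ is $S^{(k)}_{1,\dots,1}$ with $m$ ones. $S^{(k)}_{1,2,1,\dots,1}$ denotes the starlike hypertree of this form with $m$ hyperedges in total. $F_{m,k}$ is obtained from $P_{m-1}^{(k)}$ by attaching a pendant hyperedge (a new hyperedge consisting of the attachment vertex and $k-1$ new vertices) to a cored vertex on the hyperedge $e_2^{(k)}$. For a $k$-uniform hypergraph $\mathcal{H}$ on $[n]$, $\mathcal{A}(\mathcal{H})$ is the $k$-order $n$-dimensional tensor with entry $\frac1{(k-1)!}$ at $(i_1,\dots,i_k)$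 if $\{i_1,\dots,i_k\}\in E(\mathcal{H})$ and $0$ otherwise; $\mathcal{D}(\mathcal{H})$ is the diagonal tensor of vertex degrees; $\mathcal{A}_\alpha(\mathcal{H})=\alpha\mathcal{D}(\mathcal{H})+(1-\alpha)\mathcal{A}(\mathcal{H})$. The $d$-th order $\mathcal{A}_\alpha$-spectral moment of $\mathcal{H}$ is the sum of the $d$-th powers of all $n(k-1)^{n-1}$ eigenvalues of $\mathcal{A}_\alpha(\mathcal{H})$; it equals the $d$-th order trace $\mathrm{Tr}_d(\mathcal{A}_\alpha(\mathcal{H}))$, where for a $k$-order $n$-dimensional tensor $\mathcal{T}$ and $d\ge1$, $$\mathrm{Tr}_{d}(\mathcal{T})=(k-1)^{n-1}\sum_{d_1+\cdots+d_n=d}\ \prod_{i=1}^{n}\frac{1}{(d_i(k-1))!}\Big(\sum_{\gamma\in[n]^{k-1}}(\mathcal{T})_{i\gamma}\frac{\partial}{\partial a_{i\gamma}}\Big)^{d_i}\mathrm{tr}\big(A^{d(k-1)}\big),$$ with $A=(a_{ij})$ an $n\times n$ matrix of indeterminates, $d_i\ge0$ integers, $\frac{\partial}{\partial a_{i\gamma}}=\frac{\partial}{\partial a_{i i_2}}\cdots\frac{\partial}{\partial a_{i i_k}}$ for $\gamma=i_2\cdots i_k$. -}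

module Defs where

open import Level using (Level; _⊔_) renaming (suc to lsuc)
open import Algebra.Bundles using (CommutativeRing)
import Algebra.Properties.Semiring.Mult as Mult
open import Data.Bool.Base using (if_then_else_)
import Data.Bool.Properties as Bool
open import Data.Fin.Base using (Fin; zero; suc; toℕ; splitAt)
import Data.Fin.Properties as Fin
open import Data.Fin.Subset using (Subset; Side; inside; outside; _∈_; _∪_; ⋃; ⊥; ⁅_⁆; ∣_∣)
open import Data.Fin.Subset.Properties using (_∈?_)
open import Data.List.Base as List
  using (List; []; _∷_; [_]; _++_; concatMap; cartesianProductWith; upTo; allFin)
open import Data.Nat.Base as ℕ using (ℕ; zero; suc; _∸_; _≤_; _!)
open import Data.Nat.DivMod using (_mod_)
import Data.Nat.Properties as ℕ
open import Data.Product.Base using (_×_; _,_)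
import Data.Product.Properties as Product
open import Data.Sum.Base using (_⊎_; [_,_]′)
open import Data.Vec.Base as Vec using (Vec; []; _∷_)
import Data.Vec.Properties as Vec
open import Function.Base using (_∘_; id)
open import Function.Bundles using (_↔_; _⇔_; Inverse)
open import Function.Definitions using (Injective)
open import Relation.Binary.Core using (Rel)
open import Relation.Binary.Construct.Closure.ReflexiveTransitive using (Star)
open import Relation.Binary.PropositionalEquality.Core using (_≡_)
open import Relation.Binary.Structures using (IsStrictTotalOrder)
open import Relation.Nullary.Decidable.Core using (Dec; does; _×-dec_)
open import Relation.Nullary.Negation.Core using (¬_)

------------------------------------------------------------------------
-- Ordered fields

-- Stands in for ℝ, which the library lacks; classically ℝ is an instance.
-- The value of _⁻¹ at 0# is unconstrained and never used.

record OrderedField (c ℓ₁ ℓ₂ : Level) : Set (lsuc (c ⊔ ℓ₁ ⊔ ℓ₂)) where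
  infix  4 _<_ _≤ᶠ_
  infix  8 _⁻¹
  field
    commutativeRing : CommutativeRing c ℓ₁
  open CommutativeRing commutativeRing public
  field
    _<_                : Rel Carrier ℓ₂
    isStrictTotalOrder : IsStrictTotalOrder _≈_ _<_
    +-monoˡ-<          : ∀ z {x y} → x < y → x + z < y + z
    *-positive         : ∀ {x y} → 0# < x → 0# < y → 0# < x * y
    0#≉1#              : ¬ (0# ≈ 1#)
    _⁻¹                : Carrier → Carrier
    ⁻¹-inverseʳ        : ∀ x → ¬ (x ≈ 0#) → x * x ⁻¹ ≈ 1#

  _≤ᶠ_ : Rel Carrier (ℓ₁ ⊔ ℓ₂)
  x ≤ᶠ y = (x < y) ⊎ (x ≈ y)

------------------------------------------------------------------------
-- Hypergraphs with n vertices and m hyperedges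

-- Repeated hyperedges are excluded by the field `simple` of IsHypertree.

record Hypergraph (n m : ℕ) : Set where
  constructor hypergraph
  field
    edge : Fin m → Subset n

open Hypergraph public

degree : ∀ {n m} → Hypergraph n m → Fin n → ℕ
degree {m = m} H v = List.length (List.filter (λ e → v ∈? edge H e) (allFin m))

Cored : ∀ {n m} → Hypergraph n m → Fin n → Set
Cored H v = degree H v ≡ 1

Uniform : ∀ {n m} → ℕ → Hypergraph n m → Set
Uniform k H = ∀ e → ∣ edge H e ∣ ≡ k

data Adjacent {n m} (H : Hypergraph n m) (u v : Fin n) : Set where
  via : ∀ e → u ∈ edge H e → v ∈ edge H e → Adjacent H u v

Connected : ∀ {n m} → Hypergraph n m → Set
Connected H = ∀ u v → Star (Adjacent H) u v

cyclicSuc : ∀ {l} → Fin (suc l) → Fin (suc l)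
cyclicSuc {l} i = suc (toℕ i) mod suc l

-- v₀ e₀ v₁ e₁ ⋯ vₗ₋₁ eₗ₋₁ v₀ with l ≥ 2, distinct vᵢ, distinct eᵢ, and
-- vᵢ , vᵢ₊₁ ∈ eᵢ (indices modulo l).

record Cycle {n m} (H : Hypergraph n m) : Set where
  field
    length-2         : ℕ
    vertex           : Fin (2 ℕ.+ length-2) → Fin n
    hyperedge        : Fin (2 ℕ.+ length-2) → Fin m
    vertex-distinct  : Injective _≡_ _≡_ vertex
    edge-distinct    : Injective _≡_ _≡_ hyperedge
    vertex∈edge      : ∀ i → vertex i ∈ edge H (hyperedge i)
    next-vertex∈edge : ∀ i → vertex (cyclicSuc i) ∈ edge H (hyperedge i)

record IsHypertree {n m} (k : ℕ) (H : Hypergraph n m) : Set where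
  field
    simple    : Injective _≡_ _≡_ (edge H)
    uniform   : Uniform k H
    connected : Connected H
    acyclic   : ¬ Cycle H

record _≅_ {n m n′ m′} (G : Hypergraph n m) (H : Hypergraph n′ m′) : Set where
  field
    vertices  : Fin n ↔ Fin n′
    edges     : Fin m ↔ Fin m′
    incidence : ∀ v e → v ∈ edge G e ⇔ Inverse.to vertices v ∈ edge H (Inverse.to edges e)

------------------------------------------------------------------------
-- Particular hypertrees (k ≥ 2)

-- The vertices of the underlying path graph are the multiples of k - 1; the
-- k - 2 vertices inserted into the edge between i (k - 1) and (i + 1)(k - 1)
-- are the numbers strictly between these two.  Vertex 0 is an end vertex.

hyperpath : (k r : ℕ) → Hypergraph (suc (r ℕ.* (k ∸ 1))) r
hyperpath k r = hypergraph λ i → Vec.tabulate λ v → does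
  ((toℕ i ℕ.* (k ∸ 1) ℕ.≤? toℕ v) ×-dec (toℕ v ℕ.≤? suc (toℕ i) ℕ.* (k ∸ 1)))

-- The disjoint union of G and H with vertex v of G identified with vertex 0
-- of H; vertex suc w of H becomes the w-th vertex after those of G.

coalesce : ∀ {n m n′ m′} → Hypergraph n m → Fin n → Hypergraph (suc n′) m′ →
           Hypergraph (n ℕ.+ n′) (m ℕ.+ m′)
coalesce {m = m} G v H =
  hypergraph ([ (λ e → edge G e Vec.++ ⊥) , transport ∘ edge H ]′ ∘ splitAt m)
  where
  transport : ∀ {n′} → Subset (suc n′) → Subset _
  transport (s ∷ p) = (if s then ⁅ v ⁆ else ⊥) Vec.++ p

attachPendant : ∀ {n m} (k : ℕ) → Hypergraph n m → Fin n →
                Hypergraph (n ℕ.+ 1 ℕ.* (k ∸ 1)) (m ℕ.+ 1)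
attachPendant k G v = coalesce G v (hyperpath k 1)

-- The shared vertex is vertex 0; starlike k [] is a single vertex.

starlike : (k : ℕ) (ns : List ℕ) →
           Hypergraph (suc (List.sum (List.map (ℕ._* (k ∸ 1)) ns))) (List.sum ns)
starlike k []       = hypergraph λ ()
starlike k (n ∷ ns) = coalesce (hyperpath k n) zero (starlike k ns)

hyperstar : (k m : ℕ) → Hypergraph _ _
hyperstar k m = starlike k (List.replicate m 1)

-- S_{1,2,1,…,1} with m ≥ 3 hyperedges in total.

starlike₁₂₁ : (k m : ℕ) → Hypergraph _ _
starlike₁₂₁ k m = starlike k (1 ∷ 2 ∷ List.replicate (m ∸ 3) 1)

------------------------------------------------------------------------
-- Enumerations

tuples : (n r : ℕ) → List (Vec (Fin n) r)
tuples n zero    = [ [] ]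
tuples n (suc r) = cartesianProductWith _∷_ (allFin n) (tuples n r)

-- All (d₁ , … , dₙ) with dᵢ ≥ 0 and d₁ + ⋯ + dₙ = d.

compositions : (n d : ℕ) → List (Vec ℕ n)
compositions zero    zero    = [ [] ]
compositions zero    (suc d) = []
compositions (suc n) d       =
  concatMap (λ a → List.map (a ∷_) (compositions n (d ∸ a))) (upTo (suc d))

------------------------------------------------------------------------
-- Tensors and traces over an ordered field

module _ {c ℓ₁ ℓ₂} (K : OrderedField c ℓ₁ ℓ₂) where

  open OrderedField K hiding (zero)
  open Mult semiring using () renaming (_×_ to _·_)

  infixl 7 _*ₚ_

  private
    ∑ : ∀ {a} {A : Set a} → List A → (A → Carrier) → Carrier
    ∑ xs f = List.foldr (λ x s → f x + s) 0# xs

    1/_ : ℕ → Carrier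
    1/ n = (n · 1#) ⁻¹

  -- An entry of a tensor of order k ≥ 1 and dimension n is addressed by its
  -- first index i and the tuple γ ∈ [n]^{k-1} of the remaining ones.

  Tensor : (k n : ℕ) → Set c
  Tensor k n = Fin n → Vec (Fin n) (k ∸ 1) → Carrier

  -- The indeterminate a_ij is the pair (i , j).  A polynomial is a formal sum
  -- of terms (c , x₁ ∷ ⋯ ∷ xᵣ ∷ []), each denoting c x₁ ⋯ xᵣ; it is not
  -- normalised, so the order of factors and of terms is immaterial.

  Monomial Polynomial : ℕ → Set _
  Monomial n   = List (Fin n × Fin n)
  Polynomial n = List (Carrier × Monomial n)

  scale : ∀ {n} → Carrier → Polynomial n → Polynomial n
  scale a = List.map λ (b , w) → a * b , w

  _*ₚ_ : ∀ {n} → Polynomial n → Polynomial n → Polynomial n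
  _*ₚ_ = cartesianProductWith λ (a , u) (b , w) → a * b , u ++ w

  constantTerm : ∀ {n} → Polynomial n → Carrier
  constantTerm p = ∑ p λ { (a , []) → a ; (a , _ ∷ _) → 0# }

  -- Leibniz rule: one summand for each occurrence of x in the monomial.

  ∂ₘ : ∀ {n} → Fin n × Fin n → Monomial n → List (Monomial n)
  ∂ₘ x []      = []
  ∂ₘ x (y ∷ w) =
    (if does (Product.≡-dec Fin._≟_ Fin._≟_ x y) then [ w ] else [])
    ++ List.map (y ∷_) (∂ₘ x w)

  ∂ : ∀ {n} → Fin n × Fin n → Polynomial n → Polynomial n
  ∂ x = concatMap λ (a , w) → List.map (a ,_) (∂ₘ x w)

  PolyMatrix : ℕ → Set c
  PolyMatrix n = Fin n → Fin n → Polynomial n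

  indeterminates : ∀ {n} → PolyMatrix n
  indeterminates i j = [ 1# , [ i , j ] ]

  matrixPower : ∀ {n} → PolyMatrix n → ℕ → PolyMatrix n
  matrixPower     A zero    i j = if does (i Fin.≟ j) then [ 1# , [] ] else []
  matrixPower {n} A (suc N) i j =
    concatMap (λ l → A i l *ₚ matrixPower A N l j) (allFin n)

  matrixTrace : ∀ {n} → PolyMatrix n → Polynomial n
  matrixTrace {n} A = concatMap (λ i → A i i) (allFin n)

  -- Σ_γ T_{iγ} ∂/∂a_{iγ}

  operator : ∀ {n} (k : ℕ) → Tensor k n → Fin n → Polynomial n → Polynomial n
  operator {n} k T i p = concatMap
    (λ γ → scale (T i γ) (Vec.foldr′ (λ j → ∂ (i , j)) p γ))
    (tuples n (k ∸ 1))

  iterate : ∀ {a} {A : Set a} → ℕ → (A → A) → A → A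
  iterate zero    f = id
  iterate (suc d) f = f ∘ iterate d f

  -- The trace Tr_d.  The differential operators have total order d(k-1), the
  -- degree of the homogeneous polynomial tr(A^{d(k-1)}), so the polynomial
  -- produced is constant; constantTerm reads it as an element of K.

  Tr : ∀ {n} (k d : ℕ) → Tensor k n → Carrier
  Tr {n} k d T =
    ((k ∸ 1) ℕ.^ (n ∸ 1)) · ∑ (compositions n d) λ ds →
      constantTerm (List.foldr
        (λ i p → scale (1/ ((Vec.lookup ds i ℕ.* (k ∸ 1)) !))
                       (iterate (Vec.lookup ds i) (operator k T i) p))
        (matrixTrace (matrixPower indeterminates (d ℕ.* (k ∸ 1))))
        (allFin n))

  adjacencyTensor : ∀ {n m} (k : ℕ) → Hypergraph n m → Tensor k n
  adjacencyTensor k H i γ =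
    if does (Fin.any? λ e → Vec.≡-dec Bool._≟_ indexSet (edge H e))
    then 1/ ((k ∸ 1) !) else 0#
    where
    indexSet : Subset _
    indexSet = ⁅ i ⁆ ∪ ⋃ (Vec.toList (Vec.map ⁅_⁆ γ))

  degreeTensor : ∀ {n m} (k : ℕ) → Hypergraph n m → Tensor k n
  degreeTensor k H i γ =
    if does (Vec.≡-dec Fin._≟_ γ (Vec.replicate (k ∸ 1) i))
    then degree H i · 1# else 0#

  Aα : ∀ {n m} → Carrier → (k : ℕ) → Hypergraph n m → Tensor k n
  Aα α k H i γ = α * degreeTensor k H i γ + (1# - α) * adjacencyTensor k H i γ

  -- The sum of the d-th powers of the eigenvalues of Aα, expressed as Tr_d.

  spectralMoment : ∀ {n m} → Carrier → (k d : ℕ) → Hypergraph n m → Carrier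
  spectralMoment α k d H = Tr k d (Aα α k H)

  ----------------------------------------------------------------------
  -- Extremal k-uniform hypertrees with m hyperedges

  -- The moment of H is compared with those of hypertrees of any order n; the
  -- extremal hypertree itself must belong to the class.

  module Extremal (α : Carrier) (k d m : ℕ) where

    private
      M : ∀ {n m} → Hypergraph n m → Carrier
      M = spectralMoment α k d

    InClass : ∀ {n m′} → Hypergraph n m′ → Set
    InClass {m′ = m′} H = m′ ≡ m × IsHypertree k H

    IsLargest IsSmallest : ∀ {n m′} → Hypergraph n m′ → Set _
    IsLargest  H = InClass H ×
      (∀ {n} (G : Hypergraph n m) → IsHypertree k G → M G ≤ᶠ M H)
    IsSmallest H = InClass H ×
      (∀ {n} (G : Hypergraph n m) → IsHypertree k G → M H ≤ᶠ M G)

    -- H comes second to H₁: strictly after H₁, and first among the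
    -- hypertrees not isomorphic to H₁.

    IsSecondLargest IsSecondSmallest :
      ∀ {n₁ m₁ n m′} → Hypergraph n₁ m₁ → Hypergraph n m′ → Set _
    IsSecondLargest  H₁ H = InClass H × M H < M H₁ ×
      (∀ {n} (G : Hypergraph n m) → IsHypertree k G → ¬ (G ≅ H₁) → M G ≤ᶠ M H)
    IsSecondSmallest H₁ H = InClass H × M H₁ < M H ×
      (∀ {n} (G : Hypergraph n m) → IsHypertree k G → ¬ (G ≅ H₁) → M H ≤ᶠ M G)

{-# OPTIONS --safe #-}
-- In the expansion of Tr_d a summand is a sequence of rows (i , γ) whose arcs i → γⱼ can be
-- rearranged into a closed walk.  Put f(v,e) for the number of rows with first index v and
-- index set e.  The walk leaves every vertex as often as it enters it, so the matrices k f(v,e)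
-- and [v ∈ e] Σᵤ f(u,e) have equal row sums and equal column sums; as the incidence graph has
-- no cycles, they agree.  For d < 2k this leaves d loops at one vertex, or one hyperedge with
-- each of its vertices used once together with d - k loops at vertices of it.  Renaming the
-- vertices does not change the coefficients, so for constants A, B depending only on k, m, α
--   Tr₂     = A Σ d_v² + B                                             (A > 0),
--   Tr_{k+2} = A Σ d_v^{k+2} + B Σ d_v³ + C Σ_e Σ_{u<v∈e} d_u d_v       (A, B ≥ 0, C > 0).
-- With x_v = d_v - 1, a hypertree has k m = n + m - 1 incidences, whence Σ x_v = m - 1.  Thus
-- Σ x_v² is (m - 1)² if one vertex lies in all hyperedges, and at most (m - 2)² + 1 otherwise.
-- The first two sums of Tr_{k+2} are least when all x_v ≤ 1.  The third one is bounded by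
-- e₂(x|e) ≥ s_e - 1, where s_e is the number of v ∈ e with x_v ≥ 1; equality throughout
-- means x_v ≤ 1 and s_e ≤ 2, that is, a hyperpath.
module Submission where

open import Defs
open import Data.Bool.Base using (Bool; true; false; if_then_else_)
import Data.Bool.Properties as Bool
open import Data.Empty using (⊥-elim) renaming (⊥ to Absurd)
open import Data.Fin.Base as Fin
  using (Fin; zero; suc; toℕ; fromℕ<; splitAt; punchIn; punchOut; inject₁; _↑ˡ_; _↑ʳ_)
import Data.Fin.Properties as Fin
open import Data.Fin.Properties using (_≟_; toℕ-injective)
open import Data.Fin.Permutation as Perm using (Permutation; _⟨$⟩ʳ_; _⟨$⟩ˡ_)
open import Data.Fin.Subset
  using (Subset; _∈_; _∉_; _∪_; ⋃; ⊥; ⊤; ⁅_⁆; ∣_∣; ∁; Nonempty; _⊆_; _-_)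
open import Data.Fin.Subset.Properties
  using (_∈?_; ∉⊥; x∈⁅x⁆; x∈⁅y⁆⇒x≡y; x∈p∪q⁺; x∈p∪q⁻; ∣⊥∣≡0; ∣⁅x⁆∣≡1; ∣∁p∣≡n∸∣p∣; ∈⊤; ⊆-antisym; _⊆?_; x∈p∧x≢y⇒x∈p-y; p─q⊆p; p⊂q⇒∣p∣<∣q∣; ∣p∣≤n; ∣⊤∣≡n; x∈p⇒x∉∁p; x∉p⇒x∈∁p; x∈∁p⇒x∉p)
open import Data.List.Base as List
  using (List; []; _∷_; [_]; _++_; concatMap; cartesianProductWith; upTo; allFin)
import Data.List.Properties as List
open import Data.List.Membership.Propositional using (lose; find) renaming (_∈_ to _∈ˡ_; _∉_ to _∉ˡ_)
import Data.List.Membership.Propositional.Properties as Mem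
open import Data.List.Relation.Binary.Permutation.Propositional as ↭
  using (_↭_; ↭-sym)
import Data.List.Relation.Binary.Permutation.Propositional.Properties as ↭
open import Data.List.Relation.Unary.All as All using (All; []; _∷_)
import Data.List.Relation.Unary.All.Properties as All
open import Data.List.Relation.Unary.AllPairs as AllPairs using (AllPairs; []; _∷_)
import Data.List.Relation.Unary.AllPairs.Properties as AllPairs
open import Data.List.Relation.Unary.Any as Any using (Any; here; there)
open import Data.List.Relation.Unary.Unique.Propositional using (Unique)
import Data.List.Relation.Unary.Unique.Propositional.Properties as Unique
open import Data.Nat.Base as ℕ
  using (ℕ; zero; suc; _+_; _*_; _∸_; _^_; _≤_; _<_; _⊓_; z≤n; s≤s; _!)
open import Data.Nat.DivMod using (_mod_; _/_; _%_)
import Data.Nat.DivMod as ℕ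
import Data.Nat.Properties as ℕ
import Data.Nat.ListAction as ListAction
open import Data.Nat.Tactic.RingSolver using (solve-∀)
open import Data.Product.Base using (Σ; ∃; ∃₂; _×_; _,_; proj₁; proj₂)
import Data.Product.Properties as Product
open import Data.Sum.Base using (_⊎_; inj₁; inj₂)
import Data.Sum.Properties as Sum
open import Data.Vec.Base as Vec using (Vec; []; _∷_)
import Data.Vec.Properties as Vec
open import Function.Base using (_∘_; id; case_of_)
open import Function.Bundles using (_⇔_; Equivalence; mk⇔)
open import Function.Definitions using (Injective)
open import Relation.Binary.Construct.Closure.ReflexiveTransitive using (Star; ε; _◅_; _◅◅_)
import Relation.Binary.Construct.Closure.ReflexiveTransitive as Star
import Relation.Binary.PropositionalEquality as ≡
open import Relation.Binary.Definitions as Tri using (Tri)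
open import Relation.Binary.PropositionalEquality
  using (_≡_; _≢_; refl; sym; trans; cong; cong₂; subst; subst₂; module ≡-Reasoning)
open import Relation.Nullary.Decidable.Core using (Dec; yes; no; does; _×-dec_; _⊎-dec_; _→-dec_; ¬?)
open import Relation.Nullary.Decidable using (dec-true; dec-false; does-⇔)
open import Relation.Nullary.Negation.Core using (¬_; contradiction)
open import Algebra.Properties.Semiring.Sum ℕ.+-*-semiring
  using (sum; sum-cong-≗; sum-remove; ∑-distrib-+; ∑-comm; sum-permute; *-distribˡ-sum)

-- Sums over Fin n

-- No coefficient is evaluated. It is enough that coefficients of hyperedges of equal size agree,
-- since a permutation of the vertices carries one hyperedge to the other, and that the decisive
-- ones are positive. Positivity takes one list of rows whose arcs form a closed walk: loops at a
-- vertex for the sum of powers, an Eulerian circuit through a hyperedge for C. Polynomials are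
-- unnormalised lists, and identities between them would hold only up to reordering. So everything
-- is dualised: a linear functional is a function on monomials, and differentiation acts on it by
-- its transpose. The condition d < 2k excludes a hyperedge used twice and two hyperedges at once;
-- for d = k + 2 it says k ≥ 3. The constants are attached to a number n of vertices, so two moments
-- are compared only once n = 1 + m (k - 1) is known for both hypertrees. Connectedness gives ≤
-- here, acyclicity gives ≥. Subtraction in ℕ is avoided by moving terms: e₂(x|e) ≥ s_e - 1 is
-- summed as Y ≤ E + m, and the sums of pairs are compared after adding m.

𝟙 : ∀ {p} {P : Set p} → Dec P → ℕ
𝟙 d = if does d then 1 else 0

𝟙-yes : ∀ {p} {P : Set p} (d : Dec P) → P → 𝟙 d ≡ 1
𝟙-yes d p rewrite dec-true d p = refl

𝟙-no : ∀ {p} {P : Set p} (d : Dec P) → ¬ P → 𝟙 d ≡ 0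
𝟙-no d ¬p rewrite dec-false d ¬p = refl

𝟙-cong : ∀ {p q} {P : Set p} {Q : Set q} (d : Dec P) (e : Dec Q) → (P → Q) → (Q → P) → 𝟙 d ≡ 𝟙 e
𝟙-cong (yes p) e f g = sym (𝟙-yes e (f p))
𝟙-cong (no ¬p) e f g = sym (𝟙-no e (¬p ∘ g))

𝟙≤1 : ∀ {p} {P : Set p} (d : Dec P) → 𝟙 d ≤ 1
𝟙≤1 (yes _) = s≤s z≤n
𝟙≤1 (no _)  = z≤n

𝟙-pos : ∀ {p} {P : Set p} (d : Dec P) → 1 ≤ 𝟙 d → P
𝟙-pos (yes p) _ = p

sum-mono : ∀ {n} {f g : Fin n → ℕ} → (∀ i → f i ≤ g i) → sum f ≤ sum g
sum-mono {zero}  h = z≤n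
sum-mono {suc n} h = ℕ.+-mono-≤ (h zero) (sum-mono (h ∘ suc))

sum-zero : ∀ {n} {f : Fin n → ℕ} → (∀ i → f i ≡ 0) → sum f ≡ 0
sum-zero {zero}  h = refl
sum-zero {suc n} h = cong₂ _+_ (h zero) (sum-zero (h ∘ suc))

sum-const : ∀ n c → sum {n} (λ _ → c) ≡ n * c
sum-const zero    c = refl
sum-const (suc n) c = cong (c +_) (sum-const n c)

-- Summands that cannot exceed their bounds must meet them once the totals agree. This turns a
-- double count into an identity at each index, as in `row-count`, `excess-V≡` and `full-degree⇒∈`.
sum-tight : ∀ {n} {f g : Fin n → ℕ} → (∀ i → f i ≤ g i) → sum g ≤ sum f → ∀ i → f i ≡ g i
sum-tight {suc n} {f} {g} h le i = go i
  where
  h₀ : f zero ≡ g zero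
  h₀ = ℕ.≤-antisym (h zero) (ℕ.+-cancelʳ-≤ (sum (f ∘ suc)) _ _
    (ℕ.≤-trans (ℕ.+-monoʳ-≤ (g zero) (sum-mono (h ∘ suc))) le))
  go : ∀ i → f i ≡ g i
  go zero    = h₀
  go (suc j) = sum-tight (h ∘ suc)
    (ℕ.+-cancelˡ-≤ (f zero) _ _ (subst (λ z → z + sum (g ∘ suc) ≤ sum f) (sym h₀) le)) j

sum-only : ∀ {n} {f : Fin n → ℕ} j → (∀ i → i ≢ j → f i ≡ 0) → sum f ≡ f j
sum-only {suc n} {f} zero h =
  trans (cong (f zero +_) (sum-zero (λ i → h (suc i) λ ()))) (ℕ.+-identityʳ _)
sum-only {suc n} {f} (suc j) h =
  cong₂ _+_ (h zero λ ()) (sum-only j (λ i i≢j → h (suc i) (i≢j ∘ Fin.suc-injective)))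

sum-δ : ∀ {n} (j : Fin n) (f : Fin n → ℕ) → sum (λ i → 𝟙 (i ≟ j) * f i) ≡ f j
sum-δ j f = trans (sum-only j (λ i i≢j → cong (_* f i) (𝟙-no (i ≟ j) i≢j)))
  (trans (cong (_* f j) (𝟙-yes (j ≟ j) refl)) (ℕ.*-identityˡ (f j)))

sum-δ₁ : ∀ {n} (j : Fin n) → sum (λ i → 𝟙 (i ≟ j)) ≡ 1
sum-δ₁ j = trans (sum-only j (λ i i≢j → 𝟙-no (i ≟ j) i≢j)) (𝟙-yes (j ≟ j) refl)

term≤sum : ∀ {n} (f : Fin n → ℕ) j → f j ≤ sum f
term≤sum f zero    = ℕ.m≤m+n _ _
term≤sum f (suc j) = ℕ.≤-trans (term≤sum (f ∘ suc) j) (ℕ.m≤n+m _ _)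

sum-pos : ∀ {n} (f : Fin n → ℕ) → 1 ≤ sum f → ∃ λ j → 1 ≤ f j
sum-pos f le with Fin.any? (λ j → 1 ℕ.≤? f j)
... | yes p = p
... | no ¬p = contradiction
  (subst (1 ≤_) (sum-zero (λ i → ℕ.n≤0⇒n≡0 (ℕ.≤-pred (ℕ.≰⇒> (λ q → ¬p (i , q)))))) le) (λ ())

-- Removing the position `V zero` leaves an injection into one index fewer, given by `punchOut`. The
-- excesses of a few distinguished vertices are bounded by the total excess in this way.
sum-injection : ∀ {s n} (V : Fin s → Fin n) → Injective _≡_ _≡_ V → (f : Fin n → ℕ) →
                sum (f ∘ V) ≤ sum f
sum-injection {zero}  V inj f = z≤n
sum-injection {suc s} {zero} V inj f with () ← V zero
sum-injection {suc s} {suc n} V inj f = begin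
  f v + sum (f ∘ V ∘ suc)          ≡⟨ cong (f v +_) (sum-cong-≗ λ j → cong f (sym (Fin.punchIn-punchOut (v≢ j)))) ⟩
  f v + sum (f ∘ punchIn v ∘ V′)   ≤⟨ ℕ.+-monoʳ-≤ (f v) (sum-injection V′ inj′ (f ∘ punchIn v)) ⟩
  f v + sum (f ∘ punchIn v)        ≡⟨ sym (sum-remove f) ⟩
  sum f                            ∎
  where
  open ℕ.≤-Reasoning
  v = V zero
  v≢ : ∀ j → v ≢ V (suc j)
  v≢ j eq with () ← inj eq
  V′ : Fin s → Fin n
  V′ j = punchOut (v≢ j)
  inj′ : Injective _≡_ _≡_ V′
  inj′ {i} {j} eq = Fin.suc-injective (inj (Fin.punchOut-injective (v≢ i) (v≢ j) eq))

infixr 5 _◂_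
_◂_ : ∀ {s} {A : Set} → A → (Fin s → A) → Fin (suc s) → A
(a ◂ V) zero    = a
(a ◂ V) (suc j) = V j

injective-∷ : ∀ {s n} (V : Fin s → Fin n) (v : Fin n) → Injective _≡_ _≡_ V → (∀ j → V j ≢ v) →
              Injective _≡_ _≡_ (v ◂ V)
injective-∷ V v inj v∉ {zero}  {zero}  eq = refl
injective-∷ V v inj v∉ {zero}  {suc j} eq = contradiction (sym eq) (v∉ j)
injective-∷ V v inj v∉ {suc i} {zero}  eq = contradiction eq (v∉ i)
injective-∷ V v inj v∉ {suc i} {suc j} eq = cong suc (inj eq)

two≤sum : ∀ {n} (f : Fin n → ℕ) {a b} → a ≢ b → f a + f b ≤ sum f
two≤sum f {a} {b} a≢b = subst (_≤ sum f) (cong (f a +_) (ℕ.+-identityʳ (f b)))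
  (sum-injection _ (injective-∷ (λ (_ : Fin 1) → b) a (λ { {zero} {zero} _ → refl }) (λ _ → a≢b ∘ sym)) f)

three≤sum : ∀ {n} (f : Fin n → ℕ) {a b c} → a ≢ b → a ≢ c → b ≢ c → f a + (f b + f c) ≤ sum f
three≤sum f {a} {b} {c} a≢b a≢c b≢c =
  subst (_≤ sum f) (cong (λ z → f a + (f b + z)) (ℕ.+-identityʳ (f c)))
  (sum-injection _ (injective-∷ _ a
    (injective-∷ (λ (_ : Fin 1) → c) b (λ { {zero} {zero} _ → refl }) (λ _ → b≢c ∘ sym))
    (λ { zero → a≢b ∘ sym ; (suc zero) → a≢c ∘ sym })) f)

∣_∣≡sum : ∀ {n} (p : Subset n) → ∣ p ∣ ≡ sum (λ v → 𝟙 (v ∈? p))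
∣ [] ∣≡sum          = refl
∣ true ∷ p ∣≡sum = cong suc (trans ∣ p ∣≡sum (sum-cong-≗ λ v →
  𝟙-cong (v ∈? p) (suc v ∈? (true ∷ p)) Vec.there (λ { (Vec.there q) → q })))
∣ false ∷ p ∣≡sum = trans ∣ p ∣≡sum (sum-cong-≗ λ v →
  𝟙-cong (v ∈? p) (suc v ∈? (false ∷ p)) Vec.there (λ { (Vec.there q) → q }))

subset-ext : ∀ {n} {p q : Subset n} → (∀ v → v ∈ p → v ∈ q) → (∀ v → v ∈ q → v ∈ p) → p ≡ q
subset-ext f g = ⊆-antisym (λ {v} → f v) (λ {v} → g v)

-- Cycles

-- A witness found below `b` is not a subterm of `b`, so the descent is driven by a bound on it.
least : ∀ {p} {P : ℕ → Set p} → (∀ i → Dec (P i)) → ∀ b → P b →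
        ∃ λ b → P b × (∀ c → c < b → ¬ P c)
least {P = P} P? b = go b b ℕ.≤-refl
  where
  go : ∀ fuel b → b ≤ fuel → P b → ∃ λ b → P b × (∀ c → c < b → ¬ P c)
  go fuel b le Pb with ℕ.anyUpTo? P? b
  ... | no ¬p = b , Pb , λ c c<b Pc → ¬p (c , c<b , Pc)
  go zero b le Pb | yes (c , c<b , Pc) = contradiction (ℕ.≤-trans c<b le) λ ()
  go (suc fuel) b le Pb | yes (c , c<b , Pc) = go fuel c (ℕ.≤-pred (ℕ.≤-trans c<b le)) Pc

toℕ-cyclicSuc : ∀ {l} (i : Fin (suc l)) →
  (toℕ (cyclicSuc i) ≡ suc (toℕ i) × suc (toℕ i) < suc l) ⊎ (toℕ (cyclicSuc i) ≡ 0 × toℕ i ≡ l)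
toℕ-cyclicSuc {l} i with suc (toℕ i) ℕ.<? suc l
... | yes lt = inj₁ (trans (Fin.toℕ-fromℕ< _) (ℕ.m<n⇒m%n≡m lt) , lt)
... | no ≮ = inj₂ (trans (Fin.toℕ-fromℕ< _) (trans (cong (λ z → suc z % suc l) i≡l) (ℕ.n%n≡0 (suc l))) , i≡l)
  where
  i≡l : toℕ i ≡ l
  i≡l = ℕ.≤-antisym (Fin.toℕ≤pred[n] i) (ℕ.≤-pred (ℕ.≮⇒≥ ≮))

module _ {n m} (H : Hypergraph n m) where

  -- With sequences indexed by ℕ, a segment of an infinite walk becomes a cycle by a mere shift.
  -- Only the last step, where `cyclicSuc` wraps around, needs a hypothesis of its own.
  cycle-of-sequences : (V : ℕ → Fin n) (E : ℕ → Fin m) (l : ℕ) →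
    (∀ i j → i < j → j < 2 + l → V i ≢ V j) → (∀ i j → i < j → j < 2 + l → E i ≢ E j) →
    (∀ i → V i ∈ edge H (E i)) → (∀ i → V (suc i) ∈ edge H (E i)) →
    V 0 ∈ edge H (E (suc l)) → Cycle H
  cycle-of-sequences V E l V≢ E≢ V∈E next close = record
    { length-2         = l
    ; vertex           = V ∘ toℕ
    ; hyperedge        = E ∘ toℕ
    ; vertex-distinct  = distinct V V≢
    ; edge-distinct    = distinct E E≢
    ; vertex∈edge      = V∈E ∘ toℕ
    ; next-vertex∈edge = next′
    }
    where
    distinct : ∀ {A : Set} (f : ℕ → A) → (∀ i j → i < j → j < 2 + l → f i ≢ f j) →
               Injective _≡_ _≡_ (f ∘ toℕ {2 + l})
    distinct f f≢ {i} {j} eq with ℕ.<-cmp (toℕ i) (toℕ j)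
    ... | Tri.tri< lt _ _ = contradiction eq (f≢ _ _ lt (Fin.toℕ<n j))
    ... | Tri.tri≈ _ e _ = toℕ-injective e
    ... | Tri.tri> _ _ gt = contradiction (sym eq) (f≢ _ _ gt (Fin.toℕ<n i))
    next′ : ∀ (i : Fin (2 + l)) → V (toℕ (cyclicSuc i)) ∈ edge H (E (toℕ i))
    next′ i with toℕ-cyclicSuc i
    ... | inj₁ (eq , _) = subst (λ z → V z ∈ edge H (E (toℕ i))) (sym eq) (next (toℕ i))
    ... | inj₂ (eq , i≡) = subst₂ (λ y z → V y ∈ edge H (E z)) (sym eq) (sym i≡) close

  -- A relation without leaves between vertices and hyperedges carries an infinite walk that
  -- never turns back; its first repetition closes a cycle.

  module _ (R : Fin n → Fin m → Set) (R⇒∈ : ∀ {v e} → R v e → v ∈ edge H e)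
           (vertex′ : ∀ {v e} → R v e → ∃ λ v′ → v′ ≢ v × R v′ e)
           (edge′ : ∀ {v e} → R v e → ∃ λ e′ → e′ ≢ e × R v e′) where

    leafless⇒cycle : ∃₂ R → Cycle H
    leafless⇒cycle start = found (least Rep? b₀ rep₀)
      where
      step : ∃₂ R → ∃₂ R
      step (v , e , r) with vertex′ r
      ... | v′ , _ , r′ with edge′ r′
      ... | e′ , _ , r″ = v′ , e′ , r″
      walk : ℕ → ∃₂ R
      walk zero    = start
      walk (suc i) = step (walk i)
      V : ℕ → Fin n
      V i = proj₁ (walk i)
      E : ℕ → Fin m
      E i = proj₁ (proj₂ (walk i))
      V∈E : ∀ i → V i ∈ edge H (E i)
      V∈E i = R⇒∈ (proj₂ (proj₂ (walk i)))
      next : ∀ i → V (suc i) ∈ edge H (E i)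
      next i = R⇒∈ (proj₂ (proj₂ (vertex′ (proj₂ (proj₂ (walk i))))))
      V≢ : ∀ i → V (suc i) ≢ V i
      V≢ i = proj₁ (proj₂ (vertex′ (proj₂ (proj₂ (walk i)))))
      E≢ : ∀ i → E (suc i) ≢ E i
      E≢ i = proj₁ (proj₂ (edge′ (proj₂ (proj₂ (vertex′ (proj₂ (proj₂ (walk i))))))))
      Rep : ℕ → Set
      Rep b = ∃ λ a → a < b × (V a ≡ V b ⊎ E a ≡ E b)
      Rep? : ∀ b → Dec (Rep b)
      Rep? b = ℕ.anyUpTo? (λ a → (V a ≟ V b) ⊎-dec (E a ≟ E b)) b
      pigeons : ∃₂ λ i j → i Fin.< j × V (toℕ {suc n} i) ≡ V (toℕ j)
      pigeons = Fin.pigeonhole (ℕ.n<1+n n) (V ∘ toℕ)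
      b₀ : ℕ
      b₀ = toℕ (proj₁ (proj₂ pigeons))
      rep₀ : Rep b₀
      rep₀ = let i , j , i<j , eq = pigeons in toℕ i , i<j , inj₁ eq

      -- Consecutive terms differ, so a repetition spans at least two steps. This gives the length
      -- of at least 2 that a cycle must have.
      gap : ∀ {A : Set} (f : ℕ → A) → (∀ i → f (suc i) ≢ f i) →
            ∀ a b → a < b → f a ≡ f b → ∃ λ l → b ≡ a + (2 + l)
      gap f f≢ a b a<b eq with ℕ.m≤n⇒∃[o]m+o≡n a<b
      ... | zero , refl = contradiction (sym (trans eq (cong f (ℕ.+-identityʳ (suc a))))) (f≢ a)
      ... | suc l , refl = l , sym (trans (ℕ.+-suc a (suc l)) refl)

      found : (∃ λ b → Rep b × (∀ c → c < b → ¬ Rep c)) → Cycle H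
      found (b , rep , minimal) with ℕ.anyUpTo? (λ a → V a ≟ V b) b
      -- The vertices and hyperedges with indices a, ..., b - 1 form the cycle; minimality of `b`
      -- makes them distinct.
      ... | yes (a , a<b , Va≡Vb) with gap V V≢ a b a<b Va≡Vb
      ...   | l , refl = cycle-of-sequences (V ∘ (a +_)) (E ∘ (a +_)) l
        (λ i j i<j j<l eq → minimal (a + j) (ℕ.+-monoʳ-< a j<l) (a + i , ℕ.+-monoʳ-< a i<j , inj₁ eq))
        (λ i j i<j j<l eq → minimal (a + j) (ℕ.+-monoʳ-< a j<l) (a + i , ℕ.+-monoʳ-< a i<j , inj₂ eq))
        (λ i → V∈E (a + i))
        (λ i → subst (λ z → V z ∈ edge H (E (a + i))) (sym (ℕ.+-suc a i)) (next (a + i)))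
        (subst (_∈ edge H (E (a + suc l)))
          (trans (cong V (sym (ℕ.+-suc a (suc l)))) (trans (sym Va≡Vb) (cong V (sym (ℕ.+-identityʳ a)))))
          (next (a + suc l)))
      found (b , (a , a<b , inj₁ Va≡Vb) , minimal) | no ¬V = contradiction (a , a<b , Va≡Vb) ¬V
      -- Only a hyperedge returns at `b`. The cycle has the indices a + 1, ..., b and is closed by
      -- `E b`, which contains `V (suc a)` because it equals `E a`. As `b` itself belongs to the
      -- cycle, its vertex is kept apart from the others by `¬V`.
      found (b , (a , a<b , inj₂ Ea≡Eb) , minimal) | no ¬V with gap E E≢ a b a<b Ea≡Eb
      ... | l , refl = cycle-of-sequences (V ∘ (suc a +_)) (E ∘ (suc a +_)) l
        V-distinct E-distinct
        (λ i → V∈E (suc a + i))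
        (λ i → subst (λ z → V (suc z) ∈ edge H (E (suc a + i))) (sym (ℕ.+-suc a i)) (next (suc a + i)))
        (subst₂ (λ y z → V (suc y) ∈ edge H z) (sym (ℕ.+-identityʳ a))
          (trans Ea≡Eb (cong E (ℕ.+-suc a (suc l)))) (next a))
        where
        lt : ∀ {i j} → i < j → suc a + i < suc a + j
        lt = ℕ.+-monoʳ-< (suc a)
        end : suc a + suc l ≡ a + (2 + l)
        end = sym (ℕ.+-suc a (suc l))
        within : ∀ {j} → j < 2 + l → suc a + j < a + (2 + l) ⊎ suc a + j ≡ a + (2 + l)
        within {j} j< = ℕ.m≤n⇒m<n∨m≡n (subst (suc (a + j) ≤_) end (ℕ.+-monoʳ-≤ (suc a) (ℕ.≤-pred j<)))
        V-distinct : ∀ i j → i < j → j < 2 + l → V (suc a + i) ≢ V (suc a + j)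
        V-distinct i j i<j j< eq with within j<
        ... | inj₁ <b = minimal (suc a + j) <b (suc a + i , lt i<j , inj₁ eq)
        ... | inj₂ ≡b = ¬V (suc a + i , subst (suc a + i <_) ≡b (lt i<j) , trans eq (cong V ≡b))
        E-distinct : ∀ i j → i < j → j < 2 + l → E (suc a + i) ≢ E (suc a + j)
        E-distinct i j i<j j< eq with within j<
        ... | inj₁ <b = minimal (suc a + j) <b (suc a + i , lt i<j , inj₂ eq)
        ... | inj₂ ≡b = minimal (suc a + i) (subst (suc a + i <_) ≡b (lt i<j))
          (a , s≤s (ℕ.m≤m+n a i) , inj₂ (trans Ea≡Eb (trans (cong E (sym ≡b)) (sym eq))))

-- Counting in hypertrees

sum-cancel : ∀ {n} {f g : Fin n → ℕ} j → (∀ i → i ≢ j → f i ≡ g i) → sum f ≡ sum g → f j ≡ g j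
sum-cancel {suc n} {f} {g} zero h eq = ℕ.+-cancelʳ-≡ (sum (f ∘ suc)) _ _
  (trans eq (cong (g zero +_) (sym (sum-cong-≗ λ i → h (suc i) λ ()))))
sum-cancel {suc n} {f} {g} (suc j) h eq = sum-cancel j (λ i i≢j → h (suc i) (i≢j ∘ Fin.suc-injective))
  (ℕ.+-cancelˡ-≡ (f zero) _ _ (trans eq (cong (_+ sum (g ∘ suc)) (sym (h zero λ ())))))

length-filter : ∀ {n p} {A : Set} {P : A → Set p} (P? : ∀ a → Dec (P a)) (f : Fin n → A) →
                List.length (List.filter P? (List.tabulate f)) ≡ sum (λ i → 𝟙 (P? (f i)))
length-filter {zero}  P? f = refl
length-filter {suc n} P? f with P? (f zero)
... | yes _ = cong suc (length-filter P? (f ∘ suc))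
... | no _  = length-filter P? (f ∘ suc)

x∉p-x : ∀ {n} (p : Subset n) x → x ∉ p - x
x∉p-x (true ∷ p)  zero    ()
x∉p-x (false ∷ p) zero    ()
x∉p-x (s ∷ p)     (suc x) (Vec.there q) = x∉p-x p x q

module _ {n m} (H : Hypergraph n m) where

  inc : Fin n → Fin m → ℕ
  inc v e = 𝟙 (v ∈? edge H e)

  deg : Fin n → ℕ
  deg v = sum (inc v)

  degree≡deg : ∀ v → degree H v ≡ deg v
  degree≡deg v = length-filter (λ e → v ∈? edge H e) id

  deg-pos : ∀ {v e} → v ∈ edge H e → 1 ≤ deg v
  deg-pos {v} {e} v∈e = subst (_≤ deg v) (𝟙-yes (v ∈? edge H e) v∈e) (term≤sum (inc v) e)

  sum-incident : ∀ (f : Fin n → ℕ) →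
    sum (λ e → sum (λ v → inc v e * f v)) ≡ sum (λ v → deg v * f v)
  sum-incident f = trans (∑-comm (λ e v → inc v e * f v)) (sum-cong-≗ λ v →
    trans (sum-cong-≗ λ e → ℕ.*-comm (inc v e) (f v))
    (trans (sym (*-distribˡ-sum (f v) (inc v))) (ℕ.*-comm (f v) (deg v))))

  -- The positions where the matrices differ lie on incidences. Equal sums mean that no row and no
  -- column contains just one of them, so they form a leafless part of the incidence graph, which a
  -- forest does not have.
  matrix-unique : ¬ Cycle H → (a b : Fin n → Fin m → ℕ) →
    (∀ v e → v ∉ edge H e → a v e ≡ b v e) →
    (∀ v → sum (a v) ≡ sum (b v)) →
    (∀ e → sum (λ v → a v e) ≡ sum (λ v → b v e)) →
    ∀ v e → a v e ≡ b v e
  matrix-unique acyclic a b off rows columns v e with a v e ℕ.≟ b v e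
  ... | yes eq = eq
  ... | no neq = contradiction (leafless⇒cycle H R R⇒∈ vertex′ edge′ (v , e , neq)) acyclic
    where
    R : Fin n → Fin m → Set
    R v e = a v e ≢ b v e
    R⇒∈ : ∀ {v e} → R v e → v ∈ edge H e
    R⇒∈ {v} {e} r with v ∈? edge H e
    ... | yes p = p
    ... | no ¬p = contradiction (off v e ¬p) r
    differ : ∀ {N} (f g : Fin N → ℕ) j → sum f ≡ sum g → f j ≢ g j → ∃ λ i → i ≢ j × f i ≢ g i
    differ f g j eq neq with Fin.any? (λ i → ¬? (i ≟ j) ×-dec ¬? (f i ℕ.≟ g i))
    ... | yes p = p
    ... | no ¬p = contradiction (sum-cancel j same eq) neq
      where
      same : ∀ i → i ≢ j → f i ≡ g i
      same i i≢j with f i ℕ.≟ g i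
      ... | yes q = q
      ... | no ¬q = contradiction (i , i≢j , ¬q) ¬p
    vertex′ : ∀ {v e} → R v e → ∃ λ v′ → v′ ≢ v × R v′ e
    vertex′ {v} {e} = differ (λ v → a v e) (λ v → b v e) v (columns e)
    edge′ : ∀ {v e} → R v e → ∃ λ e′ → e′ ≢ e × R v e′
    edge′ {v} {e} = differ (a v) (b v) e (rows v)

  Shared : Subset m → Fin n → Fin m → Set
  Shared A v e = v ∈ edge H e × ∃ λ f → f ∈ A × f ≢ e × v ∈ edge H f

  shared? : ∀ A v e → Dec (Shared A v e)
  shared? A v e = (v ∈? edge H e) ×-dec
    Fin.any? (λ f → (f ∈? A) ×-dec (¬? (f ≟ e) ×-dec (v ∈? edge H f)))

  AtMostOneShared : Subset m → Fin m → Set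
  AtMostOneShared A e = ∀ u v → Shared A u e → Shared A v e → u ≡ v

  -- Otherwise every hyperedge of `A` has two vertices shared within `A`, and each of these lies in
  -- a second hyperedge of `A`; the shared incidences then form a leafless relation.
  leaf-edge : ¬ Cycle H → (A : Subset m) → Nonempty A → ∃ λ e → e ∈ A × AtMostOneShared A e
  leaf-edge acyclic A (e₀ , e₀∈A) with
    Fin.any? (λ e → (e ∈? A) ×-dec Fin.all? (λ u → Fin.all? (λ v →
      shared? A u e →-dec (shared? A v e →-dec (u ≟ v)))))
  ... | yes p = p
  ... | no ¬p = contradiction (leafless⇒cycle H R (λ r → proj₁ (proj₂ r)) vertex′ edge′ start) acyclic
    where
    R : Fin n → Fin m → Set
    R v e = e ∈ A × Shared A v e
    two : ∀ e → e ∈ A → ∃₂ λ u v → u ≢ v × Shared A u e × Shared A v e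
    two e e∈A with Fin.any? (λ u → Fin.any? (λ v → ¬? (u ≟ v) ×-dec (shared? A u e ×-dec shared? A v e)))
    ... | yes q = q
    ... | no ¬q = contradiction (e , e∈A , unique) ¬p
      where
      unique : AtMostOneShared A e
      unique u v su sv with u ≟ v
      ... | yes eq = eq
      ... | no neq = contradiction (u , v , neq , su , sv) ¬q
    vertex′ : ∀ {v e} → R v e → ∃ λ v′ → v′ ≢ v × R v′ e
    vertex′ {v} {e} (e∈A , _) with two e e∈A
    ... | u₁ , u₂ , neq , s₁ , s₂ with u₁ ≟ v
    ...   | no u₁≢v = u₁ , u₁≢v , e∈A , s₁
    ...   | yes refl = u₂ , neq ∘ sym , e∈A , s₂
    edge′ : ∀ {v e} → R v e → ∃ λ e′ → e′ ≢ e × R v e′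
    edge′ {v} {e} (e∈A , v∈e , f , f∈A , f≢e , v∈f) = f , f≢e , f∈A , v∈f , e , e∈A , f≢e ∘ sym , v∈e
    start : ∃₂ R
    start = let u , _ , _ , s , _ = two e₀ e₀∈A in u , e₀ , e₀∈A , s

  degIn : Subset m → Fin n → ℕ
  degIn A v = sum (λ e → 𝟙 (e ∈? A) * inc v e)

  -- Hyperedges are removed one at a time, always a leaf. Removing `e` lowers the excess only at
  -- vertices shared with the rest, hence by at most 1 in total. This is the half of the vertex
  -- count that rests on acyclicity.
  excess≤ : ¬ Cycle H → ∀ c (A : Subset m) → ∣ A ∣ ≡ c → sum (λ v → degIn A v ∸ 1) ≤ c ∸ 1
  excess≤ acyclic zero A ∣A∣≡0 = ℕ.≤-reflexive (sum-zero λ v → cong (_∸ 1) (sum-zero λ e →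
    cong (_* inc v e) (ℕ.n≤0⇒n≡0 (subst (𝟙 (e ∈? A) ≤_) (trans (sym ∣ A ∣≡sum) ∣A∣≡0) (term≤sum _ e)))))
  excess≤ acyclic (suc c) A ∣A∣≡ with leaf-edge acyclic A (nonempty (sum-pos _ (subst (1 ≤_) (trans (sym ∣A∣≡) ∣ A ∣≡sum) (s≤s z≤n))))
    where
    nonempty : (∃ λ e → 1 ≤ 𝟙 (e ∈? A)) → Nonempty A
    nonempty (e , le) = e , 𝟙-pos (e ∈? A) le
  ... | e , e∈A , unique = begin
    sum (λ v → degIn A v ∸ 1)                    ≤⟨ sum-mono split ⟩
    sum (λ v → (degIn A′ v ∸ 1) + s v)           ≡⟨ ∑-distrib-+ (λ v → degIn A′ v ∸ 1) s ⟩
    sum (λ v → degIn A′ v ∸ 1) + sum s           ≤⟨ bound c refl ⟩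
    c                                            ∎
    where
    open ℕ.≤-Reasoning
    A′ : Subset m
    A′ = A - e
    member : ∀ f → 𝟙 (f ∈? A) ≡ 𝟙 (f ∈? A′) + 𝟙 (f ≟ e)
    member f with f ≟ e
    ... | yes refl = trans (𝟙-yes (f ∈? A) e∈A) (cong (_+ 1) (sym (𝟙-no (f ∈? A′) (x∉p-x A f))))
    ... | no f≢e = trans (𝟙-cong (f ∈? A) (f ∈? A′) (λ p → x∈p∧x≢y⇒x∈p-y p f≢e) (p─q⊆p A ⁅ e ⁆)) (sym (ℕ.+-identityʳ _))
    ∣A′∣ : ∣ A′ ∣ ≡ c
    ∣A′∣ = ℕ.suc-injective (begin-equality
      suc ∣ A′ ∣ ≡⟨ cong suc ∣ A′ ∣≡sum ⟩
      suc (sum (λ f → 𝟙 (f ∈? A′))) ≡⟨ ℕ.+-comm 1 _ ⟩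
      sum (λ f → 𝟙 (f ∈? A′)) + 1 ≡⟨ cong (sum (λ f → 𝟙 (f ∈? A′)) +_) (sym (sum-δ₁ e)) ⟩
      sum (λ f → 𝟙 (f ∈? A′)) + sum (λ f → 𝟙 (f ≟ e)) ≡⟨ sym (∑-distrib-+ (λ f → 𝟙 (f ∈? A′)) _) ⟩
      sum (λ f → 𝟙 (f ∈? A′) + 𝟙 (f ≟ e)) ≡⟨ sum-cong-≗ (sym ∘ member) ⟩
      sum (λ f → 𝟙 (f ∈? A)) ≡⟨ sym ∣ A ∣≡sum ⟩
      ∣ A ∣ ≡⟨ ∣A∣≡ ⟩
      suc c ∎)
    degIn-split : ∀ v → degIn A v ≡ degIn A′ v + inc v e
    degIn-split v = begin-equality
      sum (λ f → 𝟙 (f ∈? A) * inc v f)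
        ≡⟨ sum-cong-≗ (λ f → trans (cong (_* inc v f) (member f)) (ℕ.*-distribʳ-+ (inc v f) (𝟙 (f ∈? A′)) _)) ⟩
      sum (λ f → 𝟙 (f ∈? A′) * inc v f + 𝟙 (f ≟ e) * inc v f)
        ≡⟨ ∑-distrib-+ (λ f → 𝟙 (f ∈? A′) * inc v f) _ ⟩
      degIn A′ v + sum (λ f → 𝟙 (f ≟ e) * inc v f)
        ≡⟨ cong (degIn A′ v +_) (sum-δ e (inc v)) ⟩
      degIn A′ v + inc v e ∎
    s : Fin n → ℕ
    s v = inc v e * (1 ⊓ degIn A′ v)
    arith : ∀ d i → i ≤ 1 → (d + i) ∸ 1 ≤ (d ∸ 1) + i * (1 ⊓ d)
    arith zero    zero    _ = z≤n
    arith zero    (suc zero) _ = z≤n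
    arith (suc d) zero    _ = ℕ.≤-refl
    arith (suc d) (suc zero) _ = ℕ.≤-refl
    arith d (suc (suc i)) (s≤s ())
    split : ∀ v → degIn A v ∸ 1 ≤ (degIn A′ v ∸ 1) + s v
    split v = subst (λ z → z ∸ 1 ≤ (degIn A′ v ∸ 1) + s v) (sym (degIn-split v)) (arith (degIn A′ v) (inc v e) (𝟙≤1 (v ∈? edge H e)))
    shared : ∀ v → 1 ≤ s v → Shared A v e
    shared v le with v ∈? edge H e
    ... | no _ = contradiction le λ ()
    ... | yes v∈e with sum-pos (λ f → 𝟙 (f ∈? A′) * inc v f)
                         (ℕ.≤-trans le (ℕ.≤-trans (ℕ.≤-reflexive (ℕ.+-identityʳ _)) (ℕ.m⊓n≤n 1 (degIn A′ v))))
    ...   | f , 1≤ with f ∈? A′ | v ∈? edge H f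
    ...     | yes f∈A′ | yes v∈f = v∈e , f , p─q⊆p A ⁅ e ⁆ f∈A′ , (λ { refl → x∉p-x A e f∈A′ }) , v∈f
    ...     | yes _    | no _  = contradiction 1≤ λ ()
    ...     | no _     | _     = contradiction 1≤ λ ()
    s≤1 : ∀ v → s v ≤ 1
    s≤1 v = ℕ.*-mono-≤ (𝟙≤1 (v ∈? edge H e)) (ℕ.m⊓n≤m 1 (degIn A′ v))
    sum-s≤1 : sum s ≤ 1
    sum-s≤1 with 1 ℕ.≤? sum s
    ... | no ≰ = ℕ.≤-trans (ℕ.≤-pred (ℕ.≰⇒> ≰)) z≤n
    ... | yes le with sum-pos s le
    ...   | v , 1≤sv = subst (_≤ 1) (sym (sum-only v λ u u≢v →
            ℕ.n≤0⇒n≡0 (ℕ.≤-pred (ℕ.≰⇒> λ 1≤su → u≢v (unique u v (shared u 1≤su) (shared v 1≤sv)))))) (s≤1 v)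
    -- `c` is the number of hyperedges that remain. If it is 0, the target is 0 and `s` must vanish
    -- altogether; otherwise the bounds c - 1 and 1 add up.
    bound : ∀ c′ → c ≡ c′ → sum (λ v → degIn A′ v ∸ 1) + sum s ≤ c
    bound zero refl = ℕ.≤-reflexive (cong₂ _+_
      (ℕ.n≤0⇒n≡0 (excess≤ acyclic c A′ ∣A′∣))
      (sum-zero λ v → trans (cong (λ z → inc v e * (1 ⊓ z)) (sum-zero λ f →
        cong (_* inc v f) (ℕ.n≤0⇒n≡0 (subst (𝟙 (f ∈? A′) ≤_) (trans (sym ∣ A′ ∣≡sum) ∣A′∣) (term≤sum _ f)))))
        (ℕ.*-zeroʳ (inc v e))))
    bound (suc c′) refl = ℕ.≤-trans (ℕ.+-mono-≤ (excess≤ acyclic c A′ ∣A′∣) sum-s≤1) (ℕ.≤-reflexive (ℕ.+-comm c′ 1))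

  crossing : ∀ {q} {Q : Fin n → Set q} → (∀ v → Dec (Q v)) → ∀ {u v} → Star (Adjacent H) u v → Q u → ¬ Q v →
             ∃ λ e → ∃₂ λ a b → a ∈ edge H e × b ∈ edge H e × Q a × ¬ Q b
  crossing Q? ε Qu ¬Qv = contradiction Qu ¬Qv
  crossing Q? (_◅_ {j = w} (via e u∈e w∈e) path) Qu ¬Qv with Q? w
  ... | yes Qw = crossing Q? path Qw ¬Qv
  ... | no ¬Qw = e , _ , w , u∈e , w∈e , Qu , ¬Qw

module _ {n m k} (H : Hypergraph n m) (uniform : Uniform k H) where

  sum-inc : ∀ e → sum (λ v → inc H v e) ≡ k
  sum-inc e = trans (sym ∣ edge H e ∣≡sum) (uniform e)

  handshake : sum (deg H) ≡ m * k
  handshake = trans (∑-comm (inc H)) (trans (sum-cong-≗ sum-inc) (sum-const m k))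

  covered : Subset n → ℕ
  covered W = sum (λ e → 𝟙 (edge H e ⊆? W))

  -- `W` is explored from the root. A hyperedge that leaves `W` already meets it, so it adds at most
  -- k - 1 vertices, and it becomes covered, which preserves the bound on the size of `W`. `fuel`
  -- bounds the number of vertices still outside.
  grow : ∀ {root} → Connected H → ∀ fuel (W : Subset n) → root ∈ W → n ≤ ∣ W ∣ + fuel →
         ∣ W ∣ ≤ 1 + covered W * (k ∸ 1) → n ≤ 1 + m * (k ∸ 1)
  grow {root} connected fuel W root∈W n≤ ∣W∣≤ with Fin.any? (λ v → ¬? (v ∈? W))
  ... | no all∈ = ℕ.≤-trans n≤∣W∣ (ℕ.≤-trans ∣W∣≤ (s≤s (ℕ.*-monoˡ-≤ (k ∸ 1)
        (ℕ.≤-trans (sum-mono (λ e → 𝟙≤1 (edge H e ⊆? W))) (ℕ.≤-reflexive (trans (sum-const m 1) (ℕ.*-identityʳ m)))))))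
    where
    n≤∣W∣ : n ≤ ∣ W ∣
    n≤∣W∣ = ℕ.≤-reflexive (sym (trans ∣ W ∣≡sum (trans (sum-cong-≗ λ v → 𝟙-yes (v ∈? W) (in-W v)) (trans (sum-const n 1) (ℕ.*-identityʳ n)))))
      where
      in-W : ∀ v → v ∈ W
      in-W v with v ∈? W
      ... | yes p = p
      ... | no ¬p = contradiction (v , ¬p) all∈
  ... | yes (v , v∉W) with crossing H (_∈? W) (connected root v) root∈W v∉W
  ... | e , a , b , a∈e , b∈e , a∈W , b∉W = next fuel n≤
    where
    W′ : Subset n
    W′ = W ∪ edge H e
    open ℕ.≤-Reasoning
    pointwise : ∀ v → 𝟙 (v ∈? W′) + 𝟙 (v ≟ a) ≤ 𝟙 (v ∈? W) + inc H v e
    pointwise v with v ≟ a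
    ... | yes refl = ℕ.≤-trans (ℕ.+-monoˡ-≤ 1 (𝟙≤1 (v ∈? W′)))
      (ℕ.≤-reflexive (sym (cong₂ _+_ (𝟙-yes (v ∈? W) a∈W) (𝟙-yes (v ∈? edge H e) a∈e))))
    ... | no _ with v ∈? W′
    ...   | no _ = z≤n
    ...   | yes p with x∈p∪q⁻ W (edge H e) p
    ...     | inj₁ q = ℕ.≤-trans (ℕ.≤-reflexive (sym (𝟙-yes (v ∈? W) q))) (ℕ.m≤m+n _ _)
    ...     | inj₂ q = ℕ.≤-trans (ℕ.≤-reflexive (sym (𝟙-yes (v ∈? edge H e) q))) (ℕ.m≤n+m _ _)
    size : ∣ W′ ∣ + 1 ≤ ∣ W ∣ + k
    size = begin
      ∣ W′ ∣ + 1 ≡⟨ cong₂ _+_ ∣ W′ ∣≡sum (sym (sum-δ₁ a)) ⟩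
      sum (λ v → 𝟙 (v ∈? W′)) + sum (λ v → 𝟙 (v ≟ a)) ≡⟨ sym (∑-distrib-+ (λ v → 𝟙 (v ∈? W′)) _) ⟩
      sum (λ v → 𝟙 (v ∈? W′) + 𝟙 (v ≟ a)) ≤⟨ sum-mono pointwise ⟩
      sum (λ v → 𝟙 (v ∈? W) + inc H v e) ≡⟨ ∑-distrib-+ (λ v → 𝟙 (v ∈? W)) _ ⟩
      sum (λ v → 𝟙 (v ∈? W)) + sum (λ v → inc H v e) ≡⟨ cong₂ _+_ (sym ∣ W ∣≡sum) (sum-inc e) ⟩
      ∣ W ∣ + k ∎
    covered-grows : suc (covered W) ≤ covered W′
    covered-grows = begin
      suc (covered W) ≡⟨ ℕ.+-comm 1 (covered W) ⟩
      covered W + 1 ≡⟨ cong (covered W +_) (sym (sum-δ₁ e)) ⟩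
      covered W + sum (λ f → 𝟙 (f ≟ e)) ≡⟨ sym (∑-distrib-+ (λ f → 𝟙 (edge H f ⊆? W)) _) ⟩
      sum (λ f → 𝟙 (edge H f ⊆? W) + 𝟙 (f ≟ e)) ≤⟨ sum-mono one ⟩
      covered W′ ∎
      where
      one : ∀ f → 𝟙 (edge H f ⊆? W) + 𝟙 (f ≟ e) ≤ 𝟙 (edge H f ⊆? W′)
      one f with f ≟ e
      ... | yes refl = ℕ.≤-reflexive (trans (cong (_+ 1) (𝟙-no (edge H f ⊆? W) (λ sub → b∉W (sub b∈e))))
                         (sym (𝟙-yes (edge H f ⊆? W′) (λ p → x∈p∪q⁺ {p = W} (inj₂ p)))))
      ... | no _ with edge H f ⊆? W
      ...   | no _ = z≤n
      ...   | yes sub = ℕ.≤-reflexive (sym (𝟙-yes (edge H f ⊆? W′) (λ p → x∈p∪q⁺ {p = W} (inj₁ (sub p)))))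
    bigger : suc ∣ W ∣ ≤ ∣ W′ ∣
    bigger = p⊂q⇒∣p∣<∣q∣ ((λ p → x∈p∪q⁺ {p = W} (inj₁ p)) , b , x∈p∪q⁺ {p = W} (inj₂ b∈e) , b∉W)
    bound : ∣ W′ ∣ ≤ 1 + covered W′ * (k ∸ 1)
    bound = ℕ.+-cancelʳ-≤ 1 _ _ (begin
      ∣ W′ ∣ + 1 ≤⟨ size ⟩
      ∣ W ∣ + k ≤⟨ ℕ.+-mono-≤ ∣W∣≤ (k≤ k) ⟩
      1 + covered W * (k ∸ 1) + ((k ∸ 1) + 1) ≡⟨ arith (covered W) (k ∸ 1) ⟩
      1 + suc (covered W) * (k ∸ 1) + 1 ≤⟨ ℕ.+-monoˡ-≤ 1 (s≤s (ℕ.*-monoˡ-≤ (k ∸ 1) covered-grows)) ⟩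
      1 + covered W′ * (k ∸ 1) + 1 ∎)
      where
      k≤ : ∀ k → k ≤ (k ∸ 1) + 1
      k≤ zero = z≤n
      k≤ (suc k) = ℕ.≤-reflexive (ℕ.+-comm 1 k)
      arith : ∀ c j → 1 + c * j + (j + 1) ≡ 1 + suc c * j + 1
      arith = solve-∀
    next : ∀ fuel → n ≤ ∣ W ∣ + fuel → n ≤ 1 + m * (k ∸ 1)
    next zero n≤ = contradiction (ℕ.≤-trans bigger (ℕ.≤-trans (∣p∣≤n W′) n≤)) (ℕ.<⇒≱ (s≤s (ℕ.≤-reflexive (ℕ.+-identityʳ _))))
    next (suc fuel) n≤ = grow connected fuel W′ (x∈p∪q⁺ {p = W} (inj₁ root∈W))
      (ℕ.≤-trans n≤ (ℕ.≤-trans (ℕ.≤-reflexive (ℕ.+-suc ∣ W ∣ fuel)) (ℕ.+-monoˡ-≤ fuel bigger))) bound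

  order≤ : Connected H → n ≤ 1 + m * (k ∸ 1)
  order≤ connected with n ℕ.≟ 0
  ... | yes refl = z≤n
  ... | no n≢0 = grow connected n ⁅ root ⁆ (x∈⁅x⁆ root) (ℕ.m≤n+m n _)
        (ℕ.≤-trans (ℕ.≤-reflexive (∣⁅x⁆∣≡1 root)) (s≤s z≤n))
    where
    root : Fin n
    root = fromℕ< (ℕ.n≢0⇒n>0 n≢0)

module Hypertree {n m k} {H : Hypergraph n m} (tree : IsHypertree k H) (2≤k : 2 ≤ k) (1≤m : 1 ≤ m) where

  open IsHypertree tree

  deg≥1 : ∀ v → 1 ≤ deg H v
  deg≥1 v with sum-pos (λ u → inc H u e₀) (subst (1 ≤_) (sym (sum-inc H uniform e₀)) (ℕ.≤-trans (s≤s z≤n) 2≤k))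
    where
    e₀ : Fin m
    e₀ = fromℕ< 1≤m
  ... | u , 1≤ with connected v u
  ...   | ε = deg-pos H (𝟙-pos (v ∈? edge H _) 1≤)
  ...   | via e v∈e _ ◅ _ = deg-pos H v∈e

  excess : Fin n → ℕ
  excess v = deg H v ∸ 1

  deg≡ : ∀ v → deg H v ≡ 1 + excess v
  deg≡ v = sym (ℕ.m+[n∸m]≡n (deg≥1 v))

  excess+order : sum excess + n ≡ m * k
  excess+order = trans (cong (sum excess +_) (sym (trans (sum-const n 1) (ℕ.*-identityʳ n))))
    (trans (sym (∑-distrib-+ excess (λ _ → 1)))
    (trans (sum-cong-≗ λ v → trans (ℕ.+-comm (excess v) 1) (sym (deg≡ v))) (handshake H uniform)))

  sum-excess≤ : sum excess ≤ m ∸ 1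
  sum-excess≤ = subst (_≤ m ∸ 1)
    (sum-cong-≗ λ v → cong (_∸ 1) (sum-cong-≗ λ e → trans (cong (_* inc H v e) (𝟙-yes (e ∈? ⊤) ∈⊤)) (ℕ.+-identityʳ _)))
    (excess≤ H acyclic m ⊤ (∣⊤∣≡n m))

  mk-split : m * k ≡ (m ∸ 1) + (1 + m * (k ∸ 1))
  mk-split = trans (cong (m *_) (sym (ℕ.m+[n∸m]≡n (ℕ.≤-trans (s≤s z≤n) 2≤k))))
    (trans (ℕ.*-suc m (k ∸ 1)) (trans (cong (_+ m * (k ∸ 1)) (sym (ℕ.m∸n+n≡m 1≤m))) (ℕ.+-assoc (m ∸ 1) 1 _)))

  -- The two upper bounds, on the order by connectedness and on the total excess by acyclicity, add
  -- up to `m * k`. So do the quantities themselves by `excess+order`; hence both bounds are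
  -- attained.
  order : n ≡ 1 + m * (k ∸ 1)
  order = ℕ.≤-antisym (order≤ H uniform connected)
    (ℕ.+-cancelˡ-≤ (m ∸ 1) _ _ (ℕ.≤-trans (ℕ.≤-reflexive (trans (sym mk-split) (sym excess+order))) (ℕ.+-monoˡ-≤ n sum-excess≤)))

  sum-excess : sum excess ≡ m ∸ 1
  sum-excess = ℕ.+-cancelʳ-≡ n _ _ (trans excess+order (trans mk-split (cong ((m ∸ 1) +_) (sym order))))

-- Ordered fields and list sums

module FieldTheory {c ℓ₁ ℓ₂} (K : OrderedField c ℓ₁ ℓ₂) where

  open OrderedField K public
    renaming ( _+_ to infixl 6 _+ᴷ_ ; _*_ to infixl 7 _*ᴷ_ ; -_ to infix 8 -ᴷ_; _-_ to infixl 6 _-ᴷ_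
             ; _<_ to infix 4 _<ᴷ_ ; refl to ≈-refl ; sym to ≈-sym ; trans to ≈-trans
             ; reflexive to ≈-reflexive ; zero to *ᴷ-zero ; _≈_ to infix 4 _≈_)
  open import Algebra.Properties.Semiring.Mult semiring public
    using (×-homo-+; ×1-homo-*; ×-congʳ; ×-assoc-*) renaming (_×_ to _·_)
  open import Algebra.Properties.Ring ring using (-‿distribˡ-*; -‿distribʳ-*; -‿involutive)
  open import Relation.Binary.Reasoning.Setoid setoid public
  open import Relation.Binary.Structures using (IsStrictTotalOrder)
  open IsStrictTotalOrder isStrictTotalOrder public
    using (compare; <-respʳ-≈; <-respˡ-≈) renaming (trans to <ᴷ-trans; irrefl to <ᴷ-irrefl)

  +-mono-<ᴷ : ∀ {x y u v} → x <ᴷ y → u <ᴷ v → x +ᴷ u <ᴷ y +ᴷ v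
  +-mono-<ᴷ {x} {y} {u} {v} x<y u<v = <ᴷ-trans (+-monoˡ-< u x<y)
    (<-respˡ-≈ (+-comm u y) (<-respʳ-≈ (+-comm v y) (+-monoˡ-< y u<v)))

  ≤ᶠ-refl : ∀ {x} → x ≤ᶠ x
  ≤ᶠ-refl = inj₂ ≈-refl

  ≤ᶠ-resp : ∀ {x x′ y y′} → x ≈ x′ → y ≈ y′ → x ≤ᶠ y → x′ ≤ᶠ y′
  ≤ᶠ-resp p q (inj₁ lt) = inj₁ (<-respˡ-≈ p (<-respʳ-≈ q lt))
  ≤ᶠ-resp p q (inj₂ eq) = inj₂ (≈-trans (≈-sym p) (≈-trans eq q))

  +-mono-≤ᶠ : ∀ {x y u v} → x ≤ᶠ y → u ≤ᶠ v → x +ᴷ u ≤ᶠ y +ᴷ v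
  +-mono-≤ᶠ (inj₁ p) (inj₁ q) = inj₁ (+-mono-<ᴷ p q)
  +-mono-≤ᶠ (inj₁ p) (inj₂ q) = inj₁ (<-respʳ-≈ (+-congˡ q) (+-monoˡ-< _ p))
  +-mono-≤ᶠ {x} {y} {u} {v} (inj₂ p) (inj₁ q) = inj₁
    (<-respˡ-≈ (+-comm u x) (<-respʳ-≈ (≈-trans (+-comm v x) (+-congʳ p)) (+-monoˡ-< x q)))
  +-mono-≤ᶠ (inj₂ p) (inj₂ q) = inj₂ (+-cong p q)

  +-mono-≤ᶠ-< : ∀ {x y u v} → x ≤ᶠ y → u <ᴷ v → x +ᴷ u <ᴷ y +ᴷ v
  +-mono-≤ᶠ-< (inj₁ p) q = +-mono-<ᴷ p q
  +-mono-≤ᶠ-< {x} {y} {u} {v} (inj₂ p) q =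
    <-respˡ-≈ (+-comm u x) (<-respʳ-≈ (≈-trans (+-comm v x) (+-congʳ p)) (+-monoˡ-< x q))

  +-nonneg : ∀ {x y} → 0# ≤ᶠ x → 0# ≤ᶠ y → 0# ≤ᶠ x +ᴷ y
  +-nonneg p q = ≤ᶠ-resp (+-identityˡ 0#) ≈-refl (+-mono-≤ᶠ p q)

  +-pos-nonneg : ∀ {x y} → 0# <ᴷ x → 0# ≤ᶠ y → 0# <ᴷ x +ᴷ y
  +-pos-nonneg {x} {y} p q = <-respʳ-≈ (+-comm y x) (<-respˡ-≈ (+-identityˡ 0#) (+-mono-≤ᶠ-< q p))

  +-nonneg-pos : ∀ {x y} → 0# ≤ᶠ x → 0# <ᴷ y → 0# <ᴷ x +ᴷ y
  +-nonneg-pos p q = <-respˡ-≈ (+-identityˡ 0#) (+-mono-≤ᶠ-< p q)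

  *-nonneg : ∀ {x y} → 0# ≤ᶠ x → 0# ≤ᶠ y → 0# ≤ᶠ x *ᴷ y
  *-nonneg (inj₁ p) (inj₁ q) = inj₁ (*-positive p q)
  *-nonneg {x} (inj₁ p) (inj₂ q) = inj₂ (≈-trans (≈-sym (zeroʳ x)) (*-congˡ q))
  *-nonneg {x} {y} (inj₂ p) _ = inj₂ (≈-trans (≈-sym (zeroˡ y)) (*-congʳ p))

  <⇒0<- : ∀ {x y} → x <ᴷ y → 0# <ᴷ y -ᴷ x
  <⇒0<- {x} x<y = <-respˡ-≈ (-‿inverseʳ x) (+-monoˡ-< (-ᴷ x) x<y)

  0<1 : 0# <ᴷ 1#
  0<1 with compare 0# 1#
  ... | Tri.tri< lt _ _ = lt
  ... | Tri.tri≈ _ eq _ = contradiction eq 0#≉1#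
  ... | Tri.tri> _ _ gt = <-respʳ-≈ square (*-positive 0<-1 0<-1)
    where
    0<-1 : 0# <ᴷ -ᴷ 1#
    0<-1 = <-respʳ-≈ (+-identityˡ (-ᴷ 1#)) (<⇒0<- gt)
    square : (-ᴷ 1#) *ᴷ (-ᴷ 1#) ≈ 1#
    square = ≈-trans (≈-sym (-‿distribˡ-* 1# (-ᴷ 1#)))
      (≈-trans (-‿cong (*-identityˡ (-ᴷ 1#))) (-‿involutive 1#))

  0≤1 : 0# ≤ᶠ 1#
  0≤1 = inj₁ 0<1

  ·1-nonneg : ∀ n → 0# ≤ᶠ n · 1#
  ·1-nonneg zero    = ≤ᶠ-refl
  ·1-nonneg (suc n) = +-nonneg 0≤1 (·1-nonneg n)

  ·1-pos : ∀ {n} → 1 ≤ n → 0# <ᴷ n · 1#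
  ·1-pos {suc n} _ = +-pos-nonneg 0<1 (·1-nonneg n)

  ⁻¹-pos : ∀ {x} → 0# <ᴷ x → 0# <ᴷ x ⁻¹
  ⁻¹-pos {x} 0<x with compare 0# (x ⁻¹)
  ... | Tri.tri< lt _ _ = lt
  ... | Tri.tri≈ _ eq _ = contradiction (begin
    0#          ≈⟨ zeroʳ x ⟨
    x *ᴷ 0#     ≈⟨ *-congˡ eq ⟩
    x *ᴷ x ⁻¹   ≈⟨ ⁻¹-inverseʳ x (λ e → <ᴷ-irrefl (≈-sym e) 0<x) ⟩
    1#          ∎) 0#≉1#
  ... | Tri.tri> _ _ gt = contradiction (<-respʳ-≈ sum≈0 (+-pos-nonneg 0<1 (inj₁ (*-positive 0<x (<⇒0<- gt))))) (<ᴷ-irrefl ≈-refl)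
    where
    sum≈0 : 1# +ᴷ x *ᴷ (0# -ᴷ x ⁻¹) ≈ 0#
    sum≈0 = begin
      1# +ᴷ x *ᴷ (0# -ᴷ x ⁻¹)  ≈⟨ +-congˡ (*-congˡ (+-identityˡ _)) ⟩
      1# +ᴷ x *ᴷ (-ᴷ (x ⁻¹))   ≈⟨ +-congˡ (-‿distribʳ-* x (x ⁻¹)) ⟨
      1# -ᴷ x *ᴷ x ⁻¹          ≈⟨ +-congˡ (-‿cong (⁻¹-inverseʳ x (λ e → <ᴷ-irrefl (≈-sym e) 0<x))) ⟩
      1# -ᴷ 1#                 ≈⟨ -‿inverseʳ 1# ⟩
      0#                       ∎

  *-monoʳ-≤ᶠ : ∀ {a x y} → 0# ≤ᶠ a → x ≤ᶠ y → a *ᴷ x ≤ᶠ a *ᴷ y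
  *-monoʳ-≤ᶠ 0≤a (inj₂ eq) = inj₂ (*-congˡ eq)
  *-monoʳ-≤ᶠ {a} {x} {y} 0≤a (inj₁ x<y) = ≤ᶠ-resp (+-identityˡ (a *ᴷ x)) (begin
    a *ᴷ (y -ᴷ x) +ᴷ a *ᴷ x    ≈⟨ distribˡ a (y -ᴷ x) x ⟨
    a *ᴷ (y -ᴷ x +ᴷ x)         ≈⟨ *-congˡ (≈-trans (+-assoc y (-ᴷ x) x) (≈-trans (+-congˡ (-‿inverseˡ x)) (+-identityʳ y))) ⟩
    a *ᴷ y                     ∎)
    (+-mono-≤ᶠ (*-nonneg 0≤a (inj₁ (<⇒0<- x<y))) ≤ᶠ-refl)

  *-monoʳ-<ᴷ : ∀ {a x y} → 0# <ᴷ a → x <ᴷ y → a *ᴷ x <ᴷ a *ᴷ y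
  *-monoʳ-<ᴷ {a} {x} {y} 0<a x<y = <-respˡ-≈ (+-identityˡ (a *ᴷ x)) (<-respʳ-≈ (begin
    a *ᴷ (y -ᴷ x) +ᴷ a *ᴷ x    ≈⟨ distribˡ a (y -ᴷ x) x ⟨
    a *ᴷ (y -ᴷ x +ᴷ x)         ≈⟨ *-congˡ (≈-trans (+-assoc y (-ᴷ x) x) (≈-trans (+-congˡ (-‿inverseˡ x)) (+-identityʳ y))) ⟩
    a *ᴷ y                     ∎)
    (+-monoˡ-< (a *ᴷ x) (*-positive 0<a (<⇒0<- x<y))))

  ·1-mono-≤ : ∀ {m n} → m ≤ n → m · 1# ≤ᶠ n · 1#
  ·1-mono-≤ {n = n} z≤n = ·1-nonneg n
  ·1-mono-≤ (s≤s p) = +-mono-≤ᶠ ≤ᶠ-refl (·1-mono-≤ p)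

  ·1-mono-< : ∀ {m n} → m < n → m · 1# <ᴷ n · 1#
  ·1-mono-< {m} {n} (s≤s {n = n′} p) with ·1-mono-≤ p
  ... | m≤n′ = <-respˡ-≈ (+-identityˡ (m · 1#)) (<-respʳ-≈ (+-comm (n′ · 1#) 1#)
        (<-respˡ-≈ (+-comm (m · 1#) 0#) (+-mono-≤ᶠ-< m≤n′ 0<1)))

  ∑ : ∀ {a} {A : Set a} → List A → (A → Carrier) → Carrier
  ∑ xs f = List.foldr (λ x s → f x +ᴷ s) 0# xs

  module _ {a} {A : Set a} where

    ∑-cong : ∀ (xs : List A) {f g} → (∀ x → f x ≈ g x) → ∑ xs f ≈ ∑ xs g
    ∑-cong []       h = ≈-refl
    ∑-cong (x ∷ xs) h = +-cong (h x) (∑-cong xs h)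

    ∑-cong-∈ : ∀ (xs : List A) {f g} → (∀ x → x ∈ˡ xs → f x ≈ g x) → ∑ xs f ≈ ∑ xs g
    ∑-cong-∈ []       h = ≈-refl
    ∑-cong-∈ (x ∷ xs) h = +-cong (h x (here refl)) (∑-cong-∈ xs (λ y y∈ → h y (there y∈)))

    ∑-++ : ∀ (xs : List A) {ys f} → ∑ (xs ++ ys) f ≈ ∑ xs f +ᴷ ∑ ys f
    ∑-++ []       = ≈-sym (+-identityˡ _)
    ∑-++ (x ∷ xs) = ≈-trans (+-congˡ (∑-++ xs)) (≈-sym (+-assoc _ _ _))

    ∑-zero : ∀ (xs : List A) {f} → (∀ x → x ∈ˡ xs → f x ≈ 0#) → ∑ xs f ≈ 0#
    ∑-zero []       h = ≈-refl
    ∑-zero (x ∷ xs) h = ≈-trans (+-cong (h x (here refl)) (∑-zero xs (λ y y∈ → h y (there y∈)))) (+-identityˡ 0#)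

    ∑-+ : ∀ (xs : List A) {f g} → ∑ xs (λ x → f x +ᴷ g x) ≈ ∑ xs f +ᴷ ∑ xs g
    ∑-+ []       = ≈-sym (+-identityˡ 0#)
    ∑-+ (x ∷ xs) {f} {g} = begin
      f x +ᴷ g x +ᴷ ∑ xs (λ x → f x +ᴷ g x)   ≈⟨ +-congˡ (∑-+ xs) ⟩
      f x +ᴷ g x +ᴷ (∑ xs f +ᴷ ∑ xs g)        ≈⟨ +-assoc _ _ _ ⟩
      f x +ᴷ (g x +ᴷ (∑ xs f +ᴷ ∑ xs g))      ≈⟨ +-congˡ (x∙yz≈y∙xz _ _ _) ⟩
      f x +ᴷ (∑ xs f +ᴷ (g x +ᴷ ∑ xs g))      ≈⟨ +-assoc _ _ _ ⟨
      f x +ᴷ ∑ xs f +ᴷ (g x +ᴷ ∑ xs g)        ∎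
      where open import Algebra.Properties.CommutativeSemigroup +-commutativeSemigroup using (x∙yz≈y∙xz)

    ∑-*ˡ : ∀ (xs : List A) {b f} → ∑ xs (λ x → b *ᴷ f x) ≈ b *ᴷ ∑ xs f
    ∑-*ˡ []       {b} = ≈-sym (zeroʳ b)
    ∑-*ˡ (x ∷ xs) {b} {f} = ≈-trans (+-congˡ (∑-*ˡ xs)) (≈-sym (distribˡ b (f x) (∑ xs f)))

    ∑-↭ : ∀ {xs ys : List A} {f} → xs ↭ ys → ∑ xs f ≈ ∑ ys f
    ∑-↭ ↭.refl = ≈-refl
    ∑-↭ (↭.prep x p) = +-congˡ (∑-↭ p)
    ∑-↭ {f = f} (↭.swap x y p) = ≈-trans (≈-sym (+-assoc _ _ _))
      (≈-trans (+-cong (+-comm (f x) (f y)) (∑-↭ p)) (+-assoc _ _ _))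
    ∑-↭ (↭.trans p q) = ≈-trans (∑-↭ p) (∑-↭ q)

    ∑-nonneg : ∀ (xs : List A) {f} → (∀ x → 0# ≤ᶠ f x) → 0# ≤ᶠ ∑ xs f
    ∑-nonneg []       h = ≤ᶠ-refl
    ∑-nonneg (x ∷ xs) h = +-nonneg (h x) (∑-nonneg xs h)

    ∑-pos : ∀ {xs : List A} {f x} → (∀ x → 0# ≤ᶠ f x) → x ∈ˡ xs → 0# <ᴷ f x → 0# <ᴷ ∑ xs f
    ∑-pos {x ∷ xs} h (here refl) p = +-pos-nonneg p (∑-nonneg xs h)
    ∑-pos {x ∷ xs} h (there x∈)  p = +-nonneg-pos (h x) (∑-pos h x∈ p)

    -- No test for zero in the field is made: each term brings its own alternative, and the first
    -- one that offers a witness decides.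
    ∑-zero-or : ∀ {p} {P : A → Set p} (xs : List A) {f} → (∀ x → x ∈ˡ xs → f x ≈ 0# ⊎ P x) →
                ∑ xs f ≈ 0# ⊎ ∃ λ x → x ∈ˡ xs × P x
    ∑-zero-or [] h = inj₁ ≈-refl
    ∑-zero-or (x ∷ xs) h with h x (here refl) | ∑-zero-or xs (λ y y∈ → h y (there y∈))
    ... | inj₂ Px | _ = inj₂ (x , here refl , Px)
    ... | inj₁ p | inj₁ q = inj₁ (≈-trans (+-cong p q) (+-identityˡ 0#))
    ... | inj₁ _ | inj₂ (y , y∈ , Py) = inj₂ (y , there y∈ , Py)

  module _ {a b} {A : Set a} {B : Set b} where

    ∑-map : ∀ (g : B → A) (xs : List B) {f} → ∑ (List.map g xs) f ≡ ∑ xs (f ∘ g)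
    ∑-map g []       = refl
    ∑-map g (x ∷ xs) {f} = cong (f (g x) +ᴷ_) (∑-map g xs)

    ∑-concatMap : ∀ (g : B → List A) (xs : List B) {f} →
                  ∑ (concatMap g xs) f ≈ ∑ xs (λ x → ∑ (g x) f)
    ∑-concatMap g []       = ≈-refl
    ∑-concatMap g (x ∷ xs) = ≈-trans (∑-++ (g x)) (+-congˡ (∑-concatMap g xs))

    ∑-swap : ∀ (xs : List A) (ys : List B) {f : A → B → Carrier} →
             ∑ xs (λ x → ∑ ys (f x)) ≈ ∑ ys (λ y → ∑ xs (λ x → f x y))
    ∑-swap []       ys = ≈-sym (∑-zero ys (λ _ _ → ≈-refl))
    ∑-swap (x ∷ xs) ys {f} = ≈-trans (+-congˡ (∑-swap xs ys)) (≈-sym (∑-+ ys))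

  ∏ : ∀ {a} {A : Set a} → List A → (A → Carrier) → Carrier
  ∏ xs f = List.foldr (λ x s → f x *ᴷ s) 1# xs

  module _ {a} {A : Set a} where

    ∏-cong : ∀ (xs : List A) {f g} → (∀ x → f x ≈ g x) → ∏ xs f ≈ ∏ xs g
    ∏-cong []       h = ≈-refl
    ∏-cong (x ∷ xs) h = *-cong (h x) (∏-cong xs h)

    ∏-↭ : ∀ {xs ys : List A} {f} → xs ↭ ys → ∏ xs f ≈ ∏ ys f
    ∏-↭ ↭.refl = ≈-refl
    ∏-↭ (↭.prep x p) = *-congˡ (∏-↭ p)
    ∏-↭ {f = f} (↭.swap x y p) = ≈-trans (≈-sym (*-assoc _ _ _))
      (≈-trans (*-cong (*-comm (f x) (f y)) (∏-↭ p)) (*-assoc _ _ _))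
    ∏-↭ (↭.trans p q) = ≈-trans (∏-↭ p) (∏-↭ q)

    ∏-pos : ∀ (xs : List A) {f} → (∀ x → 0# <ᴷ f x) → 0# <ᴷ ∏ xs f
    ∏-pos []       h = 0<1
    ∏-pos (x ∷ xs) h = *-positive (h x) (∏-pos xs h)

  ∏-map : ∀ {a b} {A : Set a} {B : Set b} (g : B → A) (xs : List B) {f} →
          ∏ (List.map g xs) f ≡ ∏ xs (f ∘ g)
  ∏-map g []       = refl
  ∏-map g (x ∷ xs) {f} = cong (f (g x) *ᴷ_) (∏-map g xs)

-- Closed walks

data Walk {n} : Fin n → Fin n → List (Fin n × Fin n) → Set where
  []  : ∀ {i} → Walk i i []
  _∷_ : ∀ {l j w} i → Walk l j w → Walk i j ((i , l) ∷ w)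

arcs : ∀ {n r} → Fin n → Vec (Fin n) r → List (Fin n × Fin n)
arcs i γ = List.map (i ,_) (Vec.toList γ)

arcs* : ∀ {n r} → List (Fin n × Vec (Fin n) r) → List (Fin n × Fin n)
arcs* []            = []
arcs* ((i , γ) ∷ R) = arcs i γ ++ arcs* R

-- Functionals on monomials

module Functionals {c ℓ₁ ℓ₂} (K : OrderedField c ℓ₁ ℓ₂) {n : ℕ} where

  open FieldTheory K

  Arc : Set
  Arc = Fin n × Fin n

  Row : ℕ → Set
  Row r = Fin n × Vec (Fin n) r

  -- A linear functional on polynomials, given by its values on monomials. In the dual no equality
  -- of unnormalised polynomials arises: `eval-∂` replaces a derivative by its transpose `Δ`, until
  -- only the closed walks of the matrix power are left to be evaluated.
  Functional : Set c
  Functional = List Arc → Carrier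

  infix 4 _≐_
  _≐_ : Functional → Functional → Set ℓ₁
  φ ≐ ψ = ∀ w → φ w ≈ ψ w

  eval : Functional → Polynomial K n → Carrier
  eval φ p = ∑ p (λ { (a , w) → a *ᴷ φ w })

  constant : Functional
  constant []      = 1#
  constant (_ ∷ _) = 0#

  constantTerm-eval : ∀ p → constantTerm K p ≈ eval constant p
  constantTerm-eval []                = ≈-refl
  constantTerm-eval ((a , [])    ∷ p) = +-cong (≈-sym (*-identityʳ a)) (constantTerm-eval p)
  constantTerm-eval ((a , _ ∷ _) ∷ p) = +-cong (≈-sym (zeroʳ a)) (constantTerm-eval p)

  eval-scale : ∀ φ b p → eval φ (scale K b p) ≈ b *ᴷ eval φ p
  eval-scale φ b p = ≈-trans (≈-reflexive (∑-map _ p))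
    (≈-trans (∑-cong p (λ { (a , w) → *-assoc b a (φ w) })) (∑-*ˡ p))

  Δ : Arc → Functional → Functional
  Δ x φ w = ∑ (∂ₘ K x w) φ

  Δ-cong : ∀ x {φ ψ} → φ ≐ ψ → Δ x φ ≐ Δ x ψ
  Δ-cong x h w = ∑-cong (∂ₘ K x w) h

  eval-∂ : ∀ φ x p → eval φ (∂ K x p) ≈ eval (Δ x φ) p
  eval-∂ φ x p = ≈-trans (∑-concatMap _ p) (∑-cong p λ { (a , w) →
    ≈-trans (≈-reflexive (∑-map _ (∂ₘ K x w))) (∑-*ˡ (∂ₘ K x w)) })

  infix 4 _≟ₐ_
  _≟ₐ_ : (x y : Arc) → Dec (x ≡ y)
  _≟ₐ_ = Product.≡-dec _≟_ _≟_

  pick : Arc → Arc → Carrier → Carrier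
  pick x y b = if does (x ≟ₐ y) then b else 0#

  pick-∑ : ∀ {a} {A : Set a} x y (xs : List A) {f} → ∑ xs (λ z → pick x y (f z)) ≈ pick x y (∑ xs f)
  pick-∑ x y xs with does (x ≟ₐ y)
  ... | true  = ≈-refl
  ... | false = ∑-zero xs (λ _ _ → ≈-refl)

  Δ-∷ : ∀ x φ y w → Δ x φ (y ∷ w) ≈ pick x y (φ w) +ᴷ Δ x (φ ∘ (y ∷_)) w
  Δ-∷ x φ y w = ≈-trans (∑-++ (if does (x ≟ₐ y) then [ w ] else []))
    (+-cong head (≈-reflexive (∑-map (y ∷_) (∂ₘ K x w))))
    where
    head : ∑ (if does (x ≟ₐ y) then [ w ] else []) φ ≈ pick x y (φ w)
    head with does (x ≟ₐ y)
    ... | true  = +-identityʳ _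
    ... | false = ≈-refl

  Δ-comm : ∀ x y φ → Δ x (Δ y φ) ≐ Δ y (Δ x φ)
  Δ-comm x y φ []      = ≈-refl
  Δ-comm x y φ (z ∷ w) = begin
    Δ x (Δ y φ) (z ∷ w)                                         ≈⟨ expand x y ⟩
    pick x z (Δ y φ w) +ᴷ (pick y z (Δ x φ w) +ᴷ Δ x (Δ y (φ ∘ (z ∷_))) w)
      ≈⟨ +-congˡ (+-congˡ (Δ-comm x y (φ ∘ (z ∷_)) w)) ⟩
    pick x z (Δ y φ w) +ᴷ (pick y z (Δ x φ w) +ᴷ Δ y (Δ x (φ ∘ (z ∷_))) w)
      ≈⟨ x∙yz≈y∙xz _ _ _ ⟩
    pick y z (Δ x φ w) +ᴷ (pick x z (Δ y φ w) +ᴷ Δ y (Δ x (φ ∘ (z ∷_))) w)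
      ≈⟨ expand y x ⟨
    Δ y (Δ x φ) (z ∷ w)                                         ∎
    where
    open import Algebra.Properties.CommutativeSemigroup +-commutativeSemigroup using (x∙yz≈y∙xz)
    expand : ∀ x y → Δ x (Δ y φ) (z ∷ w) ≈
      pick x z (Δ y φ w) +ᴷ (pick y z (Δ x φ w) +ᴷ Δ x (Δ y (φ ∘ (z ∷_))) w)
    expand x y = ≈-trans (Δ-∷ x (Δ y φ) z w) (+-congˡ
      (≈-trans (∑-cong (∂ₘ K x w) (Δ-∷ y φ z))
      (≈-trans (∑-+ (∂ₘ K x w)) (+-congʳ (pick-∑ y z (∂ₘ K x w))))))

  -- Transposition reverses the order of composition: the head of the list belongs to the outermost
  -- derivative and acts first on the functional.
  Δ* : List Arc → Functional → Functional
  Δ* []      φ = φ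
  Δ* (x ∷ X) φ = Δ* X (Δ x φ)

  Δ*-cong : ∀ X {φ ψ} → φ ≐ ψ → Δ* X φ ≐ Δ* X ψ
  Δ*-cong []      h = h
  Δ*-cong (x ∷ X) h = Δ*-cong X (Δ-cong x h)

  Δ*-Δ : ∀ X x φ → Δ* X (Δ x φ) ≐ Δ x (Δ* X φ)
  Δ*-Δ []      x φ w = ≈-refl
  Δ*-Δ (y ∷ X) x φ w = ≈-trans (Δ*-cong X (Δ-comm y x φ) w) (Δ*-Δ X x (Δ y φ) w)

  Δ*-comm : ∀ X Y φ → Δ* X (Δ* Y φ) ≐ Δ* Y (Δ* X φ)
  Δ*-comm []      Y φ w = ≈-refl
  Δ*-comm (x ∷ X) Y φ w = ≈-trans (Δ*-cong X (λ v → ≈-sym (Δ*-Δ Y x φ v)) w) (Δ*-comm X Y (Δ x φ) w)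

  Δ*-++ : ∀ X Y φ → Δ* (X ++ Y) φ ≡ Δ* Y (Δ* X φ)
  Δ*-++ []      Y φ = refl
  Δ*-++ (x ∷ X) Y φ = Δ*-++ X Y (Δ x φ)

  ∂ₘ-↭ : ∀ x w {w′} → w′ ∈ˡ ∂ₘ K x w → w ↭ x ∷ w′
  ∂ₘ-↭ x (y ∷ w) w′∈ with x ≟ₐ y
  ∂ₘ-↭ x (y ∷ w) (here refl) | yes refl = ↭.refl
  ∂ₘ-↭ x (y ∷ w) (there w′∈) | yes _ with Mem.∈-map⁻ (y ∷_) w′∈
  ... | w″ , w″∈ , refl = ↭.trans (↭.prep y (∂ₘ-↭ x w w″∈)) (↭.swap y x ↭.refl)
  ∂ₘ-↭ x (y ∷ w) w′∈ | no _ with Mem.∈-map⁻ (y ∷_) w′∈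
  ... | w″ , w″∈ , refl = ↭.trans (↭.prep y (∂ₘ-↭ x w w″∈)) (↭.swap y x ↭.refl)

  ∂ₘ-∈ : ∀ x {w} → x ∈ˡ w → ∃ λ w′ → w′ ∈ˡ ∂ₘ K x w
  ∂ₘ-∈ x {y ∷ w} (here refl) with x ≟ₐ x
  ... | yes _ = w , here refl
  ... | no ¬p = contradiction refl ¬p
  ∂ₘ-∈ x {y ∷ w} (there x∈) with ∂ₘ-∈ x x∈
  ... | w′ , w′∈ = y ∷ w′ , Mem.∈-++⁺ʳ (if does (x ≟ₐ y) then [ w ] else []) (Mem.∈-map⁺ (y ∷_) w′∈)

  -- `Δ* X constant w` counts the ways to match the factors of `w` with `X`. In the trace this
  -- discards all rows whose arcs cannot be rearranged into a closed walk.
  Δ*-vanishes : ∀ X w → Δ* X constant w ≈ 0# ⊎ w ↭ X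
  Δ*-vanishes []      []      = inj₂ ↭.refl
  Δ*-vanishes []      (_ ∷ _) = inj₁ ≈-refl
  Δ*-vanishes (x ∷ X) w with ∑-zero-or (∂ₘ K x w) (λ w′ _ → Δ*-vanishes X w′)
  ... | inj₁ p = inj₁ (≈-trans (Δ*-Δ X x constant w) p)
  ... | inj₂ (w′ , w′∈ , w′↭X) = inj₂ (↭.trans (∂ₘ-↭ x w w′∈) (↭.prep x w′↭X))

  constant-nonneg : ∀ w → 0# ≤ᶠ constant w
  constant-nonneg []      = 0≤1
  constant-nonneg (_ ∷ _) = ≤ᶠ-refl

  Δ*-nonneg : ∀ X {φ} → (∀ w → 0# ≤ᶠ φ w) → ∀ w → 0# ≤ᶠ Δ* X φ w
  Δ*-nonneg []      h = h
  Δ*-nonneg (x ∷ X) h = Δ*-nonneg X (λ w → ∑-nonneg (∂ₘ K x w) h)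

  Δ*-pos : ∀ X {w} → w ↭ X → 0# <ᴷ Δ* X constant w
  Δ*-pos [] {w} p with ↭.↭-empty-inv p
  ... | refl = 0<1
  Δ*-pos (x ∷ X) {w} p with ∂ₘ-∈ x (↭.∈-resp-↭ (↭-sym p) (here refl))
  ... | w′ , w′∈ = <-respʳ-≈ (≈-sym (Δ*-Δ X x constant w))
    (∑-pos (Δ*-nonneg X constant-nonneg) w′∈ (Δ*-pos X (↭.drop-∷ (↭.trans (↭-sym (∂ₘ-↭ x w w′∈)) p))))

  walks : ℕ → Fin n → Fin n → List (List Arc)
  walks zero    i j = if does (i ≟ j) then [ [] ] else []
  walks (suc N) i j = concatMap (λ l → List.map ((i , l) ∷_) (walks N l j)) (allFin n)

  closedWalks : ℕ → List (List Arc)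
  closedWalks N = concatMap (λ i → walks N i i) (allFin n)

  eval-matrixPower : ∀ N i j φ → eval φ (matrixPower K (indeterminates K) N i j) ≈ ∑ (walks N i j) φ
  eval-matrixPower zero i j φ with does (i ≟ j)
  ... | true  = +-congʳ (*-identityˡ _)
  ... | false = ≈-refl
  eval-matrixPower (suc N) i j φ = ≈-trans (∑-concatMap _ (allFin n))
    (≈-trans (∑-cong (allFin n) step) (≈-sym (∑-concatMap _ (allFin n))))
    where
    A : PolyMatrix K n
    A = indeterminates K
    step : ∀ l → eval φ (_*ₚ_ K (A i l) (matrixPower K A N l j)) ≈ ∑ (List.map ((i , l) ∷_) (walks N l j)) φ
    step l = begin
      eval φ (_*ₚ_ K (A i l) q)                    ≈⟨ ≈-reflexive (cong (eval φ) (List.++-identityʳ (List.map f q))) ⟩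
      eval φ (List.map f q)                        ≈⟨ ≈-reflexive (∑-map f q) ⟩
      ∑ q (λ { (b , w) → (1# *ᴷ b) *ᴷ φ ((i , l) ∷ w) })  ≈⟨ ∑-cong q (λ { (b , w) → *-congʳ (*-identityˡ b) }) ⟩
      eval (φ ∘ ((i , l) ∷_)) q                    ≈⟨ eval-matrixPower N l j (φ ∘ ((i , l) ∷_)) ⟩
      ∑ (walks N l j) (φ ∘ ((i , l) ∷_))           ≈⟨ ≈-reflexive (∑-map ((i , l) ∷_) (walks N l j)) ⟨
      ∑ (List.map ((i , l) ∷_) (walks N l j)) φ    ∎
      where
      q = matrixPower K A N l j
      f : Carrier × List Arc → Carrier × List Arc
      f (b , w) = 1# *ᴷ b , (i , l) ∷ w

  eval-matrixTrace : ∀ N φ → eval φ (matrixTrace K (matrixPower K (indeterminates K) N)) ≈ ∑ (closedWalks N) φ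
  eval-matrixTrace N φ = ≈-trans (∑-concatMap _ (allFin n))
    (≈-trans (∑-cong (allFin n) (λ i → eval-matrixPower N i i φ)) (≈-sym (∑-concatMap _ (allFin n))))

  walks⇒Walk : ∀ N i j {w} → w ∈ˡ walks N i j → Walk i j w
  walks⇒Walk zero i j w∈ with i ≟ j
  walks⇒Walk zero i j (here refl) | yes refl = []
  walks⇒Walk (suc N) i j w∈ with Mem.∈-concatMap⁻ _ {xs = allFin n} w∈
  ... | p with Any.satisfied p
  ...   | l , w∈′ with Mem.∈-map⁻ _ w∈′
  ...     | w′ , w′∈ , refl = i ∷ walks⇒Walk N l j w′∈

  Walk⇒walks : ∀ {i j w} → Walk i j w → w ∈ˡ walks (List.length w) i j
  Walk⇒walks {i} [] with i ≟ i
  ... | yes _ = here refl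
  ... | no ¬p = contradiction refl ¬p
  Walk⇒walks (_∷_ {l} i W) = Mem.∈-concatMap⁺ _ (lose (Mem.∈-allFin l) (Mem.∈-map⁺ _ (Walk⇒walks W)))

  closedWalks⇒Walk : ∀ N {w} → w ∈ˡ closedWalks N → ∃ λ i → Walk i i w
  closedWalks⇒Walk N w∈ with Any.satisfied (Mem.∈-concatMap⁻ _ {xs = allFin n} w∈)
  ... | i , w∈′ = i , walks⇒Walk N i i w∈′

  Walk⇒closedWalks : ∀ {i w} → Walk i i w → w ∈ˡ closedWalks (List.length w)
  Walk⇒closedWalks {i} W = Mem.∈-concatMap⁺ _ (lose (Mem.∈-allFin i) (Walk⇒walks W))

  -- Expansion of a product of the operators Σ_γ T_{iγ} ∂_{iγ}, for i running through I.

  module Expansion {r : ℕ} (N : ℕ) where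

    module _ (T : Fin n → Vec (Fin n) r → Carrier) where

      -- Unfolded, `S I constant` is the sum, over all lists `R` of rows with first indices `I`, of
      -- `weight R` times the sum of `Δ* (arcs* R) constant` over the closed walks.
      S : List (Fin n) → Functional → Carrier
      S []      φ = ∑ (closedWalks N) φ
      S (i ∷ I) φ = ∑ (tuples n r) λ γ → T i γ *ᴷ S I (Δ* (arcs i γ) φ)

      weight : List (Row r) → Carrier
      weight R = ∏ R λ { (i , γ) → T i γ }

      S-cong : ∀ I {φ ψ} → φ ≐ ψ → S I φ ≈ S I ψ
      S-cong []      h = ∑-cong (closedWalks N) h
      S-cong (i ∷ I) h = ∑-cong (tuples n r) λ γ → *-congˡ (S-cong I (Δ*-cong (arcs i γ) h))

      -- The operators commute. This lets a renaming of the vertices permute the blocks of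
      -- operators, and lets a witness for positivity list its rows in any order.
      S-↭ : ∀ {I J} φ → I ↭ J → S I φ ≈ S J φ
      S-↭ φ ↭.refl = ≈-refl
      S-↭ φ (↭.prep i p) = ∑-cong (tuples n r) λ γ → *-congˡ (S-↭ _ p)
      S-↭ φ (↭.swap {xs = I} {ys = J} i j p) = begin
        ∑ ts (λ γ → T i γ *ᴷ ∑ ts (λ δ → T j δ *ᴷ S I (Δ* (arcs j δ) (Δ* (arcs i γ) φ))))
          ≈⟨ ∑-cong ts (λ γ → ∑-*ˡ ts) ⟨
        ∑ ts (λ γ → ∑ ts (λ δ → T i γ *ᴷ (T j δ *ᴷ S I (Δ* (arcs j δ) (Δ* (arcs i γ) φ)))))
          ≈⟨ ∑-swap ts ts ⟩
        ∑ ts (λ δ → ∑ ts (λ γ → T i γ *ᴷ (T j δ *ᴷ S I (Δ* (arcs j δ) (Δ* (arcs i γ) φ)))))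
          ≈⟨ ∑-cong ts (λ δ → ∑-cong ts (λ γ → ≈-trans (x∙yz≈y∙xz _ _ _) (*-congˡ (*-congˡ
               (≈-trans (S-↭ _ p) (S-cong J (Δ*-comm (arcs j δ) (arcs i γ) φ))))))) ⟩
        ∑ ts (λ δ → ∑ ts (λ γ → T j δ *ᴷ (T i γ *ᴷ S J (Δ* (arcs i γ) (Δ* (arcs j δ) φ)))))
          ≈⟨ ∑-cong ts (λ δ → ∑-*ˡ ts) ⟩
        ∑ ts (λ δ → T j δ *ᴷ ∑ ts (λ γ → T i γ *ᴷ S J (Δ* (arcs i γ) (Δ* (arcs j δ) φ)))) ∎
        where
        ts = tuples n r
        open import Algebra.Properties.CommutativeSemigroup *-commutativeSemigroup using (x∙yz≈y∙xz)
      S-↭ φ (↭.trans p q) = ≈-trans (S-↭ φ p) (S-↭ φ q)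

      S-nonneg : (∀ i γ → 0# ≤ᶠ T i γ) → ∀ I {φ} → (∀ w → 0# ≤ᶠ φ w) → 0# ≤ᶠ S I φ
      S-nonneg T≥0 []      φ≥0 = ∑-nonneg (closedWalks N) φ≥0
      S-nonneg T≥0 (i ∷ I) φ≥0 = ∑-nonneg (tuples n r) λ γ →
        *-nonneg (T≥0 i γ) (S-nonneg T≥0 I (Δ*-nonneg (arcs i γ) φ≥0))

      -- One positive summand suffices because none is negative. `X` collects the arcs of the rows
      -- already consumed.
      S-pos : (∀ i γ → 0# ≤ᶠ T i γ) → ∀ R X → All (λ { (i , γ) → 0# <ᴷ T i γ }) R →
              ∀ {w} → w ∈ˡ closedWalks N → w ↭ X ++ arcs* R →
              0# <ᴷ S (List.map proj₁ R) (Δ* X constant)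
      S-pos T≥0 [] X [] {w} w∈ w↭ = ∑-pos (Δ*-nonneg X constant-nonneg) w∈
        (Δ*-pos X (subst (w ↭_) (List.++-identityʳ X) w↭))
      S-pos T≥0 ((i , γ) ∷ R) X (p ∷ ps) {w} w∈ w↭ = ∑-pos
        (λ δ → *-nonneg (T≥0 i δ) (S-nonneg T≥0 (List.map proj₁ R) (Δ*-nonneg (arcs i δ) (Δ*-nonneg X constant-nonneg))))
        (∈-tuples γ)
        (*-positive p (subst (λ φ → 0# <ᴷ S (List.map proj₁ R) φ) (Δ*-++ X (arcs i γ) constant)
          (S-pos T≥0 R (X ++ arcs i γ) ps w∈ (subst (w ↭_) (sym (List.++-assoc X (arcs i γ) (arcs* R))) w↭))))
        where
        ∈-tuples : ∀ {s} (γ : Vec (Fin n) s) → γ ∈ˡ tuples n s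
        ∈-tuples []      = here refl
        ∈-tuples (j ∷ γ) = Mem.∈-cartesianProductWith⁺ _∷_ (Mem.∈-allFin j) (∈-tuples γ)

    -- Only rows whose arcs form a closed walk have to be compared, as the others contribute zero on
    -- both sides. During the induction `a` and `b` absorb the tensor entries chosen so far, and `X`
    -- their arcs. With b = 0 the lemma shows that a term vanishes.
    S-compare : ∀ T₁ T₂ I X a b →
      (∀ R → List.map proj₁ R ≡ I → ∀ {w} → w ∈ˡ closedWalks N → w ↭ X ++ arcs* R →
        a *ᴷ weight T₁ R ≈ b *ᴷ weight T₂ R) →
      a *ᴷ S T₁ I (Δ* X constant) ≈ b *ᴷ S T₂ I (Δ* X constant)
    S-compare T₁ T₂ [] X a b h = ≈-trans (≈-sym (∑-*ˡ (closedWalks N)))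
      (≈-trans (∑-cong-∈ (closedWalks N) termwise) (∑-*ˡ (closedWalks N)))
      where
      termwise : ∀ w → w ∈ˡ closedWalks N → a *ᴷ Δ* X constant w ≈ b *ᴷ Δ* X constant w
      termwise w w∈ with Δ*-vanishes X w
      ... | inj₁ p = ≈-trans (*-congˡ p) (≈-trans (zeroʳ a) (≈-sym (≈-trans (*-congˡ p) (zeroʳ b))))
      ... | inj₂ q = *-congʳ (≈-trans (≈-sym (*-identityʳ a))
        (≈-trans (h [] refl w∈ (subst (w ↭_) (sym (List.++-identityʳ X)) q)) (*-identityʳ b)))
    S-compare T₁ T₂ (i ∷ I) X a b h = begin
      a *ᴷ ∑ ts (λ γ → T₁ i γ *ᴷ S T₁ I (Δ* (arcs i γ) (Δ* X constant)))
        ≈⟨ ∑-*ˡ ts ⟨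
      ∑ ts (λ γ → a *ᴷ (T₁ i γ *ᴷ S T₁ I (Δ* (arcs i γ) (Δ* X constant))))
        ≈⟨ ∑-cong ts step ⟩
      ∑ ts (λ γ → b *ᴷ (T₂ i γ *ᴷ S T₂ I (Δ* (arcs i γ) (Δ* X constant))))
        ≈⟨ ∑-*ˡ ts ⟩
      b *ᴷ ∑ ts (λ γ → T₂ i γ *ᴷ S T₂ I (Δ* (arcs i γ) (Δ* X constant))) ∎
      where
      ts = tuples n r
      step : ∀ γ → a *ᴷ (T₁ i γ *ᴷ S T₁ I (Δ* (arcs i γ) (Δ* X constant))) ≈
                   b *ᴷ (T₂ i γ *ᴷ S T₂ I (Δ* (arcs i γ) (Δ* X constant)))
      step γ rewrite sym (Δ*-++ X (arcs i γ) constant) =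
        ≈-trans (≈-sym (*-assoc _ _ _)) (≈-trans
          (S-compare T₁ T₂ I (X ++ arcs i γ) (a *ᴷ T₁ i γ) (b *ᴷ T₂ i γ) λ R eq {w} w∈ w↭ →
            ≈-trans (*-assoc _ _ _) (≈-trans
              (h ((i , γ) ∷ R) (cong (i ∷_) eq) w∈ (subst (w ↭_) (List.++-assoc X (arcs i γ) (arcs* R)) w↭))
              (≈-sym (*-assoc _ _ _))))
          (*-assoc _ _ _))

-- Lists

unique-resp-↭ : ∀ {a} {A : Set a} {xs ys : List A} → xs ↭ ys → Unique xs → Unique ys
unique-resp-↭ p = Unique-resp-↭ (↭.↭⇒↭ₛ p)
  where open import Data.List.Relation.Binary.Permutation.Setoid.Properties (≡.setoid _) using (Unique-resp-↭)

permutation-injective : ∀ {n} (π : Permutation n n) → Injective _≡_ _≡_ (π ⟨$⟩ʳ_)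
permutation-injective π eq = trans (sym (Perm.inverseˡ π)) (trans (cong (π ⟨$⟩ˡ_) eq) (Perm.inverseˡ π))

unique-extract : ∀ {a} {A : Set a} {xs : List A} ys → Unique xs → Unique ys →
  (∀ {y} → y ∈ˡ ys → y ∈ˡ xs) → ∃ λ zs → xs ↭ ys ++ zs × (∀ {z} → z ∈ˡ zs → z ∉ˡ ys)
unique-extract {xs = xs} [] xs! _ _ = xs , ↭.refl , λ _ ()
unique-extract {A = A} {xs = xs} (y ∷ ys) xs! (y∉ ∷ ys!) sub with Mem.∈-∃++ (sub (here refl))
... | as , bs , refl with unique-resp-↭ (↭.shift y as bs) xs!
... | y∉as++bs ∷ rest! with unique-extract ys rest! ys! sub′
  where
  sub′ : ∀ {z} → z ∈ˡ ys → z ∈ˡ as ++ bs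
  sub′ z∈ with ↭.∈-resp-↭ (↭.shift y as bs) (sub (there z∈))
  ... | here refl = contradiction refl (All.lookup y∉ z∈)
  ... | there p   = p
... | zs , p , disjoint = zs , ↭.trans (↭.shift y as bs) (↭.prep y p) , λ
  { z∈ (here refl) → All.lookup y∉as++bs (↭.∈-resp-↭ (↭-sym p) (Mem.∈-++⁺ʳ ys z∈)) refl
  ; z∈ (there z∈ys) → disjoint z∈ z∈ys }

unique-↭ : ∀ {a} {A : Set a} {xs ys : List A} → Unique xs → Unique ys →
  (∀ {y} → y ∈ˡ ys → y ∈ˡ xs) → (∀ {y} → y ∈ˡ xs → y ∈ˡ ys) → xs ↭ ys
unique-↭ {ys = ys} xs! ys! sub sup with unique-extract ys xs! ys! sub
... | [] , p , _ = ↭.trans p (↭.↭-reflexive (List.++-identityʳ ys))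
... | z ∷ zs , p , disjoint =
  contradiction (sup (↭.∈-resp-↭ (↭-sym p) (Mem.∈-++⁺ʳ ys (here refl)))) (disjoint (here refl))

map-permutation-↭ : ∀ {n} (π : Permutation n n) → List.map (π ⟨$⟩ʳ_) (allFin n) ↭ allFin n
map-permutation-↭ {n} π = unique-↭
  (Unique.map⁺ (permutation-injective π) (Unique.allFin⁺ n)) (Unique.allFin⁺ n)
  (λ {y} _ → subst (_∈ˡ List.map (π ⟨$⟩ʳ_) (allFin n)) (Perm.inverseʳ π) (Mem.∈-map⁺ (π ⟨$⟩ʳ_) (Mem.∈-allFin (π ⟨$⟩ˡ y))))
  (λ _ → Mem.∈-allFin _)

∈-compositions : ∀ {n d} (ds : Vec ℕ n) → sum (Vec.lookup ds) ≡ d → ds ∈ˡ compositions n d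
∈-compositions {d = zero}  []       eq = here refl
∈-compositions {d = suc d} []       ()
∈-compositions {suc n} {d} (a ∷ ds) eq = Mem.∈-concatMap⁺ _ (lose (Mem.∈-upTo⁺ a≤d) (Mem.∈-map⁺ (a ∷_)
  (∈-compositions ds (trans (sym (ℕ.m+n∸m≡n a _)) (cong (_∸ a) eq)))))
  where
  a≤d : a < suc d
  a≤d = s≤s (subst (a ≤_) eq (ℕ.m≤m+n a _))

compositions-unique : ∀ n d → Unique (compositions n d)
compositions-unique zero    zero    = [] ∷ []
compositions-unique zero    (suc d) = []
compositions-unique (suc n) d = Unique.concat⁺
  (All.map⁺ (All.tabulate λ {a} _ → Unique.map⁺ Vec.∷-injectiveʳ (compositions-unique n (d ∸ a))))
  (AllPairs.map⁺ (AllPairs.map disjoint (Unique.upTo⁺ (suc d))))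
  where
  disjoint : ∀ {a b} → a ≢ b → ∀ {ds} →
    ¬ (ds ∈ˡ List.map (a ∷_) (compositions n (d ∸ a)) × ds ∈ˡ List.map (b ∷_) (compositions n (d ∸ b)))
  disjoint a≢b (p , q) with Mem.∈-map⁻ _ p | Mem.∈-map⁻ _ q
  ... | _ , _ , refl | _ , _ , eq = a≢b (Vec.∷-injectiveˡ eq)

blocks : ∀ {A : Set} → (A → ℕ) → List A → List A
blocks d = concatMap (λ i → List.replicate (d i) i)

blocks-↭ : ∀ {A : Set} (d : A → ℕ) {xs ys} → xs ↭ ys → blocks d xs ↭ blocks d ys
blocks-↭ d ↭.refl = ↭.refl
blocks-↭ d (↭.prep x p) = ↭.++⁺ˡ (List.replicate (d x) x) (blocks-↭ d p)
blocks-↭ d (↭.swap x y p) = ↭.trans (↭.shifts (List.replicate (d x) x) (List.replicate (d y) y))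
  (↭.++⁺ˡ (List.replicate (d y) y) (↭.++⁺ˡ (List.replicate (d x) x) (blocks-↭ d p)))
blocks-↭ d (↭.trans p q) = ↭.trans (blocks-↭ d p) (blocks-↭ d q)

map-blocks : ∀ {A B : Set} (f : A → B) {d : A → ℕ} {d′ : B → ℕ} → (∀ i → d′ (f i) ≡ d i) →
             ∀ xs → List.map f (blocks d xs) ≡ blocks d′ (List.map f xs)
map-blocks f h []       = refl
map-blocks f {d} {d′} h (x ∷ xs) = trans (List.map-++ f (List.replicate (d x) x) _)
  (cong₂ _++_ (trans (List.map-replicate f (d x) x) (cong (λ c → List.replicate c (f x)) (sym (h x)))) (map-blocks f h xs))

count : ∀ {n} → Fin n → List (Fin n) → ℕ
count i []      = 0
count i (u ∷ U) = 𝟙 (i ≟ u) + count i U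

count-++ : ∀ {n} (i : Fin n) U {V} → count i (U ++ V) ≡ count i U + count i V
count-++ i []      = refl
count-++ i (u ∷ U) = trans (cong (𝟙 (i ≟ u) +_) (count-++ i U)) (sym (ℕ.+-assoc (𝟙 (i ≟ u)) _ _))

count-∉ : ∀ {n} {i : Fin n} {U} → i ∉ˡ U → count i U ≡ 0
count-∉ {U = []} _ = refl
count-∉ {i = i} {u ∷ U} i∉ = cong₂ _+_ (𝟙-no (i ≟ u) (i∉ ∘ here)) (count-∉ (i∉ ∘ there))

count-∈ : ∀ {n} {i : Fin n} {U} → 1 ≤ count i U → i ∈ˡ U
count-∈ {i = i} {u ∷ U} le with i ≟ u
... | yes p = here p
... | no _  = there (count-∈ le)

∈-count : ∀ {n} {i : Fin n} {U} → i ∈ˡ U → 1 ≤ count i U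
∈-count {i = i} {u ∷ U} (here p) = subst (λ z → 1 ≤ z + count i U) (sym (𝟙-yes (i ≟ u) p)) (s≤s z≤n)
∈-count {i = i} {u ∷ U} (there p) = ℕ.≤-trans (∈-count p) (ℕ.m≤n+m _ (𝟙 (i ≟ u)))

count-↭ : ∀ {n} (i : Fin n) {U V} → U ↭ V → count i U ≡ count i V
count-↭ i ↭.refl = refl
count-↭ i (↭.prep x p) = cong (𝟙 (i ≟ x) +_) (count-↭ i p)
count-↭ i (↭.swap {ys = ys} x y p) = trans (cong (λ z → 𝟙 (i ≟ x) + (𝟙 (i ≟ y) + z)) (count-↭ i p))
  (trans (sym (ℕ.+-assoc (𝟙 (i ≟ x)) (𝟙 (i ≟ y)) _)) (trans (cong (_+ count i ys) (ℕ.+-comm (𝟙 (i ≟ x)) (𝟙 (i ≟ y)))) (ℕ.+-assoc (𝟙 (i ≟ y)) (𝟙 (i ≟ x)) _)))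
count-↭ i (↭.trans p q) = trans (count-↭ i p) (count-↭ i q)

count⇒↭ : ∀ {n} (U V : List (Fin n)) → (∀ i → count i U ≡ count i V) → U ↭ V
count⇒↭ [] [] h = ↭.refl
count⇒↭ [] (v ∷ V) h = contradiction (trans (h v) (cong (_+ count v V) (𝟙-yes (v ≟ v) refl))) λ ()
count⇒↭ (u ∷ U) V h with Mem.∈-∃++ (count-∈ {i = u} {V} (subst (1 ≤_) (h u) (∈-count {U = u ∷ U} (here refl))))
... | as , bs , refl = ↭.trans (↭.prep u (count⇒↭ U (as ++ bs) λ i →
  ℕ.+-cancelˡ-≡ (𝟙 (i ≟ u)) _ _ (trans (h i) (count-↭ i (↭.shift u as bs))))) (↭-sym (↭.shift u as bs))

count-replicate : ∀ {n} (i j : Fin n) c → count i (List.replicate c j) ≡ 𝟙 (i ≟ j) * c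
count-replicate i j zero    = sym (ℕ.*-zeroʳ (𝟙 (i ≟ j)))
count-replicate i j (suc c) = trans (cong (𝟙 (i ≟ j) +_) (count-replicate i j c)) (sym (ℕ.*-suc (𝟙 (i ≟ j)) c))

count-blocks : ∀ {n} (d : Fin n → ℕ) i → count i (blocks d (allFin n)) ≡ d i
count-blocks {n} d i = trans (go id) (trans (sum-cong-≗ λ j → cong (_* d j) (𝟙-cong (i ≟ j) (j ≟ i) sym sym)) (sum-δ i d))
  where
  go : ∀ {s} (f : Fin s → Fin n) → count i (blocks d (List.tabulate f)) ≡ sum (λ j → 𝟙 (i ≟ f j) * d (f j))
  go {zero}  f = refl
  go {suc s} f = trans (count-++ i (List.replicate (d (f zero)) (f zero))) (cong₂ _+_ (count-replicate i (f zero) _) (go (f ∘ suc)))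

sum-count : ∀ {n} (U : List (Fin n)) → sum (λ i → count i U) ≡ List.length U
sum-count {n} []      = sum-zero {n} (λ _ → refl)
sum-count {n} (u ∷ U) = trans (∑-distrib-+ (λ i → 𝟙 (i ≟ u)) (λ i → count i U)) (cong₂ _+_ (sum-δ₁ u) (sum-count U))

count-map : ∀ {n} (π : Permutation n n) i U → count (π ⟨$⟩ʳ i) (List.map (π ⟨$⟩ʳ_) U) ≡ count i U
count-map π i []      = refl
count-map π i (u ∷ U) = cong₂ _+_ (𝟙-cong (_ ≟ _) (i ≟ u) (permutation-injective π) (cong (π ⟨$⟩ʳ_))) (count-map π i U)

-- Invariance under renaming of the vertices

-- The same expression as the local definition in `adjacencyTensor`, with which it agrees by
-- computation.
indexSet : ∀ {n r} → Fin n → Vec (Fin n) r → Subset n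
indexSet i γ = ⁅ i ⁆ ∪ ⋃ (Vec.toList (Vec.map ⁅_⁆ γ))

∈-indexSet⁻ : ∀ {n r} (i : Fin n) (γ : Vec (Fin n) r) {v} → v ∈ indexSet i γ → v ∈ˡ i ∷ Vec.toList γ
∈-indexSet⁻ i γ v∈ with x∈p∪q⁻ ⁅ i ⁆ (⋃ (Vec.toList (Vec.map ⁅_⁆ γ))) v∈
... | inj₁ v∈i = here (x∈⁅y⁆⇒x≡y i v∈i)
... | inj₂ v∈γ = there (go γ v∈γ)
  where
  go : ∀ {s} (γ : Vec (Fin _) s) {v} → v ∈ ⋃ (Vec.toList (Vec.map ⁅_⁆ γ)) → v ∈ˡ Vec.toList γ
  go []      v∈ = contradiction v∈ ∉⊥
  go (j ∷ γ) v∈ with x∈p∪q⁻ ⁅ j ⁆ (⋃ (Vec.toList (Vec.map ⁅_⁆ γ))) v∈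
  ... | inj₁ v∈j = here (x∈⁅y⁆⇒x≡y j v∈j)
  ... | inj₂ v∈γ = there (go γ v∈γ)

∈-indexSet⁺ : ∀ {n r} (i : Fin n) (γ : Vec (Fin n) r) {v} → v ∈ˡ i ∷ Vec.toList γ → v ∈ indexSet i γ
∈-indexSet⁺ i γ (here refl) = x∈p∪q⁺ (inj₁ (x∈⁅x⁆ i))
∈-indexSet⁺ {n} i γ (there v∈) = x∈p∪q⁺ {p = ⁅ i ⁆} (inj₂ (go γ v∈))
  where
  go : ∀ {s} (γ : Vec (Fin n) s) {v} → v ∈ˡ Vec.toList γ → v ∈ ⋃ (Vec.toList (Vec.map ⁅_⁆ γ))
  go (j ∷ γ) (here refl) = x∈p∪q⁺ (inj₁ (x∈⁅x⁆ j))
  go (j ∷ γ) (there v∈)  = x∈p∪q⁺ {p = ⁅ j ⁆} (inj₂ (go γ v∈))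

module Renaming {c ℓ₁ ℓ₂} (K : OrderedField c ℓ₁ ℓ₂) {n : ℕ} (π : Permutation n n) where

  open FieldTheory K
  open Functionals K {n}

  p : Fin n → Fin n
  p = π ⟨$⟩ʳ_

  pᵃ : Arc → Arc
  pᵃ (i , j) = p i , p j

  pᵃ-injective : ∀ {x y} → pᵃ x ≡ pᵃ y → x ≡ y
  pᵃ-injective eq = cong₂ _,_ (permutation-injective π (Product.,-injectiveˡ eq)) (permutation-injective π (Product.,-injectiveʳ eq))

  p* : List Arc → List Arc
  p* = List.map pᵃ

  ∑-allFin : ∀ (f : Fin n → Carrier) → ∑ (allFin n) (f ∘ p) ≈ ∑ (allFin n) f
  ∑-allFin f = ≈-trans (≈-reflexive (sym (∑-map p (allFin n)))) (∑-↭ (map-permutation-↭ π))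

  ∂ₘ-rename : ∀ x w → ∂ₘ K (pᵃ x) (p* w) ≡ List.map p* (∂ₘ K x w)
  ∂ₘ-rename x [] = refl
  ∂ₘ-rename x (y ∷ w) rewrite does-⇔ (mk⇔ pᵃ-injective (cong pᵃ)) (pᵃ x ≟ₐ pᵃ y) (x ≟ₐ y) | ∂ₘ-rename x w =
    sym (trans (List.map-++ p* (if does (x ≟ₐ y) then [ w ] else []) _) (cong₂ _++_ head
      (trans (sym (List.map-∘ (∂ₘ K x w))) (List.map-∘ (∂ₘ K x w)))))
    where
    head : List.map p* (if does (x ≟ₐ y) then [ w ] else []) ≡ (if does (x ≟ₐ y) then [ p* w ] else [])
    head with does (x ≟ₐ y)
    ... | true  = refl
    ... | false = refl

  Δ-rename : ∀ x φ → Δ (pᵃ x) φ ∘ p* ≐ Δ x (φ ∘ p*)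
  Δ-rename x φ w = ≈-reflexive (trans (cong (λ ws → ∑ ws φ) (∂ₘ-rename x w)) (∑-map p* (∂ₘ K x w)))

  Δ*-rename : ∀ X φ → Δ* (p* X) φ ∘ p* ≐ Δ* X (φ ∘ p*)
  Δ*-rename []      φ w = ≈-refl
  Δ*-rename (x ∷ X) φ w = ≈-trans (Δ*-rename X (Δ (pᵃ x) φ) w) (Δ*-cong X (Δ-rename x φ) w)

  ∑-walks : ∀ N i j φ → ∑ (walks N i j) (φ ∘ p*) ≈ ∑ (walks N (p i) (p j)) φ
  ∑-walks zero i j φ rewrite does-⇔ (mk⇔ (permutation-injective π) (cong p)) (p i ≟ p j) (i ≟ j) with does (i ≟ j)
  ... | true  = ≈-refl
  ... | false = ≈-refl
  ∑-walks (suc N) i j φ = begin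
    ∑ (walks (suc N) i j) (φ ∘ p*)                                      ≈⟨ ∑-concatMap _ (allFin n) ⟩
    ∑ (allFin n) (λ l → ∑ (List.map ((i , l) ∷_) (walks N l j)) (φ ∘ p*))
      ≈⟨ ∑-cong (allFin n) (λ l → ≈-trans (≈-reflexive (∑-map _ (walks N l j))) (∑-walks N l j (φ ∘ ((p i , p l) ∷_)))) ⟩
    ∑ (allFin n) (λ l → ∑ (walks N (p l) (p j)) (φ ∘ ((p i , p l) ∷_)))
      ≈⟨ ∑-allFin (λ l → ∑ (walks N l (p j)) (φ ∘ ((p i , l) ∷_))) ⟩
    ∑ (allFin n) (λ l → ∑ (walks N l (p j)) (φ ∘ ((p i , l) ∷_)))
      ≈⟨ ∑-cong (allFin n) (λ l → ≈-reflexive (sym (∑-map _ (walks N l (p j))))) ⟩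
    ∑ (allFin n) (λ l → ∑ (List.map ((p i , l) ∷_) (walks N l (p j))) φ)
      ≈⟨ ∑-concatMap _ (allFin n) ⟨
    ∑ (walks (suc N) (p i) (p j)) φ ∎

  ∑-closedWalks : ∀ N φ → ∑ (closedWalks N) (φ ∘ p*) ≈ ∑ (closedWalks N) φ
  ∑-closedWalks N φ = begin
    ∑ (closedWalks N) (φ ∘ p*)                          ≈⟨ ∑-concatMap _ (allFin n) ⟩
    ∑ (allFin n) (λ i → ∑ (walks N i i) (φ ∘ p*))       ≈⟨ ∑-cong (allFin n) (λ i → ∑-walks N i i φ) ⟩
    ∑ (allFin n) (λ i → ∑ (walks N (p i) (p i)) φ)      ≈⟨ ∑-allFin (λ i → ∑ (walks N i i) φ) ⟩
    ∑ (allFin n) (λ i → ∑ (walks N i i) φ)              ≈⟨ ∑-concatMap _ (allFin n) ⟨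
    ∑ (closedWalks N) φ ∎

  ∑-tuples-suc : ∀ s (f : Vec (Fin n) (suc s) → Carrier) →
                 ∑ (tuples n (suc s)) f ≈ ∑ (allFin n) (λ i → ∑ (tuples n s) (λ γ → f (i ∷ γ)))
  ∑-tuples-suc s f = go (allFin n)
    where
    go : ∀ is → ∑ (cartesianProductWith _∷_ is (tuples n s)) f ≈ ∑ is (λ i → ∑ (tuples n s) (λ γ → f (i ∷ γ)))
    go []       = ≈-refl
    go (i ∷ is) = ≈-trans (∑-++ (List.map (i ∷_) (tuples n s))) (+-cong (≈-reflexive (∑-map (i ∷_) (tuples n s))) (go is))

  ∑-tuples : ∀ s (f : Vec (Fin n) s → Carrier) → ∑ (tuples n s) (f ∘ Vec.map p) ≈ ∑ (tuples n s) f
  ∑-tuples zero f = ≈-refl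
  ∑-tuples (suc s) f = begin
    ∑ (tuples n (suc s)) (f ∘ Vec.map p)                                  ≈⟨ ∑-tuples-suc s (f ∘ Vec.map p) ⟩
    ∑ (allFin n) (λ i → ∑ (tuples n s) (λ γ → f (p i ∷ Vec.map p γ)))     ≈⟨ ∑-cong (allFin n) (λ i → ∑-tuples s (λ γ → f (p i ∷ γ))) ⟩
    ∑ (allFin n) (λ i → ∑ (tuples n s) (λ γ → f (p i ∷ γ)))               ≈⟨ ∑-allFin (λ i → ∑ (tuples n s) (λ γ → f (i ∷ γ))) ⟩
    ∑ (allFin n) (λ i → ∑ (tuples n s) (λ γ → f (i ∷ γ)))                 ≈⟨ ∑-tuples-suc s f ⟨
    ∑ (tuples n (suc s)) f ∎

  constant-rename : constant ∘ p* ≐ constant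
  constant-rename []      = ≈-refl
  constant-rename (_ ∷ _) = ≈-refl

  module _ {r : ℕ} (N : ℕ) where

    open Expansion {r} N

    arcs-rename : ∀ i (γ : Vec (Fin n) r) → arcs (p i) (Vec.map p γ) ≡ p* (arcs i γ)
    arcs-rename i γ = trans (cong (List.map (p i ,_)) (Vec.toList-map p γ))
      (trans (sym (List.map-∘ (Vec.toList γ))) (List.map-∘ (Vec.toList γ)))

    -- The sums run over all tuples and all closed walks, and `π` permutes both. The renamed sum is
    -- therefore the old one, applied to the functional pulled back along `p*`.
    S-rename : ∀ {T T′} → (∀ i γ → T′ (p i) (Vec.map p γ) ≈ T i γ) →
               ∀ I φ → S T′ (List.map p I) φ ≈ S T I (φ ∘ p*)
    S-rename h []      φ = ≈-sym (∑-closedWalks N φ)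
    S-rename {T} {T′} h (i ∷ I) φ = ≈-trans (≈-sym (∑-tuples r _)) (∑-cong (tuples n r) λ γ →
      *-cong (h i γ) (≈-trans (S-rename h I _) (S-cong T I λ w →
        ≈-trans (≈-reflexive (cong (λ X → Δ* X φ (p* w)) (arcs-rename i γ))) (Δ*-rename (arcs i γ) φ w))))

-- Expansion of the trace

module Traces {c ℓ₁ ℓ₂} (K : OrderedField c ℓ₁ ℓ₂) (k d n : ℕ) where

  open FieldTheory K
  open Functionals K {n}

  N r : ℕ
  r = k ∸ 1
  N = d * r

  open Expansion {r} N

  invFactorial : ℕ → Carrier
  invFactorial a = (((a * r) !) · 1#) ⁻¹

  factor : (Fin n → ℕ) → Carrier
  factor ds = ∏ (allFin n) (invFactorial ∘ ds)

  invFactorial-pos : ∀ a → 0# <ᴷ invFactorial a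
  invFactorial-pos a = ⁻¹-pos (·1-pos (ℕ.1≤n! (a * r)))

  factor-pos : ∀ ds → 0# <ᴷ factor ds
  factor-pos ds = ∏-pos (allFin n) (λ i → invFactorial-pos (ds i))

  term : Tensor K k n → (Fin n → ℕ) → Carrier
  term T ds = factor ds *ᴷ S T (blocks ds (allFin n)) constant

  module _ (T : Tensor K k n) where

    eval-derivatives : ∀ φ i {s} (γ : Vec (Fin n) s) q →
      eval φ (Vec.foldr′ (λ j → ∂ K (i , j)) q γ) ≈ eval (Δ* (List.map (i ,_) (Vec.toList γ)) φ) q
    eval-derivatives φ i []      q = ≈-refl
    eval-derivatives φ i (j ∷ γ) q = ≈-trans (eval-∂ φ (i , j) (Vec.foldr′ (λ j → ∂ K (i , j)) q γ)) (eval-derivatives (Δ (i , j) φ) i γ q)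

    eval-operator : ∀ φ i q → eval φ (operator K k T i q) ≈
                    ∑ (tuples n r) (λ γ → T i γ *ᴷ eval (Δ* (arcs i γ) φ) q)
    eval-operator φ i q = ≈-trans (∑-concatMap _ (tuples n r)) (∑-cong (tuples n r) λ γ →
      ≈-trans (eval-scale φ (T i γ) (Vec.foldr′ (λ j → ∂ K (i , j)) q γ)) (*-congˡ (eval-derivatives φ i γ q)))

    eval-iterate : ∀ c i I q → (∀ φ → eval φ q ≈ c *ᴷ S T I φ) →
      ∀ a φ → eval φ (iterate K a (operator K k T i) q) ≈ c *ᴷ S T (List.replicate a i ++ I) φ
    eval-iterate c i I q h zero    φ = h φ
    eval-iterate c i I q h (suc a) φ = ≈-trans (eval-operator φ i (iterate K a (operator K k T i) q))
      (≈-trans (∑-cong (tuples n r) λ γ → ≈-trans (*-congˡ (eval-iterate c i I q h a (Δ* (arcs i γ) φ))) (x∙yz≈y∙xz _ _ _))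
        (∑-*ˡ (tuples n r)))
      where open import Algebra.Properties.CommutativeSemigroup *-commutativeSemigroup using (x∙yz≈y∙xz)

    summand : Vec ℕ n → Polynomial K n → List (Fin n) → Polynomial K n
    summand ds = List.foldr λ i q → scale K (invFactorial (Vec.lookup ds i)) (iterate K (Vec.lookup ds i) (operator K k T i) q)

    eval-summand : ∀ ds q → (∀ φ → eval φ q ≈ ∑ (closedWalks N) φ) → ∀ L φ →
      eval φ (summand ds q L) ≈ ∏ L (invFactorial ∘ Vec.lookup ds) *ᴷ S T (blocks (Vec.lookup ds) L) φ
    eval-summand ds q h []      φ = ≈-trans (h φ) (≈-sym (*-identityˡ _))
    eval-summand ds q h (i ∷ L) φ = ≈-trans (eval-scale φ (invFactorial (Vec.lookup ds i)) (iterate K (Vec.lookup ds i) (operator K k T i) (summand ds q L))) (≈-trans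
      (*-congˡ (eval-iterate _ i (blocks (Vec.lookup ds) L) (summand ds q L) (eval-summand ds q h L) (Vec.lookup ds i) φ)) (≈-sym (*-assoc _ _ _)))

    -- The outermost operator of the fold belongs to the first vertex and acts first on the
    -- functional, so the operators appear in `blocks` in the order of the vertices. The inverse
    -- factorials are collected in `factor`.
    Tr-expansion : Tr K k d T ≈ (r ^ (n ∸ 1)) · ∑ (compositions n d) (term T ∘ Vec.lookup)
    Tr-expansion = ×-congʳ (r ^ (n ∸ 1)) (∑-cong (compositions n d) λ ds →
      ≈-trans (constantTerm-eval (summand ds P (allFin n))) (eval-summand ds P (eval-matrixTrace N) (allFin n) constant))
      where
      P = matrixTrace K (matrixPower K (indeterminates K) N)

  -- The tensor Aα of the single hyperedge E, with every degree replaced by 1 / α: the powers of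
  -- the degrees in the moments factor out, and its terms are their coefficients.

  localTensor : Carrier → Subset n → Fin n → Vec (Fin n) r → Carrier
  localTensor β E i γ = if does (Vec.≡-dec _≟_ γ (Vec.replicate r i)) then 1# else
    (if does (Vec.≡-dec Bool._≟_ (indexSet i γ) E) then β else 0#)

  -- The exponents of the surviving shapes: one row for each vertex of `E` and one for each loop in
  -- `U`. The empty `E` stands for the rows consisting of loops alone.
  multiplicity : Subset n → List (Fin n) → Fin n → ℕ
  multiplicity E U i = 𝟙 (i ∈? E) + count i U

  Φ : Carrier → Subset n → List (Fin n) → Carrier
  Φ β E U = term (localTensor β E) (multiplicity E U)

  module _ (π : Permutation n n) where

    open Renaming K π

    -- Both the local tensor and the exponents are built from `E` and `U` alone, so they follow
    -- these under a renaming. The blocks come out in another order, which `S-↭` repairs.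
    Φ-rename : ∀ β E E′ U → (∀ i → i ∈ E → p i ∈ E′) → (∀ i → p i ∈ E′ → i ∈ E) →
               Φ β E′ (List.map p U) ≈ Φ β E U
    Φ-rename β E E′ U f g = *-cong factor≈ (≈-trans
      (S-↭ T′ constant (↭-sym (↭.trans (↭.↭-reflexive (map-blocks p multiplicity≡ (allFin n))) (blocks-↭ _ (map-permutation-↭ π)))))
      (≈-trans (S-rename N tensor≈ (blocks (multiplicity E U) (allFin n)) constant)
        (S-cong (localTensor β E) (blocks (multiplicity E U) (allFin n)) constant-rename)))
      where
      T′ = localTensor β E′
      multiplicity≡ : ∀ i → multiplicity E′ (List.map p U) (p i) ≡ multiplicity E U i
      multiplicity≡ i = cong₂ _+_ (𝟙-cong (p i ∈? E′) (i ∈? E) (g i) (f i)) (count-map π i U)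
      factor≈ : factor (multiplicity E′ (List.map p U)) ≈ factor (multiplicity E U)
      factor≈ = ≈-trans (∏-↭ (↭-sym (map-permutation-↭ π))) (≈-trans (≈-reflexive (∏-map p (allFin n)))
        (∏-cong (allFin n) λ i → ≈-reflexive (cong invFactorial (multiplicity≡ i))))
      loop-rename : ∀ {i} (γ : Vec (Fin n) r) → Vec.map p γ ≡ Vec.replicate r (p i) → γ ≡ Vec.replicate r i
      loop-rename {i} γ eq = map-injective γ _ (trans eq (sym (Vec.map-replicate p i r)))
        where
        map-injective : ∀ {s} (γ δ : Vec (Fin n) s) → Vec.map p γ ≡ Vec.map p δ → γ ≡ δ
        map-injective []      []      _ = refl
        map-injective (a ∷ γ) (b ∷ δ) eq =
          cong₂ _∷_ (permutation-injective π (Vec.∷-injectiveˡ eq)) (map-injective γ δ (Vec.∷-injectiveʳ eq))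
      index-rename⁺ : ∀ i (γ : Vec (Fin n) r) {v} → v ∈ indexSet i γ → p v ∈ indexSet (p i) (Vec.map p γ)
      index-rename⁺ i γ v∈ = ∈-indexSet⁺ (p i) (Vec.map p γ)
        (subst (λ L → _ ∈ˡ p i ∷ L) (sym (Vec.toList-map p γ)) (Mem.∈-map⁺ p (∈-indexSet⁻ i γ v∈)))
      index-rename⁻ : ∀ i (γ : Vec (Fin n) r) {v} → p v ∈ indexSet (p i) (Vec.map p γ) → v ∈ indexSet i γ
      index-rename⁻ i γ {v} v∈ with Mem.∈-map⁻ p {xs = i ∷ Vec.toList γ} (subst (λ L → p v ∈ˡ p i ∷ L) (Vec.toList-map p γ) (∈-indexSet⁻ (p i) (Vec.map p γ) v∈))
      ... | u , u∈ , eq = subst (_∈ indexSet i γ) (sym (permutation-injective π eq)) (∈-indexSet⁺ i γ u∈)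
      onto : ∀ {Q : Fin n → Set} → (∀ v → Q (p v)) → ∀ v → Q v
      onto {Q} h v = subst Q (Perm.inverseʳ π) (h (π ⟨$⟩ˡ v))
      tensor≈ : ∀ i γ → T′ (p i) (Vec.map p γ) ≈ localTensor β E i γ
      tensor≈ i γ rewrite
          does-⇔ (mk⇔ (loop-rename {i} γ) (λ eq → trans (cong (Vec.map p) eq) (Vec.map-replicate p i r)))
            (Vec.≡-dec _≟_ (Vec.map p γ) (Vec.replicate r (p i))) (Vec.≡-dec _≟_ γ (Vec.replicate r i))
        | does-⇔ (mk⇔
            (λ eq → subset-ext
              (λ v v∈ → g v (subst (p v ∈_) eq (index-rename⁺ i γ v∈)))
              (λ v v∈ → index-rename⁻ i γ (subst (p v ∈_) (sym eq) (f v v∈))))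
            (λ eq → subset-ext
              (onto (λ v v∈ → f v (subst (v ∈_) eq (index-rename⁻ i γ v∈))))
              (onto (λ v v∈ → index-rename⁺ i γ (subst (v ∈_) (sym eq) (g v v∈))))))
            (Vec.≡-dec Bool._≟_ (indexSet (p i) (Vec.map p γ)) E′) (Vec.≡-dec Bool._≟_ (indexSet i γ) E)
        = ≈-refl

-- Rows whose arcs form a closed walk

total : ∀ {A : Set} → (A → ℕ) → List A → ℕ
total g []       = 0
total g (x ∷ xs) = g x + total g xs

total-cong : ∀ {A : Set} {f g : A → ℕ} → (∀ x → f x ≡ g x) → ∀ xs → total f xs ≡ total g xs
total-cong h []       = refl
total-cong h (x ∷ xs) = cong₂ _+_ (h x) (total-cong h xs)

total-* : ∀ {A : Set} c (f : A → ℕ) xs → total (λ x → c * f x) xs ≡ c * total f xs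
total-* c f []       = sym (ℕ.*-zeroʳ c)
total-* c f (x ∷ xs) = trans (cong (c * f x +_) (total-* c f xs)) (sym (ℕ.*-distribˡ-+ c (f x) _))

sum-total : ∀ {A : Set} {n} (f : Fin n → A → ℕ) xs →
            sum (λ i → total (f i) xs) ≡ total (λ x → sum (λ i → f i x)) xs
sum-total {n = n} f [] = sum-zero {n} λ _ → refl
sum-total f (x ∷ xs) = trans (∑-distrib-+ (λ i → f i x) (λ i → total (f i) xs))
  (cong (sum (λ i → f i x) +_) (sum-total f xs))

term≤total : ∀ {A : Set} {f : A → ℕ} {x xs} → x ∈ˡ xs → f x ≤ total f xs
term≤total (here refl) = ℕ.m≤m+n _ _
term≤total (there p)   = ℕ.≤-trans (term≤total p) (ℕ.m≤n+m _ _)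

total-zero : ∀ {A : Set} {f : A → ℕ} {xs} → All (λ x → f x ≡ 0) xs → total f xs ≡ 0
total-zero []       = refl
total-zero (p ∷ ps) = cong₂ _+_ p (total-zero ps)

total-one : ∀ {A : Set} (xs : List A) → total (λ _ → 1) xs ≡ List.length xs
total-one []       = refl
total-one (x ∷ xs) = cong suc (total-one xs)

walk-balance : ∀ {n} {i j : Fin n} {w} v → Walk i j w →
  count v (List.map proj₁ w) + 𝟙 (v ≟ j) ≡ count v (List.map proj₂ w) + 𝟙 (v ≟ i)
walk-balance v [] = refl
walk-balance v (_∷_ {l} {j} {w} i W) = begin
  𝟙 (v ≟ i) + a + 𝟙 (v ≟ j)   ≡⟨ ℕ.+-assoc (𝟙 (v ≟ i)) a _ ⟩
  𝟙 (v ≟ i) + (a + 𝟙 (v ≟ j)) ≡⟨ cong (𝟙 (v ≟ i) +_) (walk-balance v W) ⟩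
  𝟙 (v ≟ i) + (b + 𝟙 (v ≟ l)) ≡⟨ ℕ.+-comm (𝟙 (v ≟ i)) _ ⟩
  b + 𝟙 (v ≟ l) + 𝟙 (v ≟ i)   ≡⟨ cong (_+ 𝟙 (v ≟ i)) (ℕ.+-comm b _) ⟩
  𝟙 (v ≟ l) + b + 𝟙 (v ≟ i)   ∎
  where
  open ≡-Reasoning
  a = count v (List.map proj₁ w)
  b = count v (List.map proj₂ w)

walk-loops : ∀ {n} {i j : Fin n} {w} → Walk i j w → All (λ { (a , b) → a ≡ b }) w → All (λ x → proj₁ x ≡ i) w
walk-loops []      []            = []
walk-loops (i ∷ W) (refl ∷ ps) = refl ∷ walk-loops W ps

-- Where no arc joins `u` to another vertex, a walk that is at `u` once is there always. This form
-- of connectedness confines the loops to the hyperedge in `loops-inside`.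
walk-separated : ∀ {n} u {i j : Fin n} {w} → Walk i j w →
  All (λ { (a , b) → (a ≡ u → b ≡ u) × (b ≡ u → a ≡ u) }) w →
  (i ≡ u × All (λ x → proj₁ x ≡ u) w) ⊎ (i ≢ u × All (λ x → proj₁ x ≢ u) w)
walk-separated u {i} [] [] with i ≟ u
... | yes p = inj₁ (p , [])
... | no ¬p = inj₂ (¬p , [])
walk-separated u (i ∷ W) ((f , g) ∷ ps) with walk-separated u W ps
... | inj₁ (l≡u , q) = inj₁ (g l≡u , g l≡u ∷ q)
... | inj₂ (l≢u , q) = inj₂ (l≢u ∘ f , (l≢u ∘ f) ∷ q)

module _ {n m} (H : Hypergraph n m) {r : ℕ} where

  -- L lists the vertices of the loop rows, E the pairs (first index, hyperedge) of the others.

  data Tagged : List (Fin n × Vec (Fin n) r) → List (Fin n) → List (Fin n × Fin m) → Set where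
    []   : Tagged [] [] []
    loop : ∀ {i γ R L E} → γ ≡ Vec.replicate r i → Tagged R L E → Tagged ((i , γ) ∷ R) (i ∷ L) E
    hyper : ∀ {i γ R L E e} → indexSet i γ ≡ edge H e → Tagged R L E →
           Tagged ((i , γ) ∷ R) L ((i , e) ∷ E)

  tagged-count : ∀ v {R L E} → Tagged R L E →
    count v (List.map proj₁ R) ≡ count v L + count v (List.map proj₁ E)
  tagged-count v [] = refl
  tagged-count v (loop {i} _ t) = trans (cong (𝟙 (v ≟ i) +_) (tagged-count v t)) (sym (ℕ.+-assoc (𝟙 (v ≟ i)) _ _))
  tagged-count v (hyper {i} {L = L} _ t) = trans (cong (𝟙 (v ≟ i) +_) (tagged-count v t)) (swap (𝟙 (v ≟ i)) (count v L) _)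
    where
    swap : ∀ a b c → a + (b + c) ≡ b + (a + c)
    swap = solve-∀

  tagged-length : ∀ {R L E} → Tagged R L E → List.length R ≡ List.length L + List.length E
  tagged-length [] = refl
  tagged-length (loop _ t) = cong suc (tagged-length t)
  tagged-length (hyper _ t) = trans (cong suc (tagged-length t)) (sym (ℕ.+-suc _ _))

  tagged-roots : ∀ {R L E} → Tagged R L E → All (λ { (i , e) → i ∈ edge H e }) E
  tagged-roots [] = []
  tagged-roots (loop _ t) = tagged-roots t
  tagged-roots (hyper {i} {γ} eq t) = subst (i ∈_) eq (∈-indexSet⁺ i γ (here refl)) ∷ tagged-roots t

  uses : List (Fin n × Fin m) → Fin m → ℕ
  uses E e = total (λ x → 𝟙 (e ≟ proj₂ x)) E

  rooted : List (Fin n × Fin m) → Fin n → Fin m → ℕ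
  rooted E v e = total (λ x → 𝟙 (v ≟ proj₁ x) * 𝟙 (e ≟ proj₂ x)) E

  sum-uses : ∀ E → sum (uses E) ≡ List.length E
  sum-uses E = trans (sum-total (λ e x → 𝟙 (e ≟ proj₂ x)) E)
    (trans (total-cong (λ x → sum-δ₁ (proj₂ x)) E) (total-one E))

  module _ (uniform : Uniform (suc r) H) where

    -- Each vertex of `e` occurs among the k entries of the row, and `e` has k vertices; so each
    -- occurs exactly once.
    row-count : ∀ i (γ : Vec (Fin n) r) e → indexSet i γ ≡ edge H e →
                ∀ v → inc H v e ≡ count v (i ∷ Vec.toList γ)
    row-count i γ e eq = sum-tight pointwise (ℕ.≤-reflexive
      (trans (sum-count (i ∷ Vec.toList γ)) (trans (cong suc (Vec.length-toList γ)) (sym (sum-inc H uniform e)))))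
      where
      pointwise : ∀ v → inc H v e ≤ count v (i ∷ Vec.toList γ)
      pointwise v with v ∈? edge H e
      ... | no _   = z≤n
      ... | yes v∈ = ∈-count (∈-indexSet⁻ i γ (subst (v ∈_) (sym eq) v∈))

    -- A loop row has as many tails as heads at `v`. A hyperedge row with first index `i` has r
    -- tails at `i` and one head at every other vertex of its hyperedge; adding 1 on the left at all
    -- of its vertices and k on the right at `i` balances it.
    tagged-balance : ∀ v {R L E} → Tagged R L E →
      count v (List.map proj₁ (arcs* R)) + total (λ x → inc H v (proj₂ x)) E ≡
      count v (List.map proj₂ (arcs* R)) + total (λ x → suc r * 𝟙 (v ≟ proj₁ x)) E
    tagged-balance v [] = refl
    tagged-balance v (loop {i} {R = R} {E = E} refl t) = begin
      count v (List.map proj₁ (arcs i δ ++ arcs* R)) + A  ≡⟨ cong (_+ A) (split proj₁) ⟩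
      count v (List.map proj₁ (arcs i δ)) + O + A          ≡⟨ ℕ.+-assoc (count v (List.map proj₁ (arcs i δ))) O A ⟩
      count v (List.map proj₁ (arcs i δ)) + (O + A)        ≡⟨ cong₂ _+_ (cong (count v) (same r)) (tagged-balance v t) ⟩
      count v (List.map proj₂ (arcs i δ)) + (I + B)        ≡⟨ sym (ℕ.+-assoc (count v (List.map proj₂ (arcs i δ))) I B) ⟩
      count v (List.map proj₂ (arcs i δ)) + I + B          ≡⟨ cong (_+ B) (sym (split proj₂)) ⟩
      count v (List.map proj₂ (arcs i δ ++ arcs* R)) + B   ∎
      where
      open ≡-Reasoning
      δ = Vec.replicate r i
      A = total (λ x → inc H v (proj₂ x)) E
      B = total (λ x → suc r * 𝟙 (v ≟ proj₁ x)) E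
      O = count v (List.map proj₁ (arcs* R))
      I = count v (List.map proj₂ (arcs* R))
      split : ∀ (f : Fin n × Fin n → Fin n) → count v (List.map f (arcs i δ ++ arcs* R)) ≡
              count v (List.map f (arcs i δ)) + count v (List.map f (arcs* R))
      split f = trans (cong (count v) (List.map-++ f (arcs i δ) (arcs* R))) (count-++ v (List.map f (arcs i δ)))
      same : ∀ s → List.map proj₁ (arcs i (Vec.replicate s i)) ≡ List.map proj₂ (arcs i (Vec.replicate s i))
      same zero    = refl
      same (suc s) = cong (i ∷_) (same s)
    tagged-balance v (hyper {i} {γ} {R = R} {E = E} {e = e} eq t) = begin
      count v (List.map proj₁ (arcs i γ ++ arcs* R)) + (inc H v e + A)
        ≡⟨ cong₂ (λ y z → y + (z + A)) (split proj₁) (row-count i γ e eq v) ⟩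
      count v (List.map proj₁ (arcs i γ)) + O + ((𝟙 (v ≟ i) + count v (Vec.toList γ)) + A)
        ≡⟨ cong (λ y → y + O + ((𝟙 (v ≟ i) + count v (Vec.toList γ)) + A)) (outs γ) ⟩
      r * 𝟙 (v ≟ i) + O + ((𝟙 (v ≟ i) + count v (Vec.toList γ)) + A)
        ≡⟨ rearrange (𝟙 (v ≟ i)) (r * 𝟙 (v ≟ i)) O (count v (Vec.toList γ)) A ⟩
      count v (Vec.toList γ) + (O + A) + (𝟙 (v ≟ i) + r * 𝟙 (v ≟ i))
        ≡⟨ cong (λ y → count v (Vec.toList γ) + y + (𝟙 (v ≟ i) + r * 𝟙 (v ≟ i))) (tagged-balance v t) ⟩
      count v (Vec.toList γ) + (I + B) + (𝟙 (v ≟ i) + r * 𝟙 (v ≟ i))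
        ≡⟨ rearrange′ (count v (Vec.toList γ)) I B (𝟙 (v ≟ i) + r * 𝟙 (v ≟ i)) ⟩
      count v (Vec.toList γ) + I + (suc r * 𝟙 (v ≟ i) + B)
        ≡⟨ cong (_+ (suc r * 𝟙 (v ≟ i) + B)) (sym (trans (split proj₂) (cong (λ z → count v z + I) (ins γ)))) ⟩
      count v (List.map proj₂ (arcs i γ ++ arcs* R)) + (suc r * 𝟙 (v ≟ i) + B) ∎
      where
      open ≡-Reasoning
      A = total (λ x → inc H v (proj₂ x)) E
      B = total (λ x → suc r * 𝟙 (v ≟ proj₁ x)) E
      O = count v (List.map proj₁ (arcs* R))
      I = count v (List.map proj₂ (arcs* R))
      split : ∀ (f : Fin n × Fin n → Fin n) → count v (List.map f (arcs i γ ++ arcs* R)) ≡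
              count v (List.map f (arcs i γ)) + count v (List.map f (arcs* R))
      split f = trans (cong (count v) (List.map-++ f (arcs i γ) (arcs* R))) (count-++ v (List.map f (arcs i γ)))
      outs : ∀ {s} (γ : Vec (Fin n) s) → count v (List.map proj₁ (arcs i γ)) ≡ s * 𝟙 (v ≟ i)
      outs []      = refl
      outs (j ∷ γ) = cong (𝟙 (v ≟ i) +_) (outs γ)
      ins : ∀ {s} (γ : Vec (Fin n) s) → List.map proj₂ (arcs i γ) ≡ Vec.toList γ
      ins []      = refl
      ins (j ∷ γ) = cong (j ∷_) (ins γ)
      rearrange : ∀ a b o g x → b + o + ((a + g) + x) ≡ g + (o + x) + (a + b)
      rearrange = solve-∀
      rearrange′ : ∀ g i b s → g + (i + b) + s ≡ g + i + (s + b)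
      rearrange′ = solve-∀

    module _ (acyclic : ¬ Cycle H) {R L E} (t : Tagged R L E) {i₀ w} (W : Walk i₀ i₀ w) (w↭ : w ↭ arcs* R) where

      rooted-uses : ∀ v e → suc r * rooted E v e ≡ inc H v e * uses E e
      rooted-uses = matrix-unique H acyclic (λ v e → suc r * rooted E v e) (λ v e → inc H v e * uses E e) off rows columns
        where
        open ≡-Reasoning
        off : ∀ v e → v ∉ edge H e → suc r * rooted E v e ≡ inc H v e * uses E e
        off v e v∉ = trans (cong (suc r *_) (total-zero (All.map zero-at (tagged-roots t)))) (trans (ℕ.*-zeroʳ (suc r))
          (cong (_* uses E e) (sym (𝟙-no (v ∈? edge H e) v∉))))
          where
          zero-at : ∀ {x} → proj₁ x ∈ edge H (proj₂ x) → 𝟙 (v ≟ proj₁ x) * 𝟙 (e ≟ proj₂ x) ≡ 0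
          zero-at {j , f} j∈f with v ≟ j | e ≟ f
          ... | yes refl | yes refl = contradiction j∈f v∉
          ... | yes _    | no _     = refl
          ... | no _     | _        = refl
        rows : ∀ v → sum (λ e → suc r * rooted E v e) ≡ sum (λ e → inc H v e * uses E e)
        rows v = begin
          sum (λ e → suc r * rooted E v e)
            ≡⟨ *-distribˡ-sum (suc r) (rooted E v) ⟨
          suc r * sum (rooted E v)
            ≡⟨ cong (suc r *_) (sum-total (λ e x → 𝟙 (v ≟ proj₁ x) * 𝟙 (e ≟ proj₂ x)) E) ⟩
          suc r * total (λ x → sum (λ e → 𝟙 (v ≟ proj₁ x) * 𝟙 (e ≟ proj₂ x))) E
            ≡⟨ cong (suc r *_) (total-cong (λ x → trans (sym (*-distribˡ-sum (𝟙 (v ≟ proj₁ x)) (λ e → 𝟙 (e ≟ proj₂ x))))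
                 (trans (cong (𝟙 (v ≟ proj₁ x) *_) (sum-δ₁ (proj₂ x))) (ℕ.*-identityʳ _))) E) ⟩
          suc r * total (λ x → 𝟙 (v ≟ proj₁ x)) E
            ≡⟨ total-* (suc r) (λ x → 𝟙 (v ≟ proj₁ x)) E ⟨
          total (λ x → suc r * 𝟙 (v ≟ proj₁ x)) E
            ≡⟨ ℕ.+-cancelˡ-≡ (count v (List.map proj₁ (arcs* R))) _ _
                 (trans (tagged-balance v t) (cong (_+ total (λ x → suc r * 𝟙 (v ≟ proj₁ x)) E) (sym balanced))) ⟨
          total (λ x → inc H v (proj₂ x)) E
            ≡⟨ total-cong (λ x → trans (sum-cong-≗ λ e → ℕ.*-comm (inc H v e) (𝟙 (e ≟ proj₂ x))) (sum-δ (proj₂ x) (inc H v))) E ⟨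
          total (λ x → sum (λ e → inc H v e * 𝟙 (e ≟ proj₂ x))) E
            ≡⟨ sum-total (λ e x → inc H v e * 𝟙 (e ≟ proj₂ x)) E ⟨
          sum (λ e → total (λ x → inc H v e * 𝟙 (e ≟ proj₂ x)) E)
            ≡⟨ sum-cong-≗ (λ e → total-* (inc H v e) (λ x → 𝟙 (e ≟ proj₂ x)) E) ⟩
          sum (λ e → inc H v e * uses E e) ∎
          where
          balanced : count v (List.map proj₁ (arcs* R)) ≡ count v (List.map proj₂ (arcs* R))
          balanced = trans (sym (count-↭ v (↭.map⁺ proj₁ w↭)))
            (trans (ℕ.+-cancelʳ-≡ (𝟙 (v ≟ i₀)) _ _ (walk-balance v W)) (count-↭ v (↭.map⁺ proj₂ w↭)))
        columns : ∀ e → sum (λ v → suc r * rooted E v e) ≡ sum (λ v → inc H v e * uses E e)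
        columns e = begin
          sum (λ v → suc r * rooted E v e)
            ≡⟨ *-distribˡ-sum (suc r) (λ v → rooted E v e) ⟨
          suc r * sum (λ v → rooted E v e)
            ≡⟨ cong (suc r *_) (trans (sum-total (λ v x → 𝟙 (v ≟ proj₁ x) * 𝟙 (e ≟ proj₂ x)) E)
                 (total-cong (λ x → sum-δ (proj₁ x) (λ _ → 𝟙 (e ≟ proj₂ x))) E)) ⟩
          suc r * uses E e
            ≡⟨ ℕ.*-comm (suc r) (uses E e) ⟩
          uses E e * suc r
            ≡⟨ cong (uses E e *_) (sum-inc H uniform e) ⟨
          uses E e * sum (λ v → inc H v e)
            ≡⟨ *-distribˡ-sum (uses E e) (λ v → inc H v e) ⟩
          sum (λ v → uses E e * inc H v e)
            ≡⟨ sum-cong-≗ (λ v → ℕ.*-comm (uses E e) (inc H v e)) ⟩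
          sum (λ v → inc H v e * uses E e) ∎

      uses≡ : ∀ {i e} → (i , e) ∈ˡ E → uses E e ≡ suc r * rooted E i e × 1 ≤ rooted E i e
      uses≡ {i} {e} x∈ = sym (trans (rooted-uses i e) (trans (cong (_* uses E e) (𝟙-yes (i ∈? edge H e) (All.lookup (tagged-roots t) x∈))) (ℕ.*-identityˡ _)))
        , subst (_≤ rooted E i e) (cong₂ _*_ (𝟙-yes (i ≟ i) refl) (𝟙-yes (e ≟ e) refl)) (term≤total x∈)

      module _ (short : List.length R < 2 * suc r) where

        length-E : List.length E < 2 * suc r
        length-E = ℕ.≤-trans (s≤s (ℕ.≤-trans (ℕ.m≤n+m _ (List.length L)) (ℕ.≤-reflexive (sym (tagged-length t))))) short

        -- `uses` is k times a positive number and at most the number of rows, which is below 2k, so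
        -- that number is 1. A second hyperedge would take k further rows for the same reason, which
        -- gives `single-edge`.
        uses-k : ∀ {i e} → (i , e) ∈ˡ E → uses E e ≡ suc r
        uses-k {i} {e} x∈ = trans (proj₁ (uses≡ x∈)) (trans (cong (suc r *_) rooted≡1) (ℕ.*-identityʳ (suc r)))
          where
          rooted≡1 : rooted E i e ≡ 1
          rooted≡1 = ℕ.≤-antisym (ℕ.≤-pred (ℕ.*-cancelˡ-< (suc r) _ 2 (ℕ.≤-trans (s≤s (ℕ.≤-trans
            (ℕ.≤-reflexive (sym (proj₁ (uses≡ x∈)))) (ℕ.≤-trans (term≤sum (uses E) e) (ℕ.≤-reflexive (sum-uses E)))))
            (ℕ.≤-trans length-E (ℕ.≤-reflexive (ℕ.*-comm 2 (suc r))))))) (proj₂ (uses≡ x∈))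

        single-edge : ∀ {i e i′ e′} → (i , e) ∈ˡ E → (i′ , e′) ∈ˡ E → e′ ≡ e
        single-edge {e = e} {e′ = e′} x∈ y∈ with e′ ≟ e
        ... | yes p = p
        ... | no ¬p = contradiction (ℕ.≤-trans (two≤sum (uses E) ¬p) (ℕ.≤-reflexive (sum-uses E)))
          (ℕ.<⇒≱ (ℕ.≤-trans length-E (ℕ.≤-reflexive (sym (trans (cong₂ _+_ (uses-k y∈) (uses-k x∈)) (cong (suc r +_) (sym (ℕ.+-identityʳ (suc r)))))))))

        roots-count : ∀ {i e} → (i , e) ∈ˡ E → ∀ v → count v (List.map proj₁ E) ≡ inc H v e
        roots-count {i} {e} x∈ v = ℕ.*-cancelˡ-≡ _ _ (suc r) (begin
          suc r * count v (List.map proj₁ E) ≡⟨ cong (suc r *_) (go E (λ y∈ → single-edge x∈ y∈)) ⟩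
          suc r * rooted E v e               ≡⟨ rooted-uses v e ⟩
          inc H v e * uses E e               ≡⟨ cong (inc H v e *_) (uses-k x∈) ⟩
          inc H v e * suc r                  ≡⟨ ℕ.*-comm (inc H v e) (suc r) ⟩
          suc r * inc H v e                  ∎)
          where
          open ≡-Reasoning
          go : ∀ E → (∀ {i′ e′} → (i′ , e′) ∈ˡ E → e′ ≡ e) → count v (List.map proj₁ E) ≡ rooted E v e
          go []            h = refl
          go ((j , f) ∷ E) h = cong₂ _+_
            (sym (trans (cong (𝟙 (v ≟ j) *_) (𝟙-yes (e ≟ f) (sym (h (here refl))))) (ℕ.*-identityʳ _)))
            (go E (λ y∈ → h (there y∈)))

        length-roots : ∀ {i e} → (i , e) ∈ˡ E → List.length E ≡ suc r
        length-roots {i} {e} x∈ = trans (sym (sum-uses E)) (trans (sum-only e (λ f f≢e → total-zero (All.tabulate λ {y} y∈ →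
          𝟙-no (f ≟ proj₂ y) (λ eq → f≢e (trans eq (single-edge x∈ y∈)))))) (uses-k x∈))

        module _ (1≤r : 1 ≤ r) where

          row-arc : ∀ {s} (γ : Vec (Fin n) s) i → 1 ≤ s → ∃ λ b → (i , b) ∈ˡ arcs i γ
          row-arc (b ∷ γ) i _ = b , here refl

          tagged-separated : ∀ u {e R L E} → u ∉ edge H e → (∀ {i′ e′} → (i′ , e′) ∈ˡ E → e′ ≡ e) → Tagged R L E →
            All (λ { (a , b) → (a ≡ u → b ≡ u) × (b ≡ u → a ≡ u) }) (arcs* R)
          tagged-separated u u∉ h [] = []
          tagged-separated u u∉ h (loop {i} refl t) = All.++⁺ (go r) (tagged-separated u u∉ h t)
            where
            go : ∀ s → All (λ { (a , b) → (a ≡ u → b ≡ u) × (b ≡ u → a ≡ u) }) (arcs i (Vec.replicate s i))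
            go zero    = []
            go (suc s) = (id , id) ∷ go s
          tagged-separated u {e} u∉ h (hyper {i} {γ} eq t) with h (here refl)
          ... | refl = All.++⁺ (All.map⁺ (All.tabulate λ {b} b∈ →
                (λ { refl → contradiction (member (here refl)) u∉ }) , (λ { refl → contradiction (member (there b∈)) u∉ })))
                (tagged-separated u u∉ (λ y∈ → h (there y∈)) t)
            where
            member : ∀ {v} → v ∈ˡ i ∷ Vec.toList γ → v ∈ edge H e
            member v∈ = subst (_ ∈_) eq (∈-indexSet⁺ i γ v∈)

          loop-arc : ∀ {u R L E} → u ∈ˡ L → Tagged R L E → ∃ λ b → (u , b) ∈ˡ arcs* R
          loop-arc (here refl) (loop {i} {γ} _ t) = let b , b∈ = row-arc γ i 1≤r in b , Mem.∈-++⁺ˡ b∈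
          loop-arc (there u∈) (loop {i} {γ} _ t) = let b , b∈ = loop-arc u∈ t in b , Mem.∈-++⁺ʳ (arcs i γ) b∈
          loop-arc u∈ (hyper {i} {γ} _ t) = let b , b∈ = loop-arc u∈ t in b , Mem.∈-++⁺ʳ (arcs i γ) b∈

          root-arc : ∀ {i e R L E} → (i , e) ∈ˡ E → Tagged R L E → ∃ λ b → (i , b) ∈ˡ arcs* R
          root-arc (here refl) (hyper {i} {γ} _ t) = let b , b∈ = row-arc γ i 1≤r in b , Mem.∈-++⁺ˡ b∈
          root-arc (there x∈) (hyper {i} {γ} _ t) = let b , b∈ = root-arc x∈ t in b , Mem.∈-++⁺ʳ (arcs i γ) b∈
          root-arc x∈ (loop {i} {γ} _ t) = let b , b∈ = root-arc x∈ t in b , Mem.∈-++⁺ʳ (arcs i γ) b∈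

          -- The arcs do not join a vertex `u` outside `e` to any other vertex. So a closed walk
          -- cannot contain both an arc of a loop at `u` and an arc that starts at a root in `e`.
          -- Both arcs exist because a row has r ≥ 1 arcs.
          loops-inside : ∀ {i e} → (i , e) ∈ˡ E → ∀ {u} → u ∈ˡ L → u ∈ edge H e
          loops-inside {i} {e} x∈ {u} u∈ with u ∈? edge H e
          ... | yes p = p
          ... | no u∉ with walk-separated u W (↭.All-resp-↭ (↭-sym w↭) (tagged-separated u u∉ (λ y∈ → single-edge x∈ y∈) t))
          ...   | inj₁ (_ , all) = contradiction
                  (subst (_∈ edge H e) (All.lookup all (↭.∈-resp-↭ (↭-sym w↭) (proj₂ (root-arc x∈ t)))) (All.lookup (tagged-roots t) x∈)) u∉
          ...   | inj₂ (_ , all) = contradiction refl (All.lookup all (↭.∈-resp-↭ (↭-sym w↭) (proj₂ (loop-arc u∈ t))))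

          loops-equal : E ≡ [] → ∀ {u} → u ∈ˡ L → u ≡ i₀
          loops-equal refl u∈ = All.lookup (walk-loops W (↭.All-resp-↭ (↭-sym w↭) (all-loops t)))
            (↭.∈-resp-↭ (↭-sym w↭) (proj₂ (loop-arc u∈ t)))
            where
            all-loops : ∀ {R L} → Tagged R L [] → All (λ { (a , b) → a ≡ b }) (arcs* R)
            all-loops [] = []
            all-loops (loop {i} refl t) = All.++⁺ (go r) (all-loops t)
              where
              go : ∀ s → All (λ { (a , b) → a ≡ b }) (arcs i (Vec.replicate s i))
              go zero    = []
              go (suc s) = refl ∷ go s

-- The moments of a hypertree

if-yes : ∀ {a p} {A : Set a} {P : Set p} {x y : A} (D : Dec P) → P → (if does D then x else y) ≡ x
if-yes D p rewrite dec-true D p = refl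

if-no : ∀ {a p} {A : Set a} {P : Set p} {x y : A} (D : Dec P) → ¬ P → (if does D then x else y) ≡ y
if-no D ¬p rewrite dec-false D ¬p = refl

module _ {n m} (H : Hypergraph n m) {r : ℕ} (1≤r : 1 ≤ r) (uniform : Uniform (suc r) H) where

  -- A loop row contains `i` k ≥ 2 times, a hyperedge row contains no vertex twice. So the diagonal
  -- part and the adjacency part of a tensor entry are never nonzero together.
  loop≢edge : ∀ i e → indexSet i (Vec.replicate r i) ≢ edge H e
  loop≢edge i e eq = contradiction (ℕ.≤-trans (s≤s 1≤r) (ℕ.≤-trans (ℕ.≤-reflexive (sym (repeated r)))
      (subst (_≤ 1) (row-count H uniform i (Vec.replicate r i) e eq i) (𝟙≤1 (i ∈? edge H e))))) λ { (s≤s ()) }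
    where
    repeated : ∀ s → count i (i ∷ Vec.toList (Vec.replicate s i)) ≡ suc s
    repeated zero    = cong (_+ 0) (𝟙-yes (i ≟ i) refl)
    repeated (suc s) = cong₂ _+_ (𝟙-yes (i ≟ i) refl) (repeated s)

  second-vertex : ∀ e i → ∃ λ v → v ∈ edge H e × v ≢ i
  second-vertex e i with Fin.any? (λ v → (v ∈? edge H e) ×-dec ¬? (v ≟ i))
  ... | yes p = p
  ... | no ¬p = contradiction (ℕ.≤-trans (s≤s 1≤r) (ℕ.≤-trans (ℕ.≤-reflexive (sym (sum-inc H uniform e)))
          (ℕ.≤-trans (sum-mono only-i) (ℕ.≤-reflexive (sum-δ₁ i))))) λ { (s≤s ()) }
    where
    only-i : ∀ v → inc H v e ≤ 𝟙 (v ≟ i)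
    only-i v with v ∈? edge H e | v ≟ i
    ... | no _  | _     = z≤n
    ... | yes _ | yes _ = s≤s z≤n
    ... | yes q | no ¬q = contradiction (v , q , ¬q) ¬p

  data Kind (i : Fin n) (γ : Vec (Fin n) r) : Set where
    loop  : γ ≡ Vec.replicate r i → Kind i γ
    hyper : ∀ e → indexSet i γ ≡ edge H e → Kind i γ
    other : γ ≢ Vec.replicate r i → (∀ e → indexSet i γ ≢ edge H e) → Kind i γ

  kind : ∀ i γ → Kind i γ
  kind i γ with Vec.≡-dec _≟_ γ (Vec.replicate r i) | Fin.any? (λ e → Vec.≡-dec Bool._≟_ (indexSet i γ) (edge H e))
  ... | yes p | _            = loop p
  ... | no _  | yes (e , eq) = hyper e eq
  ... | no ¬p | no ¬q        = other ¬p (λ e eq → ¬q (e , eq))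

  -- The two shapes of the rows whose arcs can be traversed by a closed walk.

  data Shape (d : ℕ) (L : List (Fin n)) (E : List (Fin n × Fin m)) : Set where
    loops : ∀ i → E ≡ [] → L ≡ List.replicate d i → Shape d L E
    around : ∀ e → (∀ v → count v (List.map proj₁ E) ≡ inc H v e) → (∀ {u} → u ∈ˡ L → u ∈ edge H e) →
             List.length L + suc r ≡ d → (∀ {i e′} → (i , e′) ∈ˡ E → e′ ≡ e) → Shape d L E

  shape : ¬ Cycle H → ∀ {R L E} → Tagged H R L E → ∀ {i w} → Walk i i w → w ↭ arcs* R →
          List.length R < 2 * suc r → Shape (List.length R) L E
  shape acyclic {L = L} {E = []} t {i} W w↭ short = loops i refl
    (trans (constant-list L (loops-equal H uniform acyclic t W w↭ short 1≤r refl))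
      (cong (λ c → List.replicate c i) (sym (trans (tagged-length H t) (ℕ.+-identityʳ _)))))
    where
    constant-list : ∀ L → (∀ {u} → u ∈ˡ L → u ≡ i) → L ≡ List.replicate (List.length L) i
    constant-list []      h = refl
    constant-list (u ∷ L) h = cong₂ _∷_ (h (here refl)) (constant-list L (h ∘ there))
  shape acyclic {L = L} {E = (j , e) ∷ E} t W w↭ short = around e
    (roots-count H uniform acyclic t W w↭ short (here refl))
    (loops-inside H uniform acyclic t W w↭ short 1≤r (here refl))
    (trans (cong (List.length L +_) (sym (length-roots H uniform acyclic t W w↭ short (here refl)))) (sym (tagged-length H t)))
    (single-edge H uniform acyclic t W w↭ short (here refl))

-- U runs through the multisets of d - k vertices of e, each listed once.

record LoopMultisets {n m} (H : Hypergraph n m) (k d : ℕ) : Set where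
  field
    multisets : Fin m → List (List (Fin n))
    within    : ∀ {e U} → U ∈ˡ multisets e → (∀ {u} → u ∈ˡ U → u ∈ edge H e) × List.length U + k ≡ d
    complete  : ∀ e U → (∀ {u} → u ∈ˡ U → u ∈ edge H e) → List.length U + k ≡ d →
                ∃ λ U′ → U′ ∈ˡ multisets e × U′ ↭ U
    distinct  : ∀ e → AllPairs (λ U U′ → ¬ (U ↭ U′)) (multisets e)

module Moments {c ℓ₁ ℓ₂} (K : OrderedField c ℓ₁ ℓ₂) (α : OrderedField.Carrier K)
  {n m r d} {H : Hypergraph n m} (1≤r : 1 ≤ r) (tree : IsHypertree (suc r) H)
  (1≤d : 1 ≤ d) (d<2k : d < 2 * suc r) (𝓛 : LoopMultisets H (suc r) d) where

  open FieldTheory K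
  open Functionals K {n}
  open Traces K (suc r) d n hiding (r)
  open Expansion {r} N
  open IsHypertree tree using (simple; uniform; acyclic)
  open LoopMultisets 𝓛

  T : Tensor K (suc r) n
  T = Aα K α (suc r) H

  β : Carrier
  β = (1# -ᴷ α) *ᴷ ((r !) · 1#) ⁻¹

  x : Fin n → Carrier
  x u = α *ᴷ (degree H u · 1#)

  -- E is a hyperedge or, to single out the rows consisting of loops, the empty set.

  Local : Subset n → Set
  Local E = ∀ i (γ : Vec (Fin n) r) → indexSet i γ ≡ E → ∃ λ e → E ≡ edge H e

  T-loop : ∀ i → T i (Vec.replicate r i) ≈ x i
  T-loop i = begin
    T i (Vec.replicate r i)
      ≡⟨ cong₂ (λ y z → α *ᴷ y +ᴷ (1# -ᴷ α) *ᴷ z) (if-yes (Vec.≡-dec _≟_ _ (Vec.replicate r i)) refl)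
           (if-no (Fin.any? _) (λ { (e , eq) → loop≢edge H 1≤r uniform i e eq })) ⟩
    x i +ᴷ (1# -ᴷ α) *ᴷ 0#   ≈⟨ +-congˡ (zeroʳ _) ⟩
    x i +ᴷ 0#                ≈⟨ +-identityʳ _ ⟩
    x i                      ∎

  T-edge : ∀ {i γ e} → indexSet i γ ≡ edge H e → T i γ ≈ β
  T-edge {i} {γ} {e} eq = begin
    T i γ
      ≡⟨ cong₂ (λ y z → α *ᴷ y +ᴷ (1# -ᴷ α) *ᴷ z)
           (if-no (Vec.≡-dec _≟_ γ (Vec.replicate r i)) (λ { refl → loop≢edge H 1≤r uniform i e eq }))
           (if-yes (Fin.any? _) (e , eq)) ⟩
    α *ᴷ 0# +ᴷ β   ≈⟨ +-congʳ (zeroʳ α) ⟩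
    0# +ᴷ β        ≈⟨ +-identityˡ β ⟩
    β              ∎

  T-other : ∀ {i γ} → γ ≢ Vec.replicate r i → (∀ e → indexSet i γ ≢ edge H e) → T i γ ≈ 0#
  T-other {i} {γ} ¬loop ¬edge = begin
    T i γ
      ≡⟨ cong₂ (λ y z → α *ᴷ y +ᴷ (1# -ᴷ α) *ᴷ z) (if-no (Vec.≡-dec _≟_ γ (Vec.replicate r i)) ¬loop)
           (if-no (Fin.any? _) (λ { (e , eq) → ¬edge e eq })) ⟩
    α *ᴷ 0# +ᴷ (1# -ᴷ α) *ᴷ 0#   ≈⟨ +-cong (zeroʳ _) (zeroʳ _) ⟩
    0# +ᴷ 0#                     ≈⟨ +-identityˡ 0# ⟩
    0#                           ∎

  module _ {E₀ : Subset n} (local : Local E₀) where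

    private
      T₀ : Fin n → Vec (Fin n) r → Carrier
      T₀ = localTensor β E₀

    T₀-edge : ∀ {i γ e} → indexSet i γ ≡ edge H e → edge H e ≡ E₀ → T₀ i γ ≈ β
    T₀-edge {i} {γ} {e} eq eq₀ = ≈-reflexive (trans
      (if-no (Vec.≡-dec _≟_ γ (Vec.replicate r i)) (λ { refl → loop≢edge H 1≤r uniform i e eq }))
      (if-yes (Vec.≡-dec Bool._≟_ (indexSet i γ) E₀) (trans eq eq₀)))

    T₀-other : ∀ {i γ} → γ ≢ Vec.replicate r i → (∀ e → indexSet i γ ≢ edge H e) → T₀ i γ ≈ 0#
    T₀-other {i} {γ} ¬loop ¬edge = ≈-reflexive (trans (if-no (Vec.≡-dec _≟_ γ (Vec.replicate r i)) ¬loop)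
      (if-no (Vec.≡-dec Bool._≟_ (indexSet i γ) E₀) λ eq → let e , eq₀ = local i γ eq in ¬edge e (trans eq eq₀)))

    -- A loop row at `i` has the entry `x i` in `T` and 1 in the local tensor, a hyperedge row has
    -- `β` in both. The two weights differ by the loops alone.
    weights : ∀ {R : List (Row r)} {L E} → Tagged H R L E → (∀ {i e} → (i , e) ∈ˡ E → edge H e ≡ E₀) →
              weight T R ≈ ∏ L x *ᴷ weight T₀ R
    weights [] h = ≈-sym (*-identityˡ 1#)
    weights (loop {i} {R = R} {L = L} refl t) h = ≈-trans (*-cong (T-loop i) (weights t h))
      (≈-trans (≈-sym (*-assoc _ _ _)) (*-congˡ (≈-sym (≈-trans (*-congʳ
        (≈-reflexive (if-yes (Vec.≡-dec _≟_ (Vec.replicate r i) (Vec.replicate r i)) refl))) (*-identityˡ _)))))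
    weights (hyper {i} {γ} {L = L} {e = e} eq t) h = ≈-trans (*-cong (T-edge {i} {γ} {e} eq) (weights t (h ∘ there)))
      (≈-trans (x∙yz≈y∙xz _ _ _) (*-congˡ (*-congʳ (≈-sym (T₀-edge {i} {γ} {e} eq (h (here refl)))))))
      where open import Algebra.Properties.CommutativeSemigroup *-commutativeSemigroup using (x∙yz≈y∙xz)

  tagged-or-zero : ∀ R → (∃₂ λ L E → Tagged H R L E) ⊎
    (weight T R ≈ 0# × (∀ E₀ → Local E₀ → weight (localTensor β E₀) R ≈ 0#))
  tagged-or-zero [] = inj₁ ([] , [] , [])
  tagged-or-zero ((i , γ) ∷ R) with tagged-or-zero R
  ... | inj₂ (p , q) = inj₂ (≈-trans (*-congˡ p) (zeroʳ _) , λ E₀ l → ≈-trans (*-congˡ (q E₀ l)) (zeroʳ _))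
  ... | inj₁ (L , E , t) with kind H 1≤r uniform i γ
  ...   | loop eq    = inj₁ (i ∷ L , E , loop eq t)
  ...   | hyper e eq = inj₁ (L , (i , e) ∷ E , hyper eq t)
  ...   | other ¬l ¬e = inj₂ (≈-trans (*-congʳ (T-other {i} {γ} ¬l ¬e)) (zeroˡ _) , λ E₀ l → ≈-trans (*-congʳ (T₀-other {E₀} l {i} {γ} ¬l ¬e)) (zeroˡ _))

  module _ (ds : Fin n → ℕ) (sum-ds : sum ds ≡ d) where

    private
      I : List (Fin n)
      I = blocks ds (allFin n)

    length-I : List.length I ≡ d
    length-I = trans (sym (sum-count I)) (trans (sum-cong-≗ (count-blocks ds)) sum-ds)

    shape-of : ∀ {R : List (Row r)} {L E} → List.map proj₁ R ≡ I → Tagged H R L E → ∀ {w} → w ∈ˡ closedWalks N → w ↭ arcs* R → Shape H 1≤r uniform d L E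
    shape-of {R} {L} {E} eq t w∈ w↭ = subst (λ c → Shape H 1≤r uniform c L E) length-R
      (shape H 1≤r uniform acyclic t (proj₂ (closedWalks⇒Walk N w∈)) w↭ (subst (_< 2 * suc r) (sym length-R) d<2k))
      where
      length-R : List.length R ≡ d
      length-R = trans (sym (List.length-map proj₁ R)) (trans (cong List.length eq) length-I)

    roots : ∀ {R : List (Row r)} {L E} → List.map proj₁ R ≡ I → Tagged H R L E → ∀ v → ds v ≡ count v L + count v (List.map proj₁ E)
    roots eq t v = trans (sym (count-blocks ds v)) (trans (cong (count v) (sym eq)) (tagged-count H v t))

    term-vanishes : (∀ {R : List (Row r)} {L E} → List.map proj₁ R ≡ I → Tagged H R L E → Shape H 1≤r uniform d L E → Absurd) → term T ds ≈ 0#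
    term-vanishes no-shape = ≈-trans (*-congˡ S≈0) (zeroʳ _)
      where
      S≈0 : S T I constant ≈ 0#
      S≈0 = ≈-trans (≈-sym (*-identityˡ _)) (≈-trans (S-compare T T I [] 1# 0# zero-weight) (zeroˡ _))
        where
        zero-weight : ∀ R → List.map proj₁ R ≡ I → ∀ {w} → w ∈ˡ closedWalks N → w ↭ arcs* R → 1# *ᴷ weight T R ≈ 0# *ᴷ weight T R
        zero-weight R eq w∈ w↭ with tagged-or-zero R
        ... | inj₁ (L , E , t) = ⊥-elim (no-shape eq t (shape-of eq t w∈ w↭))
        ... | inj₂ (p , _) = ≈-trans (*-identityˡ _) (≈-trans p (≈-sym (zeroˡ _)))

    -- With the exponents fixed, all surviving lists of rows have the same loops up to order. The
    -- factor between the two weights is then the same for all of them, and `S-compare` takes it out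
    -- of the whole sum.
    term-factors : ∀ {E₀ U} → Local E₀ → (∀ v → ds v ≡ multiplicity E₀ U v) →
      (∀ {R : List (Row r)} {L E} → List.map proj₁ R ≡ I → Tagged H R L E → Shape H 1≤r uniform d L E →
        L ↭ U × (∀ {i e} → (i , e) ∈ˡ E → edge H e ≡ E₀)) →
      term T ds ≈ ∏ U x *ᴷ term (localTensor β E₀) ds
    term-factors {E₀} {U} local _ recognise = ≈-trans (*-congˡ S≈) (x∙yz≈y∙xz _ _ _)
      where
      open import Algebra.Properties.CommutativeSemigroup *-commutativeSemigroup using (x∙yz≈y∙xz)
      S≈ : S T I constant ≈ ∏ U x *ᴷ S (localTensor β E₀) I constant
      S≈ = ≈-trans (≈-sym (*-identityˡ _)) (S-compare T (localTensor β E₀) I [] 1# (∏ U x) weight≈)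
        where
        weight≈ : ∀ R → List.map proj₁ R ≡ I → ∀ {w} → w ∈ˡ closedWalks N → w ↭ arcs* R →
                  1# *ᴷ weight T R ≈ ∏ U x *ᴷ weight (localTensor β E₀) R
        weight≈ R eq w∈ w↭ with tagged-or-zero R
        ... | inj₂ (p , q) = ≈-trans (*-identityˡ _) (≈-trans p (≈-sym (≈-trans (*-congˡ (q E₀ local)) (zeroʳ _))))
        ... | inj₁ (L , E , t) with recognise eq t (shape-of eq t w∈ w↭)
        ...   | L↭U , edges = ≈-trans (*-identityˡ _) (≈-trans (weights local t edges) (*-congʳ (∏-↭ L↭U)))

  term-cong : ∀ T {ds ds′ : Fin n → ℕ} → (∀ i → ds i ≡ ds′ i) → term T ds ≈ term T ds′
  term-cong T {ds} {ds′} h = *-cong (∏-cong (allFin n) (λ i → ≈-reflexive (cong invFactorial (h i))))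
    (≈-reflexive (cong (λ I → S T I constant) (List.concatMap-cong (λ i → cong (λ c → List.replicate c i) (h i)) (allFin n))))

  ⊥-local : Local ⊥
  ⊥-local i γ eq = contradiction (subst (i ∈_) eq (∈-indexSet⁺ i γ (here refl))) ∉⊥

  multiplicity-⊥ : ∀ U v → multiplicity ⊥ U v ≡ count v U
  multiplicity-⊥ U v = cong (_+ count v U) (𝟙-no (v ∈? ⊥ {n}) ∉⊥)

  sum-multiplicity : ∀ E U → sum (multiplicity E U) ≡ ∣ E ∣ + List.length U
  sum-multiplicity E U = trans (∑-distrib-+ (λ i → 𝟙 (i ∈? E)) (λ i → count i U)) (cong₂ _+_ (sym ∣ E ∣≡sum) (sum-count U))

  support : ∀ {e U} → (∀ {u} → u ∈ˡ U → u ∈ edge H e) → ∀ v → 1 ≤ multiplicity (edge H e) U v → v ∈ edge H e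
  support {e} {U} U⊆e v le with v ∈? edge H e
  ... | yes p = p
  ... | no _  = U⊆e (count-∈ le)

  support⁺ : ∀ {e U v} → v ∈ edge H e → 1 ≤ multiplicity (edge H e) U v
  support⁺ {e} {U} {v} p = subst (λ z → 1 ≤ z + count v U) (sym (𝟙-yes (v ∈? edge H e) p)) (s≤s z≤n)

  -- Loops are placed at vertices of the hyperedge, so the hyperedge is the support of its exponent
  -- vector.
  same-edge : ∀ {e U e′ U′} → (∀ {u} → u ∈ˡ U → u ∈ edge H e) → (∀ {u} → u ∈ˡ U′ → u ∈ edge H e′) →
    (∀ v → multiplicity (edge H e) U v ≡ multiplicity (edge H e′) U′ v) → edge H e ≡ edge H e′
  same-edge {U = U} {U′ = U′} s s′ h = subset-ext
    (λ v v∈ → support s′ v (subst (1 ≤_) (h v) (support⁺ {U = U} v∈)))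
    (λ v v∈ → support s v (subst (1 ≤_) (sym (h v)) (support⁺ {U = U′} v∈)))

  loops≢around : ∀ {i e U} → ¬ (∀ v → count v (List.replicate d i) ≡ multiplicity (edge H e) U v)
  loops≢around {i} {e} {U} h = let v , v∈ , v≢i = second-vertex H 1≤r uniform e i in
    contradiction (subst (1 ≤_) (trans (sym (h v)) (trans (count-replicate v i d) (cong (_* d) (𝟙-no (v ≟ i) v≢i)))) (support⁺ {U = U} v∈)) λ ()

  loops-injective : ∀ {i j : Fin n} → (∀ v → count v (List.replicate d i) ≡ count v (List.replicate d j)) → i ≡ j
  loops-injective {i} {j} h with i ≟ j
  ... | yes p = p
  ... | no ¬p = contradiction (subst (1 ≤_) (trans (sym (trans (cong (_* d) (𝟙-yes (i ≟ i) refl)) (ℕ.*-identityˡ d)))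
      (trans (sym (count-replicate i i d)) (trans (h i) (trans (count-replicate i j d) (cong (_* d) (𝟙-no (i ≟ j) ¬p)))))) 1≤d) λ ()

  term-loops : ∀ i → term T (multiplicity ⊥ (List.replicate d i)) ≈ ∏ (List.replicate d i) x *ᴷ Φ β ⊥ (List.replicate d i)
  term-loops i = term-factors (multiplicity ⊥ U) (trans (sum-multiplicity ⊥ U) (cong₂ _+_ (∣⊥∣≡0 n) (List.length-replicate d)))
    {⊥} {U} ⊥-local (λ _ → refl) recognise
    where
    U = List.replicate d i
    recognise : ∀ {R : List (Row r)} {L E} → List.map proj₁ R ≡ blocks (multiplicity ⊥ U) (allFin n) → Tagged H R L E → Shape H 1≤r uniform d L E →
        L ↭ U × (∀ {j e} → (j , e) ∈ˡ E → edge H e ≡ ⊥)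
    recognise {R} {L} {E} eq t (loops j refl refl) = count⇒↭ L U (λ v → trans (sym (ℕ.+-identityʳ _))
      (trans (sym (roots (multiplicity ⊥ U) (trans (sum-multiplicity ⊥ U) (cong₂ _+_ (∣⊥∣≡0 n) (List.length-replicate d))) eq t v)) (multiplicity-⊥ U v))) , λ ()
    recognise {R} {L} {E} eq t (around e rc L⊆e _ _) = ⊥-elim (loops≢around {i} {e} {L} λ v → trans (sym (multiplicity-⊥ U v))
      (trans (roots (multiplicity ⊥ U) (trans (sum-multiplicity ⊥ U) (cong₂ _+_ (∣⊥∣≡0 n) (List.length-replicate d))) eq t v)
        (trans (ℕ.+-comm (count v L) _) (cong (_+ count v L) (rc v)))))

  term-around : ∀ e U → (∀ {u} → u ∈ˡ U → u ∈ edge H e) → List.length U + suc r ≡ d →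
    term T (multiplicity (edge H e) U) ≈ ∏ U x *ᴷ Φ β (edge H e) U
  term-around e U U⊆e len = term-factors (multiplicity (edge H e) U) sum≡ {edge H e} {U} (λ _ _ _ → e , refl) (λ _ → refl) recognise
    where
    sum≡ : sum (multiplicity (edge H e) U) ≡ d
    sum≡ = trans (sum-multiplicity (edge H e) U) (trans (cong (_+ List.length U) (uniform e)) (trans (ℕ.+-comm (suc r) _) len))
    recognise : ∀ {R : List (Row r)} {L E} → List.map proj₁ R ≡ blocks (multiplicity (edge H e) U) (allFin n) → Tagged H R L E → Shape H 1≤r uniform d L E →
        L ↭ U × (∀ {j e′} → (j , e′) ∈ˡ E → edge H e′ ≡ edge H e)
    recognise {R} {L} eq t (loops j refl refl) = ⊥-elim (loops≢around {j} {e} {U} λ v →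
      trans (sym (ℕ.+-identityʳ _)) (sym (roots (multiplicity (edge H e) U) sum≡ eq t v)))
    recognise {R} {L} eq t (around e′ rc L⊆e′ _ single) = count⇒↭ L U counts , λ y∈ → trans (cong (edge H) (single y∈)) e′≡e
      where
      mult≡ : ∀ v → multiplicity (edge H e′) L v ≡ multiplicity (edge H e) U v
      mult≡ v = trans (cong (_+ count v L) (sym (rc v))) (trans (ℕ.+-comm _ (count v L)) (sym (roots (multiplicity (edge H e) U) sum≡ eq t v)))
      e′≡e : edge H e′ ≡ edge H e
      e′≡e = same-edge L⊆e′ U⊆e mult≡
      counts : ∀ v → count v L ≡ count v U
      counts v = ℕ.+-cancelˡ-≡ (𝟙 (v ∈? edge H e′)) _ _ (trans (mult≡ v) (cong (λ E → 𝟙 (v ∈? E) + count v U) (sym e′≡e)))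

  vector : Subset n → List (Fin n) → Vec ℕ n
  vector E U = Vec.tabulate (multiplicity E U)

  vector-injective : ∀ {E U E′ U′} → vector E U ≡ vector E′ U′ → ∀ v → multiplicity E U v ≡ multiplicity E′ U′ v
  vector-injective {E} {U} {E′} {U′} eq v = trans (sym (Vec.lookup∘tabulate (multiplicity E U) v))
    (trans (cong (λ ds → Vec.lookup ds v) eq) (Vec.lookup∘tabulate (multiplicity E′ U′) v))

  -- The exponent vectors of the two shapes. They are pairwise distinct, so every choice of vertex,
  -- or of hyperedge and loops, owns one term of the trace; all other terms vanish by `other-term`.
  targetsᴸ targetsᴱ targets : List (Vec ℕ n)
  targetsᴸ = List.map (λ i → vector ⊥ (List.replicate d i)) (allFin n)
  targetsᴱ = concatMap (λ e → List.map (vector (edge H e)) (multisets e)) (allFin m)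
  targets  = targetsᴸ ++ targetsᴱ

  targets-unique : Unique targets
  targets-unique = Unique.++⁺ loops! around! (λ { (p , q) → disjoint p q })
    where
    loops! : Unique targetsᴸ
    loops! = Unique.map⁺ {f = λ i → vector ⊥ (List.replicate d i)} (λ {i} {j} eq → loops-injective λ v →
      trans (sym (multiplicity-⊥ (List.replicate d i) v)) (trans (vector-injective {⊥} {List.replicate d i} {⊥} {List.replicate d j} eq v) (multiplicity-⊥ (List.replicate d j) v))) (Unique.allFin⁺ n)
    around! : Unique targetsᴱ
    around! = Unique.concat⁺
      (All.map⁺ (All.tabulate λ {e} _ → AllPairs.map⁺ (AllPairs.map (λ {U} {U′} ¬↭ eq → ¬↭ (count⇒↭ U U′ λ v →
        ℕ.+-cancelˡ-≡ (𝟙 (v ∈? edge H e)) _ _ (vector-injective {edge H e} {U} {edge H e} {U′} eq v))) (distinct e))))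
      (AllPairs.map⁺ (AllPairs.map apart (Unique.allFin⁺ m)))
      where
      apart : ∀ {e e′} → e ≢ e′ → ∀ {ds} → ¬ (ds ∈ˡ List.map (vector (edge H e)) (multisets e) × ds ∈ˡ List.map (vector (edge H e′)) (multisets e′))
      apart {e} {e′} e≢ (p , q) with Mem.∈-map⁻ _ p | Mem.∈-map⁻ _ q
      ... | U , U∈ , refl | U′ , U′∈ , eq = e≢ (simple (same-edge (proj₁ (within U∈)) (proj₁ (within U′∈))
        (vector-injective {edge H e} {U} {edge H e′} {U′} eq)))
    disjoint : ∀ {ds} → ds ∈ˡ targetsᴸ → ds ∉ˡ targetsᴱ
    disjoint p q with Mem.∈-map⁻ _ p | Any.satisfied (Mem.∈-concatMap⁻ _ {xs = allFin m} q)
    ... | i , _ , refl | e , q′ with Mem.∈-map⁻ _ q′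
    ...   | U , _ , eq = loops≢around {i} {e} {U} λ v → trans (sym (multiplicity-⊥ (List.replicate d i) v))
              (vector-injective {⊥} {List.replicate d i} {edge H e} {U} eq v)

  targets⊆compositions : ∀ {ds} → ds ∈ˡ targets → ds ∈ˡ compositions n d
  targets⊆compositions ds∈ with Mem.∈-++⁻ targetsᴸ ds∈
  ... | inj₁ p with Mem.∈-map⁻ _ p
  ...   | i , _ , refl = ∈-compositions _ (trans (sum-cong-≗ (Vec.lookup∘tabulate (multiplicity ⊥ (List.replicate d i))))
          (trans (sum-multiplicity ⊥ (List.replicate d i)) (cong₂ _+_ (∣⊥∣≡0 n) (List.length-replicate d))))
  targets⊆compositions ds∈ | inj₂ q with Any.satisfied (Mem.∈-concatMap⁻ _ {xs = allFin m} q)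
  ... | e , q′ with Mem.∈-map⁻ _ q′
  ...   | U , U∈ , refl = ∈-compositions _ (trans (sum-cong-≗ (Vec.lookup∘tabulate (multiplicity (edge H e) U)))
          (trans (sum-multiplicity (edge H e) U) (trans (cong (_+ List.length U) (uniform e)) (trans (ℕ.+-comm (suc r) _) (proj₂ (within U∈))))))

  module _ (ds : Vec ℕ n) (sum-ds : sum (Vec.lookup ds) ≡ d) (ds∉ : ds ∉ˡ targets) where

    extensional : ∀ {E U} → (∀ v → Vec.lookup ds v ≡ multiplicity E U v) → ds ≡ vector E U
    extensional h = trans (sym (Vec.tabulate∘lookup ds)) (Vec.tabulate-cong h)

    other-term : term T (Vec.lookup ds) ≈ 0#
    other-term = term-vanishes (Vec.lookup ds) sum-ds absurd
      where
      absurd : ∀ {R : List (Row r)} {L E} → List.map proj₁ R ≡ blocks (Vec.lookup ds) (allFin n) → Tagged H R L E → Shape H 1≤r uniform d L E → Absurd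
      absurd eq t (loops i refl refl) = ds∉ (Mem.∈-++⁺ˡ (subst (_∈ˡ targetsᴸ)
        (sym (extensional {⊥} {List.replicate d i} λ v → trans (roots (Vec.lookup ds) sum-ds eq t v) (trans (ℕ.+-identityʳ _) (sym (multiplicity-⊥ (List.replicate d i) v)))))
        (Mem.∈-map⁺ _ (Mem.∈-allFin i))))
      absurd {L = L} eq t (around e rc L⊆e len _) with complete e L L⊆e len
      ... | U , U∈ , U↭L = ds∉ (Mem.∈-++⁺ʳ targetsᴸ (subst (_∈ˡ targetsᴱ)
        (sym (extensional {edge H e} {U} λ v → trans (roots (Vec.lookup ds) sum-ds eq t v) (trans (ℕ.+-comm (count v L) _)
          (cong₂ _+_ (rc v) (sym (count-↭ v U↭L))))))
        (Mem.∈-concatMap⁺ _ (lose (Mem.∈-allFin e) (Mem.∈-map⁺ (vector (edge H e)) U∈)))))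

  compositions-sum : ∀ n d {ds} → ds ∈ˡ compositions n d → sum (Vec.lookup ds) ≡ d
  compositions-sum zero    zero    (here refl) = refl
  compositions-sum (suc n) d ds∈ with Mem.∈-concatMap⁻ _ {xs = upTo (suc d)} ds∈
  ... | p with find p
  ...   | a , a∈ , q with Mem.∈-map⁻ (a ∷_) q
  ...     | ds , ds∈′ , refl = trans (cong (a +_) (compositions-sum n (d ∸ a) ds∈′)) (ℕ.m+[n∸m]≡n (ℕ.≤-pred (Mem.∈-upTo⁻ a∈)))

  moment-formula : ∑ (compositions n d) (term T ∘ Vec.lookup) ≈
    ∑ (allFin n) (λ i → ∏ (List.replicate d i) x *ᴷ Φ β ⊥ (List.replicate d i)) +ᴷ
    ∑ (allFin m) (λ e → ∑ (multisets e) (λ U → ∏ U x *ᴷ Φ β (edge H e) U))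
  moment-formula with unique-extract targets (compositions-unique n d) targets-unique targets⊆compositions
  ... | zs , p , disjoint = begin
    ∑ (compositions n d) f                 ≈⟨ ∑-↭ p ⟩
    ∑ (targets ++ zs) f                    ≈⟨ ∑-++ targets ⟩
    ∑ targets f +ᴷ ∑ zs f                  ≈⟨ +-congˡ (∑-zero zs (λ ds ds∈ → other-term ds
                                                (compositions-sum n d (↭.∈-resp-↭ (↭-sym p) (Mem.∈-++⁺ʳ targets ds∈))) (disjoint ds∈))) ⟩
    ∑ targets f +ᴷ 0#                      ≈⟨ +-identityʳ _ ⟩
    ∑ targets f                            ≈⟨ ∑-++ targetsᴸ ⟩
    ∑ targetsᴸ f +ᴷ ∑ targetsᴱ f           ≈⟨ +-cong loops-part around-part ⟩
    _                                      ∎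
    where
    f : Vec ℕ n → Carrier
    f = term T ∘ Vec.lookup
    loops-part : ∑ targetsᴸ f ≈ ∑ (allFin n) (λ i → ∏ (List.replicate d i) x *ᴷ Φ β ⊥ (List.replicate d i))
    loops-part = ≈-trans (≈-reflexive (∑-map _ (allFin n))) (∑-cong (allFin n) λ i →
      ≈-trans (term-cong T {ds′ = multiplicity ⊥ (List.replicate d i)} (Vec.lookup∘tabulate (multiplicity ⊥ (List.replicate d i)))) (term-loops i))
    around-part : ∑ targetsᴱ f ≈ ∑ (allFin m) (λ e → ∑ (multisets e) (λ U → ∏ U x *ᴷ Φ β (edge H e) U))
    around-part = ≈-trans (∑-concatMap _ (allFin m)) (∑-cong (allFin m) λ e →
      ≈-trans (≈-reflexive (∑-map _ (multisets e))) (∑-cong-∈ (multisets e) λ U U∈ →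
        ≈-trans (term-cong T {ds′ = multiplicity (edge H e) U} (Vec.lookup∘tabulate (multiplicity (edge H e) U))) (term-around e U (proj₁ (within U∈)) (proj₂ (within U∈)))))

-- Isomorphisms from matching incidence counts

-- `zero` is matched with some `j` of the same label. Deleting both keeps the fibres of the two
-- labellings equal in size, and `Perm.insert` adds the matched pair to the permutation of the rest.
label-permutation : ∀ {n} {A : Set} (_≟ᴬ_ : (a b : A) → Dec (a ≡ b)) (f g : Fin n → A) →
  (∀ a → sum (λ i → 𝟙 (f i ≟ᴬ a)) ≡ sum (λ i → 𝟙 (g i ≟ᴬ a))) →
  ∃ λ (π : Permutation n n) → ∀ i → g (π ⟨$⟩ʳ i) ≡ f i
label-permutation {zero}  _≟ᴬ_ f g h = Perm.id , λ ()
label-permutation {suc n} _≟ᴬ_ f g h = extend (sum-pos (λ i → 𝟙 (g i ≟ᴬ f zero))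
  (subst (1 ≤_) (h (f zero)) (subst (λ z → 1 ≤ z + sum (λ i → 𝟙 (f (suc i) ≟ᴬ f zero))) (sym (𝟙-yes (f zero ≟ᴬ f zero) refl)) (s≤s z≤n))))
  where
  extend : (∃ λ j → 1 ≤ 𝟙 (g j ≟ᴬ f zero)) → ∃ λ (π : Permutation (suc n) (suc n)) → ∀ i → g (π ⟨$⟩ʳ i) ≡ f i
  extend (j , 1≤) with label-permutation _≟ᴬ_ (f ∘ suc) (g ∘ punchIn j) h′
    where
    gj≡ : g j ≡ f zero
    gj≡ = 𝟙-pos (g j ≟ᴬ f zero) 1≤
    h′ : ∀ a → sum (λ i → 𝟙 (f (suc i) ≟ᴬ a)) ≡ sum (λ i → 𝟙 (g (punchIn j i) ≟ᴬ a))
    h′ a = ℕ.+-cancelˡ-≡ (𝟙 (f zero ≟ᴬ a)) _ _ (trans (h a)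
      (trans (sum-remove {i = j} (λ i → 𝟙 (g i ≟ᴬ a))) (cong (λ z → 𝟙 (z ≟ᴬ a) + sum (λ i → 𝟙 (g (punchIn j i) ≟ᴬ a))) gj≡)))
  ... | π , πh = Perm.insert zero j π , λ
    { zero    → 𝟙-pos (g j ≟ᴬ f zero) 1≤
    ; (suc i) → trans (cong g (Perm.insert-punchIn zero j π i)) (πh i) }

module Labels {n m s} (G : Hypergraph n m) (V : Fin s → Fin n) (V-injective : Injective _≡_ _≡_ V)
  (private-degree : ∀ v → (∀ j → V j ≢ v) → deg G v ≡ 1) where

  -- A vertex outside `V` lies in exactly one hyperedge, and this is its label. Incidence thus
  -- depends on the label alone, and every bijection that respects labels respects incidences.
  data Label (v : Fin n) : Fin s ⊎ Fin m → Set where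
    at-center : ∀ j → V j ≡ v → Label v (inj₁ j)
    in-edge : ∀ e → v ∈ edge G e → (∀ e′ → v ∈ edge G e′ → e′ ≡ e) → (∀ j → V j ≢ v) → Label v (inj₂ e)

  label : ∀ v → ∃ (Label v)
  label v with Fin.any? (λ j → V j ≟ v)
  ... | yes (j , eq) = inj₁ j , at-center j eq
  ... | no ¬p with sum-pos (inc G v) (ℕ.≤-reflexive (sym (private-degree v (λ j eq → ¬p (j , eq)))))
  ...   | e , 1≤ = inj₂ e , in-edge e v∈e unique (λ j eq → ¬p (j , eq))
    where
    v∈e : v ∈ edge G e
    v∈e = 𝟙-pos (v ∈? edge G e) 1≤
    unique : ∀ e′ → v ∈ edge G e′ → e′ ≡ e
    unique e′ v∈e′ with e′ ≟ e
    ... | yes p = p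
    ... | no e′≢e = contradiction (ℕ.≤-trans (ℕ.≤-reflexive (sym (cong₂ _+_ (𝟙-yes (v ∈? edge G e′) v∈e′) (𝟙-yes (v ∈? edge G e) v∈e))))
            (ℕ.≤-trans (two≤sum (inc G v) e′≢e) (ℕ.≤-reflexive (private-degree v (λ j eq → ¬p (j , eq)))))) λ { (s≤s ()) }

  lab : Fin n → Fin s ⊎ Fin m
  lab v = proj₁ (label v)

  infix 4 _≟ˡ_
  _≟ˡ_ : (a b : Fin s ⊎ Fin m) → Dec (a ≡ b)
  _≟ˡ_ = Sum.≡-dec _≟_ _≟_

  lab-V : ∀ j → lab (V j) ≡ inj₁ j
  lab-V j with label (V j)
  ... | inj₁ i , at-center i eq = cong inj₁ (V-injective eq)
  ... | inj₂ e , in-edge e _ _ none = contradiction refl (none j)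

  count-at-center : ∀ j → sum (λ v → 𝟙 (lab v ≟ˡ inj₁ j)) ≡ 1
  count-at-center j = trans (sum-cong-≗ λ v → 𝟙-cong (lab v ≟ˡ inj₁ j) (v ≟ V j) (to v) (λ { refl → lab-V j })) (sum-δ₁ (V j))
    where
    to : ∀ v → lab v ≡ inj₁ j → v ≡ V j
    to v with label v
    ... | inj₁ i , at-center i eq = λ { refl → sym eq }
    ... | inj₂ e , _ = λ ()

  count-private : ∀ e → ∣ edge G e ∣ ≡ sum (λ v → 𝟙 (lab v ≟ˡ inj₂ e)) + sum (λ j → inc G (V j) e)
  count-private e = begin
    ∣ edge G e ∣                     ≡⟨ ∣ edge G e ∣≡sum ⟩
    sum (λ v → inc G v e)            ≡⟨ sum-cong-≗ pointwise ⟩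
    sum (λ v → 𝟙 (lab v ≟ˡ inj₂ e) + sum (λ j → inc G (V j) e * 𝟙 (lab v ≟ˡ inj₁ j)))
      ≡⟨ ∑-distrib-+ (λ v → 𝟙 (lab v ≟ˡ inj₂ e)) _ ⟩
    A + sum (λ v → sum (λ j → inc G (V j) e * 𝟙 (lab v ≟ˡ inj₁ j)))
      ≡⟨ cong (A +_) (∑-comm (λ v j → inc G (V j) e * 𝟙 (lab v ≟ˡ inj₁ j))) ⟩
    A + sum (λ j → sum (λ v → inc G (V j) e * 𝟙 (lab v ≟ˡ inj₁ j)))
      ≡⟨ cong (A +_) (sum-cong-≗ λ j → trans (sym (*-distribˡ-sum (inc G (V j) e) (λ v → 𝟙 (lab v ≟ˡ inj₁ j))))
           (trans (cong (inc G (V j) e *_) (count-at-center j)) (ℕ.*-identityʳ _))) ⟩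
    A + sum (λ j → inc G (V j) e)    ∎
    where
    open ≡-Reasoning
    A = sum (λ v → 𝟙 (lab v ≟ˡ inj₂ e))
    pointwise : ∀ v → inc G v e ≡ 𝟙 (lab v ≟ˡ inj₂ e) + sum (λ j → inc G (V j) e * 𝟙 (lab v ≟ˡ inj₁ j))
    pointwise v with label v
    ... | inj₁ i , at-center i refl = sym (cong₂ _+_ (𝟙-no (inj₁ i ≟ˡ inj₂ e) λ ()) (trans (sum-cong-≗ λ j →
            trans (ℕ.*-comm (inc G (V j) e) _) (cong (_* inc G (V j) e) (𝟙-cong (inj₁ i ≟ˡ inj₁ j) (j ≟ i) (λ { refl → refl }) (λ { refl → refl }))))
            (sum-δ i (λ j → inc G (V j) e))))
    ... | inj₂ f , in-edge f v∈f unique _ = trans (𝟙-cong (v ∈? edge G e) (inj₂ f ≟ˡ inj₂ e) (λ v∈e → cong inj₂ (sym (unique e v∈e))) (λ { refl → v∈f }))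
            (sym (trans (cong (𝟙 (inj₂ f ≟ˡ inj₂ e) +_) (sum-zero λ j → trans (cong (inc G (V j) e *_) (𝟙-no (inj₂ f ≟ˡ inj₁ j) λ ())) (ℕ.*-zeroʳ (inc G (V j) e)))) (ℕ.+-identityʳ _)))

-- A hypergraph is determined up to the vertices of degree one by its edge sizes and the
-- incidences of the remaining vertices V.

module Skeleton {n m s} (G H : Hypergraph n m) (sizes : ∀ e → ∣ edge G e ∣ ≡ ∣ edge H e ∣)
  (V W : Fin s → Fin n) (V-injective : Injective _≡_ _≡_ V) (W-injective : Injective _≡_ _≡_ W)
  (V⇒W : ∀ j e → V j ∈ edge G e → W j ∈ edge H e) (W⇒V : ∀ j e → W j ∈ edge H e → V j ∈ edge G e)
  (V-private : ∀ v → (∀ j → V j ≢ v) → deg G v ≡ 1) (W-private : ∀ v → (∀ j → W j ≢ v) → deg H v ≡ 1) where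

  private
    module LG = Labels G V V-injective V-private
    module LH = Labels H W W-injective W-private

  matching : ∃ λ (π : Permutation n n) → ∀ v → LH.lab (π ⟨$⟩ʳ v) ≡ LG.lab v
  matching = label-permutation LG._≟ˡ_ LG.lab LH.lab λ
    { (inj₁ j) → trans (LG.count-at-center j) (sym (LH.count-at-center j))
    ; (inj₂ e) → ℕ.+-cancelʳ-≡ (sum (λ j → inc G (V j) e)) _ _ (trans (sym (LG.count-private e)) (trans (sizes e)
        (trans (LH.count-private e) (cong (sum (λ v → 𝟙 (LH.lab v LH.≟ˡ inj₂ e)) +_)
          (sum-cong-≗ λ j → 𝟙-cong (W j ∈? edge H e) (V j ∈? edge G e) (W⇒V j e) (V⇒W j e)))))) }

  π : Permutation n n
  π = proj₁ matching

  π-V : ∀ j → π ⟨$⟩ʳ V j ≡ W j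
  π-V j with LH.label (π ⟨$⟩ʳ V j) | trans (proj₂ matching (V j)) (LG.lab-V j)
  ... | inj₁ i , LH.at-center i eq | refl = sym eq

  π-incidence : ∀ v e → v ∈ edge G e ⇔ π ⟨$⟩ʳ v ∈ edge H e
  π-incidence v e with LG.label v | LH.label (π ⟨$⟩ʳ v) | proj₂ matching v
  ... | inj₁ j , LG.at-center j refl | inj₁ j , LH.at-center j eq | refl =
    mk⇔ (λ v∈ → subst (_∈ edge H e) eq (V⇒W j e v∈)) (λ πv∈ → W⇒V j e (subst (_∈ edge H e) (sym eq) πv∈))
  ... | inj₂ f , LG.in-edge f v∈f u _ | inj₂ f , LH.in-edge f πv∈f u′ _ | refl =
    mk⇔ (λ v∈ → subst (λ z → π ⟨$⟩ʳ v ∈ edge H z) (sym (u e v∈)) πv∈f) (λ πv∈ → subst (λ z → v ∈ edge G z) (sym (u′ e πv∈)) v∈f)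

  isomorphism : G ≅ H
  isomorphism = record { vertices = π ; edges = Perm.id ; incidence = π-incidence }

-- The hyperedges E and ∁ E turn a permutation carrying E to E′ into an isomorphism.

module _ {n s} (E E′ : Subset n) (sizes : ∣ E ∣ ≡ ∣ E′ ∣) (V W : Fin s → Fin n)
  (V-injective : Injective _≡_ _≡_ V) (W-injective : Injective _≡_ _≡_ W)
  (V⇒W : ∀ j → V j ∈ E → W j ∈ E′) (W⇒V : ∀ j → W j ∈ E′ → V j ∈ E) where

  bipartition : Subset n → Hypergraph n 2
  bipartition E = hypergraph λ { zero → E ; (suc zero) → ∁ E }

  bipartition-degree : ∀ E v → deg (bipartition E) v ≡ 1
  bipartition-degree E v with v ∈? E
  ... | yes v∈ = cong₂ (λ y z → y + (z + 0)) (𝟙-yes (yes v∈) v∈) (𝟙-no (v ∈? ∁ E) (x∈p⇒x∉∁p v∈))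
  ... | no v∉  = cong (_+ 0) (𝟙-yes (v ∈? ∁ E) (x∉p⇒x∈∁p v∉))

  carry : ∃ λ (π : Permutation n n) → (∀ j → π ⟨$⟩ʳ V j ≡ W j) ×
          (∀ v → v ∈ E → π ⟨$⟩ʳ v ∈ E′) × (∀ v → π ⟨$⟩ʳ v ∈ E′ → v ∈ E)
  carry = S.π , S.π-V , (λ v → Equivalence.to (S.π-incidence v zero)) , (λ v → Equivalence.from (S.π-incidence v zero))
    where
    sizes₂ : ∀ e → ∣ edge (bipartition E) e ∣ ≡ ∣ edge (bipartition E′) e ∣
    sizes₂ zero       = sizes
    sizes₂ (suc zero) = trans (∣∁p∣≡n∸∣p∣ E) (trans (cong (n ∸_) sizes) (sym (∣∁p∣≡n∸∣p∣ E′)))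
    forth : ∀ j e → V j ∈ edge (bipartition E) e → W j ∈ edge (bipartition E′) e
    forth j zero           = V⇒W j
    forth j (suc zero) Vj∈ = x∉p⇒x∈∁p λ Wj∈ → x∈∁p⇒x∉p Vj∈ (W⇒V j Wj∈)
    back : ∀ j e → W j ∈ edge (bipartition E′) e → V j ∈ edge (bipartition E) e
    back j zero           = W⇒V j
    back j (suc zero) Wj∈ = x∉p⇒x∈∁p λ Vj∈ → x∈∁p⇒x∉p Wj∈ (V⇒W j Vj∈)
    module S = Skeleton (bipartition E) (bipartition E′) sizes₂ V W V-injective W-injective forth back
      (λ v _ → bipartition-degree E v) (λ v _ → bipartition-degree E′ v)

-- Values of the local coefficients

elements : ∀ {n} → Subset n → List (Fin n)
elements E = List.filter (_∈? E) (allFin _)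

elements-unique : ∀ {n} (E : Subset n) → Unique (elements E)
elements-unique E = Unique.filter⁺ (_∈? E) (Unique.allFin⁺ _)

∈-elements⁺ : ∀ {n} {E : Subset n} {v} → v ∈ E → v ∈ˡ elements E
∈-elements⁺ {E = E} v∈ = Mem.∈-filter⁺ (_∈? E) (Mem.∈-allFin _) v∈

∈-elements⁻ : ∀ {n} {E : Subset n} {v} → v ∈ˡ elements E → v ∈ E
∈-elements⁻ {E = E} v∈ = proj₂ (Mem.∈-filter⁻ (_∈? E) {xs = allFin _} v∈)

count-unique : ∀ {n} {L : List (Fin n)} → Unique L → ∀ {v} → v ∈ˡ L → count v L ≡ 1
count-unique {L = u ∷ L} (u∉ ∷ L!) {v} (here refl) =
  cong₂ _+_ (𝟙-yes (v ≟ v) refl) (count-∉ (λ v∈ → All.lookup u∉ v∈ refl))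
count-unique {L = u ∷ L} (u∉ ∷ L!) {v} (there v∈) =
  cong₂ _+_ (𝟙-no (v ≟ u) (λ { refl → All.lookup u∉ v∈ refl })) (count-unique L! v∈)

count-elements : ∀ {n} (E : Subset n) v → count v (elements E) ≡ 𝟙 (v ∈? E)
count-elements E v with v ∈? E
... | yes p = count-unique (elements-unique E) (∈-elements⁺ p)
... | no ¬p = count-∉ (¬p ∘ ∈-elements⁻)

length-elements : ∀ {n} (E : Subset n) → List.length (elements E) ≡ ∣ E ∣
length-elements E = trans (length-filter (_∈? E) id) (sym ∣ E ∣≡sum)

-- An Eulerian circuit of the complete digraph: the star at x, with a circuit of the
-- remaining vertices inserted at the first of them.

star : ∀ {n} → Fin n → List (Fin n) → List (Fin n × Fin n)
star x = concatMap λ z → (x , z) ∷ (z , x) ∷ []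

circuit : ∀ {n} → Fin n → List (Fin n) → List (Fin n × Fin n)
circuit x []      = []
circuit x (y ∷ l) = (x , y) ∷ circuit y l ++ (y , x) ∷ star x l

walk-++ : ∀ {n} {i j l : Fin n} {w w′} → Walk i j w → Walk j l w′ → Walk i l (w ++ w′)
walk-++ []      W′ = W′
walk-++ (i ∷ W) W′ = i ∷ walk-++ W W′

walk-star : ∀ {n} (x : Fin n) l → Walk x x (star x l)
walk-star x []      = []
walk-star x (z ∷ l) = x ∷ (z ∷ walk-star x l)

walk-circuit : ∀ {n} (x : Fin n) l → Walk x x (circuit x l)
walk-circuit x []      = []
walk-circuit x (y ∷ l) = x ∷ walk-++ (walk-circuit y l) (y ∷ walk-star x l)

walk-loop : ∀ {n} (i : Fin n) s → Walk i i (arcs i (Vec.replicate s i))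
walk-loop i zero    = []
walk-loop i (suc s) = i ∷ walk-loop i s

-- Each entry paired with the vector of the others: for the vertices of a hyperedge, one row per
-- vertex.
holes : ∀ {A : Set} {q} → Vec A (suc q) → List (A × Vec A q)
holes (x ∷ [])     = [ x , [] ]
holes (x ∷ y ∷ l) = (x , y ∷ l) ∷ List.map (λ h → proj₁ h , x ∷ proj₂ h) (holes (y ∷ l))

map-holes : ∀ {A : Set} {q} (l : Vec A (suc q)) → List.map proj₁ (holes l) ≡ Vec.toList l
map-holes (x ∷ [])    = refl
map-holes (x ∷ y ∷ l) = cong (x ∷_) (trans (sym (List.map-∘ (holes (y ∷ l)))) (map-holes (y ∷ l)))

holes-∈ : ∀ {A : Set} {q} (l : Vec A (suc q)) {z γ} → (z , γ) ∈ˡ holes l →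
          ∀ {v} → (v ∈ˡ z ∷ Vec.toList γ → v ∈ˡ Vec.toList l) × (v ∈ˡ Vec.toList l → v ∈ˡ z ∷ Vec.toList γ)
holes-∈ (x ∷ [])    (here refl) = id , id
holes-∈ (x ∷ y ∷ l) (here refl) = id , id
holes-∈ (x ∷ y ∷ l) (there h∈) with Mem.∈-map⁻ (λ h → proj₁ h , x ∷ proj₂ h) h∈
... | (z , γ) , h∈′ , refl = (λ { (here p) → there (proj₁ (holes-∈ (y ∷ l) h∈′) (here p))
             ; (there (here p)) → here p
             ; (there (there p)) → there (proj₁ (holes-∈ (y ∷ l) h∈′) (there p)) })
         , (λ { (here p) → there (here p)
             ; (there p) → case proj₂ (holes-∈ (y ∷ l) h∈′) p of λ { (here q) → here q ; (there q) → there (there q) } })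

concatMap-∷ : ∀ {A B : Set} (g : A → B) (h : A → List B) xs →
              concatMap (λ x → g x ∷ h x) xs ↭ List.map g xs ++ concatMap h xs
concatMap-∷ g h []       = ↭.refl
concatMap-∷ g h (x ∷ xs) = ↭.prep (g x) (↭.trans (↭.++⁺ˡ (h x) (concatMap-∷ g h xs)) (↭.shifts (h x) (List.map g xs)))

arcs*-concatMap : ∀ {n r} (R : List (Fin n × Vec (Fin n) r)) → arcs* R ≡ concatMap (λ h → arcs (proj₁ h) (proj₂ h)) R
arcs*-concatMap []      = refl
arcs*-concatMap ((i , γ) ∷ R) = cong (arcs i γ ++_) (arcs*-concatMap R)

-- A further vertex `x` adds the arcs between `x` and the others in both directions. `circuit` obeys
-- the same recursion.
arcs-holes : ∀ {n q} (x y : Fin n) (l : Vec (Fin n) q) → arcs* (holes (x ∷ y ∷ l)) ↭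
  List.map (x ,_) (y ∷ Vec.toList l) ++ (List.map (_, x) (y ∷ Vec.toList l) ++ arcs* (holes (y ∷ l)))
arcs-holes x y l = ↭.++⁺ˡ (List.map (x ,_) (y ∷ Vec.toList l)) (↭.trans
  (↭.↭-reflexive (trans (arcs*-concatMap (List.map (λ h → proj₁ h , x ∷ proj₂ h) (holes (y ∷ l))))
    (List.concatMap-map (λ h → arcs (proj₁ h) (proj₂ h)) (λ h → proj₁ h , x ∷ proj₂ h) (holes (y ∷ l)))))
  (↭.trans (concatMap-∷ (λ h → proj₁ h , x) (λ h → arcs (proj₁ h) (proj₂ h)) (holes (y ∷ l)))
    (↭.↭-reflexive (cong₂ _++_
      (trans (List.map-∘ (holes (y ∷ l))) (cong (List.map (_, x)) (map-holes (y ∷ l))))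
      (sym (arcs*-concatMap (holes (y ∷ l))))))))

star-↭ : ∀ {n} (x : Fin n) l → star x l ↭ List.map (x ,_) l ++ List.map (_, x) l
star-↭ x l = ↭.trans (concatMap-∷ (x ,_) (λ z → (z , x) ∷ []) l)
  (↭.++⁺ˡ (List.map (x ,_) l) (↭.↭-reflexive (singles l)))
  where
  singles : ∀ l → concatMap (λ z → (z , x) ∷ []) l ≡ List.map (_, x) l
  singles []      = refl
  singles (z ∷ l) = cong ((z , x) ∷_) (singles l)

circuit-↭ : ∀ {n q} (x : Fin n) (l : Vec (Fin n) q) → circuit x (Vec.toList l) ↭ arcs* (holes (x ∷ l))
circuit-↭ x []      = ↭.refl
circuit-↭ x (y ∷ l) = begin
  (x , y) ∷ circuit y l′ ++ (y , x) ∷ star x l′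
    ↭⟨ ↭.prep (x , y) (↭.++-comm (circuit y l′) _) ⟩
  (x , y) ∷ (y , x) ∷ star x l′ ++ circuit y l′
    ↭⟨ ↭.prep _ (↭.prep _ (↭.++⁺ (star-↭ x l′) (circuit-↭ y l))) ⟩
  (x , y) ∷ (y , x) ∷ (List.map (x ,_) l′ ++ List.map (_, x) l′) ++ arcs* (holes (y ∷ l))
    ≡⟨ cong (λ X → (x , y) ∷ (y , x) ∷ X) (List.++-assoc (List.map (x ,_) l′) (List.map (_, x) l′) _) ⟩
  (x , y) ∷ (y , x) ∷ List.map (x ,_) l′ ++ (List.map (_, x) l′ ++ arcs* (holes (y ∷ l)))
    ↭⟨ ↭.prep _ (↭-sym (↭.shift (y , x) (List.map (x ,_) l′) _)) ⟩
  (x , y) ∷ List.map (x ,_) l′ ++ (y , x) ∷ (List.map (_, x) l′ ++ arcs* (holes (y ∷ l)))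
    ↭⟨ ↭-sym (arcs-holes x y l) ⟩
  arcs* (holes (x ∷ y ∷ l)) ∎
  where
  open ↭.PermutationReasoning
  l′ = Vec.toList l

module Coefficients {c ℓ₁ ℓ₂} (K : OrderedField c ℓ₁ ℓ₂) (r d n : ℕ) where

  open FieldTheory K
  open Functionals K {n}
  open Traces K (suc r) d n hiding (r)
  open Expansion {r} N

  module _ {β : Carrier} where

    -- A coefficient depends on the size of `E`, on the repetitions among the loops and on which
    -- loop vertices lie in `E`. Listing these vertices by an injective family makes `U` the pattern
    -- of repetitions.
    Φ-carry : ∀ {s} (E E′ : Subset n) → ∣ E ∣ ≡ ∣ E′ ∣ → (V W : Fin s → Fin n) →
      Injective _≡_ _≡_ V → Injective _≡_ _≡_ W → (∀ j → V j ∈ E → W j ∈ E′) → (∀ j → W j ∈ E′ → V j ∈ E) →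
      (U : List (Fin s)) → Φ β E (List.map V U) ≈ Φ β E′ (List.map W U)
    Φ-carry E E′ sizes V W V! W! V⇒W W⇒V U with carry E E′ sizes V W V! W! V⇒W W⇒V
    ... | π , πV , f , g = ≈-trans (≈-sym (Φ-rename π β E E′ (List.map V U) f g))
      (≈-reflexive (cong (Φ β E′) (trans (sym (List.map-∘ U)) (List.map-cong πV U))))

    one-injective : ∀ {A : Set} {u : A} → Injective _≡_ _≡_ (λ (_ : Fin 1) → u)
    one-injective {x = zero} {y = zero} _ = refl

    two-injective : ∀ {u v : Fin n} → u ≢ v → Injective _≡_ _≡_ (u ◂ λ (_ : Fin 1) → v)
    two-injective u≢v = injective-∷ _ _ one-injective (λ _ → u≢v ∘ sym)

    Φ-loops : ∀ i j → Φ β ⊥ (List.replicate d i) ≈ Φ β ⊥ (List.replicate d j)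
    Φ-loops i j = ≈-trans (≈-reflexive (cong (Φ β ⊥) (sym (List.map-replicate (λ (_ : Fin 1) → i) d zero)))) (≈-trans
      (Φ-carry ⊥ ⊥ refl (λ (_ : Fin 1) → i) (λ _ → j) one-injective one-injective (λ _ p → contradiction p ∉⊥) (λ _ p → contradiction p ∉⊥) (List.replicate d zero))
      (≈-reflexive (cong (Φ β ⊥) (List.map-replicate (λ (_ : Fin 1) → j) d zero))))

    Φ-none : ∀ E E′ → ∣ E ∣ ≡ ∣ E′ ∣ → Φ β E [] ≈ Φ β E′ []
    Φ-none E E′ sizes = Φ-carry {zero} E E′ sizes (λ ()) (λ ()) (λ { {()} }) (λ { {()} }) (λ ()) (λ ()) []

    Φ-same : ∀ E E′ → ∣ E ∣ ≡ ∣ E′ ∣ → ∀ {u u′} → u ∈ E → u′ ∈ E′ → Φ β E (u ∷ u ∷ []) ≈ Φ β E′ (u′ ∷ u′ ∷ [])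
    Φ-same E E′ sizes {u} {u′} u∈ u′∈ = Φ-carry E E′ sizes (λ (_ : Fin 1) → u) (λ _ → u′) one-injective one-injective
      (λ _ _ → u′∈) (λ _ _ → u∈) (zero ∷ zero ∷ [])

    Φ-different : ∀ E E′ → ∣ E ∣ ≡ ∣ E′ ∣ → ∀ {u v u′ v′} → u ∈ E → v ∈ E → u ≢ v → u′ ∈ E′ → v′ ∈ E′ → u′ ≢ v′ →
      Φ β E (u ∷ v ∷ []) ≈ Φ β E′ (u′ ∷ v′ ∷ [])
    Φ-different E E′ sizes {u} {v} {u′} {v′} u∈ v∈ u≢v u′∈ v′∈ u′≢v′ = Φ-carry E E′ sizes (u ◂ λ (_ : Fin 1) → v) (u′ ◂ λ (_ : Fin 1) → v′)
      (two-injective u≢v) (two-injective u′≢v′)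
      (λ { zero _ → u′∈ ; (suc zero) _ → v′∈ }) (λ { zero _ → u∈ ; (suc zero) _ → v∈ }) (zero ∷ suc zero ∷ [])

  module _ {β : Carrier} (0<β : 0# <ᴷ β) where

    local-nonneg : ∀ E i γ → 0# ≤ᶠ localTensor β E i γ
    local-nonneg E i γ with does (Vec.≡-dec _≟_ γ (Vec.replicate r i)) | does (Vec.≡-dec Bool._≟_ (indexSet i γ) E)
    ... | true  | _     = 0≤1
    ... | false | true  = inj₁ 0<β
    ... | false | false = ≤ᶠ-refl

    local-loop : ∀ E i → 0# <ᴷ localTensor β E i (Vec.replicate r i)
    local-loop E i = subst (0# <ᴷ_) (sym (if-yes (Vec.≡-dec _≟_ (Vec.replicate r i) (Vec.replicate r i)) refl)) 0<1

    local-edge : ∀ E i γ → indexSet i γ ≡ E → 0# <ᴷ localTensor β E i γ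
    local-edge E i γ eq = go (does (Vec.≡-dec _≟_ γ (Vec.replicate r i)))
      where
      go : ∀ b → 0# <ᴷ (if b then 1# else (if does (Vec.≡-dec Bool._≟_ (indexSet i γ) E) then β else 0#))
      go true  = 0<1
      go false = subst (0# <ᴷ_) (sym (if-yes (Vec.≡-dec Bool._≟_ (indexSet i γ) E) eq)) 0<β

    Φ-nonneg : ∀ E U → 0# ≤ᶠ Φ β E U
    Φ-nonneg E U = *-nonneg (inj₁ (factor-pos (multiplicity E U)))
      (S-nonneg (localTensor β E) (local-nonneg E) (blocks (multiplicity E U) (allFin n)) constant-nonneg)

    length-arcs* : ∀ (R : List (Row r)) → List.length (arcs* R) ≡ List.length R * r
    length-arcs* []            = refl
    length-arcs* ((i , γ) ∷ R) = trans (List.length-++ (arcs i γ))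
      (cong₂ _+_ (trans (List.length-map (i ,_) (Vec.toList γ)) (Vec.length-toList γ)) (length-arcs* R))

    Φ-pos : ∀ E U (R : List (Row r)) → (∀ i → count i (List.map proj₁ R) ≡ multiplicity E U i) → List.length R ≡ d →
      All (λ { (i , γ) → 0# <ᴷ localTensor β E i γ }) R → ∀ {i w} → Walk i i w → w ↭ arcs* R → 0# <ᴷ Φ β E U
    Φ-pos E U R counts len pos {w = w} W w↭ = *-positive (factor-pos (multiplicity E U))
      (<-respʳ-≈ (S-↭ (localTensor β E) constant (count⇒↭ (List.map proj₁ R) (blocks (multiplicity E U) (allFin n)) λ i → trans (counts i) (sym (count-blocks (multiplicity E U) i))))
        (S-pos (localTensor β E) (local-nonneg E) R [] pos
          (subst (λ L → w ∈ˡ closedWalks L) (trans (↭.↭-length w↭) (trans (length-arcs* R) (cong (_* r) len))) (Walk⇒closedWalks W)) w↭))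

    Φ-loops-pos : ∀ i → 0# <ᴷ Φ β ⊥ (List.replicate d i)
    Φ-loops-pos i = Φ-pos ⊥ (List.replicate d i) (List.replicate d (i , Vec.replicate r i))
      (λ v → trans (cong (count v) (List.map-replicate proj₁ d _)) (cong (_+ count v (List.replicate d i)) (sym (𝟙-no (v ∈? ⊥ {n}) ∉⊥))))
      (List.length-replicate d) (All.replicate⁺ d (local-loop ⊥ i)) (walk d) ↭.refl
      where
      walk : ∀ c → Walk i i (arcs* (List.replicate c (i , Vec.replicate r i)))
      walk zero    = []
      walk (suc c) = walk-++ (walk-loop i r) (walk c)

module _ {c ℓ₁ ℓ₂} (K : OrderedField c ℓ₁ ℓ₂) where

  open FieldTheory K

  -- The witness has a loop row at `u`, a loop row at `v` and one hyperedge row at each vertex of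
  -- `E`. Moving `u` and `v` to the front of the vertices of `E` makes the circuit begin with the
  -- arc from `u` to `v`, so that the loops can be inserted at its first two vertices.
  Φ-different-pos : ∀ {n r} {β} → 0# <ᴷ β → (E : Subset n) → ∣ E ∣ ≡ suc r → ∀ {u v} → u ∈ E → v ∈ E → u ≢ v →
    0# <ᴷ Traces.Φ K (suc r) (suc r + 2) n β E (u ∷ v ∷ [])
  Φ-different-pos {n} {r} {β} 0<β E ∣E∣ {u} {v} u∈ v∈ u≢v
    with unique-extract (u ∷ v ∷ []) (elements-unique E) ((u≢v ∷ []) ∷ ([] ∷ []))
           (λ { (here refl) → ∈-elements⁺ u∈ ; (there (here refl)) → ∈-elements⁺ v∈ })
  ... | zs , p , _ = go zs p r (ℕ.suc-injective (trans (sym (↭.↭-length p)) (trans (length-elements E) ∣E∣)))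
    where
    -- `r` becomes a variable so that it can be replaced by the length of the rows in `holes`.
    go : ∀ zs → elements E ↭ u ∷ v ∷ zs → ∀ r → suc (List.length zs) ≡ r →
         0# <ᴷ Traces.Φ K (suc r) (suc r + 2) n β E (u ∷ v ∷ [])
    go zs p r refl = C.Φ-pos 0<β E (u ∷ v ∷ []) R counts len pos W
      (↭.++⁺ˡ (arcs u γᵘ) (↭.trans (↭-sym (↭.shift (u , v) (arcs v γᵛ) _)) (↭.++⁺ˡ (arcs v γᵛ)
        (↭.trans (↭.↭-reflexive (cong (λ l → (u , v) ∷ circuit v l ++ (v , u) ∷ star u l) (sym toList≡))) (circuit-↭ u (v ∷ zsᵛ))))))
      where
      module C = Coefficients K r (suc r + 2) n
      zsᵛ = Vec.fromList zs
      γᵘ = Vec.replicate r u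
      γᵛ = Vec.replicate r v
      toList≡ : Vec.toList zsᵛ ≡ zs
      toList≡ = Vec.toList∘fromList zs
      R : List (Fin n × Vec (Fin n) r)
      R = (u , γᵘ) ∷ (v , γᵛ) ∷ holes (u ∷ v ∷ zsᵛ)
      roots≡ : List.map proj₁ (holes (u ∷ v ∷ zsᵛ)) ≡ u ∷ v ∷ zs
      roots≡ = trans (map-holes (u ∷ v ∷ zsᵛ)) (cong (λ l → u ∷ v ∷ l) toList≡)
      counts : ∀ i → count i (List.map proj₁ R) ≡ Traces.multiplicity K (suc r) (suc r + 2) n E (u ∷ v ∷ []) i
      counts i = trans (cong (λ l → 𝟙 (i ≟ u) + (𝟙 (i ≟ v) + count i l)) roots≡)
        (trans (cong (λ z → 𝟙 (i ≟ u) + (𝟙 (i ≟ v) + z)) (trans (sym (count-↭ i p)) (count-elements E i)))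
          (rearrange (𝟙 (i ≟ u)) (𝟙 (i ≟ v)) (𝟙 (i ∈? E))))
        where
        rearrange : ∀ a b c → a + (b + c) ≡ c + (a + (b + 0))
        rearrange = solve-∀
      len : List.length R ≡ suc r + 2
      len = trans (cong (λ z → suc (suc z)) (trans (sym (List.length-map proj₁ (holes (u ∷ v ∷ zsᵛ)))) (cong List.length roots≡))) (ℕ.+-comm 2 (suc r))
      ∈E⇒ : ∀ {w} → w ∈ E → w ∈ˡ Vec.toList (u ∷ v ∷ zsᵛ)
      ∈E⇒ w∈ = subst (λ l → _ ∈ˡ u ∷ v ∷ l) (sym toList≡) (↭.∈-resp-↭ p (∈-elements⁺ w∈))
      ⇒∈E : ∀ {w} → w ∈ˡ Vec.toList (u ∷ v ∷ zsᵛ) → w ∈ E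
      ⇒∈E w∈ = ∈-elements⁻ (↭.∈-resp-↭ (↭-sym p) (subst (λ l → _ ∈ˡ u ∷ v ∷ l) toList≡ w∈))
      pos : All (λ { (i , γ) → 0# <ᴷ Traces.localTensor K (suc r) (suc r + 2) n β E i γ }) R
      pos = C.local-loop 0<β E u ∷ C.local-loop 0<β E v ∷ All.tabulate λ { {z , γ} h∈ → C.local-edge 0<β E z γ (subset-ext
        (λ w w∈ → ⇒∈E (proj₁ (holes-∈ (u ∷ v ∷ zsᵛ) h∈) (∈-indexSet⁻ z γ w∈)))
        (λ w w∈ → ∈-indexSet⁺ z γ (proj₂ (holes-∈ (u ∷ v ∷ zsᵛ) h∈) (∈E⇒ w∈)))) }
      -- The loops at `u` come first; those at `v` are inserted when the circuit first reaches `v`.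
      W : Walk u u (arcs u γᵘ ++ (u , v) ∷ arcs v γᵛ ++ circuit v zs ++ (v , u) ∷ star u zs)
      W = walk-++ (walk-loop u r) (u ∷ walk-++ (walk-loop v r) (walk-++ (walk-circuit v zs) (v ∷ walk-star u zs)))

-- The second and the (k + 2)-nd moment in terms of vertex degrees

e₂ : ∀ {A : Set} → (A → ℕ) → List A → ℕ
e₂ f []      = 0
e₂ f (x ∷ l) = f x * total f l + e₂ f l

module _ {n m} (H : Hypergraph n m) where

  degreePowers : ℕ → ℕ
  degreePowers d = sum (λ v → deg H v ^ d)

  -- This form results from summing the squares of the degrees over all incidences, where each
  -- vertex is counted `deg` times.
  degreeCubes : ℕ
  degreeCubes = sum (λ v → deg H v * (deg H v * deg H v))

  degreePairs : ℕ
  degreePairs = sum (λ e → e₂ (deg H) (elements (edge H e)))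

total-elements : ∀ {n} (E : Subset n) (f : Fin n → ℕ) → total f (elements E) ≡ sum (λ v → 𝟙 (v ∈? E) * f v)
total-elements E f = go id
  where
  go : ∀ {s} (g : Fin s → Fin _) → total f (List.filter (_∈? E) (List.tabulate g)) ≡ sum (λ j → 𝟙 (g j ∈? E) * f (g j))
  go {zero}  g = refl
  go {suc s} g with g zero ∈? E
  ... | yes _ = cong₂ _+_ (sym (ℕ.+-identityʳ (f (g zero)))) (go (g ∘ suc))
  ... | no _  = go (g ∘ suc)

pairs : ∀ {A : Set} → List A → List (List A)
pairs []      = []
pairs (x ∷ l) = (x ∷ x ∷ []) ∷ List.map (λ y → x ∷ y ∷ []) l ++ pairs l

∈-pairs⁻ : ∀ {A : Set} {l : List A} {U} → U ∈ˡ pairs l → ∃₂ λ a b → U ≡ a ∷ b ∷ [] × a ∈ˡ l × b ∈ˡ l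
∈-pairs⁻ {l = x ∷ l} (here refl) = x , x , refl , here refl , here refl
∈-pairs⁻ {l = x ∷ l} (there U∈) with Mem.∈-++⁻ (List.map (λ y → x ∷ y ∷ []) l) U∈
... | inj₁ p with Mem.∈-map⁻ (λ y → x ∷ y ∷ []) p
...   | y , y∈ , refl = x , y , refl , here refl , there y∈
∈-pairs⁻ {l = x ∷ l} (there U∈) | inj₂ q with ∈-pairs⁻ {l = l} q
... | a , b , eq , a∈ , b∈ = a , b , eq , there a∈ , there b∈

∈-pairs⁺ : ∀ {A : Set} {l : List A} {a b} → a ∈ˡ l → b ∈ˡ l → ∃ λ U → U ∈ˡ pairs l × U ↭ a ∷ b ∷ []
∈-pairs⁺ (here refl) (here refl) = _ , here refl , ↭.refl
∈-pairs⁺ (here refl) (there b∈)  = _ , there (Mem.∈-++⁺ˡ (Mem.∈-map⁺ _ b∈)) , ↭.refl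
∈-pairs⁺ (there a∈)  (here refl) = _ , there (Mem.∈-++⁺ˡ (Mem.∈-map⁺ _ a∈)) , ↭.swap _ _ ↭.refl
∈-pairs⁺ {l = x ∷ l} (there a∈) (there b∈) with ∈-pairs⁺ a∈ b∈
... | U , U∈ , p = U , there (Mem.∈-++⁺ʳ (List.map (λ y → x ∷ y ∷ []) l) U∈) , p

pairs-distinct : ∀ {A : Set} {l : List A} → Unique l → AllPairs (λ U U′ → ¬ (U ↭ U′)) (pairs l)
pairs-distinct [] = []
pairs-distinct {l = x ∷ l} (x∉ ∷ l!) =
  All.++⁺ (All.map⁺ (All.map (λ x≢y p → x≢y (sym (second p))) x∉)) (All.tabulate x-apart) ∷
  AllPairs.++⁺ (AllPairs.map⁺ (AllPairs.map (λ y≢z p → y≢z (sym (second p))) l!)) (pairs-distinct l!)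
    (All.map⁺ (All.tabulate λ _ → All.tabulate x-apart))
  where
  second : ∀ {x y z} → x ∷ y ∷ [] ↭ x ∷ z ∷ [] → z ≡ y
  second p with ↭.↭-singleton-inv (↭-sym (↭.drop-∷ p))
  ... | refl = refl
  x-apart : ∀ {y U} → U ∈ˡ pairs l → ¬ (x ∷ y ∷ [] ↭ U)
  x-apart U∈ p with ∈-pairs⁻ {l = l} U∈
  ... | a , b , refl , a∈ , b∈ with ↭.∈-resp-↭ p (here refl)
  ...   | here refl         = All.lookup x∉ a∈ refl
  ...   | there (here refl) = All.lookup x∉ b∈ refl

pair-multisets : ∀ {n m} (H : Hypergraph n m) k → LoopMultisets H k (k + 2)
pair-multisets H k = record
  { multisets = λ e → pairs (elements (edge H e))
  ; within    = λ {e} U∈ → let a , b , eq , a∈ , b∈ = ∈-pairs⁻ {l = elements (edge H e)} U∈ in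
      (λ u∈ → case subst (_ ∈ˡ_) eq u∈ of λ { (here refl) → ∈-elements⁻ a∈ ; (there (here refl)) → ∈-elements⁻ b∈ })
      , trans (cong (λ U → List.length U + k) eq) (ℕ.+-comm 2 k)
  ; complete  = λ { e (a ∷ b ∷ []) ⊆e _ → ∈-pairs⁺ (∈-elements⁺ (⊆e (here refl))) (∈-elements⁺ (⊆e (there (here refl))))
                  ; e [] _ eq → contradiction (ℕ.+-cancelʳ-≡ k 0 2 (trans eq (ℕ.+-comm k 2))) λ ()
                  ; e (_ ∷ []) _ eq → contradiction (ℕ.+-cancelʳ-≡ k 1 2 (trans eq (ℕ.+-comm k 2))) λ ()
                  ; e (_ ∷ _ ∷ _ ∷ U) _ eq → contradiction (ℕ.+-cancelʳ-≡ k (3 + List.length U) 2 (trans eq (ℕ.+-comm k 2))) λ () }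
  ; distinct  = λ e → pairs-distinct (elements-unique (edge H e))
  }

-- For d = 2 the shape of a hyperedge would use k of two rows. It occurs for k = 2 only, and then
-- without loops.
no-loop-multisets : ∀ {n m} (H : Hypergraph n m) r → 1 ≤ r → LoopMultisets H (suc r) 2
no-loop-multisets H (suc zero) _ = record
  { multisets = λ _ → [] ∷ []
  ; within    = λ { (here refl) → (λ ()) , refl }
  ; complete  = λ { e [] _ _ → [] , here refl , ↭.refl ; e (_ ∷ U) _ eq → contradiction (ℕ.+-cancelʳ-≡ 2 (suc (List.length U)) 0 eq) λ () }
  ; distinct  = λ _ → [] ∷ []
  }
no-loop-multisets H (suc (suc r)) _ = record
  { multisets = λ _ → []
  ; within    = λ ()
  ; complete  = λ e U _ eq → contradiction (subst (3 + r ≤_) eq (ℕ.m≤n+m (3 + r) (List.length U))) λ { (s≤s (s≤s ())) }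
  ; distinct  = λ _ → []
  }

-- The reference hypertree `H₀` provides a hyperedge and two of its vertices at which the
-- coefficients are taken. By `Φ-carry` the same constants serve every hypertree with these `n` and
-- `m`.
module MomentFormulas {c ℓ₁ ℓ₂} (K : OrderedField c ℓ₁ ℓ₂) (α : OrderedField.Carrier K)
  (0<α : OrderedField._<_ K (OrderedField.0# K) α) (α<1 : OrderedField._<_ K α (OrderedField.1# K))
  {n m r : ℕ} (1≤m : 1 ≤ m) (1≤r : 1 ≤ r) {H₀ : Hypergraph n m} (tree₀ : IsHypertree (suc r) H₀) where

  open FieldTheory K

  β P : Carrier
  β = (1# -ᴷ α) *ᴷ ((r !) · 1#) ⁻¹
  P = (r ^ (n ∸ 1)) · 1#

  0<β : 0# <ᴷ β
  0<β = *-positive (<⇒0<- α<1) (⁻¹-pos (·1-pos (ℕ.1≤n! r)))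

  0<P : 0# <ᴷ P
  0<P = ·1-pos (ℕ.m^n>0 r {{ℕ.>-nonZero 1≤r}} (n ∸ 1))

  P-* : ∀ y → (r ^ (n ∸ 1)) · y ≈ P *ᴷ y
  P-* y = ≈-trans (×-congʳ (r ^ (n ∸ 1)) (≈-sym (*-identityˡ y))) (≈-sym (×-assoc-* (r ^ (n ∸ 1)) 1# y))

  e₀ : Fin m
  e₀ = fromℕ< 1≤m

  u₀∈ : ∃ λ u → u ∈ edge H₀ e₀
  u₀∈ with sum-pos (λ v → inc H₀ v e₀) (subst (1 ≤_) (sym (sum-inc H₀ (IsHypertree.uniform tree₀) e₀)) (s≤s z≤n))
  ... | u , 1≤ = u , 𝟙-pos (u ∈? edge H₀ e₀) 1≤

  v₀∈ : ∃ λ v → v ∈ edge H₀ e₀ × v ≢ proj₁ u₀∈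
  v₀∈ = second-vertex H₀ 1≤r (IsHypertree.uniform tree₀) e₀ (proj₁ u₀∈)

  ∑-·1 : ∀ {N} (f : Fin N → ℕ) → ∑ (allFin N) (λ i → f i · 1#) ≈ sum f · 1#
  ∑-·1 {N} f = go id
    where
    go : ∀ {s} (g : Fin s → Fin N) → ∑ (List.tabulate g) (λ i → f i · 1#) ≈ sum (f ∘ g) · 1#
    go {zero}  g = ≈-refl
    go {suc s} g = ≈-trans (+-congˡ (go (g ∘ suc))) (≈-sym (×-homo-+ 1# (f (g zero)) _))

  infixr 8 α^_
  α^_ : ℕ → Carrier
  α^ zero  = 1#
  α^ suc d = α *ᴷ α^ d

  0<α^ : ∀ d → 0# <ᴷ α^ d
  0<α^ zero    = 0<1
  0<α^ (suc d) = *-positive 0<α (0<α^ d)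

  module LoopPart (d : ℕ) where

    open Coefficients K r d n
    open Traces K (suc r) d n hiding (r)

    c₀ : Carrier
    c₀ = P *ᴷ (Φ β ⊥ (List.replicate d (proj₁ u₀∈)) *ᴷ α^ d)

    0<c₀ : 0# <ᴷ c₀
    0<c₀ = *-positive 0<P (*-positive (Φ-loops-pos 0<β (proj₁ u₀∈)) (0<α^ d))

    module _ (H : Hypergraph n m) where

      x : Fin n → Carrier
      x u = α *ᴷ (degree H u · 1#)

      ∏-replicate : ∀ u c → ∏ (List.replicate c u) x ≈ α^ c *ᴷ ((deg H u ^ c) · 1#)
      ∏-replicate u zero    = ≈-sym (≈-trans (*-identityˡ _) (+-identityʳ 1#))
      ∏-replicate u (suc c) = begin
        α *ᴷ (degree H u · 1#) *ᴷ ∏ (List.replicate c u) x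
          ≈⟨ *-cong (*-congˡ (≈-reflexive (cong (_· 1#) (degree≡deg H u)))) (∏-replicate u c) ⟩
        α *ᴷ (deg H u · 1#) *ᴷ (α^ c *ᴷ ((deg H u ^ c) · 1#))
          ≈⟨ interchange α (deg H u · 1#) (α^ c) ((deg H u ^ c) · 1#) ⟩
        α *ᴷ α^ c *ᴷ ((deg H u · 1#) *ᴷ ((deg H u ^ c) · 1#))
          ≈⟨ *-congˡ (×1-homo-* (deg H u) (deg H u ^ c)) ⟨
        α *ᴷ α^ c *ᴷ ((deg H u * deg H u ^ c) · 1#) ∎
        where open import Algebra.Properties.CommutativeSemigroup *-commutativeSemigroup using (interchange)

      loop-part : P *ᴷ ∑ (allFin n) (λ i → ∏ (List.replicate d i) x *ᴷ Φ β ⊥ (List.replicate d i)) ≈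
                  c₀ *ᴷ (degreePowers H d · 1#)
      loop-part = begin
        P *ᴷ ∑ (allFin n) (λ i → ∏ (List.replicate d i) x *ᴷ Φ β ⊥ (List.replicate d i))
          ≈⟨ *-congˡ (∑-cong (allFin n) λ i → ≈-trans (*-cong (∏-replicate i d) (Φ-loops i (proj₁ u₀∈)))
               (≈-trans (*-comm _ _) (≈-sym (*-assoc _ _ _)))) ⟩
        P *ᴷ ∑ (allFin n) (λ i → φ *ᴷ α^ d *ᴷ ((deg H i ^ d) · 1#))
          ≈⟨ *-congˡ (≈-trans (∑-*ˡ (allFin n)) (*-congˡ (∑-·1 (λ i → deg H i ^ d)))) ⟩
        P *ᴷ (φ *ᴷ α^ d *ᴷ (degreePowers H d · 1#))
          ≈⟨ *-assoc _ _ _ ⟨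
        c₀ *ᴷ (degreePowers H d · 1#) ∎
        where
        φ = Φ β ⊥ (List.replicate d (proj₁ u₀∈))

  moment₂ : ∃₂ λ A B → 0# <ᴷ A × (∀ (H : Hypergraph n m) → IsHypertree (suc r) H →
    spectralMoment K α (suc r) 2 H ≈ A *ᴷ (degreePowers H 2 · 1#) +ᴷ B)
  moment₂ = c₀ , P *ᴷ rest H₀ , 0<c₀ , formula
    where
    open LoopPart 2
    open Coefficients K r 2 n
    open Traces K (suc r) 2 n hiding (r)
    open LoopMultisets using (multisets)
    rest : Hypergraph n m → Carrier
    rest H = ∑ (allFin m) λ e → ∑ (multisets (no-loop-multisets H r 1≤r) e) λ U → ∏ U (x H) *ᴷ Φ β (edge H e) U
    rest-same : ∀ H → IsHypertree (suc r) H → rest H ≈ rest H₀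
    rest-same H tree = ∑-cong (allFin m) λ e → go r 1≤r e refl
      where
      -- `no-loop-multisets` reduces only after matching on the row length. For k = 2 a hyperedge
      -- adds its coefficient, whatever the degrees; for larger k it adds nothing.
      go : ∀ r′ 1≤r′ e → r′ ≡ r → ∑ (multisets (no-loop-multisets H r′ 1≤r′) e) (λ U → ∏ U (x H) *ᴷ Φ β (edge H e) U) ≈
                       ∑ (multisets (no-loop-multisets H₀ r′ 1≤r′) e) (λ U → ∏ U (x H₀) *ᴷ Φ β (edge H₀ e) U)
      go (suc zero)    _ e _ = +-congʳ (*-congˡ (Φ-none (edge H e) (edge H₀ e) (trans (IsHypertree.uniform tree e) (sym (IsHypertree.uniform tree₀ e)))))
      go (suc (suc _)) _ e _ = ≈-refl
    formula : ∀ H → IsHypertree (suc r) H → spectralMoment K α (suc r) 2 H ≈ c₀ *ᴷ (degreePowers H 2 · 1#) +ᴷ P *ᴷ rest H₀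
    formula H tree = begin
      spectralMoment K α (suc r) 2 H
        ≈⟨ ≈-trans (Tr-expansion _) (P-* _) ⟩
      P *ᴷ ∑ (compositions n 2) (term (Aα K α (suc r) H) ∘ Vec.lookup)
        ≈⟨ *-congˡ (Moments.moment-formula K α 1≤r tree (s≤s z≤n) (ℕ.*-monoʳ-< 2 (s≤s 1≤r)) (no-loop-multisets H r 1≤r)) ⟩
      P *ᴷ (_ +ᴷ rest H)
        ≈⟨ distribˡ P _ _ ⟩
      P *ᴷ _ +ᴷ P *ᴷ rest H
        ≈⟨ +-cong (loop-part H) (*-congˡ (rest-same H tree)) ⟩
      c₀ *ᴷ (degreePowers H 2 · 1#) +ᴷ P *ᴷ rest H₀ ∎

  momentₖ₊₂ : 2 ≤ r → Σ Carrier λ A → ∃₂ λ B C → 0# ≤ᶠ A × 0# ≤ᶠ B × 0# <ᴷ C ×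
    (∀ (H : Hypergraph n m) → IsHypertree (suc r) H → spectralMoment K α (suc r) (suc r + 2) H ≈
      A *ᴷ (degreePowers H (suc r + 2) · 1#) +ᴷ (B *ᴷ (degreeCubes H · 1#) +ᴷ C *ᴷ (degreePairs H · 1#)))
  momentₖ₊₂ 2≤r = c₀ , P *ᴷ b , P *ᴷ c′ , inj₁ 0<c₀ , *-nonneg (inj₁ 0<P) (*-nonneg (Φ-nonneg 0<β E₀ (u₀ ∷ u₀ ∷ [])) (inj₁ (0<α^ 2)))
    , *-positive 0<P (*-positive (Φ-different-pos K 0<β E₀ (IsHypertree.uniform tree₀ e₀) (proj₂ u₀∈) (proj₁ (proj₂ v₀∈)) (proj₂ (proj₂ v₀∈) ∘ sym)) (0<α^ 2))
    , formula
    where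
    d : ℕ
    d = suc r + 2
    open LoopPart d
    open Coefficients K r d n
    open Traces K (suc r) d n hiding (r)
    E₀ = edge H₀ e₀
    u₀ = proj₁ u₀∈
    v₀ = proj₁ v₀∈
    b c′ : Carrier
    b  = Φ β E₀ (u₀ ∷ u₀ ∷ []) *ᴷ α^ 2
    c′ = Φ β E₀ (u₀ ∷ v₀ ∷ []) *ᴷ α^ 2
    -- Here k ≥ 3 enters.
    d<2k : d < 2 * suc r
    d<2k = subst (_< 2 * suc r) refl (subst (suc r + 2 <_) (cong (suc r +_) (sym (ℕ.+-identityʳ (suc r)))) (ℕ.+-monoʳ-< (suc r) (s≤s 2≤r)))

    module _ (H : Hypergraph n m) (tree : IsHypertree (suc r) H) where

      g : Fin m → List (Fin n) → Carrier
      g e U = ∏ U (x H) *ᴷ Φ β (edge H e) U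

      sizes : ∀ e → ∣ edge H e ∣ ≡ ∣ E₀ ∣
      sizes e = trans (IsHypertree.uniform tree e) (sym (IsHypertree.uniform tree₀ e₀))

      ∏-pair : ∀ u v → ∏ (u ∷ v ∷ []) (x H) ≈ α^ 2 *ᴷ ((deg H u * deg H v) · 1#)
      ∏-pair u v = begin
        x H u *ᴷ (x H v *ᴷ 1#)
          ≈⟨ *-cong (*-congˡ (≈-reflexive (cong (_· 1#) (degree≡deg H u)))) (≈-trans (*-identityʳ _) (*-congˡ (≈-reflexive (cong (_· 1#) (degree≡deg H v))))) ⟩
        α *ᴷ (deg H u · 1#) *ᴷ (α *ᴷ (deg H v · 1#))
          ≈⟨ interchange α (deg H u · 1#) α (deg H v · 1#) ⟩
        α *ᴷ α *ᴷ ((deg H u · 1#) *ᴷ (deg H v · 1#))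
          ≈⟨ *-cong (*-congˡ (≈-sym (*-identityʳ α))) (≈-sym (×1-homo-* (deg H u) (deg H v))) ⟩
        α^ 2 *ᴷ ((deg H u * deg H v) · 1#) ∎
        where open import Algebra.Properties.CommutativeSemigroup *-commutativeSemigroup using (interchange)

      scaled : ∀ {φ φ′ p y} → p ≈ α^ 2 *ᴷ y → φ ≈ φ′ → p *ᴷ φ ≈ φ′ *ᴷ α^ 2 *ᴷ y
      scaled p≈ φ≈ = ≈-trans (*-cong p≈ φ≈) (≈-trans (*-comm _ _) (≈-sym (*-assoc _ _ _)))

      g-same : ∀ e {u} → u ∈ edge H e → g e (u ∷ u ∷ []) ≈ b *ᴷ ((deg H u * deg H u) · 1#)
      g-same e {u} u∈ = scaled (∏-pair u u) (Φ-same (edge H e) E₀ (sizes e) u∈ (proj₂ u₀∈))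

      g-different : ∀ e {u v} → u ∈ edge H e → v ∈ edge H e → u ≢ v → g e (u ∷ v ∷ []) ≈ c′ *ᴷ ((deg H u * deg H v) · 1#)
      g-different e {u} {v} u∈ v∈ u≢v = scaled (∏-pair u v)
        (Φ-different (edge H e) E₀ (sizes e) u∈ v∈ u≢v (proj₂ u₀∈) (proj₁ (proj₂ v₀∈)) (proj₂ (proj₂ v₀∈) ∘ sym))

      row-sum : ∀ e {u} l → u ∈ edge H e → All (u ≢_) l → (∀ {v} → v ∈ˡ l → v ∈ edge H e) →
                ∑ l (λ v → g e (u ∷ v ∷ [])) ≈ c′ *ᴷ ((deg H u * total (deg H) l) · 1#)
      row-sum e {u} [] u∈ _ _ = ≈-sym (≈-trans (*-congˡ (≈-reflexive (cong (_· 1#) (ℕ.*-zeroʳ (deg H u))))) (zeroʳ c′))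
      row-sum e {u} (v ∷ l) u∈ (u≢v ∷ u∉) ⊆e = begin
        g e (u ∷ v ∷ []) +ᴷ ∑ l (λ v → g e (u ∷ v ∷ []))
          ≈⟨ +-cong (g-different e u∈ (⊆e (here refl)) u≢v) (row-sum e l u∈ u∉ (⊆e ∘ there)) ⟩
        c′ *ᴷ ((deg H u * deg H v) · 1#) +ᴷ c′ *ᴷ ((deg H u * total (deg H) l) · 1#)
          ≈⟨ distribˡ c′ _ _ ⟨
        c′ *ᴷ ((deg H u * deg H v) · 1# +ᴷ (deg H u * total (deg H) l) · 1#)
          ≈⟨ *-congˡ (×-homo-+ 1# (deg H u * deg H v) _) ⟨
        c′ *ᴷ ((deg H u * deg H v + deg H u * total (deg H) l) · 1#)
          ≈⟨ *-congˡ (≈-reflexive (cong (_· 1#) (sym (ℕ.*-distribˡ-+ (deg H u) (deg H v) _)))) ⟩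
        c′ *ᴷ ((deg H u * total (deg H) (v ∷ l)) · 1#) ∎

      edge-sum : ∀ e l → Unique l → (∀ {v} → v ∈ˡ l → v ∈ edge H e) →
        ∑ (pairs l) (g e) ≈ b *ᴷ (total (λ v → deg H v * deg H v) l · 1#) +ᴷ c′ *ᴷ (e₂ (deg H) l · 1#)
      edge-sum e [] _ _ = ≈-sym (≈-trans (+-cong (zeroʳ b) (zeroʳ c′)) (+-identityˡ 0#))
      edge-sum e (u ∷ l) (u∉ ∷ l!) ⊆e = begin
        g e (u ∷ u ∷ []) +ᴷ ∑ (List.map (λ v → u ∷ v ∷ []) l ++ pairs l) (g e)
          ≈⟨ +-cong (g-same e (⊆e (here refl))) (≈-trans (∑-++ (List.map (λ v → u ∷ v ∷ []) l))
               (+-cong (≈-trans (≈-reflexive (∑-map _ l)) (row-sum e l (⊆e (here refl)) u∉ (⊆e ∘ there))) (edge-sum e l l! (⊆e ∘ there)))) ⟩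
        b *ᴷ (s · 1#) +ᴷ (c′ *ᴷ (t · 1#) +ᴷ (b *ᴷ (S′ · 1#) +ᴷ c′ *ᴷ (T′ · 1#)))
          ≈⟨ +-congˡ (x∙yz≈y∙xz _ _ _) ⟩
        b *ᴷ (s · 1#) +ᴷ (b *ᴷ (S′ · 1#) +ᴷ (c′ *ᴷ (t · 1#) +ᴷ c′ *ᴷ (T′ · 1#)))
          ≈⟨ +-assoc _ _ _ ⟨
        b *ᴷ (s · 1#) +ᴷ b *ᴷ (S′ · 1#) +ᴷ (c′ *ᴷ (t · 1#) +ᴷ c′ *ᴷ (T′ · 1#))
          ≈⟨ +-cong (≈-trans (≈-sym (distribˡ b _ _)) (*-congˡ (≈-sym (×-homo-+ 1# s S′))))
                    (≈-trans (≈-sym (distribˡ c′ _ _)) (*-congˡ (≈-sym (×-homo-+ 1# t T′)))) ⟩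
        b *ᴷ ((s + S′) · 1#) +ᴷ c′ *ᴷ ((t + T′) · 1#) ∎
        where
        open import Algebra.Properties.CommutativeSemigroup +-commutativeSemigroup using (x∙yz≈y∙xz)
        s t S′ T′ : ℕ
        s  = deg H u * deg H u
        t  = deg H u * total (deg H) l
        S′ = total (λ v → deg H v * deg H v) l
        T′ = e₂ (deg H) l

      squares : Fin m → ℕ
      squares e = total (λ v → deg H v * deg H v) (elements (edge H e))

      sum-squares : sum squares ≡ degreeCubes H
      sum-squares = trans (sum-cong-≗ λ e → total-elements (edge H e) (λ v → deg H v * deg H v))
        (sum-incident H (λ v → deg H v * deg H v))

      around-part : P *ᴷ ∑ (allFin m) (λ e → ∑ (pairs (elements (edge H e))) (g e)) ≈
        P *ᴷ b *ᴷ (degreeCubes H · 1#) +ᴷ P *ᴷ c′ *ᴷ (degreePairs H · 1#)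
      around-part = begin
        P *ᴷ ∑ (allFin m) (λ e → ∑ (pairs (elements (edge H e))) (g e))
          ≈⟨ *-congˡ (∑-cong (allFin m) λ e → edge-sum e (elements (edge H e)) (elements-unique (edge H e)) ∈-elements⁻) ⟩
        P *ᴷ ∑ (allFin m) (λ e → b *ᴷ (squares e · 1#) +ᴷ c′ *ᴷ (e₂ (deg H) (elements (edge H e)) · 1#))
          ≈⟨ *-congˡ (≈-trans (∑-+ (allFin m)) (+-cong
               (≈-trans (∑-*ˡ (allFin m)) (*-congˡ (≈-trans (∑-·1 squares) (≈-reflexive (cong (_· 1#) sum-squares)))))
               (≈-trans (∑-*ˡ (allFin m)) (*-congˡ (∑-·1 (λ e → e₂ (deg H) (elements (edge H e)))))))) ⟩
        P *ᴷ (b *ᴷ (degreeCubes H · 1#) +ᴷ c′ *ᴷ (degreePairs H · 1#))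
          ≈⟨ distribˡ P _ _ ⟩
        P *ᴷ (b *ᴷ (degreeCubes H · 1#)) +ᴷ P *ᴷ (c′ *ᴷ (degreePairs H · 1#))
          ≈⟨ +-cong (*-assoc _ _ _) (*-assoc _ _ _) ⟨
        P *ᴷ b *ᴷ (degreeCubes H · 1#) +ᴷ P *ᴷ c′ *ᴷ (degreePairs H · 1#) ∎

      formula : spectralMoment K α (suc r) d H ≈
        c₀ *ᴷ (degreePowers H d · 1#) +ᴷ (P *ᴷ b *ᴷ (degreeCubes H · 1#) +ᴷ P *ᴷ c′ *ᴷ (degreePairs H · 1#))
      formula = begin
        spectralMoment K α (suc r) d H
          ≈⟨ ≈-trans (Tr-expansion _) (P-* _) ⟩
        P *ᴷ ∑ (compositions n d) (term (Aα K α (suc r) H) ∘ Vec.lookup)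
          ≈⟨ *-congˡ (Moments.moment-formula K α 1≤r tree (s≤s z≤n) d<2k (pair-multisets H (suc r))) ⟩
        P *ᴷ (_ +ᴷ ∑ (allFin m) (λ e → ∑ (pairs (elements (edge H e))) (g e)))
          ≈⟨ distribˡ P _ _ ⟩
        _
          ≈⟨ +-cong (loop-part H) around-part ⟩
        c₀ *ᴷ (degreePowers H d · 1#) +ᴷ (P *ᴷ b *ᴷ (degreeCubes H · 1#) +ᴷ P *ᴷ c′ *ᴷ (degreePairs H · 1#)) ∎

-- Inequalities between degree sums

sum-squares≤ : ∀ {n} (f : Fin n → ℕ) → sum (λ i → f i * f i) ≤ sum f * sum f
sum-squares≤ {zero}  f = z≤n
sum-squares≤ {suc n} f = begin
  a * a + sum (λ i → f (suc i) * f (suc i))   ≤⟨ ℕ.+-monoʳ-≤ (a * a) (sum-squares≤ (f ∘ suc)) ⟩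
  a * a + b * b                               ≤⟨ ℕ.m≤m+n _ (2 * (a * b)) ⟩
  a * a + b * b + 2 * (a * b)                 ≡⟨ square a b ⟩
  (a + b) * (a + b)                           ∎
  where
  open ℕ.≤-Reasoning
  a = f zero
  b = sum (f ∘ suc)
  square : ∀ a b → a * a + b * b + 2 * (a * b) ≡ (a + b) * (a + b)
  square = solve-∀

-- By convexity the sum of squares is largest when one part is 1. With a = a' + 1 and b = b' + 1 the
-- difference to N² + 1 is 2 a' b'.
two-squares≤ : ∀ N a b → a + b ≡ suc N → 1 ≤ a → a ≤ N → a * a + b * b ≤ N * N + 1
two-squares≤ N (suc a) zero eq _ a≤N = contradiction a≤N (ℕ.<⇒≱ (ℕ.≤-reflexive (trans (sym eq) (ℕ.+-identityʳ (suc a)))))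
two-squares≤ N (suc a) (suc b) eq _ _ with ℕ.suc-injective (trans (sym eq) (cong suc (ℕ.+-suc a b)))
... | refl = subst (suc a * suc a + suc b * suc b ≤_) (square a b) (ℕ.m≤m+n _ (2 * (a * b)))
  where
  square : ∀ a b → suc a * suc a + suc b * suc b + 2 * (a * b) ≡ suc (a + b) * suc (a + b) + 1
  square = solve-∀

-- One positive value is set apart and the others are merged into their sum, which cannot lower the
-- sum of squares. The case of two parts remains.
spread-squares≤ : ∀ {n} (f : Fin n → ℕ) N → sum f ≡ suc N → (∀ i → f i ≤ N) → sum (λ i → f i * f i) ≤ N * N + 1
spread-squares≤ {n} f N eq f≤ with sum-pos f (subst (1 ≤_) (sym eq) (s≤s z≤n))
spread-squares≤ {suc n} f N eq f≤ | j , 1≤fj = begin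
  sum (λ i → f i * f i)                                          ≡⟨ sum-remove {i = j} (λ i → f i * f i) ⟩
  f j * f j + sum (λ i → f (punchIn j i) * f (punchIn j i))      ≤⟨ ℕ.+-monoʳ-≤ (f j * f j) (sum-squares≤ (f ∘ punchIn j)) ⟩
  f j * f j + sum (f ∘ punchIn j) * sum (f ∘ punchIn j)
    ≤⟨ two-squares≤ N (f j) (sum (f ∘ punchIn j)) (trans (sym (sum-remove {i = j} f)) eq) 1≤fj (f≤ j) ⟩
  N * N + 1                                                      ∎
  where open ℕ.≤-Reasoning

-- The number of pairs in a list of length k.
tri : ℕ → ℕ
tri zero    = 0
tri (suc k) = k + tri k

module _ {A : Set} where

  total-mono : ∀ {f g : A → ℕ} → (∀ a → f a ≤ g a) → ∀ l → total f l ≤ total g l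
  total-mono h []      = z≤n
  total-mono h (a ∷ l) = ℕ.+-mono-≤ (h a) (total-mono h l)

  e₂-mono : ∀ {f g : A → ℕ} → (∀ a → f a ≤ g a) → ∀ l → e₂ f l ≤ e₂ g l
  e₂-mono h []      = z≤n
  e₂-mono h (a ∷ l) = ℕ.+-mono-≤ (ℕ.*-mono-≤ (h a) (total-mono h l)) (e₂-mono h l)

  -- Expanding (1 + x_a)(1 + x_b) over all pairs, each single x_a occurs L - 1 times. The summand
  -- `total x l` on the left replaces the subtraction.
  e₂-shift : ∀ {d x : A → ℕ} → (∀ a → d a ≡ 1 + x a) → ∀ l →
    e₂ d l + total x l ≡ tri (List.length l) + List.length l * total x l + e₂ x l
  e₂-shift h [] = refl
  e₂-shift {d} {x} h (a ∷ l) = begin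
    d a * total d l + e₂ d l + (x a + total x l)
      ≡⟨ cong₂ (λ y z → y * z + e₂ d l + (x a + S)) (h a) (total-shift l) ⟩
    (1 + x a) * (L + S) + e₂ d l + (x a + S)
      ≡⟨ reorder₁ (x a) L S (e₂ d l) ⟩
    (1 + x a) * (L + S) + x a + (e₂ d l + S)
      ≡⟨ cong ((1 + x a) * (L + S) + x a +_) (e₂-shift h l) ⟩
    (1 + x a) * (L + S) + x a + (tri L + L * S + e₂ x l)
      ≡⟨ reorder₂ (x a) L S (tri L) (e₂ x l) ⟩
    L + tri L + suc L * (x a + S) + (x a * S + e₂ x l) ∎
    where
    open ≡-Reasoning
    L = List.length l
    S = total x l
    total-shift : ∀ l → total d l ≡ List.length l + total x l
    total-shift []      = refl
    total-shift (b ∷ l) = trans (cong₂ _+_ (h b) (total-shift l)) (swap (x b) (List.length l) (total x l))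
      where
      swap : ∀ a b c → 1 + a + (b + c) ≡ suc b + (a + c)
      swap = solve-∀
    reorder₁ : ∀ x L S e → (1 + x) * (L + S) + e + (x + S) ≡ (1 + x) * (L + S) + x + (e + S)
    reorder₁ = solve-∀
    reorder₂ : ∀ x L S t e → (1 + x) * (L + S) + x + (t + L * S + e) ≡ L + t + suc L * (x + S) + (x * S + e)
    reorder₂ = solve-∀

  e₂-square : ∀ (f : A → ℕ) l → 2 * e₂ f l + total (λ a → f a * f a) l ≡ total f l * total f l
  e₂-square f []      = refl
  e₂-square f (a ∷ l) = trans (reorder (f a) (total f l) (e₂ f l) (total (λ a → f a * f a) l))
    (trans (cong (f a * f a + 2 * (f a * total f l) +_) (e₂-square f l)) (square (f a) (total f l)))
    where
    reorder : ∀ a s e q → 2 * (a * s + e) + (a * a + q) ≡ a * a + 2 * (a * s) + (2 * e + q)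
    reorder = solve-∀
    square : ∀ a s → a * a + 2 * (a * s) + s * s ≡ (a + s) * (a + s)
    square = solve-∀

  module _ {y : A → ℕ} (y≤1 : ∀ a → y a ≤ 1) (l : List A) where

    private
      s = total y l

    e₂-indicator : 2 * e₂ y l + s ≡ s * s
    e₂-indicator = trans (cong (2 * e₂ y l +_) (total-cong (λ a → idempotent (y a) (y≤1 a)) l)) (e₂-square y l)
      where
      idempotent : ∀ b → b ≤ 1 → b ≡ b * b
      idempotent zero       _ = refl
      idempotent (suc zero) _ = refl
      idempotent (suc (suc b)) (s≤s ())

    -- By `e₂-indicator` the value of `e₂ y l` is s (s - 1) / 2. This is at least s - 1, with
    -- equality for s = 1 and s = 2 only.
    e₂-lower : s ≤ e₂ y l + 1
    e₂-lower = go s (e₂ y l) e₂-indicator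
      where
      go : ∀ s e → 2 * e + s ≡ s * s → s ≤ e + 1
      go zero e _ = z≤n
      go (suc zero) e _ = ℕ.m≤n+m 1 e
      go (suc (suc s)) e eq = ℕ.*-cancelˡ-≤ 2 (ℕ.+-cancelʳ-≤ (2 + s) _ _ (begin
        2 * (2 + s) + (2 + s)              ≤⟨ ℕ.m≤m+n _ (s * s + s) ⟩
        2 * (2 + s) + (2 + s) + (s * s + s) ≡⟨ expand s ⟩
        (2 + s) * (2 + s) + 2              ≡⟨ cong (_+ 2) (sym eq) ⟩
        2 * e + (2 + s) + 2                ≡⟨ reorder e s ⟩
        2 * (e + 1) + (2 + s)              ∎))
        where
        open ℕ.≤-Reasoning
        expand : ∀ s → 2 * (2 + s) + (2 + s) + (s * s + s) ≡ (2 + s) * (2 + s) + 2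
        expand = solve-∀
        reorder : ∀ e s → 2 * e + (2 + s) + 2 ≡ 2 * (e + 1) + (2 + s)
        reorder = solve-∀

    e₂-lower₃ : 3 ≤ s → s ≤ e₂ y l
    e₂-lower₃ = go s (e₂ y l) e₂-indicator
      where
      go : ∀ s e → 2 * e + s ≡ s * s → 3 ≤ s → s ≤ e
      go (suc (suc (suc s))) e eq _ = ℕ.*-cancelˡ-≤ 2 (ℕ.+-cancelʳ-≤ (3 + s) _ _ (begin
        2 * (3 + s) + (3 + s)                 ≤⟨ ℕ.m≤m+n _ (s * s + 3 * s) ⟩
        2 * (3 + s) + (3 + s) + (s * s + 3 * s) ≡⟨ expand s ⟩
        (3 + s) * (3 + s)                     ≡⟨ sym eq ⟩
        2 * e + (3 + s)                       ∎))
        where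
        open ℕ.≤-Reasoning
        expand : ∀ s → 2 * (3 + s) + (3 + s) + (s * s + 3 * s) ≡ (3 + s) * (3 + s)
        expand = solve-∀
      go (suc (suc zero)) e _ (s≤s (s≤s ()))
      go (suc zero) e _ (s≤s ())

    -- For s = 1 and s = 2 the bound of `e₂-lower` is attained; for s = 3 it is exceeded by 1, which
    -- `t` pays for.
    e₂-upper : ∀ {t} → t ≤ 1 → 1 ≤ s → s ≤ 2 + t → e₂ y l + 1 ≤ s + t
    e₂-upper {t} = go s (e₂ y l) t e₂-indicator
      where
      half : ∀ {e} c → 2 * e ≡ 2 * c → e ≡ c
      half c eq = ℕ.*-cancelˡ-≡ _ c 2 eq
      go : ∀ s e t → 2 * e + s ≡ s * s → t ≤ 1 → 1 ≤ s → s ≤ 2 + t → e + 1 ≤ s + t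
      go 1 e t eq _ _ _ with half {e} 0 (ℕ.+-cancelʳ-≡ 1 _ _ eq)
      ... | refl = s≤s z≤n
      go 2 e t eq _ _ _ with half {e} 1 (ℕ.+-cancelʳ-≡ 2 _ _ eq)
      ... | refl = s≤s (s≤s z≤n)
      go 3 e 1 eq _ _ _ with half {e} 3 (ℕ.+-cancelʳ-≡ 3 _ _ eq)
      ... | refl = ℕ.≤-refl
      go 3 e 0 eq _ _ (s≤s (s≤s ()))
      go 3 e (suc (suc t)) eq (s≤s ())
      go (suc (suc (suc (suc s)))) e 0 eq _ _ (s≤s (s≤s ()))
      go (suc (suc (suc (suc s)))) e 1 eq _ _ (s≤s (s≤s (s≤s ())))
      go (suc (suc (suc (suc s)))) e (suc (suc t)) eq (s≤s ())

-- 2^d - 1, the slope of the chord of (1 + x)^d between x = 0 and x = 1. By convexity this line lies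
-- below the power at every natural number and meets it at 0 and 1. Since the sum of the excesses is
-- fixed, the linear bound sums to a constant.
mersenne : ℕ → ℕ
mersenne zero    = 0
mersenne (suc d) = 1 + 2 * mersenne d

power-lower : ∀ d x → 1 + x * mersenne d ≤ (1 + x) ^ d
power-lower zero    x = s≤s (ℕ.≤-reflexive (ℕ.*-zeroʳ x))
power-lower (suc d) zero = ℕ.≤-reflexive (sym (ℕ.^-zeroˡ (suc d)))
power-lower (suc d) (suc x) = begin
  1 + suc x * (1 + 2 * q)                          ≤⟨ ℕ.m≤m+n _ (x * suc x * q) ⟩
  1 + suc x * (1 + 2 * q) + x * suc x * q          ≡⟨ expand x q ⟩
  (2 + x) * (1 + suc x * q)                        ≤⟨ ℕ.*-monoʳ-≤ (2 + x) (power-lower d (suc x)) ⟩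
  (2 + x) * (2 + x) ^ d                            ∎
  where
  open ℕ.≤-Reasoning
  q = mersenne d
  expand : ∀ x q → 1 + suc x * (1 + 2 * q) + x * suc x * q ≡ (2 + x) * (1 + suc x * q)
  expand = solve-∀

power-exact : ∀ d x → x ≤ 1 → (1 + x) ^ d ≡ 1 + x * mersenne d
power-exact d zero _ = ℕ.^-zeroˡ d
power-exact zero (suc zero) _ = refl
power-exact (suc d) (suc zero) _ = trans (cong (2 *_) (power-exact d 1 ℕ.≤-refl)) (expand (mersenne d))
  where
  expand : ∀ q → 2 * (1 + 1 * q) ≡ 1 + 1 * (1 + 2 * q)
  expand = solve-∀
power-exact d (suc (suc x)) (s≤s ())

cube-power : ∀ a → a * (a * a) ≡ a ^ 3
cube-power a = cong (λ z → a * (a * z)) (sym (ℕ.*-identityʳ a))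

-- Degree sums of a hypertree in terms of the excesses.

module DegreeSums {n m r} {H : Hypergraph n m} (tree : IsHypertree (suc r) H) (1≤r : 1 ≤ r) (1≤m : 1 ≤ m) where

  open IsHypertree tree
  open Hypertree tree (s≤s 1≤r) 1≤m public

  private
    x = excess

  y : Fin n → ℕ
  y v = 1 ⊓ x v

  y≤1 : ∀ v → y v ≤ 1
  y≤1 v = ℕ.m⊓n≤m 1 (x v)

  y≤x : ∀ v → y v ≤ x v
  y≤x v = ℕ.m⊓n≤n 1 (x v)

  shared : Fin m → ℕ
  shared e = total y (elements (edge H e))

  degreePowers₂ : degreePowers H 2 ≡ n + 2 * (m ∸ 1) + sum (λ v → x v * x v)
  degreePowers₂ = begin
    sum (λ v → deg H v ^ 2)                              ≡⟨ sum-cong-≗ (λ v → trans (cong (_^ 2) (deg≡ v)) (expand (x v))) ⟩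
    sum (λ v → 1 + 2 * x v + x v * x v)                  ≡⟨ ∑-distrib-+ (λ v → 1 + 2 * x v) (λ v → x v * x v) ⟩
    sum (λ v → 1 + 2 * x v) + sum (λ v → x v * x v)      ≡⟨ cong (_+ sum (λ v → x v * x v)) (trans (∑-distrib-+ (λ _ → 1) (λ v → 2 * x v))
        (cong₂ _+_ (trans (sum-const n 1) (ℕ.*-identityʳ n)) (trans (sym (*-distribˡ-sum 2 x)) (cong (2 *_) sum-excess)))) ⟩
    n + 2 * (m ∸ 1) + sum (λ v → x v * x v)              ∎
    where
    open ≡-Reasoning
    expand : ∀ x → (1 + x) * ((1 + x) * 1) ≡ 1 + 2 * x + x * x
    expand = solve-∀

  linear-sum : ∀ c → sum (λ v → 1 + x v * c) ≡ n + (m ∸ 1) * c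
  linear-sum c = trans (∑-distrib-+ (λ _ → 1) (λ v → x v * c)) (cong₂ _+_ (trans (sum-const n 1) (ℕ.*-identityʳ n))
    (trans (sum-cong-≗ λ v → ℕ.*-comm (x v) c) (trans (sym (*-distribˡ-sum c x)) (trans (ℕ.*-comm c (sum x)) (cong (_* c) sum-excess)))))

  degreePowers-lower : ∀ d → n + (m ∸ 1) * mersenne d ≤ degreePowers H d
  degreePowers-lower d = subst (_≤ degreePowers H d) (linear-sum (mersenne d))
    (sum-mono λ v → subst (λ z → 1 + x v * mersenne d ≤ z ^ d) (sym (deg≡ v)) (power-lower d (x v)))

  degreeCubes≡ : degreeCubes H ≡ degreePowers H 3
  degreeCubes≡ = sum-cong-≗ λ v → cube-power (deg H v)

  private
    els : Fin m → List (Fin n)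
    els e = elements (edge H e)

  length-els : ∀ e → List.length (els e) ≡ suc r
  length-els e = trans (length-elements (edge H e)) (uniform e)

  sum-total-els : ∀ f → sum (λ e → total f (els e)) ≡ sum (λ v → (1 + x v) * f v)
  sum-total-els f = trans (sum-cong-≗ λ e → total-elements (edge H e) f)
    (trans (sum-incident H f) (sum-cong-≗ λ v → cong (_* f v) (deg≡ v)))

  -- The value of `degreePairs H + m` at a hyperpath with m ≥ 2. The runner-up exceeds it by 1.
  base : ℕ
  base = m * tri (suc r) + 2 * suc r * (m ∸ 1)

  X Y E : ℕ
  X = sum (λ v → (1 + x v) * x v)
  Y = sum (λ v → (1 + x v) * y v)
  E = sum (λ e → e₂ x (els e))

  -- Summing `e₂-shift` over the hyperedges gives k copies of `X`; one cancels against the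
  -- correction on the left, and r = k - 1 remain.
  degreePairs-split : degreePairs H ≡ m * tri (suc r) + r * X + E
  degreePairs-split = ℕ.+-cancelʳ-≡ X _ _ (begin
    degreePairs H + X
      ≡⟨ cong (degreePairs H +_) (sym (sum-total-els x)) ⟩
    degreePairs H + sum (λ e → total x (els e))
      ≡⟨ sym (∑-distrib-+ (λ e → e₂ (deg H) (els e)) (λ e → total x (els e))) ⟩
    sum (λ e → e₂ (deg H) (els e) + total x (els e))
      ≡⟨ sum-cong-≗ (λ e → trans (e₂-shift deg≡ (els e)) (cong (λ L → tri L + L * total x (els e) + e₂ x (els e)) (length-els e))) ⟩
    sum (λ e → tri (suc r) + suc r * total x (els e) + e₂ x (els e))
      ≡⟨ ∑-distrib-+ (λ e → tri (suc r) + suc r * total x (els e)) (λ e → e₂ x (els e)) ⟩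
    sum (λ e → tri (suc r) + suc r * total x (els e)) + E
      ≡⟨ cong (_+ E) (trans (∑-distrib-+ (λ _ → tri (suc r)) (λ e → suc r * total x (els e)))
           (cong₂ _+_ (sum-const m (tri (suc r))) (trans (sym (*-distribˡ-sum (suc r) (λ e → total x (els e)))) (cong (suc r *_) (sum-total-els x))))) ⟩
    m * tri (suc r) + suc r * X + E
      ≡⟨ reorder (m * tri (suc r)) r X E ⟩
    m * tri (suc r) + r * X + E + X ∎)
    where
    open ≡-Reasoning
    reorder : ∀ t r X E → t + suc r * X + E ≡ t + r * X + E + X
    reorder = solve-∀

  -- The share of `v` in `r * X + Y`. It is compared with the linear function 2k x_v, whose sum is
  -- fixed: the two agree for x_v ≤ 1, and from x_v = 2 on the share is larger.
  vertex-part : Fin n → ℕ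
  vertex-part v = (1 + x v) * (r * x v + y v)

  sum-vertex-part : r * X + Y ≡ sum vertex-part
  sum-vertex-part = trans (cong (_+ Y) (*-distribˡ-sum r (λ v → (1 + x v) * x v)))
    (trans (sym (∑-distrib-+ (λ v → r * ((1 + x v) * x v)) (λ v → (1 + x v) * y v)))
      (sum-cong-≗ λ v → collect r (x v) (y v)))
    where
    collect : ∀ r x y → r * ((1 + x) * x) + (1 + x) * y ≡ (1 + x) * (r * x + y)
    collect = solve-∀

  sum-linear : sum (λ v → 2 * suc r * x v) ≡ 2 * suc r * (m ∸ 1)
  sum-linear = trans (sym (*-distribˡ-sum (2 * suc r) x)) (cong (2 * suc r *_) sum-excess)

  -- Equality holds for r = 1 and z = 0, so the surplus of 1 at a vertex of degree three is the best
  -- possible for all r.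
  big : ∀ r z → 1 ≤ r → 2 * suc r * (2 + z) + 1 ≤ (3 + z) * (r * (2 + z) + 1)
  big (suc r) z _ = subst (2 * suc (suc r) * (2 + z) + 1 ≤_) (expand r z) (ℕ.m≤m+n _ (r * (2 + 3 * z + z * z) + 2 * z + z * z))
    where
    expand : ∀ r z → 2 * suc (suc r) * (2 + z) + 1 + (r * (2 + 3 * z + z * z) + 2 * z + z * z) ≡ (3 + z) * (suc r * (2 + z) + 1)
    expand = solve-∀

  small : ∀ r → 2 * suc r * 1 ≡ 2 * (r * 1 + 1)
  small = solve-∀

  vertex-lower : ∀ v → 2 * suc r * x v ≤ vertex-part v
  vertex-lower v with x v
  ... | zero        = ℕ.≤-trans (ℕ.≤-reflexive (ℕ.*-zeroʳ (2 * suc r))) z≤n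
  ... | suc zero    = ℕ.≤-reflexive (small r)
  ... | suc (suc z) = ℕ.≤-trans (ℕ.m≤m+n _ 1) (big r z 1≤r)

  vertex-lower⁺ : ∀ v → 2 ≤ x v → suc (2 * suc r * x v) ≤ vertex-part v
  vertex-lower⁺ v 2≤ with x v
  ... | suc (suc z) = ℕ.≤-trans (ℕ.≤-reflexive (ℕ.+-comm 1 _)) (big r z 1≤r)
  ... | suc zero    = contradiction 2≤ λ { (s≤s ()) }

  vertex-exact : ∀ v → x v ≤ 1 → vertex-part v ≡ 2 * suc r * x v
  vertex-exact v x≤1 with x v
  ... | zero        = trans (ℕ.+-identityʳ _) (trans (cong (_+ 0) (ℕ.*-zeroʳ r)) (sym (ℕ.*-zeroʳ (2 * suc r))))
  ... | suc zero    = sym (small r)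
  ... | suc (suc _) = contradiction x≤1 λ { (s≤s ()) }

  sum-one : sum {m} (λ _ → 1) ≡ m
  sum-one = trans (sum-const m 1) (ℕ.*-identityʳ m)

  edge-lower : Y ≤ E + m
  edge-lower = begin
    Y                                  ≡⟨ sym (sum-total-els y) ⟩
    sum shared                         ≤⟨ sum-mono (λ e → ℕ.≤-trans (e₂-lower y≤1 (els e)) (ℕ.+-monoˡ-≤ 1 (e₂-mono y≤x (els e)))) ⟩
    sum (λ e → e₂ x (els e) + 1)       ≡⟨ ∑-distrib-+ (λ e → e₂ x (els e)) (λ _ → 1) ⟩
    E + sum {m} (λ _ → 1)              ≡⟨ cong (E +_) sum-one ⟩
    E + m                              ∎
    where open ℕ.≤-Reasoning

  edge-lower⁺ : ∀ e → 3 ≤ shared e → suc Y ≤ E + m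
  edge-lower⁺ e₁ 3≤ = begin
    suc Y                              ≡⟨ cong suc (sym (sum-total-els y)) ⟩
    suc (sum shared)                   ≡⟨ ℕ.+-comm 1 (sum shared) ⟩
    sum shared + 1                     ≡⟨ cong (sum shared +_) (sym (sum-δ₁ e₁)) ⟩
    sum shared + sum (λ e → 𝟙 (e ≟ e₁)) ≡⟨ sym (∑-distrib-+ shared (λ e → 𝟙 (e ≟ e₁))) ⟩
    sum (λ e → shared e + 𝟙 (e ≟ e₁))  ≤⟨ sum-mono pointwise ⟩
    sum (λ e → e₂ x (els e) + 1)       ≡⟨ ∑-distrib-+ (λ e → e₂ x (els e)) (λ _ → 1) ⟩
    E + sum {m} (λ _ → 1)              ≡⟨ cong (E +_) sum-one ⟩
    E + m                              ∎
    where
    open ℕ.≤-Reasoning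
    pointwise : ∀ e → shared e + 𝟙 (e ≟ e₁) ≤ e₂ x (els e) + 1
    pointwise e with e ≟ e₁
    ... | yes refl = ℕ.+-monoˡ-≤ 1 (ℕ.≤-trans (e₂-lower₃ y≤1 (els e) 3≤) (e₂-mono y≤x (els e)))
    ... | no _ = ℕ.≤-trans (ℕ.≤-reflexive (ℕ.+-identityʳ _)) (ℕ.≤-trans (e₂-lower y≤1 (els e)) (ℕ.+-monoˡ-≤ 1 (e₂-mono y≤x (els e))))

  vertices-lower : 2 * suc r * (m ∸ 1) ≤ r * X + Y
  vertices-lower = subst₂ _≤_ sum-linear (sym sum-vertex-part) (sum-mono vertex-lower)

  vertices-lower⁺ : ∀ v → 2 ≤ x v → suc (2 * suc r * (m ∸ 1)) ≤ r * X + Y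
  vertices-lower⁺ u 2≤ = begin
    suc (2 * suc r * (m ∸ 1))                               ≡⟨ trans (cong suc (sym sum-linear)) (ℕ.+-comm 1 _) ⟩
    sum (λ v → 2 * suc r * x v) + 1                         ≡⟨ cong (sum (λ v → 2 * suc r * x v) +_) (sym (sum-δ₁ u)) ⟩
    sum (λ v → 2 * suc r * x v) + sum (λ v → 𝟙 (v ≟ u))     ≡⟨ sym (∑-distrib-+ (λ v → 2 * suc r * x v) (λ v → 𝟙 (v ≟ u))) ⟩
    sum (λ v → 2 * suc r * x v + 𝟙 (v ≟ u))                 ≤⟨ sum-mono pointwise ⟩
    sum vertex-part                                         ≡⟨ sym sum-vertex-part ⟩
    r * X + Y                                               ∎
    where
    open ℕ.≤-Reasoning
    pointwise : ∀ v → 2 * suc r * x v + 𝟙 (v ≟ u) ≤ vertex-part v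
    pointwise v with v ≟ u
    ... | yes refl = ℕ.≤-trans (ℕ.≤-reflexive (ℕ.+-comm _ 1)) (vertex-lower⁺ v 2≤)
    ... | no _     = ℕ.≤-trans (ℕ.≤-reflexive (ℕ.+-identityʳ _)) (vertex-lower v)

  pairs-lower : base ≤ degreePairs H + m
  pairs-lower = begin
    m * tri (suc r) + 2 * suc r * (m ∸ 1)   ≤⟨ ℕ.+-monoʳ-≤ (m * tri (suc r)) (ℕ.≤-trans vertices-lower (ℕ.+-monoʳ-≤ (r * X) edge-lower)) ⟩
    m * tri (suc r) + (r * X + (E + m))     ≡⟨ reorder (m * tri (suc r)) (r * X) E m ⟩
    m * tri (suc r) + r * X + E + m         ≡⟨ cong (_+ m) (sym degreePairs-split) ⟩
    degreePairs H + m                       ∎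
    where
    open ℕ.≤-Reasoning
    reorder : ∀ t a b c → t + (a + (b + c)) ≡ t + a + b + c
    reorder = solve-∀

  -- Each kind of branching costs at least 1: a vertex in three hyperedges by `vertices-lower⁺`, a
  -- hyperedge with three shared vertices by `edge-lower⁺`. A hypertree that pays exactly 1 is
  -- therefore second.
  pairs-lower⁺ : (∃ λ v → 2 ≤ x v) ⊎ (∃ λ e → 3 ≤ shared e) → suc base ≤ degreePairs H + m
  pairs-lower⁺ h = begin
    suc (m * tri (suc r) + 2 * suc r * (m ∸ 1))   ≡⟨ sym (ℕ.+-suc (m * tri (suc r)) _) ⟩
    m * tri (suc r) + suc (2 * suc r * (m ∸ 1))   ≤⟨ ℕ.+-monoʳ-≤ (m * tri (suc r)) (both h) ⟩
    m * tri (suc r) + (r * X + (E + m))           ≡⟨ reorder (m * tri (suc r)) (r * X) E m ⟩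
    m * tri (suc r) + r * X + E + m               ≡⟨ cong (_+ m) (sym degreePairs-split) ⟩
    degreePairs H + m                             ∎
    where
    open ℕ.≤-Reasoning
    reorder : ∀ t a b c → t + (a + (b + c)) ≡ t + a + b + c
    reorder = solve-∀
    both : (∃ λ v → 2 ≤ x v) ⊎ (∃ λ e → 3 ≤ shared e) → suc (2 * suc r * (m ∸ 1)) ≤ r * X + (E + m)
    both (inj₁ (v , 2≤)) = ℕ.≤-trans (vertices-lower⁺ v 2≤) (ℕ.+-monoʳ-≤ (r * X) edge-lower)
    both (inj₂ (e , 3≤)) = ℕ.≤-trans (s≤s vertices-lower) (ℕ.≤-trans (ℕ.≤-reflexive (sym (ℕ.+-suc (r * X) Y))) (ℕ.+-monoʳ-≤ (r * X) (edge-lower⁺ e 3≤)))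

  module _ (x≤1 : ∀ v → x v ≤ 1) where

    x≡y : ∀ v → x v ≡ y v
    x≡y v = sym (ℕ.m≥n⇒m⊓n≡n (x≤1 v))

    degreePowers-exact : ∀ d → degreePowers H d ≡ n + (m ∸ 1) * mersenne d
    degreePowers-exact d = trans (sum-cong-≗ λ v → trans (cong (_^ d) (deg≡ v)) (power-exact d (x v) (x≤1 v))) (linear-sum (mersenne d))

    -- When all excesses are at most 1 the vertex shares are exact, and any surplus comes from the
    -- hyperedges. `t` allows for those with three shared vertices: none in a hyperpath, one in the
    -- runner-up.
    pairs-upper : (t : Fin m → ℕ) → (∀ e → t e ≤ 1) → (∀ e → 1 ≤ shared e) → (∀ e → shared e ≤ 2 + t e) →
                  degreePairs H + m ≤ base + sum t
    pairs-upper t t≤1 1≤ ≤2+ = begin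
      degreePairs H + m                                 ≡⟨ cong (_+ m) degreePairs-split ⟩
      m * tri (suc r) + r * X + E + m                   ≡⟨ reorder (m * tri (suc r)) (r * X) E m ⟩
      m * tri (suc r) + r * X + (E + m)                 ≤⟨ ℕ.+-monoʳ-≤ (m * tri (suc r) + r * X) edges ⟩
      m * tri (suc r) + r * X + (Y + sum t)             ≡⟨ reorder′ (m * tri (suc r)) (r * X) Y (sum t) ⟩
      m * tri (suc r) + (r * X + Y) + sum t             ≡⟨ cong (λ z → m * tri (suc r) + z + sum t)
          (trans sum-vertex-part (trans (sum-cong-≗ λ v → vertex-exact v (x≤1 v)) sum-linear)) ⟩
      base + sum t                                      ∎
      where
      open ℕ.≤-Reasoning
      reorder : ∀ t a b c → t + a + b + c ≡ t + a + (b + c)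
      reorder = solve-∀
      reorder′ : ∀ t a b c → t + a + (b + c) ≡ t + (a + b) + c
      reorder′ = solve-∀
      edges : E + m ≤ Y + sum t
      edges = begin
        E + m                              ≡⟨ cong (E +_) (sym sum-one) ⟩
        E + sum {m} (λ _ → 1)              ≡⟨ sym (∑-distrib-+ (λ e → e₂ x (els e)) (λ _ → 1)) ⟩
        sum (λ e → e₂ x (els e) + 1)       ≤⟨ sum-mono (λ e → ℕ.≤-trans (ℕ.+-monoˡ-≤ 1 (e₂-mono (ℕ.≤-reflexive ∘ x≡y) (els e)))
                                                (e₂-upper y≤1 (els e) (t≤1 e) (1≤ e) (≤2+ e))) ⟩
        sum (λ e → shared e + t e)         ≡⟨ ∑-distrib-+ shared t ⟩
        sum shared + sum t                 ≡⟨ cong (_+ sum t) (sum-total-els y) ⟩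
        Y + sum t                          ∎

  shared-sum : ∀ e → shared e ≡ sum (λ v → inc H v e * y v)
  shared-sum e = total-elements (edge H e) y

  y-pos : ∀ {v} → 1 ≤ x v → y v ≡ 1
  y-pos {v} 1≤ = ℕ.m≤n⇒m⊓n≡m 1≤

  two-edges⇒shared : ∀ {v e f} → e ≢ f → v ∈ edge H e → v ∈ edge H f → 1 ≤ x v
  two-edges⇒shared {v} {e} {f} e≢f v∈e v∈f = ℕ.∸-monoˡ-≤ 1 (subst (_≤ deg H v)
    (cong₂ _+_ (𝟙-yes (v ∈? edge H e) v∈e) (𝟙-yes (v ∈? edge H f) v∈f)) (two≤sum (inc H v) e≢f))

  -- `e₂-upper` fails at s = 0, so isolated hyperedges must be excluded. A vertex of another
  -- hyperedge either lies in `e` or is reached by a path that leaves `e` through a shared vertex.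
  shared≥1 : 2 ≤ m → ∀ e → 1 ≤ shared e
  shared≥1 2≤m e = count-shared touching
    where
    count-shared : (∃ λ v → v ∈ edge H e × 1 ≤ x v) → 1 ≤ shared e
    count-shared (v , v∈e , 1≤xv) = subst₂ _≤_ (cong₂ _*_ (𝟙-yes (v ∈? edge H e) v∈e) (y-pos {v} 1≤xv)) (sym (shared-sum e))
      (term≤sum (λ v → inc H v e * y v) v)
    member : ∀ f → ∃ λ v → v ∈ edge H f
    member f with sum-pos (λ v → inc H v f) (subst (1 ≤_) (sym (sum-inc H uniform f)) (s≤s z≤n))
    ... | v , 1≤ = v , 𝟙-pos (v ∈? edge H f) 1≤
    other-edge : ∃ λ f → f ≢ e
    other-edge with Fin.any? (λ f → ¬? (f ≟ e))
    ... | yes p = p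
    ... | no ¬p = contradiction (ℕ.≤-trans 2≤m (ℕ.≤-trans (ℕ.≤-reflexive (sym sum-one))
        (ℕ.≤-trans (sum-mono {f = λ _ → 1} {g = λ f → 𝟙 (f ≟ e)} only) (ℕ.≤-reflexive (sum-δ₁ e))))) λ { (s≤s ()) }
      where
      only : ∀ f → 1 ≤ 𝟙 (f ≟ e)
      only f with f ≟ e
      ... | yes _ = ℕ.≤-refl
      ... | no ¬q = contradiction (f , ¬q) ¬p
    touching : ∃ λ v → v ∈ edge H e × 1 ≤ x v
    touching with other-edge
    ... | f , f≢e with member f | member e
    ...   | w , w∈f | u , u∈e with w ∈? edge H e
    ...     | yes w∈e = w , w∈e , two-edges⇒shared {w} (f≢e ∘ sym) w∈e w∈f
    ...     | no w∉e with crossing H (_∈? edge H e) (connected u w) u∈e w∉e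
    ...       | g , a , b , a∈g , b∈g , a∈e , b∉e = a , a∈e , two-edges⇒shared {a} (λ { refl → b∉e b∈g }) a∈e a∈g

-- Recognising stars and paths

injective⇒permutation : ∀ {n} (f : Fin n → Fin n) → Injective _≡_ _≡_ f →
  ∃ λ (σ : Permutation n n) → ∀ i → σ ⟨$⟩ʳ i ≡ f i
injective⇒permutation {n} f inj = Perm.permutation f (proj₁ ∘ preimage) (proj₂ ∘ preimage) (λ i → inj (proj₂ (preimage (f i)))) , λ _ → refl
  where
  preimage : ∀ j → ∃ λ i → f i ≡ j
  preimage j with Fin.any? (λ i → f i ≟ j)
  ... | yes p = p
  ... | no ¬p = contradiction (Fin.injective⇒≤ (injective-∷ f j inj λ i eq → ¬p (i , eq))) (ℕ.<⇒≱ (ℕ.n<1+n n))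

sum-reindex : ∀ {n} (σ : Permutation n n) (f : Fin n → ℕ) → sum (λ i → f (σ ⟨$⟩ʳ i)) ≡ sum f
sum-reindex σ f = sym (sum-permute f σ)

module Recognition {n m r} {H : Hypergraph n m} (tree : IsHypertree (suc r) H) (1≤r : 1 ≤ r) (1≤m : 1 ≤ m) where

  open DegreeSums tree 1≤r 1≤m public
  open IsHypertree tree

  -- The total excess is m - 1. Distinct vertices that already carry this amount leave nothing for
  -- the others.
  exhaust : ∀ {s} (V : Fin s → Fin n) → Injective _≡_ _≡_ V → m ∸ 1 ≤ sum (excess ∘ V) →
            ∀ v → (∀ j → V j ≢ v) → excess v ≡ 0
  exhaust V inj enough v v∉ = ℕ.n≤0⇒n≡0 (ℕ.+-cancelʳ-≤ (sum (excess ∘ V)) _ _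
    (ℕ.≤-trans (sum-injection (v ◂ V) (injective-∷ V v inj v∉) excess) (ℕ.≤-trans (ℕ.≤-reflexive sum-excess) enough)))

  degree-one : ∀ {v} → excess v ≡ 0 → deg H v ≡ 1
  degree-one {v} eq = trans (deg≡ v) (cong suc eq)

  excess≤1⇒ : ∀ {v e f g} → excess v ≤ 1 → e ≢ f → v ∈ edge H e → v ∈ edge H f → v ∈ edge H g → g ≡ e ⊎ g ≡ f
  excess≤1⇒ {v} {e} {f} {g} ≤1 e≢f v∈e v∈f v∈g with g ≟ e | g ≟ f
  ... | yes p | _     = inj₁ p
  ... | no _  | yes q = inj₂ q
  ... | no ¬p | no ¬q = contradiction (ℕ.≤-trans (ℕ.≤-reflexive (sym (cong₂ _+_ (𝟙-yes (v ∈? edge H g) v∈g)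
        (cong₂ _+_ (𝟙-yes (v ∈? edge H e) v∈e) (𝟙-yes (v ∈? edge H f) v∈f)))))
        (ℕ.≤-trans (three≤sum (inc H v) ¬p ¬q e≢f) (ℕ.≤-trans (ℕ.≤-reflexive (deg≡ v)) (s≤s ≤1)))) λ { (s≤s (s≤s ())) }

  shared≤ : ∀ {s} (V : Fin s → Fin n) → (∀ v → (∀ j → V j ≢ v) → excess v ≡ 0) →
            ∀ e → shared e ≤ sum (λ j → inc H (V j) e)
  shared≤ V off e = begin
    shared e                                                ≡⟨ shared-sum e ⟩
    sum (λ v → inc H v e * y v)                             ≤⟨ sum-mono (λ v → ℕ.*-monoʳ-≤ (inc H v e) (covered-by v)) ⟩
    sum (λ v → inc H v e * sum (λ j → 𝟙 (v ≟ V j)))         ≡⟨ sum-cong-≗ (λ v → *-distribˡ-sum (inc H v e) (λ j → 𝟙 (v ≟ V j))) ⟩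
    sum (λ v → sum (λ j → inc H v e * 𝟙 (v ≟ V j)))         ≡⟨ ∑-comm (λ v j → inc H v e * 𝟙 (v ≟ V j)) ⟩
    sum (λ j → sum (λ v → inc H v e * 𝟙 (v ≟ V j)))
      ≡⟨ sum-cong-≗ (λ j → trans (sum-cong-≗ λ v → ℕ.*-comm (inc H v e) _) (sum-δ (V j) (λ v → inc H v e))) ⟩
    sum (λ j → inc H (V j) e)                               ∎
    where
    open ℕ.≤-Reasoning
    covered-by : ∀ v → y v ≤ sum (λ j → 𝟙 (v ≟ V j))
    covered-by v with Fin.any? (λ j → V j ≟ v)
    ... | yes (j , refl) = ℕ.≤-trans (y≤1 v) (subst (_≤ sum (λ i → 𝟙 (V j ≟ V i))) (𝟙-yes (V j ≟ V j) refl) (term≤sum (λ i → 𝟙 (V j ≟ V i)) j))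
    ... | no ¬p = ℕ.≤-trans (y≤x v) (ℕ.≤-trans (ℕ.≤-reflexive (off v (λ j eq → ¬p (j , eq)))) z≤n)

  two-shared : ∀ {e u v} → u ≢ v → u ∈ edge H e → v ∈ edge H e → 1 ≤ excess u → 1 ≤ excess v → 2 ≤ shared e
  two-shared {e} {u} {v} u≢v u∈ v∈ 1≤u 1≤v = subst₂ _≤_
    (cong₂ _+_ (cong₂ _*_ (𝟙-yes (u ∈? edge H e) u∈) (y-pos {u} 1≤u)) (cong₂ _*_ (𝟙-yes (v ∈? edge H e) v∈) (y-pos {v} 1≤v)))
    (sym (shared-sum e)) (two≤sum (λ v → inc H v e * y v) u≢v)

  three-shared : ∀ {e u v w} → u ≢ v → u ≢ w → v ≢ w → u ∈ edge H e → v ∈ edge H e → w ∈ edge H e →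
    1 ≤ excess u → 1 ≤ excess v → 1 ≤ excess w → 3 ≤ shared e
  three-shared {e} {u} {v} {w} u≢v u≢w v≢w u∈ v∈ w∈ 1≤u 1≤v 1≤w = subst₂ _≤_
    (cong₂ _+_ (cong₂ _*_ (𝟙-yes (u ∈? edge H e) u∈) (y-pos {u} 1≤u))
      (cong₂ _+_ (cong₂ _*_ (𝟙-yes (v ∈? edge H e) v∈) (y-pos {v} 1≤v)) (cong₂ _*_ (𝟙-yes (w ∈? edge H e) w∈) (y-pos {w} 1≤w))))
    (sym (shared-sum e)) (three≤sum (λ v → inc H v e * y v) u≢v u≢w v≢w)

  full-degree⇒∈ : ∀ {c} → deg H c ≡ m → ∀ e → c ∈ edge H e
  full-degree⇒∈ {c} eq e = 𝟙-pos (c ∈? edge H e) (ℕ.≤-reflexive (sym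
    (sum-tight {f = inc H c} {g = λ _ → 1} (λ e → 𝟙≤1 (c ∈? edge H e)) (ℕ.≤-reflexive (trans sum-one (sym eq))) e)))

  ∈⇒full-degree : ∀ {c} → (∀ e → c ∈ edge H e) → deg H c ≡ m
  ∈⇒full-degree {c} c∈ = trans (sum-cong-≗ λ e → 𝟙-yes (c ∈? edge H e) (c∈ e)) sum-one

  star-private : ∀ {c} → (∀ e → c ∈ edge H e) → ∀ v → (∀ (j : Fin 1) → c ≢ v) → deg H v ≡ 1
  star-private {c} c∈ v c≢v = degree-one {v} (exhaust (λ (_ : Fin 1) → c) (λ { {zero} {zero} _ → refl })
    (ℕ.≤-reflexive (trans (cong (_∸ 1) (sym (∈⇒full-degree c∈))) (sym (ℕ.+-identityʳ (excess c))))) v c≢v)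

  -- m - 1 distinct vertices of positive excess use up the total: each has excess exactly 1, and
  -- every other vertex is cored. Exhibiting the shared vertices thus fixes all degrees.
  module Exhausting {s} (V : Fin s → Fin n) (V-injective : Injective _≡_ _≡_ V) (s≡ : s ≡ m ∸ 1)
    (excess-V : ∀ j → 1 ≤ excess (V j)) where

    sum-ones : sum {s} (λ _ → 1) ≡ m ∸ 1
    sum-ones = trans (sum-const s 1) (trans (ℕ.*-identityʳ s) s≡)

    off-V : ∀ v → (∀ j → V j ≢ v) → excess v ≡ 0
    off-V = exhaust V V-injective (ℕ.≤-trans (ℕ.≤-reflexive (sym sum-ones)) (sum-mono excess-V))

    excess-V≡ : ∀ j → 1 ≡ excess (V j)
    excess-V≡ = sum-tight excess-V (ℕ.≤-trans (sum-injection V V-injective excess)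
      (ℕ.≤-reflexive (trans sum-excess (sym sum-ones))))

    excess≤1 : ∀ v → excess v ≤ 1
    excess≤1 v with Fin.any? (λ j → V j ≟ v)
    ... | yes (j , refl) = ℕ.≤-reflexive (sym (excess-V≡ j))
    ... | no ¬p = ℕ.≤-trans (ℕ.≤-reflexive (off-V v (λ j eq → ¬p (j , eq)))) z≤n

star-isomorphism : ∀ {n m r} {G H : Hypergraph n m} → IsHypertree (suc r) G → IsHypertree (suc r) H → 1 ≤ r → 1 ≤ m →
  ∀ {c c′} → (∀ e → c ∈ edge G e) → (∀ e → c′ ∈ edge H e) → G ≅ H
star-isomorphism {G = G} {H} treeG treeH 1≤r 1≤m {c} {c′} c∈ c′∈ = Skeleton.isomorphism {s = 1} G H
  (λ e → trans (IsHypertree.uniform treeG e) (sym (IsHypertree.uniform treeH e)))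
  (λ _ → c) (λ _ → c′) (λ { {zero} {zero} _ → refl }) (λ { {zero} {zero} _ → refl })
  (λ _ e _ → c′∈ e) (λ _ e _ → c∈ e)
  (Recognition.star-private treeG 1≤r 1≤m c∈) (Recognition.star-private treeH 1≤r 1≤m c′∈)

-- Only the incidences of the joints with consecutive hyperedges are supplied; the count in
-- `Exhausting` shows that the joints have no others.
module PathLike {n q r} {H : Hypergraph n (suc q)} (tree : IsHypertree (suc r) H) (1≤r : 1 ≤ r)
  (σ : Permutation (suc q) (suc q)) (V : Fin q → Fin n) (V-injective : Injective _≡_ _≡_ V)
  (V∈₁ : ∀ j → V j ∈ edge H (σ ⟨$⟩ʳ inject₁ j)) (V∈₂ : ∀ j → V j ∈ edge H (σ ⟨$⟩ʳ suc j)) where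

  open Recognition tree 1≤r (s≤s z≤n)

  σ≢ : ∀ j → σ ⟨$⟩ʳ inject₁ j ≢ σ ⟨$⟩ʳ suc j
  σ≢ j eq = ℕ.1+n≢n (trans (cong toℕ (sym (permutation-injective σ eq))) (Fin.toℕ-inject₁ j))

  excess-V : ∀ j → 1 ≤ excess (V j)
  excess-V j = two-edges⇒shared {V j} (σ≢ j) (V∈₁ j) (V∈₂ j)

  open Exhausting V V-injective refl excess-V public

  V∈⇒ : ∀ j e → V j ∈ edge H (σ ⟨$⟩ʳ e) → e ≡ inject₁ j ⊎ e ≡ suc j
  V∈⇒ j e V∈ with excess≤1⇒ (excess≤1 (V j)) (σ≢ j) (V∈₁ j) (V∈₂ j) V∈
  ... | inj₁ p = inj₁ (permutation-injective σ p)
  ... | inj₂ p = inj₂ (permutation-injective σ p)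

  incidences≤2 : ∀ e → sum (λ j → inc H (V j) (σ ⟨$⟩ʳ e)) ≤ 2
  incidences≤2 e = begin
    sum (λ j → inc H (V j) (σ ⟨$⟩ʳ e))                        ≤⟨ sum-mono bound ⟩
    sum (λ j → 𝟙 (inject₁ j ≟ e) + 𝟙 (suc j ≟ e))             ≡⟨ ∑-distrib-+ (λ j → 𝟙 (inject₁ j ≟ e)) (λ j → 𝟙 (suc j ≟ e)) ⟩
    sum (λ j → 𝟙 (inject₁ j ≟ e)) + sum (λ j → 𝟙 (suc j ≟ e))
      ≤⟨ ℕ.+-mono-≤ (at-most-one inject₁ Fin.inject₁-injective) (at-most-one suc Fin.suc-injective) ⟩
    2                                                         ∎
    where
    open ℕ.≤-Reasoning
    at-most-one : (f : Fin q → Fin (suc q)) → Injective _≡_ _≡_ f → sum (λ j → 𝟙 (f j ≟ e)) ≤ 1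
    at-most-one f inj = ℕ.≤-trans (sum-injection f inj (λ i → 𝟙 (i ≟ e))) (ℕ.≤-reflexive (sum-δ₁ e))
    bound : ∀ j → inc H (V j) (σ ⟨$⟩ʳ e) ≤ 𝟙 (inject₁ j ≟ e) + 𝟙 (suc j ≟ e)
    bound j with V j ∈? edge H (σ ⟨$⟩ʳ e)
    ... | no _ = z≤n
    ... | yes V∈ with V∈⇒ j e V∈
    ...   | inj₁ refl = ℕ.≤-trans (ℕ.≤-reflexive (sym (𝟙-yes (inject₁ j ≟ inject₁ j) refl))) (ℕ.m≤m+n _ _)
    ...   | inj₂ refl = ℕ.≤-trans (ℕ.≤-reflexive (sym (𝟙-yes (suc j ≟ suc j) refl))) (ℕ.m≤n+m _ (𝟙 (inject₁ j ≟ suc j)))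

  shared≤2 : ∀ e → shared e ≤ 2
  shared≤2 e = ℕ.≤-trans (shared≤ V off-V e) (subst (λ f → sum (λ j → inc H (V j) f) ≤ 2) (Perm.inverseʳ σ) (incidences≤2 (σ ⟨$⟩ˡ e)))

  private-V : ∀ v → (∀ j → V j ≢ v) → deg H v ≡ 1
  private-V v v∉ = degree-one {v} (off-V v v∉)

relabel : ∀ {n m} → Permutation m m → Hypergraph n m → Hypergraph n m
relabel σ H = hypergraph λ e → edge H (σ ⟨$⟩ʳ e)

-- A certificate for being a hyperpath: `V j` joins the hyperedges in positions j and j + 1. By
-- `path-isomorphism` two uniform hypertrees of equal size that carry one are isomorphic.
record PathOrder {n q} (H : Hypergraph n (suc q)) : Set where
  field
    σ           : Permutation (suc q) (suc q)
    V           : Fin q → Fin n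
    V-injective : Injective _≡_ _≡_ V
    V∈₁         : ∀ j → V j ∈ edge H (σ ⟨$⟩ʳ inject₁ j)
    V∈₂         : ∀ j → V j ∈ edge H (σ ⟨$⟩ʳ suc j)

  joined : ∀ j e → e ≡ inject₁ j ⊎ e ≡ suc j → V j ∈ edge H (σ ⟨$⟩ʳ e)
  joined j _ (inj₁ refl) = V∈₁ j
  joined j _ (inj₂ refl) = V∈₂ j

-- `Skeleton` compares hyperedges of equal index, so both hypertrees are relabelled along their
-- orders. The bijection of hyperedges goes back along `σᴳ` and forth along `σᴴ`.
path-isomorphism : ∀ {n q r} {G H : Hypergraph n (suc q)} → IsHypertree (suc r) G → IsHypertree (suc r) H → 1 ≤ r →
  PathOrder G → PathOrder H → G ≅ H
path-isomorphism {n} {q} {r} {G} {H} treeG treeH 1≤r orderG orderH = record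
  { vertices  = S.π
  ; edges     = Perm.flip σᴳ Perm.∘ₚ σᴴ
  ; incidence = λ v e → mk⇔
      (λ v∈ → Equivalence.to (S.π-incidence v (σᴳ ⟨$⟩ˡ e)) (subst (λ f → v ∈ edge G f) (sym (Perm.inverseʳ σᴳ)) v∈))
      (λ πv∈ → subst (λ f → v ∈ edge G f) (Perm.inverseʳ σᴳ) (Equivalence.from (S.π-incidence v (σᴳ ⟨$⟩ˡ e)) πv∈))
  }
  where
  module OG = PathOrder orderG
  module OH = PathOrder orderH
  σᴳ = OG.σ
  σᴴ = OH.σ
  module PG = PathLike treeG 1≤r OG.σ OG.V OG.V-injective OG.V∈₁ OG.V∈₂
  module PH = PathLike treeH 1≤r OH.σ OH.V OH.V-injective OH.V∈₁ OH.V∈₂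
  module S = Skeleton (relabel σᴳ G) (relabel σᴴ H)
    (λ e → trans (IsHypertree.uniform treeG (σᴳ ⟨$⟩ʳ e)) (sym (IsHypertree.uniform treeH (σᴴ ⟨$⟩ʳ e))))
    OG.V OH.V OG.V-injective OH.V-injective
    (λ j e → OH.joined j e ∘ PG.V∈⇒ j e) (λ j e → OG.joined j e ∘ PH.V∈⇒ j e)
    (λ v v∉ → trans (sum-reindex σᴳ (inc G v)) (PG.private-V v v∉))
    (λ v v∉ → trans (sum-reindex σᴴ (inc H v)) (PH.private-V v v∉))

-- A hypertree in which every vertex lies in at most two hyperedges and every hyperedge has
-- at most two such vertices is traversed from an end hyperedge; the traversal can only be
-- extended at its head.

module Traverse {n q r} {H : Hypergraph n (suc q)} (tree : IsHypertree (suc r) H) (1≤r : 1 ≤ r) where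

  open Recognition tree 1≤r (s≤s z≤n)
  open IsHypertree tree

  -- The newest hyperedge stands at the head, and the last entry is an end hyperedge. `v` is the
  -- joint between `f` and `e`.
  data Chain : ∀ {c} → Vec (Fin (suc q)) (suc c) → Set where
    start : ∀ {e} → shared e ≤ 1 → Chain (e ∷ [])
    step  : ∀ {c e f} {es : Vec (Fin (suc q)) c} v → Chain (e ∷ es) → v ∈ edge H f → v ∈ edge H e →
            (∀ i → Vec.lookup (e ∷ es) i ≢ f) → Chain (f ∷ e ∷ es)

  chain-injective : ∀ {c} {es : Vec (Fin (suc q)) (suc c)} → Chain es → ∀ {i j} → Vec.lookup es i ≡ Vec.lookup es j → i ≡ j
  chain-injective (start _) {zero} {zero} _ = refl
  chain-injective (step _ C _ _ f∉) {zero}  {zero}  _  = refl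
  chain-injective (step _ C _ _ f∉) {zero}  {suc j} eq = contradiction (sym eq) (f∉ j)
  chain-injective (step _ C _ _ f∉) {suc i} {zero}  eq = contradiction eq (f∉ i)
  chain-injective (step _ C _ _ f∉) {suc i} {suc j} eq = cong suc (chain-injective C eq)

  joints : ∀ {c} {es : Vec (Fin (suc q)) (suc c)} → Chain es → ∀ j → ∃ λ v →
           v ∈ edge H (Vec.lookup es (inject₁ j)) × v ∈ edge H (Vec.lookup es (suc j))
  joints (step v C v∈f v∈e _) zero    = v , v∈f , v∈e
  joints (step _ C _ _ _)     (suc j) = joints C j

  module _ (excess≤1 : ∀ v → excess v ≤ 1) (shared≤2 : ∀ e → shared e ≤ 2) where

    not-three : ∀ {v e f g} → e ≢ f → g ≢ e → g ≢ f → v ∈ edge H e → v ∈ edge H f → v ∉ edge H g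
    not-three {v} e≢f g≢e g≢f v∈e v∈f v∈g with excess≤1⇒ (excess≤1 v) e≢f v∈e v∈f v∈g
    ... | inj₁ p = g≢e p
    ... | inj₂ p = g≢f p

    -- Behind the head all shared vertices are taken: an inner hyperedge has its two joints, the end
    -- hyperedge its one. Meeting a new hyperedge `f` would require a further shared vertex, since a
    -- joint that also lies in `f` would belong to three hyperedges.
    blocked : ∀ {c} {e} {es : Vec (Fin (suc q)) c} → Chain (e ∷ es) → ∀ i {w f} →
              w ∈ edge H (Vec.lookup es i) → w ∈ edge H f → ¬ (∀ j → Vec.lookup (e ∷ es) j ≢ f)
    blocked (step v C v∈f′ v∈e f′∉) (suc i) w∈g w∈f f∉ = blocked C i w∈g w∈f (f∉ ∘ suc)
    blocked (step v (start ≤1) v∈f′ v∈e f′∉) zero {w} {f} w∈e w∈f f∉ =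
      ℕ.<⇒≱ (two-shared {u = v} {v = w}
        (λ { refl → not-three (f′∉ zero) (f∉ (suc zero) ∘ sym) (f∉ zero ∘ sym) v∈e v∈f′ w∈f }) v∈e w∈e
        (two-edges⇒shared {v} (f′∉ zero) v∈e v∈f′) (two-edges⇒shared {w} (f∉ (suc zero)) w∈e w∈f)) ≤1
    blocked (step {e = e} v (step {e = e′} u C u∈e u∈e′ e∉) v∈f′ v∈e f′∉) zero {w} {f} w∈e w∈f f∉ =
      ℕ.<⇒≱ (three-shared {u = v} {v = u} {w = w}
        (λ { refl → not-three (f′∉ zero) (e∉ zero) (f′∉ (suc zero)) v∈e v∈f′ u∈e′ })
        (λ { refl → not-three (f′∉ zero) (f∉ (suc zero) ∘ sym) (f∉ zero ∘ sym) v∈e v∈f′ w∈f })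
        (λ { refl → not-three (e∉ zero) (f∉ (suc (suc zero)) ∘ sym) (f∉ (suc zero) ∘ sym) u∈e′ u∈e w∈f })
        v∈e u∈e w∈e
        (two-edges⇒shared {v} (f′∉ zero) v∈e v∈f′) (two-edges⇒shared {u} (e∉ zero) u∈e′ u∈e) (two-edges⇒shared {w} (f∉ (suc zero)) w∈e w∈f))
        (shared≤2 e)

    -- With two shared vertices in every hyperedge there would be 2m incidences of shared vertices,
    -- but m - 1 vertices of degree two have only 2 (m - 1).
    first : ∃ λ e → shared e ≤ 1
    first with Fin.any? (λ e → shared e ℕ.≤? 1)
    ... | yes p = p
    ... | no ¬p = contradiction (begin
      suc q * 2                       ≡⟨ sum-const (suc q) 2 ⟨
      sum {suc q} (λ _ → 2)           ≤⟨ sum-mono (λ e → ℕ.≰⇒> (λ le → ¬p (e , le))) ⟩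
      sum shared                      ≡⟨ sum-total-els y ⟩
      sum (λ v → (1 + excess v) * y v) ≡⟨ sum-cong-≗ (λ v → cong ((1 + excess v) *_) (sym (x≡y excess≤1 v))) ⟩
      sum (λ v → (1 + excess v) * excess v) ≤⟨ sum-mono (λ v → ℕ.*-monoˡ-≤ (excess v) (s≤s (excess≤1 v))) ⟩
      sum (λ v → 2 * excess v)        ≡⟨ trans (sym (*-distribˡ-sum 2 excess)) (cong (2 *_) sum-excess) ⟩
      2 * q                           ≡⟨ ℕ.*-comm 2 q ⟩
      q * 2                           ∎) (ℕ.<⇒≱ (ℕ.m≤n⇒m≤1+n (ℕ.n<1+n (q * 2))))
      where open ℕ.≤-Reasoning

    -- Connectedness yields a new hyperedge that meets the chain somewhere, and `blocked` forces
    -- this place to be the head.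
    extend : ∀ {c} (es : Vec (Fin (suc q)) (suc c)) → Chain es → suc c < suc q → ∃ λ f → Chain (f ∷ es)
    extend {c} (e ∷ es) C short = touching missing
      where
      missing : ∃ λ f → ∀ i → Vec.lookup (e ∷ es) i ≢ f
      missing with Fin.any? (λ f → Fin.all? (λ i → ¬? (Vec.lookup (e ∷ es) i ≟ f)))
      ... | yes p = p
      ... | no ¬p = contradiction (Fin.injective⇒≤ {f = proj₁ ∘ position} λ {f} {g} eq →
              trans (sym (proj₂ (position f))) (trans (cong (Vec.lookup (e ∷ es)) eq) (proj₂ (position g)))) (ℕ.<⇒≱ short)
        where
        position : ∀ f → ∃ λ i → Vec.lookup (e ∷ es) i ≡ f
        position f with Fin.any? (λ i → Vec.lookup (e ∷ es) i ≟ f)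
        ... | yes q = q
        ... | no ¬q = contradiction (f , λ i eq → ¬q (i , eq)) ¬p
      member : ∀ f → ∃ λ v → v ∈ edge H f
      member f with sum-pos (λ v → inc H v f) (subst (1 ≤_) (sym (sum-inc H uniform f)) (s≤s z≤n))
      ... | v , 1≤ = v , 𝟙-pos (v ∈? edge H f) 1≤
      Reached : Fin n → Set
      Reached v = ∃ λ i → v ∈ edge H (Vec.lookup (e ∷ es) i)
      reached? : ∀ v → Dec (Reached v)
      reached? v = Fin.any? λ i → v ∈? edge H (Vec.lookup (e ∷ es) i)
      attach : ∀ {f w} i → w ∈ edge H (Vec.lookup (e ∷ es) i) → w ∈ edge H f → (∀ i → Vec.lookup (e ∷ es) i ≢ f) → ∃ λ f → Chain (f ∷ e ∷ es)
      attach {f} {w} zero    w∈e w∈f f∉ = f , step w C w∈f w∈e f∉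
      attach         (suc i) w∈g w∈f f∉ = contradiction f∉ (blocked C i w∈g w∈f)
      touching : (∃ λ f → ∀ i → Vec.lookup (e ∷ es) i ≢ f) → ∃ λ f → Chain (f ∷ e ∷ es)
      touching (f , f∉) with member f | member e
      ... | w , w∈f | u , u∈e with reached? w
      ...   | yes (i , w∈) = attach i w∈ w∈f f∉
      ...   | no ¬reached with crossing H reached? (connected u w) (zero , u∈e) ¬reached
      ...     | g , a , b , a∈g , b∈g , (i , a∈) , ¬b = attach i a∈ a∈g λ { j refl → ¬b (j , b∈g) }

    chain : ∀ c → c ≤ q → ∃ λ (es : Vec (Fin (suc q)) (suc c)) → Chain es
    chain zero    _ = let e , ≤1 = first in e ∷ [] , start ≤1
    chain (suc c) c<q with chain c (ℕ.<⇒≤ c<q)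
    ... | es , C with extend es C (s≤s c<q)
    ...   | f , C′ = f ∷ es , C′

    path-order : PathOrder H
    path-order with chain q ℕ.≤-refl
    ... | es , C with injective⇒permutation (Vec.lookup es) (chain-injective C)
    ...   | σ , σ≡ = record
      { σ           = σ
      ; V           = V
      ; V-injective = λ {j} {l} → V-injective j l
      ; V∈₁         = λ j → subst (λ e → V j ∈ edge H e) (sym (σ≡ (inject₁ j))) (proj₁ (proj₂ (joints C j)))
      ; V∈₂         = λ j → subst (λ e → V j ∈ edge H e) (sym (σ≡ (suc j))) (proj₂ (proj₂ (joints C j)))
      }
      where
      V : Fin q → Fin n
      V j = proj₁ (joints C j)
      apart : ∀ {i j} → toℕ i ≢ toℕ j → Vec.lookup es i ≢ Vec.lookup es j
      apart i≢j eq = i≢j (cong toℕ (chain-injective C eq))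
      -- A common vertex would lie in the three distinct hyperedges in positions j, j + 1 and l + 1.
      later : ∀ {j l} → toℕ j < toℕ l → V j ≢ V l
      later {j} {l} j<l eq = not-three
        (apart (λ p → ℕ.1+n≢n (trans (sym p) (Fin.toℕ-inject₁ j))))
        (apart (λ p → ℕ.<⇒≢ (ℕ.<-trans j<l (ℕ.n<1+n _)) (trans (sym (Fin.toℕ-inject₁ j)) (sym p))))
        (apart (λ p → ℕ.<⇒≢ (s≤s j<l) (sym p)))
        (proj₁ (proj₂ (joints C j))) (proj₂ (proj₂ (joints C j)))
        (subst (_∈ edge H (Vec.lookup es (suc l))) (sym eq) (proj₂ (proj₂ (joints C l))))
      V-injective : ∀ j l → V j ≡ V l → j ≡ l
      V-injective j l eq with ℕ.<-cmp (toℕ j) (toℕ l)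
      ... | Tri.tri< lt _ _ = contradiction eq (later lt)
      ... | Tri.tri≈ _ e _  = toℕ-injective e
      ... | Tri.tri> _ _ gt = contradiction (sym eq) (later gt)

-- Hypertrees with ordered hyperedges

cyclicSuc≢ : ∀ {l} (i : Fin (2 + l)) → cyclicSuc i ≢ i
cyclicSuc≢ i eq with toℕ-cyclicSuc i
... | inj₁ (p , _) = ℕ.1+n≢n (trans (sym p) (cong toℕ eq))
... | inj₂ (p , q) = contradiction (trans (sym q) (trans (sym (cong toℕ eq)) p)) λ ()

cyclicPred : ∀ {l} (i : Fin (suc l)) → ∃ λ j → cyclicSuc j ≡ i
cyclicPred {l} zero with toℕ-cyclicSuc (Fin.fromℕ l)
... | inj₁ (_ , lt) = contradiction lt (ℕ.≤⇒≯ (s≤s (ℕ.≤-reflexive (sym (Fin.toℕ-fromℕ l)))))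
... | inj₂ (p , _)  = Fin.fromℕ l , toℕ-injective p
cyclicPred {l} (suc i) with toℕ-cyclicSuc (inject₁ i)
... | inj₁ (p , _) = inject₁ i , toℕ-injective (trans p (cong suc (Fin.toℕ-inject₁ i)))
... | inj₂ (_ , q) = contradiction (trans (sym (Fin.toℕ-inject₁ i)) q) (ℕ.<⇒≢ (Fin.toℕ<n i))

argmax : ∀ {l} (f : Fin (suc l) → ℕ) → ∃ λ i → ∀ j → f j ≤ f i
argmax {zero}  f = zero , λ { zero → ℕ.≤-refl }
argmax {suc l} f with argmax (f ∘ suc)
... | i , max with ℕ.≤-total (f zero) (f (suc i))
...   | inj₁ le = suc i , λ { zero → le ; (suc j) → max j }
...   | inj₂ ge = zero , λ { zero → ℕ.≤-refl ; (suc j) → ℕ.≤-trans (max j) ge }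

Early : ∀ {n m} → Hypergraph (suc n) m → Fin m → Fin (suc n) → Set
Early H e u = u ≡ zero ⊎ (∃ λ f → toℕ f < toℕ e × u ∈ edge H f)

-- A building order in which each hyperedge meets the root and the earlier hyperedges in at most one
-- vertex. Unlike acyclicity this is a local condition, and it survives coalescence. The root counts
-- as early because gluing identifies it with a vertex of a hypergraph whose hyperedges come
-- earlier.
record Rooted {n m} (k : ℕ) (H : Hypergraph (suc n) m) : Set where
  field
    uniform : Uniform k H
    reach   : ∀ v → Star (Adjacent H) zero v
    ordered : ∀ e {u v} → u ∈ edge H e → v ∈ edge H e → Early H e u → Early H e v → u ≡ v

-- On a cycle, the hyperedge of largest index contains two cycle vertices that also lie in its
-- neighbours on the cycle. Both are early, hence equal, a contradiction. Likewise, of two equal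
-- hyperedges the later would have at least two early vertices.
rooted⇒hypertree : ∀ {n m r} {H : Hypergraph (suc n) m} → 1 ≤ r → Rooted (suc r) H → IsHypertree (suc r) H
rooted⇒hypertree {n} {m} {r} {H} 1≤r R = record
  { simple    = simple
  ; uniform   = uniform
  ; connected = λ u v → Star.reverse (λ { (via e p q) → via e q p }) (reach u) ◅◅ reach v
  ; acyclic   = acyclic
  }
  where
  open Rooted R
  separate : ∀ {e f} → toℕ f < toℕ e → edge H e ≢ edge H f
  separate {e} {f} f<e eq with sum-pos (λ v → inc H v e) (subst (1 ≤_) (sym (sum-inc H uniform e)) (s≤s z≤n))
  ... | u , 1≤ with 𝟙-pos (u ∈? edge H e) 1≤ | second-vertex H 1≤r uniform e u
  ...   | u∈ | v , v∈ , v≢u = v≢u (ordered e v∈ u∈ (inj₂ (f , f<e , subst (v ∈_) eq v∈)) (inj₂ (f , f<e , subst (u ∈_) eq u∈)))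
  simple : Injective _≡_ _≡_ (edge H)
  simple {e} {f} eq with ℕ.<-cmp (toℕ e) (toℕ f)
  ... | Tri.tri< lt _ _ = contradiction (sym eq) (separate lt)
  ... | Tri.tri≈ _ p _  = toℕ-injective p
  ... | Tri.tri> _ _ gt = contradiction eq (separate gt)
  acyclic : ¬ Cycle H
  acyclic C with argmax (toℕ ∘ Cycle.hyperedge C)
  ... | i , max with cyclicPred i
  ...   | j , j≡ = cyclicSuc≢ i (sym (vertex-distinct (ordered (hyperedge i) (vertex∈edge i) (next-vertex∈edge i)
      (inj₂ (hyperedge j , before (λ eq → cyclicSuc≢ j (trans j≡ (sym (edge-distinct eq)))) , subst (λ z → vertex z ∈ edge H (hyperedge j)) j≡ (next-vertex∈edge j)))
      (inj₂ (hyperedge (cyclicSuc i) , before (λ eq → cyclicSuc≢ i (edge-distinct eq)) , vertex∈edge (cyclicSuc i))))))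
    where
    open Cycle C
    before : ∀ {l} → hyperedge l ≢ hyperedge i → toℕ (hyperedge l) < toℕ (hyperedge i)
    before {l} neq = ℕ.≤∧≢⇒< (max l) (neq ∘ toℕ-injective)

-- Coalescence of hypergraphs at a vertex

∈-++ˡ⁺ : ∀ {n n′} {p : Subset n} {q : Subset n′} {y} → y ∈ p → y ↑ˡ n′ ∈ p Vec.++ q
∈-++ˡ⁺ Vec.here      = Vec.here
∈-++ˡ⁺ (Vec.there p) = Vec.there (∈-++ˡ⁺ p)

∈-++ʳ⁺ : ∀ {n n′} (p : Subset n) {q : Subset n′} {w} → w ∈ q → n ↑ʳ w ∈ p Vec.++ q
∈-++ʳ⁺ []      w∈ = w∈
∈-++ʳ⁺ (_ ∷ p) w∈ = Vec.there (∈-++ʳ⁺ p w∈)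

∈-++⁻ : ∀ {n n′} (p : Subset n) {q : Subset n′} {x} → x ∈ p Vec.++ q →
        (∃ λ y → x ≡ y ↑ˡ n′ × y ∈ p) ⊎ (∃ λ w → x ≡ n ↑ʳ w × w ∈ q)
∈-++⁻ []      x∈ = inj₂ (_ , refl , x∈)
∈-++⁻ (_ ∷ p) Vec.here = inj₁ (zero , refl , Vec.here)
∈-++⁻ (_ ∷ p) (Vec.there x∈) with ∈-++⁻ p x∈
... | inj₁ (y , refl , y∈) = inj₁ (suc y , refl , Vec.there y∈)
... | inj₂ (w , refl , w∈) = inj₂ (w , refl , w∈)

∣++∣ : ∀ {n n′} (p : Subset n) (q : Subset n′) → ∣ p Vec.++ q ∣ ≡ ∣ p ∣ + ∣ q ∣
∣++∣ []          q = refl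
∣++∣ (true ∷ p)  q = cong suc (∣++∣ p q)
∣++∣ (false ∷ p) q = ∣++∣ p q

module Coalesce {n m n′ m′} (G : Hypergraph n m) (v : Fin n) (H : Hypergraph (suc n′) m′) where

  C : Hypergraph (n + n′) (m + m′)
  C = coalesce G v H

  ι : Fin (suc n′) → Fin (n + n′)
  ι zero    = v ↑ˡ n′
  ι (suc w) = n ↑ʳ w

  left≢right : ∀ (y : Fin n) (w : Fin n′) → y ↑ˡ n′ ≢ n ↑ʳ w
  left≢right y w eq with trans (sym (Fin.splitAt-↑ˡ n y n′)) (trans (cong (splitAt n) eq) (Fin.splitAt-↑ʳ n n′ w))
  ... | ()

  ι-injective : ∀ {a b} → ι a ≡ ι b → a ≡ b
  ι-injective {zero}  {zero}  _  = refl
  ι-injective {zero}  {suc w} eq = contradiction eq (left≢right v w)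
  ι-injective {suc w} {zero}  eq = contradiction (sym eq) (left≢right v w)
  ι-injective {suc w} {suc z} eq = cong suc (Fin.↑ʳ-injective n w z eq)

  ι≡left : ∀ {a y} → ι a ≡ y ↑ˡ n′ → a ≡ zero × y ≡ v
  ι≡left {zero}  {y} eq = refl , sym (Fin.↑ˡ-injective n′ v y eq)
  ι≡left {suc w} {y} eq = contradiction (sym eq) (left≢right y w)

  edge-left : ∀ e → edge C (e ↑ˡ m′) ≡ edge G e Vec.++ ⊥
  edge-left e rewrite Fin.splitAt-↑ˡ m e m′ = refl

  ∈-left⁺ : ∀ {y e} → y ∈ edge G e → y ↑ˡ n′ ∈ edge C (e ↑ˡ m′)
  ∈-left⁺ {y} {e} y∈ = subst (y ↑ˡ n′ ∈_) (sym (edge-left e)) (∈-++ˡ⁺ y∈)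

  ∈-left⁻ : ∀ {x e} → x ∈ edge C (e ↑ˡ m′) → ∃ λ y → x ≡ y ↑ˡ n′ × y ∈ edge G e
  ∈-left⁻ {x} {e} x∈ with ∈-++⁻ (edge G e) (subst (x ∈_) (edge-left e) x∈)
  ... | inj₁ p = p
  ... | inj₂ (w , _ , w∈) = contradiction w∈ ∉⊥

  ∈-right⁺ : ∀ {a e} → a ∈ edge H e → ι a ∈ edge C (m ↑ʳ e)
  ∈-right⁺ {a} {e} a∈ rewrite Fin.splitAt-↑ʳ m m′ e with edge H e
  ∈-right⁺ {zero}  Vec.here       | true ∷ p = ∈-++ˡ⁺ (x∈⁅x⁆ v)
  ∈-right⁺ {suc w} (Vec.there w∈) | s ∷ p    = ∈-++ʳ⁺ (if s then ⁅ v ⁆ else ⊥) w∈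

  ∈-right⁻ : ∀ {x e} → x ∈ edge C (m ↑ʳ e) → ∃ λ a → x ≡ ι a × a ∈ edge H e
  ∈-right⁻ {x} {e} x∈ rewrite Fin.splitAt-↑ʳ m m′ e with edge H e
  ∈-right⁻ x∈ | true ∷ p with ∈-++⁻ ⁅ v ⁆ x∈
  ... | inj₁ (y , refl , y∈) = zero , cong (_↑ˡ n′) (x∈⁅y⁆⇒x≡y v y∈) , Vec.here
  ... | inj₂ (w , refl , w∈) = suc w , refl , Vec.there w∈
  ∈-right⁻ x∈ | false ∷ p with ∈-++⁻ (⊥ {n}) x∈
  ... | inj₁ (y , _ , y∈) = contradiction y∈ ∉⊥
  ... | inj₂ (w , refl , w∈) = suc w , refl , Vec.there w∈

  data EdgeView : Fin (m + m′) → Set where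
    left  : ∀ e → EdgeView (e ↑ˡ m′)
    right : ∀ e → EdgeView (m ↑ʳ e)

  edge-view : ∀ e → EdgeView e
  edge-view e with splitAt m e in eq
  ... | inj₁ e₁ = subst EdgeView (Fin.splitAt⁻¹-↑ˡ eq) (left e₁)
  ... | inj₂ e₂ = subst EdgeView (Fin.splitAt⁻¹-↑ʳ eq) (right e₂)

  size-right : ∀ e → ∣ edge C (m ↑ʳ e) ∣ ≡ ∣ edge H e ∣
  size-right e rewrite Fin.splitAt-↑ʳ m m′ e with edge H e
  ... | true ∷ p  = trans (∣++∣ ⁅ v ⁆ p) (cong (_+ ∣ p ∣) (∣⁅x⁆∣≡1 v))
  ... | false ∷ p = trans (∣++∣ (⊥ {n}) p) (cong (_+ ∣ p ∣) (∣⊥∣≡0 n))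

  size-left : ∀ e → ∣ edge C (e ↑ˡ m′) ∣ ≡ ∣ edge G e ∣
  size-left e = trans (cong ∣_∣ (edge-left e)) (trans (∣++∣ (edge G e) ⊥) (trans (cong (∣ edge G e ∣ +_) (∣⊥∣≡0 n′)) (ℕ.+-identityʳ _)))

-- The hyperedges of `G` precede those of `H`, so nothing new is early for the former. A vertex of
-- `H` that lies in a hyperedge of `G` can only be its root, which was early before.
coalesce-rooted : ∀ {n m n′ m′ k} {G : Hypergraph (suc n) m} {H : Hypergraph (suc n′) m′} (v : Fin (suc n)) →
  Rooted k G → Rooted k H → Rooted k (coalesce G v H)
coalesce-rooted {n} {m} {n′} {m′} {k} {G} {H} v RG RH = record { uniform = uniform ; reach = reach ; ordered = ordered }
  where
  open Coalesce G v H
  module RG = Rooted RG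
  module RH = Rooted RH
  uniform : Uniform k C
  uniform e with edge-view e
  ... | left e₁  = trans (size-left e₁) (RG.uniform e₁)
  ... | right e₂ = trans (size-right e₂) (RH.uniform e₂)
  lift-left : ∀ {a b} → Star (Adjacent G) a b → Star (Adjacent C) (a ↑ˡ n′) (b ↑ˡ n′)
  lift-left = Star.gmap (_↑ˡ n′) λ { (via e p q) → via (e ↑ˡ m′) (∈-left⁺ p) (∈-left⁺ q) }
  lift-right : ∀ {a b} → Star (Adjacent H) a b → Star (Adjacent C) (ι a) (ι b)
  lift-right = Star.gmap ι λ { (via e p q) → via (m ↑ʳ e) (∈-right⁺ p) (∈-right⁺ q) }
  reach : ∀ x → Star (Adjacent C) zero x
  reach x with splitAt (suc n) x in eq
  ... | inj₁ y = subst (Star (Adjacent C) zero) (Fin.splitAt⁻¹-↑ˡ eq) (lift-left (RG.reach y))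
  ... | inj₂ w = subst (Star (Adjacent C) zero) (Fin.splitAt⁻¹-↑ʳ eq) (lift-left (RG.reach v) ◅◅ lift-right (RH.reach (suc w)))
  toℕ-left : ∀ e → toℕ (e ↑ˡ m′) ≡ toℕ e
  toℕ-left e = Fin.toℕ-↑ˡ e m′
  early-left : ∀ e y → Early C (e ↑ˡ m′) (y ↑ˡ n′) → Early G e y
  early-left e y (inj₁ eq) = inj₁ (Fin.↑ˡ-injective n′ y zero eq)
  early-left e y (inj₂ (f , f<e , y∈)) with edge-view f
  ... | left f₁ with ∈-left⁻ {e = f₁} y∈
  ...   | z , eq , z∈ = inj₂ (f₁ , subst₂ _<_ (toℕ-left f₁) (toℕ-left e) f<e , subst (_∈ edge G f₁) (sym (Fin.↑ˡ-injective n′ y z eq)) z∈)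
  early-left e y (inj₂ (f , f<e , y∈)) | right f₂ = contradiction
    (ℕ.<-trans (ℕ.≤-trans (s≤s (ℕ.≤-trans (ℕ.m≤m+n m (toℕ f₂)) (ℕ.≤-reflexive (sym (Fin.toℕ-↑ʳ m f₂))))) (ℕ.≤-trans f<e (ℕ.≤-reflexive (toℕ-left e)))) (Fin.toℕ<n e))
    (ℕ.<-irrefl refl)
  early-right : ∀ e a → Early C (m ↑ʳ e) (ι a) → Early H e a
  early-right e zero    _ = inj₁ refl
  early-right e (suc w) (inj₁ eq) = contradiction (sym eq) (left≢right zero w)
  early-right e (suc w) (inj₂ (f , f<e , a∈)) with edge-view f
  ... | left f₁ with ∈-left⁻ {e = f₁} a∈
  ...   | z , eq , _ = contradiction (sym eq) (left≢right z w)
  early-right e (suc w) (inj₂ (f , f<e , a∈)) | right f₂ with ∈-right⁻ {e = f₂} a∈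
  ... | b , eq , b∈ = inj₂ (f₂ , ℕ.+-cancelˡ-< m _ _ (subst₂ _<_ (Fin.toℕ-↑ʳ m f₂) (Fin.toℕ-↑ʳ m e) f<e) ,
        subst (_∈ edge H f₂) (sym (ι-injective {suc w} {b} eq)) b∈)
  ordered : ∀ e {x y} → x ∈ edge C e → y ∈ edge C e → Early C e x → Early C e y → x ≡ y
  ordered e x∈ y∈ ex ey with edge-view e
  ... | left e₁ with ∈-left⁻ {e = e₁} x∈ | ∈-left⁻ {e = e₁} y∈
  ...   | a , refl , a∈ | b , refl , b∈ = cong (_↑ˡ n′) (RG.ordered e₁ a∈ b∈ (early-left e₁ a ex) (early-left e₁ b ey))
  ordered e x∈ y∈ ex ey | right e₂ with ∈-right⁻ {e = e₂} x∈ | ∈-right⁻ {e = e₂} y∈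
  ... | a , refl , a∈ | b , refl , b∈ = cong ι (RH.ordered e₂ a∈ b∈ (early-right e₂ a ex) (early-right e₂ b ey))

-- Hyperpaths and starlike hypertrees

∈-tabulate⁺ : ∀ {n p} {P : Fin n → Set p} (P? : ∀ v → Dec (P v)) {v} → P v → v ∈ Vec.tabulate (λ v → does (P? v))
∈-tabulate⁺ P? {v} Pv = Vec.lookup⇒[]= v _ (trans (Vec.lookup∘tabulate (λ v → does (P? v)) v) (dec-true (P? v) Pv))

∈-tabulate⁻ : ∀ {n p} {P : Fin n → Set p} (P? : ∀ v → Dec (P v)) {v} → v ∈ Vec.tabulate (λ v → does (P? v)) → P v
∈-tabulate⁻ P? {v} v∈ = witness (P? v) (trans (sym (Vec.lookup∘tabulate (λ v → does (P? v)) v)) (Vec.[]=⇒lookup v∈))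
  where
  witness : ∀ {p} {P : Set p} (d : Dec P) → does d ≡ true → P
  witness (yes p) _ = p

interval-count : ∀ a l n → a + l ≤ n → sum {n} (λ v → 𝟙 ((a ℕ.≤? toℕ v) ×-dec (toℕ v ℕ.<? a + l))) ≡ l
interval-count zero zero n _ = sum-zero {n} λ v → 𝟙-no ((0 ℕ.≤? toℕ v) ×-dec (toℕ v ℕ.<? 0)) λ ()
interval-count zero (suc l) (suc n) (s≤s le) = cong suc (trans
  (sum-cong-≗ {n} λ v → 𝟙-cong ((0 ℕ.≤? suc (toℕ v)) ×-dec (suc (toℕ v) ℕ.<? suc l)) ((0 ℕ.≤? toℕ v) ×-dec (toℕ v ℕ.<? l))
    (λ { (_ , s≤s p) → z≤n , p }) (λ { (_ , p) → z≤n , s≤s p }))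
  (interval-count zero l n le))
interval-count (suc a) l (suc n) (s≤s le) = trans
  (cong₂ _+_ (𝟙-no ((suc a ℕ.≤? 0) ×-dec (0 ℕ.<? suc a + l)) λ ())
    (sum-cong-≗ {n} λ v → 𝟙-cong ((suc a ℕ.≤? suc (toℕ v)) ×-dec (suc (toℕ v) ℕ.<? suc a + l)) ((a ℕ.≤? toℕ v) ×-dec (toℕ v ℕ.<? a + l))
      (λ { (s≤s p , s≤s q) → p , q }) (λ { (p , q) → s≤s p , s≤s q })))
  (interval-count a l n le)

module Hyperpath (r q : ℕ) (1≤r : 1 ≤ r) where

  P : Hypergraph (suc (q * r)) q
  P = hyperpath (suc r) q

  ∈⁺ : ∀ {v i} → toℕ i * r ≤ toℕ v → toℕ v ≤ suc (toℕ i) * r → v ∈ edge P i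
  ∈⁺ {v} {i} p q = ∈-tabulate⁺ (λ v → (toℕ i * r ℕ.≤? toℕ v) ×-dec (toℕ v ℕ.≤? suc (toℕ i) * r)) (p , q)

  ∈⁻ : ∀ {v i} → v ∈ edge P i → toℕ i * r ≤ toℕ v × toℕ v ≤ suc (toℕ i) * r
  ∈⁻ {v} {i} = ∈-tabulate⁻ (λ v → (toℕ i * r ℕ.≤? toℕ v) ×-dec (toℕ v ℕ.≤? suc (toℕ i) * r))

  node : ∀ a → a ≤ q → ∃ λ (v : Fin (suc (q * r))) → toℕ v ≡ a * r
  node a a≤q = fromℕ< (s≤s (ℕ.*-monoˡ-≤ r a≤q)) , Fin.toℕ-fromℕ< _

  path-rooted : Rooted (suc r) P
  path-rooted = record { uniform = uniform ; reach = λ v → reach (toℕ v) v ℕ.≤-refl ; ordered = ordered }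
    where
    uniform : Uniform (suc r) P
    uniform i = trans ∣ edge P i ∣≡sum (trans (sum-cong-≗ λ v → 𝟙-cong (v ∈? edge P i)
        ((toℕ i * r ℕ.≤? toℕ v) ×-dec (toℕ v ℕ.<? toℕ i * r + suc r))
        (λ v∈ → let p , q = ∈⁻ {v} {i} v∈ in p , ℕ.≤-trans (s≤s q) (ℕ.≤-reflexive (end (toℕ i))))
        (λ { (p , q) → ∈⁺ {v} {i} p (ℕ.≤-pred (ℕ.≤-trans q (ℕ.≤-reflexive (sym (end (toℕ i)))))) }))
      (interval-count (toℕ i * r) (suc r) (suc (q * r))
        (ℕ.≤-trans (ℕ.≤-reflexive (sym (end (toℕ i)))) (s≤s (ℕ.*-monoˡ-≤ r (Fin.toℕ<n i))))))
      where
      end : ∀ i → suc (suc i * r) ≡ i * r + suc r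
      end i = trans (cong suc (ℕ.+-comm r (i * r))) (sym (ℕ.+-suc (i * r) r))
    reach : ∀ fuel v → toℕ v ≤ fuel → Star (Adjacent P) zero v
    reach fuel zero _ = ε
    reach (suc fuel) (suc v) (s≤s v≤) = reach fuel w (ℕ.≤-trans (ℕ.≤-reflexive w≡) (ℕ.≤-trans i*r≤ v≤)) ◅◅
      via i (∈⁺ {w} {i} (ℕ.≤-reflexive (trans (cong (_* r) i≡) (sym w≡)))
              (ℕ.≤-trans (ℕ.≤-reflexive w≡) (ℕ.≤-trans (ℕ.m≤n+m (a * r) r) (ℕ.≤-reflexive (cong (λ z → suc z * r) (sym i≡))))))
            (∈⁺ {suc v} {i} (ℕ.≤-trans (ℕ.≤-reflexive (cong (_* r) i≡)) (ℕ.m≤n⇒m≤1+n i*r≤))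
              (ℕ.≤-trans below (ℕ.≤-reflexive (cong (λ z → suc z * r) (sym i≡))))) ◅ ε
      where
      instance _ = ℕ.>-nonZero 1≤r
      -- The vertex `suc v` lies in hyperedge number v / r. Dividing `v` and not `suc v` puts a
      -- vertex of the underlying path into the hyperedge that ends there, so the left end `w` is a
      -- smaller vertex.
      a : ℕ
      a = toℕ v / r
      a<q : a < q
      a<q = ℕ.m<n*o⇒m/o<n (Fin.toℕ<n v)
      i : Fin q
      i = fromℕ< a<q
      i≡ : toℕ i ≡ a
      i≡ = Fin.toℕ-fromℕ< a<q
      w : Fin (suc (q * r))
      w = proj₁ (node a (ℕ.<⇒≤ a<q))
      w≡ : toℕ w ≡ a * r
      w≡ = proj₂ (node a (ℕ.<⇒≤ a<q))
      i*r≤ : a * r ≤ toℕ v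
      i*r≤ = ℕ.m/n*n≤m (toℕ v) r
      below : suc (toℕ v) ≤ suc a * r
      below = ℕ.≤-trans (s≤s (ℕ.≤-reflexive (ℕ.m≡m%n+[m/n]*n (toℕ v) r))) (ℕ.+-monoˡ-≤ (a * r) (ℕ.m%n<n (toℕ v) r))
    -- The vertices of earlier hyperedges are at most `toℕ e * r`, those of `e` at least that. So
    -- the left end is the only early vertex.
    start : ∀ e u → u ∈ edge P e → Early P e u → toℕ u ≡ toℕ e * r
    start e u u∈ (inj₁ refl) = sym (ℕ.n≤0⇒n≡0 (proj₁ (∈⁻ {zero} {e} u∈)))
    start e u u∈ (inj₂ (f , f<e , u∈f)) = ℕ.≤-antisym
      (ℕ.≤-trans (proj₂ (∈⁻ {u} {f} u∈f)) (ℕ.*-monoˡ-≤ r f<e)) (proj₁ (∈⁻ {u} {e} u∈))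
    ordered : ∀ e {u v} → u ∈ edge P e → v ∈ edge P e → Early P e u → Early P e v → u ≡ v
    ordered e {u} {v} u∈ v∈ eu ev = toℕ-injective (trans (start e u u∈ eu) (sym (start e v v∈ ev)))

hyperpath-tree : ∀ {r} q → 1 ≤ r → IsHypertree (suc r) (hyperpath (suc r) q)
hyperpath-tree {r} q 1≤r = rooted⇒hypertree 1≤r (Hyperpath.path-rooted r q 1≤r)

starlike-rooted : ∀ {r} → 1 ≤ r → ∀ ns → Rooted (suc r) (starlike (suc r) ns)
starlike-rooted 1≤r []       = record { uniform = λ () ; reach = λ { zero → ε } ; ordered = λ () }
starlike-rooted {r} 1≤r (n ∷ ns) = coalesce-rooted zero (Hyperpath.path-rooted r n 1≤r) (starlike-rooted 1≤r ns)

starlike-tree : ∀ {r} ns → 1 ≤ r → IsHypertree (suc r) (starlike (suc r) ns)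
starlike-tree ns 1≤r = rooted⇒hypertree 1≤r (starlike-rooted 1≤r ns)

hyperpath-order : ∀ {r} q → 1 ≤ r → PathOrder (hyperpath (suc r) (suc q))
hyperpath-order {r} q 1≤r = record
  { σ           = Perm.id
  ; V           = V
  ; V-injective = λ {i} {j} eq → toℕ-injective (ℕ.suc-injective (ℕ.*-cancelʳ-≡ _ _ r {{ℕ.>-nonZero 1≤r}} (trans (sym (V≡ i)) (trans (cong toℕ eq) (V≡ j)))))
  ; V∈₁         = λ j → ∈⁺ {V j} {inject₁ j}
      (ℕ.≤-trans (ℕ.≤-reflexive (cong (_* r) (Fin.toℕ-inject₁ j))) (ℕ.≤-trans (ℕ.m≤n+m (toℕ j * r) r) (ℕ.≤-reflexive (sym (V≡ j)))))
      (ℕ.≤-reflexive (trans (V≡ j) (cong (λ z → suc z * r) (sym (Fin.toℕ-inject₁ j)))))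
  ; V∈₂         = λ j → ∈⁺ {V j} {suc j} (ℕ.≤-reflexive (sym (V≡ j))) (ℕ.≤-trans (ℕ.≤-reflexive (V≡ j)) (ℕ.m≤n+m (suc (toℕ j) * r) r))
  }
  where
  open Hyperpath r (suc q) 1≤r
  V : Fin q → Fin (suc (suc q * r))
  V j = proj₁ (node (suc (toℕ j)) (ℕ.m≤n⇒m≤1+n (Fin.toℕ<n j)))
  V≡ : ∀ j → toℕ (V j) ≡ suc (toℕ j) * r
  V≡ j = proj₂ (node (suc (toℕ j)) (ℕ.m≤n⇒m≤1+n (Fin.toℕ<n j)))

root∈first : ∀ r q → zero ∈ edge (hyperpath (suc r) (suc q)) zero
root∈first r q = ∈-tabulate⁺ (λ v → (0 ℕ.≤? toℕ v) ×-dec (toℕ v ℕ.≤? 1 * r)) (z≤n , z≤n)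

star-center : ∀ r m e → zero ∈ edge (hyperstar (suc r) m) e
star-center r (suc m) e with Coalesce.edge-view (hyperpath (suc r) 1) zero (hyperstar (suc r) m) e
... | Coalesce.left zero = Coalesce.∈-left⁺ (hyperpath (suc r) 1) zero (hyperstar (suc r) m) {zero} {zero} (root∈first r 0)
... | Coalesce.right e₂  = Coalesce.∈-right⁺ (hyperpath (suc r) 1) zero (hyperstar (suc r) m) {zero} {e₂} (star-center r m e₂)

-- The runners-up

-- Just the incidences that determine the sum of squares: in a hypertree the center and `second`
-- then account for the whole excess.
record NearStar {n m} (H : Hypergraph n m) : Set where
  field
    center second : Fin n
    center≢second : center ≢ second
    missed       : Fin m
    center∈      : ∀ e → e ≢ missed → center ∈ edge H e
    {f₁ f₂}      : Fin m
    f₁≢f₂        : f₁ ≢ f₂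
    second∈₁      : second ∈ edge H f₁
    second∈₂      : second ∈ edge H f₂

two-step-near : ∀ {r n m} → 1 ≤ r → (S : Hypergraph (suc n) m) → (∀ e → zero ∈ edge S e) →
  NearStar (coalesce (hyperpath (suc r) 1) zero (coalesce (hyperpath (suc r) 2) zero S))
two-step-near {r} {n} {m} 1≤r S center∈S = record
  { center       = zero
  ; second        = C₁.ι w
  ; center≢second = λ eq → w≢zero (sym (C₁.ι-injective {zero} {w} eq))
  ; missed       = missed
  ; center∈      = center∈
  ; f₁           = 1 ↑ʳ (zero ↑ˡ m)
  ; f₂           = missed
  ; f₁≢f₂        = λ ()
  ; second∈₁      = C₁.∈-right⁺ {w} {zero ↑ˡ m} (C₂.∈-left⁺ {y} {zero} (HP.∈⁺ {y} {zero} z≤n (ℕ.≤-reflexive y≡)))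
  ; second∈₂      = C₁.∈-right⁺ {w} {suc zero ↑ˡ m} (C₂.∈-left⁺ {y} {suc zero} (HP.∈⁺ {y} {suc zero} (ℕ.≤-reflexive (sym y≡)) (ℕ.≤-trans (ℕ.≤-reflexive y≡) (ℕ.m≤n+m _ r))))
  }
  where
  module HP = Hyperpath r 2 1≤r
  module C₂ = Coalesce (hyperpath (suc r) 2) zero S
  module C₁ = Coalesce (hyperpath (suc r) 1) zero C₂.C
  y : Fin (suc (2 * r))
  y = proj₁ (HP.node 1 (s≤s z≤n))
  y≡ : toℕ y ≡ 1 * r
  y≡ = proj₂ (HP.node 1 (s≤s z≤n))
  w = y ↑ˡ n
  w≢zero : w ≢ zero
  w≢zero eq = contradiction (trans (sym (trans (Fin.toℕ-↑ˡ y n) (trans y≡ (ℕ.+-identityʳ r)))) (cong toℕ eq)) (ℕ.>⇒≢ 1≤r)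
  -- The outer hyperedge of the leg of length two, which comes after the single hyperedge of the
  -- first leg.
  missed : Fin (1 + (2 + m))
  missed = 1 ↑ʳ (suc zero ↑ˡ m)
  center∈ : ∀ e → e ≢ missed → zero ∈ edge C₁.C e
  center∈ e e≢ with C₁.edge-view e
  ... | C₁.left zero = C₁.∈-left⁺ {zero} {zero} (root∈first r 0)
  ... | C₁.right f with C₂.edge-view f
  ...   | C₂.left zero       = C₁.∈-right⁺ {zero} {zero ↑ˡ m} (C₂.∈-left⁺ {zero} {zero} (root∈first r 1))
  ...   | C₂.left (suc zero) = contradiction refl e≢
  ...   | C₂.right g         = C₁.∈-right⁺ {zero} {2 ↑ʳ g} (C₂.∈-right⁺ {zero} {g} (center∈S g))

starlike₁₂₁-near : ∀ {r} → 1 ≤ r → ∀ m → NearStar (starlike₁₂₁ (suc r) m)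
starlike₁₂₁-near {r} 1≤r m = two-step-near 1≤r (hyperstar (suc r) (m ∸ 3)) (star-center r (m ∸ 3))

-- There are N + 2 hyperedges, so the total excess is N + 1. The lower bounds N at the center and 1
-- at `second` exhaust it.
module NearStarDegrees {n N r} {H : Hypergraph n (suc (suc N))} (tree : IsHypertree (suc r) H) (1≤r : 1 ≤ r) (1≤N : 1 ≤ N)
  (near : NearStar H) where

  open NearStar near
  open Recognition tree 1≤r (s≤s z≤n)

  excess-center : N ≤ excess center
  excess-center = ℕ.≤-pred (ℕ.≤-pred (begin
    suc (suc N)                                           ≡⟨ sum-one ⟨
    sum {suc (suc N)} (λ _ → 1)                           ≤⟨ sum-mono covers ⟩
    sum (λ e → inc H center e + 𝟙 (e ≟ missed))           ≡⟨ ∑-distrib-+ (inc H center) (λ e → 𝟙 (e ≟ missed)) ⟩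
    deg H center + sum (λ e → 𝟙 (e ≟ missed))             ≡⟨ cong₂ _+_ (deg≡ center) (sum-δ₁ missed) ⟩
    suc (excess center) + 1                               ≡⟨ ℕ.+-comm _ 1 ⟩
    suc (suc (excess center))                             ∎))
    where
    open ℕ.≤-Reasoning
    covers : ∀ e → 1 ≤ inc H center e + 𝟙 (e ≟ missed)
    covers e with e ≟ missed
    ... | yes _ = ℕ.m≤n+m 1 _
    ... | no e≢ = ℕ.≤-trans (ℕ.≤-reflexive (sym (𝟙-yes (center ∈? edge H e) (center∈ e e≢)))) (ℕ.m≤m+n _ 0)

  excess-second : 1 ≤ excess second
  excess-second = two-edges⇒shared {second} f₁≢f₂ second∈₁ second∈₂

  squares-lower : N * N + 1 ≤ sum (λ v → excess v * excess v)
  squares-lower = ℕ.≤-trans (ℕ.+-mono-≤ (ℕ.*-mono-≤ excess-center excess-center) (ℕ.*-mono-≤ excess-second excess-second))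
    (two≤sum (λ v → excess v * excess v) center≢second)

  excess≤N : ∀ v → excess v ≤ N
  excess≤N v with v ≟ center
  ... | yes refl = ℕ.≤-pred (ℕ.≤-trans (ℕ.≤-reflexive (ℕ.+-comm 1 _)) (ℕ.≤-trans (ℕ.+-monoʳ-≤ (excess center) excess-second)
        (ℕ.≤-trans (two≤sum excess center≢second) (ℕ.≤-reflexive sum-excess))))
  ... | no v≢ = ℕ.≤-trans (ℕ.+-cancelʳ-≤ N _ 1 (ℕ.≤-trans (ℕ.+-monoʳ-≤ (excess v) excess-center)
        (ℕ.≤-trans (two≤sum excess v≢) (ℕ.≤-reflexive sum-excess)))) 1≤N

  squares-upper : sum (λ v → excess v * excess v) ≤ N * N + 1
  squares-upper = spread-squares≤ excess N sum-excess excess≤N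

-- The pendant hyperedge may be attached at any cored vertex of the second hyperedge; the bounds on
-- the degree sums are the same for all of them.
module Fork {r q} (1≤r : 1 ≤ r) (2≤q : 2 ≤ q) (e : Fin (suc q)) (e≡1 : toℕ e ≡ 1) (v : Fin (suc (suc q * r)))
  (v∈e : v ∈ edge (hyperpath (suc r) (suc q)) e) (cored : Cored (hyperpath (suc r) (suc q)) v) where

  private
    P  = hyperpath (suc r) (suc q)
    P₁ = hyperpath (suc r) 1
    module O = PathOrder (hyperpath-order {r} q 1≤r)
    module PL = PathLike (hyperpath-tree (suc q) 1≤r) 1≤r O.σ O.V O.V-injective O.V∈₁ O.V∈₂
    module C = Coalesce P v P₁

  F : Hypergraph (suc (suc q * r) + 1 * r) (suc q + 1)
  F = attachPendant (suc r) P v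

  tree : IsHypertree (suc r) F
  tree = rooted⇒hypertree 1≤r (coalesce-rooted v (Hyperpath.path-rooted r (suc q) 1≤r) (Hyperpath.path-rooted r 1 1≤r))

  open Recognition tree 1≤r (s≤s z≤n) public

  only-e : ∀ f → v ∈ edge P f → f ≡ e
  only-e f v∈f with f ≟ e
  ... | yes p = p
  ... | no f≢ = contradiction (ℕ.≤-trans (ℕ.≤-reflexive (sym (cong₂ _+_ (𝟙-yes (v ∈? edge P f) v∈f) (𝟙-yes (v ∈? edge P e) v∈e))))
          (ℕ.≤-trans (two≤sum (inc P v) f≢) (ℕ.≤-reflexive (trans (sym (degree≡deg P v)) cored)))) λ { (s≤s ()) }

  V≢v : ∀ j → O.V j ≢ v
  V≢v j eq = PL.σ≢ j (trans (only-e (inject₁ j) (subst (_∈ edge P (inject₁ j)) eq (O.V∈₁ j)))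
    (sym (only-e (suc j) (subst (_∈ edge P (suc j)) eq (O.V∈₂ j)))))

  -- The vertex `v` and the q joints of the path are q + 1 = m - 1 shared vertices, as many as
  -- `Exhausting` asks for.
  W : Fin (suc q) → Fin (suc (suc q * r) + 1 * r)
  W j = (v ◂ O.V) j ↑ˡ (1 * r)

  W-injective : Injective _≡_ _≡_ W
  W-injective eq = injective-∷ O.V v O.V-injective V≢v (Fin.↑ˡ-injective (1 * r) _ _ eq)

  lefts≢ : ∀ {f g : Fin (suc q)} → f ≢ g → f ↑ˡ 1 ≢ g ↑ˡ 1
  lefts≢ f≢g eq = f≢g (Fin.↑ˡ-injective 1 _ _ eq)

  pendant : Fin (suc q + 1)
  pendant = suc q ↑ʳ zero

  excess-W : ∀ j → 1 ≤ excess (W j)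
  excess-W zero    = two-edges⇒shared {W zero} (λ eq → left≢pendant eq) (C.∈-left⁺ {v} {e} v∈e) (C.∈-right⁺ {zero} {zero} (root∈first r 0))
    where
    left≢pendant : e ↑ˡ 1 ≢ pendant
    left≢pendant eq = ℕ.<⇒≢ (Fin.toℕ<n e) (trans (sym (Fin.toℕ-↑ˡ e 1)) (trans (cong toℕ eq) (trans (Fin.toℕ-↑ʳ (suc q) (zero {0})) (ℕ.+-identityʳ (suc q)))))
  excess-W (suc j) = two-edges⇒shared {W (suc j)} (lefts≢ (PL.σ≢ j)) (C.∈-left⁺ {O.V j} {inject₁ j} (O.V∈₁ j)) (C.∈-left⁺ {O.V j} {suc j} (O.V∈₂ j))

  module Ex = Exhausting W W-injective (ℕ.+-comm 1 q) excess-W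

  -- Marks the hyperedge that receives a third shared vertex.
  bump : Fin (suc q + 1) → ℕ
  bump f = 𝟙 (f ≟ e ↑ˡ 1)

  shared-upper : ∀ f → shared f ≤ 2 + bump f
  shared-upper f = ℕ.≤-trans (shared≤ W Ex.off-V f) (go f (C.edge-view f))
    where
    go : ∀ f → C.EdgeView f → inc F (W zero) f + sum (λ j → inc F (W (suc j)) f) ≤ 2 + bump f
    go _ (C.left f) = ℕ.≤-trans (ℕ.+-mono-≤ at-v along) (ℕ.≤-reflexive (ℕ.+-comm (bump (f ↑ˡ 1)) 2))
      where
      at-v : inc F (W zero) (f ↑ˡ 1) ≤ bump (f ↑ˡ 1)
      at-v with W zero ∈? edge F (f ↑ˡ 1)
      ... | no _ = z≤n
      ... | yes v∈ with C.∈-left⁻ {e = f} v∈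
      ...   | z , eq , z∈ = ℕ.≤-reflexive (sym (𝟙-yes (f ↑ˡ 1 ≟ e ↑ˡ 1)
                (cong (_↑ˡ 1) (only-e f (subst (_∈ edge P f) (sym (Fin.↑ˡ-injective (1 * r) v z eq)) z∈)))))
      along : sum (λ j → inc F (W (suc j)) (f ↑ˡ 1)) ≤ 2
      along = ℕ.≤-trans (sum-mono pointwise) (PL.incidences≤2 f)
        where
        pointwise : ∀ j → inc F (W (suc j)) (f ↑ˡ 1) ≤ inc P (O.V j) f
        pointwise j with W (suc j) ∈? edge F (f ↑ˡ 1)
        ... | no _ = z≤n
        ... | yes V∈ with C.∈-left⁻ {e = f} V∈
        ...   | z , eq , z∈ = ℕ.≤-reflexive (sym (𝟙-yes (O.V j ∈? edge P f) (subst (_∈ edge P f) (sym (Fin.↑ˡ-injective (1 * r) (O.V j) z eq)) z∈)))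
    go _ (C.right zero) = ℕ.≤-trans (ℕ.+-mono-≤ (𝟙≤1 (W zero ∈? edge F pendant)) (ℕ.≤-reflexive (sum-zero λ j → 𝟙-no (W (suc j) ∈? edge F pendant) (outside-pendant j))))
      (s≤s z≤n)
      where
      outside-pendant : ∀ j → W (suc j) ∉ edge F pendant
      outside-pendant j V∈ with C.∈-right⁻ {e = zero} V∈
      ... | a , eq , _ = V≢v j (proj₂ (C.ι≡left {a} (sym eq)))

  m≥2 : 2 ≤ suc q + 1
  m≥2 = s≤s (ℕ.m≤n+m 1 q)

  fork-upper : degreePairs F + (suc q + 1) ≤ base + 1
  fork-upper = ℕ.≤-trans (pairs-upper Ex.excess≤1 bump (λ f → 𝟙≤1 (f ≟ e ↑ˡ 1)) (shared≥1 m≥2) shared-upper)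
    (ℕ.≤-reflexive (cong (base +_) (sum-δ₁ (e ↑ˡ 1))))

  fork-lower : suc base ≤ degreePairs F + (suc q + 1)
  fork-lower = pairs-lower⁺ (inj₂ (e ↑ˡ 1 , crowded 2≤q e e≡1 refl))
    where
    -- The second hyperedge is the later one at joint 0 and the earlier one at joint 1; 2 ≤ q makes
    -- both joints exist.
    crowded : ∀ {q′} → 2 ≤ q′ → (f : Fin (suc q)) → toℕ f ≡ 1 → q′ ≡ q → 3 ≤ shared (e ↑ˡ 1)
    crowded (s≤s (s≤s _)) f f≡1 refl = three-shared {e ↑ˡ 1} {u = W zero} {v = W (suc zero)} {w = W (suc (suc zero))}
      (λ eq → case W-injective {zero} {suc zero} eq of λ ()) (λ eq → case W-injective {zero} {suc (suc zero)} eq of λ ())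
      (λ eq → case W-injective {suc zero} {suc (suc zero)} eq of λ ())
      (C.∈-left⁺ {v} {e} v∈e)
      (C.∈-left⁺ {O.V zero} {e} (subst (λ f → O.V zero ∈ edge P f) (toℕ-injective (sym e≡1)) (O.V∈₂ zero)))
      (C.∈-left⁺ {O.V (suc zero)} {e} (subst (λ f → O.V (suc zero) ∈ edge P f) (toℕ-injective (sym e≡1)) (O.V∈₁ (suc zero))))
      (excess-W zero) (excess-W (suc zero)) (excess-W (suc (suc zero)))

-- Comparison of moments

single-edge-pairs : ∀ {n r} {G H : Hypergraph n 1} → 1 ≤ r → IsHypertree (suc r) G → IsHypertree (suc r) H → degreePairs H ≤ degreePairs G
single-edge-pairs {r = r} {G} {H} 1≤r treeG treeH = begin
  degreePairs H                         ≡⟨ H.degreePairs-split ⟩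
  1 * tri (suc r) + r * H.X + H.E       ≡⟨ cong₂ (λ y z → 1 * tri (suc r) + r * y + z) X≡0 E≡0 ⟩
  1 * tri (suc r) + r * 0 + 0           ≤⟨ ℕ.+-mono-≤ (ℕ.+-monoʳ-≤ (1 * tri (suc r)) (ℕ.*-monoʳ-≤ r z≤n)) z≤n ⟩
  1 * tri (suc r) + r * G.X + G.E       ≡⟨ G.degreePairs-split ⟨
  degreePairs G                         ∎
  where
  open ℕ.≤-Reasoning
  module G = Recognition treeG 1≤r (s≤s z≤n)
  module H = Recognition treeH 1≤r (s≤s z≤n)
  x≡0 : ∀ v → H.excess v ≡ 0
  x≡0 v = ℕ.n≤0⇒n≡0 (ℕ.≤-trans (term≤sum H.excess v) (ℕ.≤-reflexive H.sum-excess))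
  X≡0 : H.X ≡ 0
  X≡0 = sum-zero λ v → trans (cong ((1 + H.excess v) *_) (x≡0 v)) (ℕ.*-zeroʳ (1 + H.excess v))
  e₂-zero : ∀ {A : Set} {f : A → ℕ} → (∀ a → f a ≡ 0) → ∀ l → e₂ f l ≡ 0
  e₂-zero h []      = refl
  e₂-zero {f = f} h (a ∷ l) = cong₂ _+_ (cong (_* total f l) (h a)) (e₂-zero h l)
  E≡0 : H.E ≡ 0
  E≡0 = sum-zero λ e → e₂-zero x≡0 (elements (edge H e))

module Comparison {c ℓ₁ ℓ₂} (K : OrderedField c ℓ₁ ℓ₂) (α : OrderedField.Carrier K)
  (0<α : OrderedField._<_ K (OrderedField.0# K) α) (α<1 : OrderedField._<_ K α (OrderedField.1# K))
  {r : ℕ} (1≤r : 1 ≤ r) where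

  open FieldTheory K

  M : ∀ {n m} → ℕ → Hypergraph n m → Carrier
  M d = spectralMoment K α (suc r) d

  module Second {n m} {G H : Hypergraph n m} (1≤m : 1 ≤ m) (treeG : IsHypertree (suc r) G) (treeH : IsHypertree (suc r) H) where

    private
      module G = Recognition treeG 1≤r 1≤m
      module H = Recognition treeH 1≤r 1≤m
      formula = MomentFormulas.moment₂ K α 0<α α<1 1≤m 1≤r treeG
      0<A = proj₁ (proj₂ (proj₂ formula))
      moment = proj₂ (proj₂ (proj₂ formula))
      powers-≤ : sum (λ v → G.excess v * G.excess v) ≤ sum (λ v → H.excess v * H.excess v) → degreePowers G 2 ≤ degreePowers H 2
      powers-≤ le = subst₂ _≤_ (sym G.degreePowers₂) (sym H.degreePowers₂) (ℕ.+-monoʳ-≤ (n + 2 * (m ∸ 1)) le)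

    second-≤ : sum (λ v → G.excess v * G.excess v) ≤ sum (λ v → H.excess v * H.excess v) → M 2 G ≤ᶠ M 2 H
    second-≤ le = ≤ᶠ-resp (≈-sym (moment G treeG)) (≈-sym (moment H treeH))
      (+-mono-≤ᶠ (*-monoʳ-≤ᶠ (inj₁ 0<A) (·1-mono-≤ (powers-≤ le))) ≤ᶠ-refl)

    second-< : sum (λ v → G.excess v * G.excess v) < sum (λ v → H.excess v * H.excess v) → M 2 G <ᴷ M 2 H
    second-< lt = <-respˡ-≈ (≈-sym (moment G treeG)) (<-respʳ-≈ (≈-sym (moment H treeH))
      (+-monoˡ-< _ (*-monoʳ-<ᴷ 0<A (·1-mono-< (subst₂ _<_ (sym G.degreePowers₂) (sym H.degreePowers₂) (ℕ.+-monoʳ-< (n + 2 * (m ∸ 1)) lt))))))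

  same-order : ∀ {n n′ m} {G : Hypergraph n m} {H : Hypergraph n′ m} → 1 ≤ m → IsHypertree (suc r) G → IsHypertree (suc r) H → n ≡ n′
  same-order 1≤m treeG treeH = trans (Hypertree.order treeG (s≤s 1≤r) 1≤m) (sym (Hypertree.order treeH (s≤s 1≤r) 1≤m))

  module _ {m} (1≤m : 1 ≤ m) where

    star-squares : ∀ {n} {H : Hypergraph n m} (tree : IsHypertree (suc r) H) {c} → (∀ e → c ∈ edge H e) →
      (m ∸ 1) * (m ∸ 1) ≤ sum (λ v → Recognition.excess tree 1≤r 1≤m v * Recognition.excess tree 1≤r 1≤m v)
    star-squares {H = H} tree {c} c∈ = subst (λ z → z * z ≤ sum (λ v → R.excess v * R.excess v)) (cong (_∸ 1) (R.∈⇒full-degree c∈)) (term≤sum (λ v → R.excess v * R.excess v) c)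
      where module R = Recognition tree 1≤r 1≤m

    -- Orders and numbers of hyperedges of concrete hypertrees are compound expressions, while the
    -- moment formula asks for equal indices. Equations between them are therefore passed on and
    -- matched with `refl` while the hypertree is still a variable.
    star-largest : ∀ {n n′ m′} (G : Hypergraph n m) (H : Hypergraph n′ m′) → m′ ≡ m → IsHypertree (suc r) G → IsHypertree (suc r) H →
      ∀ {c} → (∀ e → c ∈ edge H e) → M 2 G ≤ᶠ M 2 H
    star-largest {n} G H refl treeG treeH c∈ = go H (same-order 1≤m treeG treeH) treeH c∈
      where
      module R = Recognition treeG 1≤r 1≤m
      go : ∀ {n′} (H : Hypergraph n′ m) → n ≡ n′ → IsHypertree (suc r) H → ∀ {c} → (∀ e → c ∈ edge H e) → M 2 G ≤ᶠ M 2 H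
      go H refl treeH c∈ = Second.second-≤ 1≤m treeG treeH (ℕ.≤-trans (sum-squares≤ R.excess)
        (ℕ.≤-trans (ℕ.≤-reflexive (cong₂ _*_ R.sum-excess R.sum-excess)) (star-squares treeH c∈)))

  module _ {N} (1≤N : 1 ≤ N) where

    private
      1≤m : 1 ≤ suc (suc N)
      1≤m = s≤s z≤n

    near-star-below : ∀ {n₁ n₂} (H₁ : Hypergraph n₁ (suc (suc N))) (H₂ : Hypergraph n₂ (suc (suc N))) → n₁ ≡ n₂ →
      IsHypertree (suc r) H₁ → IsHypertree (suc r) H₂ → ∀ {c} → (∀ e → c ∈ edge H₁ e) → NearStar H₂ → M 2 H₂ <ᴷ M 2 H₁
    near-star-below H₁ H₂ refl tree₁ tree₂ c∈ near = Second.second-< 1≤m tree₂ tree₁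
      (ℕ.≤-trans (s≤s (NearStarDegrees.squares-upper tree₂ 1≤r 1≤N near)) (ℕ.≤-trans gap (star-squares 1≤m tree₁ c∈)))
      where
      -- (m - 2)² + 1 < (m - 1)² takes m ≥ 3; for m = 2 both sides are 1.
      gap : suc (N * N + 1) ≤ suc N * suc N
      gap = subst (suc (N * N + 1) ≤_) (expand N) (s≤s (ℕ.+-monoʳ-≤ (N * N) (ℕ.≤-trans 1≤N (ℕ.m≤m+n N N))))
        where
        expand : ∀ N → suc (N * N + (N + N)) ≡ suc N * suc N
        expand = solve-∀

    near-star-above : ∀ {n n₁ n₂} (G : Hypergraph n (suc (suc N))) (H₁ : Hypergraph n₁ (suc (suc N))) (H₂ : Hypergraph n₂ (suc (suc N))) →
      n ≡ n₁ → n ≡ n₂ → IsHypertree (suc r) G → IsHypertree (suc r) H₁ → IsHypertree (suc r) H₂ →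
      ∀ {c} → (∀ e → c ∈ edge H₁ e) → NearStar H₂ → ¬ (G ≅ H₁) → M 2 G ≤ᶠ M 2 H₂
    near-star-above G H₁ H₂ refl refl treeG tree₁ tree₂ c∈ near G≇H₁ = Second.second-≤ 1≤m treeG tree₂
      (ℕ.≤-trans (spread-squares≤ R.excess N R.sum-excess bounded) (NearStarDegrees.squares-lower tree₂ 1≤r 1≤N near))
      where
      module R = Recognition treeG 1≤r 1≤m
      bounded : ∀ v → R.excess v ≤ N
      bounded v with R.excess v ℕ.≤? N
      ... | yes p = p
      -- An excess above N leaves only the degree N + 2 = m, so `v` lies in every hyperedge and the
      -- hypertree is a star.
      ... | no ≰ = contradiction (star-isomorphism treeG tree₁ 1≤r 1≤m (R.full-degree⇒∈ {v} full) c∈) G≇H₁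
        where
        full : deg G v ≡ suc (suc N)
        full = ℕ.≤-antisym (ℕ.≤-trans (sum-mono (λ e → 𝟙≤1 (v ∈? edge G e))) (ℕ.≤-reflexive R.sum-one))
          (ℕ.≤-trans (s≤s (ℕ.≰⇒> ≰)) (ℕ.≤-reflexive (sym (R.deg≡ v))))

    near-star-second : ∀ {n₁ m₁ n₂ m₂} (H₁ : Hypergraph n₁ m₁) (H₂ : Hypergraph n₂ m₂) → m₁ ≡ suc (suc N) → m₂ ≡ suc (suc N) →
      IsHypertree (suc r) H₁ → IsHypertree (suc r) H₂ → ∀ {c} → (∀ e → c ∈ edge H₁ e) → NearStar H₂ →
      M 2 H₂ <ᴷ M 2 H₁ × (∀ {n} (G : Hypergraph n (suc (suc N))) → IsHypertree (suc r) G → ¬ (G ≅ H₁) → M 2 G ≤ᶠ M 2 H₂)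
    near-star-second H₁ H₂ refl refl tree₁ tree₂ c∈ near =
        near-star-below H₁ H₂ (same-order 1≤m tree₁ tree₂) tree₁ tree₂ c∈ near
      , λ G treeG → near-star-above G H₁ H₂ (same-order 1≤m treeG tree₁) (same-order 1≤m treeG tree₂) treeG tree₁ tree₂ c∈ near

  module Higher (2≤r : 2 ≤ r) where

    d : ℕ
    d = suc r + 2

    module _ {n m} {G H : Hypergraph n m} (1≤m : 1 ≤ m) (treeG : IsHypertree (suc r) G) (treeH : IsHypertree (suc r) H) where

      private
        module G = Recognition treeG 1≤r 1≤m
        module H = Recognition treeH 1≤r 1≤m
        formula = MomentFormulas.momentₖ₊₂ K α 0<α α<1 1≤m 1≤r treeG 2≤r
        0≤A = proj₁ (proj₂ (proj₂ (proj₂ formula)))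
        0≤B = proj₁ (proj₂ (proj₂ (proj₂ (proj₂ formula))))
        0<C = proj₁ (proj₂ (proj₂ (proj₂ (proj₂ (proj₂ formula)))))
        moment = proj₂ (proj₂ (proj₂ (proj₂ (proj₂ (proj₂ formula)))))

      module _ (x≤1 : ∀ v → H.excess v ≤ 1) where

        powers≤ : ∀ p → degreePowers H p ≤ degreePowers G p
        powers≤ p = ℕ.≤-trans (ℕ.≤-reflexive (H.degreePowers-exact x≤1 p)) (G.degreePowers-lower p)

        cubes≤ : degreeCubes H ≤ degreeCubes G
        cubes≤ = subst₂ _≤_ (sym H.degreeCubes≡) (sym G.degreeCubes≡) (powers≤ 3)

        -- When all excesses of `H` are at most 1, its power sums are the least possible. As A and B
        -- are nonnegative, only the pairs remain to be compared.
        higher-≤ : degreePairs H ≤ degreePairs G → M d H ≤ᶠ M d G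
        higher-≤ le = ≤ᶠ-resp (≈-sym (moment H treeH)) (≈-sym (moment G treeG))
          (+-mono-≤ᶠ (*-monoʳ-≤ᶠ 0≤A (·1-mono-≤ (powers≤ d))) (+-mono-≤ᶠ (*-monoʳ-≤ᶠ 0≤B (·1-mono-≤ cubes≤)) (*-monoʳ-≤ᶠ (inj₁ 0<C) (·1-mono-≤ le))))

        higher-< : degreePairs H < degreePairs G → M d H <ᴷ M d G
        higher-< lt = <-respˡ-≈ (≈-sym (moment H treeH)) (<-respʳ-≈ (≈-sym (moment G treeG))
          (+-mono-≤ᶠ-< (*-monoʳ-≤ᶠ 0≤A (·1-mono-≤ (powers≤ d))) (+-mono-≤ᶠ-< (*-monoʳ-≤ᶠ 0≤B (·1-mono-≤ cubes≤)) (*-monoʳ-<ᴷ 0<C (·1-mono-< lt)))))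

    module PathSums {n q} {H : Hypergraph n (suc q)} (tree : IsHypertree (suc r) H) (order : PathOrder H) where

      open PathOrder order
      open PathLike tree 1≤r σ V V-injective V∈₁ V∈₂ public using (excess≤1; shared≤2)
      open Recognition tree 1≤r (s≤s z≤n)

      path-pairs : 1 ≤ q → degreePairs H + suc q ≤ base
      path-pairs 1≤q = ℕ.≤-trans (pairs-upper excess≤1 (λ _ → 0) (λ _ → z≤n) (shared≥1 (s≤s 1≤q)) (λ e → ℕ.≤-trans (shared≤2 e) (ℕ.≤-reflexive refl)))
        (ℕ.≤-reflexive (trans (cong (base +_) (sum-zero {suc q} λ _ → refl)) (ℕ.+-identityʳ base)))

    path-below : ∀ {n n′ q} (G : Hypergraph n (suc q)) (H : Hypergraph n′ (suc q)) → n ≡ n′ →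
      IsHypertree (suc r) G → IsHypertree (suc r) H → PathOrder H → M d H ≤ᶠ M d G
    path-below {q = zero}  G H refl treeG treeH order =
      higher-≤ (s≤s z≤n) treeG treeH (PathSums.excess≤1 treeH order) (single-edge-pairs 1≤r treeG treeH)
    path-below {q = suc q} G H refl treeG treeH order =
      higher-≤ (s≤s z≤n) treeG treeH (PathSums.excess≤1 treeH order)
        (ℕ.+-cancelʳ-≤ (suc (suc q)) _ _ (ℕ.≤-trans (PathSums.path-pairs treeH order (s≤s z≤n)) (Recognition.pairs-lower treeG 1≤r (s≤s z≤n))))

    path-smallest : ∀ {n n′ q} (G : Hypergraph n (suc q)) (H : Hypergraph n′ (suc q)) → IsHypertree (suc r) G → IsHypertree (suc r) H →
      PathOrder H → M d H ≤ᶠ M d G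
    path-smallest G H treeG treeH = path-below G H (same-order (s≤s z≤n) treeG treeH) treeG treeH

    module _ {n₂ m₂} {H₂ : Hypergraph n₂ m₂} (1≤m₂ : 1 ≤ m₂) (tree₂ : IsHypertree (suc r) H₂) where

      private
        module R₂ = Recognition tree₂ 1≤r 1≤m₂

      fork-below : ∀ {n₁ q} (H₁ : Hypergraph n₁ (suc q)) → n₁ ≡ n₂ → m₂ ≡ suc q → 1 ≤ q → IsHypertree (suc r) H₁ → PathOrder H₁ →
        suc R₂.base ≤ degreePairs H₂ + m₂ → M d H₁ <ᴷ M d H₂
      fork-below {q = q} H₁ refl refl 1≤q tree₁ order lower = higher-< 1≤m₂ tree₂ tree₁ (PathSums.excess≤1 tree₁ order)
        (ℕ.+-cancelʳ-< (suc q) _ _ (ℕ.≤-trans (s≤s (PathSums.path-pairs tree₁ order 1≤q)) lower))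

      -- If no vertex lies in three hyperedges and no hyperedge has three shared vertices,
      -- `path-order` traverses the hypertree as a path. Any other hypertree branches and pays at
      -- least 1 over `base`, which is all that `H₂` pays.
      fork-above : ∀ {n n₁ q} (G : Hypergraph n (suc q)) (H₁ : Hypergraph n₁ (suc q)) → n ≡ n₁ → n ≡ n₂ → m₂ ≡ suc q →
        IsHypertree (suc r) G → IsHypertree (suc r) H₁ → PathOrder H₁ → (∀ v → R₂.excess v ≤ 1) →
        degreePairs H₂ + m₂ ≤ R₂.base + 1 → ¬ (G ≅ H₁) → M d H₂ ≤ᶠ M d G
      fork-above {q = q} G H₁ refl refl refl treeG tree₁ order x≤1 upper G≇H₁ = higher-≤ 1≤m₂ treeG tree₂ x≤1 (ℕ.+-cancelʳ-≤ (suc q) _ _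
          (ℕ.≤-trans upper (ℕ.≤-trans (ℕ.≤-reflexive (ℕ.+-comm _ 1)) (R.pairs-lower⁺ branching))))
        where
        module R = Recognition treeG 1≤r 1≤m₂
        branching : (∃ λ v → 2 ≤ R.excess v) ⊎ (∃ λ e → 3 ≤ R.shared e)
        branching with Fin.any? (λ v → 2 ℕ.≤? R.excess v) | Fin.any? (λ e → 3 ℕ.≤? R.shared e)
        ... | yes p | _     = inj₁ p
        ... | no _  | yes p = inj₂ p
        ... | no ¬p | no ¬q = contradiction (path-isomorphism treeG tree₁ 1≤r
            (Traverse.path-order treeG 1≤r (λ v → ℕ.≤-pred (ℕ.≰⇒> (λ le → ¬p (v , le)))) (λ e → ℕ.≤-pred (ℕ.≰⇒> (λ le → ¬q (e , le))))) order) G≇H₁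

-- Assembly of the four extremal statements

sum-replicate-one : ∀ m → ListAction.sum (List.replicate m 1) ≡ m
sum-replicate-one zero    = refl
sum-replicate-one (suc m) = cong suc (sum-replicate-one m)

theorem7p3 : ∀ {c ℓ₁ ℓ₂} (K : OrderedField c ℓ₁ ℓ₂) (α : OrderedField.Carrier K) →
    OrderedField._<_ K (OrderedField.0# K) α →
    OrderedField._<_ K α (OrderedField.1# K) →
    (k m : ℕ) →
    (2 ≤ k →
    (1 ≤ m → Extremal.IsLargest K α k 2 m (hyperstar k m)) ×
    (3 ≤ m → Extremal.IsSecondLargest K α k 2 m (hyperstar k m) (starlike₁₂₁ k m)))
    × (3 ≤ k →
    (1 ≤ m → Extremal.IsSmallest K α k (k + 2) m (hyperpath k m)) ×
    (4 ≤ m →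
    (e : Fin (m ∸ 1)) → toℕ e ≡ 1 →
    (v : Fin (suc ((m ∸ 1) * (k ∸ 1)))) →
    v ∈ edge (hyperpath k (m ∸ 1)) e →
    Cored (hyperpath k (m ∸ 1)) v →
    Extremal.IsSecondSmallest K α k (k + 2) m
    (hyperpath k m) (attachPendant k (hyperpath k (m ∸ 1)) v)))
theorem7p3 K α 0<α α<1 zero    m = (λ ()) , (λ ())
theorem7p3 K α 0<α α<1 (suc r) m = second , higher
  where
  second : 2 ≤ suc r →
    (1 ≤ m → Extremal.IsLargest K α (suc r) 2 m (hyperstar (suc r) m)) ×
    (3 ≤ m → Extremal.IsSecondLargest K α (suc r) 2 m (hyperstar (suc r) m) (starlike₁₂₁ (suc r) m))
  second (s≤s 1≤r) =
      (λ 1≤m → (sum-replicate-one m , star-tree) , λ G tree → star-largest 1≤m G (hyperstar (suc r) m) (sum-replicate-one m) tree star-tree (star-center r m))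
    , runner-up m
    where
    open Comparison K α 0<α α<1 1≤r
    star-tree : ∀ {m} → IsHypertree (suc r) (hyperstar (suc r) m)
    star-tree {m} = starlike-tree (List.replicate m 1) 1≤r
    runner-up : ∀ m → 3 ≤ m → Extremal.IsSecondLargest K α (suc r) 2 m (hyperstar (suc r) m) (starlike₁₂₁ (suc r) m)
    runner-up (suc zero) (s≤s ())
    runner-up (suc (suc zero)) (s≤s (s≤s ()))
    runner-up (suc (suc (suc N))) _ = (edges≡ , tree) , near-star-second (s≤s z≤n) (hyperstar (suc r) (3 + N)) (starlike₁₂₁ (suc r) (3 + N))
        (sum-replicate-one (3 + N)) edges≡ (star-tree {3 + N}) tree (star-center r (3 + N)) (starlike₁₂₁-near 1≤r (3 + N))
      where
      tree = starlike-tree (1 ∷ 2 ∷ List.replicate N 1) 1≤r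
      edges≡ = cong (3 +_) (sum-replicate-one N)
  higher : 3 ≤ suc r →
    (1 ≤ m → Extremal.IsSmallest K α (suc r) (suc r + 2) m (hyperpath (suc r) m)) ×
    (4 ≤ m → (e : Fin (m ∸ 1)) → toℕ e ≡ 1 → (v : Fin (suc ((m ∸ 1) * r))) →
      v ∈ edge (hyperpath (suc r) (m ∸ 1)) e → Cored (hyperpath (suc r) (m ∸ 1)) v →
      Extremal.IsSecondSmallest K α (suc r) (suc r + 2) m (hyperpath (suc r) m) (attachPendant (suc r) (hyperpath (suc r) (m ∸ 1)) v))
  higher (s≤s 2≤r) = smallest m , runner-up m
    where
    1≤r : 1 ≤ r
    1≤r = ℕ.<⇒≤ 2≤r
    open Comparison K α 0<α α<1 1≤r
    open Higher 2≤r
    smallest : ∀ m → 1 ≤ m → Extremal.IsSmallest K α (suc r) (suc r + 2) m (hyperpath (suc r) m)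
    smallest (suc q) _ = (refl , hyperpath-tree (suc q) 1≤r) , λ G tree →
      path-smallest G (hyperpath (suc r) (suc q)) tree (hyperpath-tree (suc q) 1≤r) (hyperpath-order q 1≤r)
    runner-up : ∀ m → 4 ≤ m → (e : Fin (m ∸ 1)) → toℕ e ≡ 1 → (v : Fin (suc ((m ∸ 1) * r))) →
      v ∈ edge (hyperpath (suc r) (m ∸ 1)) e → Cored (hyperpath (suc r) (m ∸ 1)) v →
      Extremal.IsSecondSmallest K α (suc r) (suc r + 2) m (hyperpath (suc r) m) (attachPendant (suc r) (hyperpath (suc r) (m ∸ 1)) v)
    -- With m = q + 2, the path that carries the pendant hyperedge has q + 1 ≥ 3 hyperedges. The
    -- fork counts its hyperedges as `suc q + 1`, so its order is moved along `edges≡`.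
    runner-up (suc (suc q)) (s≤s (s≤s 2≤q)) e e≡1 v v∈e cored = (edges≡ , F.tree) ,
        fork-below (s≤s z≤n) F.tree path (trans (order path-tree) (trans (cong (λ m → 1 + m * r) (sym edges≡)) (sym (order F.tree))))
          edges≡ (s≤s z≤n) path-tree path-order F.fork-lower
      , λ G treeG → fork-above (s≤s z≤n) F.tree G path (trans (order treeG) (sym (order path-tree)))
          (trans (order treeG) (trans (cong (λ m → 1 + m * r) (sym edges≡)) (sym (order F.tree)))) edges≡
          treeG path-tree path-order F.Ex.excess≤1 F.fork-upper
      where
      module F = Fork 1≤r 2≤q e e≡1 v v∈e cored
      path = hyperpath (suc r) (suc (suc q))
      path-tree = hyperpath-tree (suc (suc q)) 1≤r
      path-order = hyperpath-order (suc q) 1≤r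
      order : ∀ {n m} {H : Hypergraph n (suc m)} → IsHypertree (suc r) H → n ≡ 1 + suc m * r
      order tree = Hypertree.order tree (s≤s 1≤r) (s≤s z≤n)
      edges≡ = ℕ.+-comm (suc q) 1
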